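{- Let $d\geq 2$ and $r$ be positive integers and define $$s_1(d)=\begin{cases}5,& d=2,\\ 9,& d=3,\\ d^2-d+2\lfloor\sqrt{2d+2}\rfloor+1,& d\geq 4.\end{cases}$$ Let $P$ be an intersective integer polynomial of degree $d$. Let $s,t$ be positive integers with $s+t\geq s_1(d)$. Let $L_1$ and $L_2$ be non-degenerate linear forms in $s$ and $t$ variables respectively, with $L_1(1,1,\ldots,1)=0$. Then there exist a constant $c_0>0$ and a positive integer $N_0$, depending only on $L_1,L_2,P,r$, such that for every integer $N\geq N_0$ and every partition $\{1,\ldots,N\}=\mathcal{C}_1\cup\cdots\cup\mathcal{C}_r$ there exists $k\in\{1,\ldots,r\}$ such that, writing $M=N^{d^{ -r}}$, $$\#\{(\mathbf{n},\mathbf{z})\in\mathcal{C}_k^s\times\mathcal{C}_k^t: L_1(\mathbf{n})=L_2(P(\mathbf{z}))\}\geq c_0M^{d(s-1)+t}.$$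
   Context: A polynomial $P\in\mathbb{Z}[X]$ is intersective if for every positive integer $n$ there exists an integer $x$ with $n\mid P(x)$. A non-degenerate linear form in $t$ variables is a map $L(\mathbf{x})=b_1x_1+\cdots+b_tx_t$ with all $b_j$ non-zero integers. For $\mathbf{z}=(z_1,\ldots,z_t)$, $P(\mathbf{z})=(P(z_1),\ldots,P(z_t))$. -}

module Defs where

open import Data.Nat as ℕ using (ℕ; zero; suc; _∸_; _≤ᵇ_)
open import Data.Integer as ℤ using (ℤ; +_)
open import Data.Integer.Divisibility using (_∣_)
open import Data.Fin using (Fin)
open import Data.Fin.Properties using () renaming (_≟_ to _≟ᶠ_)
open import Data.List as List using (List; []; _∷_; [_]; _++_; upTo; concatMap; filter; cartesianProduct; length)
open import Data.Vec as Vec using (Vec; []; _∷_)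
open import Data.Vec.Relation.Unary.All using (All; all?)
open import Data.Product using (Σ; ∃; _×_; _,_; proj₁; proj₂)
open import Data.Product.Properties using ()
open import Data.Bool using (if_then_else_)
open import Relation.Nullary using (¬_; Dec)
open import Relation.Nullary.Decidable using (_×-dec_)
open import Relation.Binary.PropositionalEquality using (_≡_)

-- Integer polynomials as coefficient lists, lowest degree first:
-- a₀ ∷ a₁ ∷ … ∷ a_d represents a₀ + a₁ X + … + a_d X^d.
Poly : Set
Poly = List ℤ

eval : Poly → ℤ → ℤ
eval []       x = + 0
eval (a ∷ as) x = a ℤ.+ x ℤ.* eval as x

HasDegree : Poly → ℕ → Set
HasDegree P d = Σ (List ℤ) λ cs → Σ ℤ λ a →
  (P ≡ cs ++ [ a ]) × (length cs ≡ d) × ¬ (a ≡ + 0)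

Intersective : Poly → Set
Intersective P = (n : ℕ) → 1 ℕ.≤ n → ∃ λ (x : ℤ) → (+ n) ∣ eval P x

LinForm : ℕ → Set
LinForm m = Vec ℤ m

NonDegenerate : ∀ {m} → LinForm m → Set
NonDegenerate b = All (λ bj → ¬ (bj ≡ + 0)) b

applyL : ∀ {m} → LinForm m → Vec ℤ m → ℤ
applyL []       []       = + 0
applyL (b ∷ bs) (x ∷ xs) = b ℤ.* x ℤ.+ applyL bs xs

ones : (m : ℕ) → Vec ℤ m
ones m = Vec.replicate m (+ 1)

isqrtAux : ℕ → ℕ → ℕ
isqrtAux n zero    = 0
isqrtAux n (suc k) = if (suc k ℕ.* suc k) ≤ᵇ n then suc k else isqrtAux n k

isqrt : ℕ → ℕ
isqrt n = isqrtAux n n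

s₁ : ℕ → ℕ
s₁ 2 = 5
s₁ 3 = 9
s₁ d = d ℕ.* d ∸ d ℕ.+ 2 ℕ.* isqrt (2 ℕ.* d ℕ.+ 2) ℕ.+ 1

allVecs : (m N : ℕ) → List (Vec ℕ m)
allVecs zero    N = [ [] ]
allVecs (suc m) N = concatMap (λ x → List.map (x ∷_) (allVecs m N)) (List.map suc (upTo N))

toℤ : ∀ {m} → Vec ℕ m → Vec ℤ m
toℤ = Vec.map +_

-- The colour class C_k of a colouring χ restricted to {1,…,N}:
-- a partition {1,…,N} = C₁ ∪ ⋯ ∪ C_r is given by χ : ℕ → Fin r,
-- C_k = {n ∈ {1,…,N} : χ n ≡ k}.
-- Solutions (n , z) ∈ C_k^s × C_k^t of L₁(n) = L₂(P(z)).
Good : ∀ {r s t} → (χ : ℕ → Fin r) → Fin r → Poly → LinForm s → LinForm t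
     → Vec ℕ s × Vec ℕ t → Set
Good χ k P L₁ L₂ (ns , zs) =
  All (λ n → χ n ≡ k) ns × All (λ z → χ z ≡ k) zs ×
  (applyL L₁ (toℤ ns) ≡ applyL L₂ (Vec.map (eval P) (toℤ zs)))

good? : ∀ {r s t} → (χ : ℕ → Fin r) → (k : Fin r) → (P : Poly) → (L₁ : LinForm s) → (L₂ : LinForm t)
      → (p : Vec ℕ s × Vec ℕ t) → Dec (Good χ k P L₁ L₂ p)
good? χ k P L₁ L₂ (ns , zs) =
  all? (λ n → χ n ≟ᶠ k) ns ×-dec (all? (λ z → χ z ≟ᶠ k) zs ×-dec
  (applyL L₁ (toℤ ns) ℤ.≟ applyL L₂ (Vec.map (eval P) (toℤ zs))))

count : ∀ {r s t} → (N : ℕ) → (χ : ℕ → Fin r) → Fin r → Poly → LinForm s → LinForm t → ℕ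
count {s = s} {t = t} N χ k P L₁ L₂ =
  length (filter (good? χ k P L₁ L₂) (cartesianProduct (allVecs s N) (allVecs t N)))

module Submission where

-- Fix m with m^(d^r) ≈ N. At each of the scales m^(d^r), …, m^d, m one finds a dense set of families z₀ + f · w whose
-- restriction to a homothetic copy of a large box is monochromatic (Gallai's theorem and pigeonhole), chosen so that for every
-- tuple z from a family, L₂(P(z)) is a popular difference of the first coordinates at all larger scales. Two of the r + 1 scales
-- share a colour. If y is taken at the smaller of these and x, x′ at the larger with b₁ x′₀ − b₁ x₀ = L₂(P(z)) and equal
-- remaining coordinates, then L₁(1, …, 1) = 0 makes this difference the value of L₁ at a monochromatic tuple, and counting the
-- triples (y, x, x′) gives the bound.
--
-- The popular differences come from a polynomial recurrence theorem: for a unitary action T of ℤ^I and a vector g that keeps a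
-- positive proportion of its mass under averaging, ⟨T^p(z) g, g⟩ is bounded below on average over boxes. Repeated van der
-- Corput differencing over independent box variables shows that the average of T^p(z) factors through averages along
-- progressions of length ≈ u^d with a common difference W; intersectivity supplies a class ξ mod W with W ∣ P(ξ), on which
-- p(z) only moves along such progressions. If the return is small, the finer average has larger energy, and this can happen
-- only boundedly often.

import Data.Fin as Fin
import Data.Fin.Properties as Finₚ
import Data.Integer as ℤ
import Data.Integer.Divisibility.Signed as Signed
import Data.Integer.Properties as ℤₚ
import Data.Integer.Tactic.RingSolver as ℤ-Solver
import Data.List as List
import Data.List.Properties as Listₚ
import Data.List.Relation.Unary.All as ListAll
import Data.List.Relation.Unary.Any as Any
import Data.List.Relation.Unary.Any.Properties as Anyₚ
import Data.List.Relation.Unary.Unique.DecPropositional.Properties as UniqueDec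
import Data.List.Relation.Unary.Unique.Propositional.Properties as Uniqueₚ
import Data.Nat as ℕ
import Data.Nat.Divisibility as ℕ∣
import Data.Nat.DivMod as DivMod
import Data.Nat.Properties as ℕₚ
import Data.Product.Properties as Productₚ
import Data.Rational as ℚ
import Data.Rational.Properties as ℚₚ
import Data.Vec as Vec
import Data.Vec.Properties as Vecₚ
import Data.Vec.Relation.Unary.All as All
import Data.Vec.Relation.Unary.All.Properties as Allₚ

open import Data.Empty using (⊥-elim)
open import Data.Fin using (Fin; zero; suc)
open import Data.Integer using (ℤ; +_; -[1+_])
open import Data.List using (List; []; _∷_; [_]; length; map; _++_; allFin; cartesianProduct; cartesianProductWith; deduplicate; downFrom; filter)
open import Data.List.Membership.Propositional using (_∈_)
open import Data.List.Membership.Propositional.Properties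
open import Data.List.Relation.Unary.AllPairs using ([]; _∷_)
open import Data.List.Relation.Unary.Any using (here; there)
open import Data.List.Relation.Unary.Unique.Propositional using (Unique)
open import Data.Nat using (ℕ; zero; suc; _∸_; _!)
open import Data.Nat.ListAction using (sum)
open import Data.Nat.Tactic.RingSolver using () renaming (solve-∀ to ℕ-solve)
open import Data.Product using (_×_; _,_; proj₁; proj₂; Σ-syntax; ∃-syntax)
open import Data.Rational using (ℚ; 0ℚ; 1ℚ)
open import Data.Sum using (_⊎_; inj₁; inj₂)
open import Data.Unit using (⊤; tt)
open import Data.Vec using (Vec; []; _∷_; lookup; replicate; tabulate)
open import Data.Vec.Relation.Unary.All using (All; []; _∷_)
open import Defs using (Poly; eval; Intersective)
open import Function using (id)
open import Relation.Binary.Definitions using (DecidableEquality)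
open import Relation.Binary.PropositionalEquality hiding ([_])
open import Relation.Nullary using (Dec; yes; no; ¬_)
open import Relation.Nullary.Decidable using (¬?)

-- The colour that repeats, and the position and step that Gallai's theorem gives to a family,
-- become known only after the popular differences must be in place. So all larger scales and all
-- tuples of positions are treated at once: ℤ^I has one coordinate for each such pair and acts on a
-- product of point sets, where one return is a simultaneous return in every factor. For z of size R
-- the values P(z) have size R^d and can be differences only at scales R₂ ≥ R^d, whence the
-- exponents d^i; a colour shared by the scales R and R₂ yields about R^t R₂^(s-1) solutions, which
-- is smallest for R = m and R₂ = m^d. A dense set is seen only through finite averages, so
-- invariance is replaced by absorption up to an error 1/K, and every constant has to be fixed
-- before the space is. This is why the moduli are factorials: the next common difference may depend
-- on a bound for the coefficients that differencing leaves, not on the coefficients themselves.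
-- Gallai's theorem works with weights in ℕ; a common constant B is therefore added to all weights,
-- and L₁(1, ..., 1) = 0 removes it again.

module RationalSums where

  -- Finite sums and averages of rationals over lists.

  open import Data.Maybe using (Maybe; just; nothing)
  open import Level using (0ℓ)
  open import Tactic.RingSolver.Core.AlmostCommutativeRing using (AlmostCommutativeRing; fromCommutativeRing)
  open import Data.Rational using (_+_; _*_; _-_; -_; _≤_; _<_)
  open import Tactic.RingSolver using (solve-∀)

  ℚ-ring : AlmostCommutativeRing 0ℓ 0ℓ
  ℚ-ring = fromCommutativeRing ℚₚ.+-*-commutativeRing isZero
    where
    isZero : ∀ x → Maybe (0ℚ ≡ x)
    isZero x with 0ℚ ℚ.≟ x
    ... | yes p = just p
    ... | no _ = nothing

  ≤-by : ∀ {x y} d → 0ℚ ≤ d → y ≡ x + d → x ≤ y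
  ≤-by {x} {y} d 0≤d refl = subst (_≤ x + d) (ℚₚ.+-identityʳ x) (ℚₚ.+-monoʳ-≤ x 0≤d)

  0≤-diff : ∀ {x y} → x ≤ y → 0ℚ ≤ y - x
  0≤-diff {x} {y} x≤y = subst (_≤ y - x) (ℚₚ.+-inverseʳ x) (ℚₚ.+-monoˡ-≤ (- x) x≤y)

  0≤-+ : ∀ {x y} → 0ℚ ≤ x → 0ℚ ≤ y → 0ℚ ≤ x + y
  0≤-+ p q = ℚₚ.+-mono-≤ p q

  *-monoˡ : ∀ {r x y} → 0ℚ ≤ r → x ≤ y → r * x ≤ r * y
  *-monoˡ {r} 0≤r = ℚₚ.*-monoˡ-≤-nonNeg r {{ℚ.nonNegative 0≤r}}

  *-monoʳ : ∀ {r x y} → 0ℚ ≤ r → x ≤ y → x * r ≤ y * r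
  *-monoʳ {r} 0≤r = ℚₚ.*-monoʳ-≤-nonNeg r {{ℚ.nonNegative 0≤r}}

  0≤-* : ∀ {x y} → 0ℚ ≤ x → 0ℚ ≤ y → 0ℚ ≤ x * y
  0≤-* {x} {y} p q = subst (_≤ x * y) (ℚₚ.*-zeroʳ x) (*-monoˡ p q)

  0≤-sq : ∀ x → 0ℚ ≤ x * x
  0≤-sq x with ℚₚ.≤-total 0ℚ x
  ... | inj₁ p = 0≤-* p p
  ... | inj₂ p = subst (0ℚ ≤_) (neg-sq x) (0≤-* (ℚₚ.neg-antimono-≤ p) (ℚₚ.neg-antimono-≤ p))
    where
    neg-sq : ∀ x → (- x) * (- x) ≡ x * x
    neg-sq = solve-∀ ℚ-ring

  0≤1 : 0ℚ ≤ 1ℚ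
  0≤1 = ℚₚ.nonNegative⁻¹ 1ℚ

  -- Recursion in place of a fraction n/1: the laws below become plain inductions, with no
  -- normalisation of fractions.
  ι : ℕ → ℚ
  ι zero = 0ℚ
  ι (suc n) = 1ℚ + ι n

  0≤ι : ∀ n → 0ℚ ≤ ι n
  0≤ι zero = ℚₚ.≤-refl
  0≤ι (suc n) = 0≤-+ 0≤1 (0≤ι n)

  ι-+ : ∀ m n → ι (m ℕ.+ n) ≡ ι m + ι n
  ι-+ zero n = sym (ℚₚ.+-identityˡ (ι n))
  ι-+ (suc m) n = trans (cong (λ t → 1ℚ + t) (ι-+ m n)) (sym (ℚₚ.+-assoc 1ℚ (ι m) (ι n)))

  ι-* : ∀ m n → ι (m ℕ.* n) ≡ ι m * ι n
  ι-* zero n = sym (ℚₚ.*-zeroˡ (ι n))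
  ι-* (suc m) n = trans (ι-+ n (m ℕ.* n)) (trans (cong (λ t → ι n + t) (ι-* m n)) (lem (ι m) (ι n)))
    where
    lem : ∀ a b → b + a * b ≡ (1ℚ + a) * b
    lem = solve-∀ ℚ-ring

  ι-mono : ∀ {m n} → m ℕ.≤ n → ι m ≤ ι n
  ι-mono {n = n} ℕ.z≤n = 0≤ι n
  ι-mono (ℕ.s≤s p) = ℚₚ.+-monoʳ-≤ 1ℚ (ι-mono p)

  0<1 : 0ℚ < 1ℚ
  0<1 = ℚₚ.positive⁻¹ 1ℚ

  ι-pos : ∀ n → 0ℚ < ι (suc n)
  ι-pos n = subst (_< 1ℚ + ι n) (ℚₚ.+-identityˡ 0ℚ) (ℚₚ.+-mono-<-≤ 0<1 (0≤ι n))

  ι-reflects-≤ : ∀ {m n} → ι m ≤ ι n → m ℕ.≤ n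
  ι-reflects-≤ {zero} p = ℕ.z≤n
  ι-reflects-≤ {suc m} {zero} p = ⊥-elim (ℚₚ.<-irrefl refl (ℚₚ.<-≤-trans (ι-pos m) p))
  ι-reflects-≤ {suc m} {suc n} p = ℕ.s≤s (ι-reflects-≤ (subst₂ _≤_ (lem (ι m)) (lem (ι n)) (ℚₚ.+-monoʳ-≤ (- 1ℚ) p)))
    where
    lem : ∀ a → - 1ℚ + (1ℚ + a) ≡ a
    lem = solve-∀ ℚ-ring

  *-cancelˡ : ∀ {x y} n → ι (suc n) * x ≤ ι (suc n) * y → x ≤ y
  *-cancelˡ n = ℚₚ.*-cancelˡ-≤-pos (ι (suc n)) {{ℚ.positive (ι-pos n)}}

  -- The value 0 at 0 is a default: the average over an empty list is 0, and `inv-*`, hence the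
  -- exchange and product rules for `E`, hold for all lists.
  inv : ℕ → ℚ
  inv zero = 0ℚ
  inv (suc n) = ℚ.1/_ (ι (suc n)) {{ℚₚ.pos⇒nonZero (ι (suc n)) {{ℚ.positive (ι-pos n)}}}}

  inv-inverse : ∀ n → inv (suc n) * ι (suc n) ≡ 1ℚ
  inv-inverse n = ℚₚ.*-inverseˡ (ι (suc n)) {{ℚₚ.pos⇒nonZero (ι (suc n)) {{ℚ.positive (ι-pos n)}}}}

  0≤inv : ∀ n → 0ℚ ≤ inv n
  0≤inv zero = ℚₚ.≤-refl
  0≤inv (suc n) = *-cancelˡ n (subst₂ _≤_ (sym (ℚₚ.*-zeroʳ (ι (suc n))))
    (sym (trans (ℚₚ.*-comm (ι (suc n)) (inv (suc n))) (inv-inverse n))) 0≤1)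

  inv-* : ∀ m n → inv (m ℕ.* n) ≡ inv m * inv n
  inv-* zero n = sym (ℚₚ.*-zeroˡ (inv n))
  inv-* (suc m) zero rewrite ℕₚ.*-zeroʳ m = sym (ℚₚ.*-zeroʳ (inv (suc m)))
  inv-* (suc m) (suc n) = begin
    inv mn ≡⟨ sym (ℚₚ.*-identityʳ (inv mn)) ⟩
    inv mn * 1ℚ ≡⟨ cong (λ t → inv mn * t) (sym (cong₂ _*_ (inv-inverse m) (inv-inverse n))) ⟩
    inv mn * ((inv (suc m) * ι (suc m)) * (inv (suc n) * ι (suc n))) ≡⟨ lem (inv mn) (inv (suc m)) (ι (suc m)) (inv (suc n)) (ι (suc n)) ⟩
    (inv mn * (ι (suc m) * ι (suc n))) * (inv (suc m) * inv (suc n)) ≡⟨ cong (λ t → (inv mn * t) * (inv (suc m) * inv (suc n))) (sym (ι-* (suc m) (suc n))) ⟩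
    (inv mn * ι mn) * (inv (suc m) * inv (suc n)) ≡⟨ cong (_* (inv (suc m) * inv (suc n))) (inv-inverse (n ℕ.+ m ℕ.* suc n)) ⟩
    1ℚ * (inv (suc m) * inv (suc n)) ≡⟨ ℚₚ.*-identityˡ _ ⟩
    inv (suc m) * inv (suc n) ∎
    where
    open ≡-Reasoning
    mn = suc m ℕ.* suc n
    lem : ∀ a b c d e → a * ((b * c) * (d * e)) ≡ (a * (c * e)) * (b * d)
    lem = solve-∀ ℚ-ring

  private variable
    A B C : Set

  Σ : List A → (A → ℚ) → ℚ
  Σ [] f = 0ℚ
  Σ (x ∷ xs) f = f x + Σ xs f

  Σ-mono : ∀ (xs : List A) {f g : A → ℚ} → (∀ x → x ∈ xs → f x ≤ g x) → Σ xs f ≤ Σ xs g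
  Σ-mono [] h = ℚₚ.≤-refl
  Σ-mono (x ∷ xs) h = ℚₚ.+-mono-≤ (h x (here refl)) (Σ-mono xs λ y y∈ → h y (there y∈))

  Σ-cong : ∀ (xs : List A) {f g : A → ℚ} → (∀ x → f x ≡ g x) → Σ xs f ≡ Σ xs g
  Σ-cong [] h = refl
  Σ-cong (x ∷ xs) h = cong₂ _+_ (h x) (Σ-cong xs h)

  Σ-+ : ∀ (xs : List A) (f g : A → ℚ) → Σ xs (λ x → f x + g x) ≡ Σ xs f + Σ xs g
  Σ-+ [] f g = sym (ℚₚ.+-identityˡ 0ℚ)
  Σ-+ (x ∷ xs) f g = trans (cong (λ t → f x + g x + t) (Σ-+ xs f g)) (lem (f x) (g x) (Σ xs f) (Σ xs g))
    where
    lem : ∀ a b c d → a + b + (c + d) ≡ a + c + (b + d)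
    lem = solve-∀ ℚ-ring

  Σ-* : ∀ (xs : List A) c (f : A → ℚ) → Σ xs (λ x → c * f x) ≡ c * Σ xs f
  Σ-* [] c f = sym (ℚₚ.*-zeroʳ c)
  Σ-* (x ∷ xs) c f = trans (cong (λ t → c * f x + t) (Σ-* xs c f)) (sym (ℚₚ.*-distribˡ-+ c (f x) (Σ xs f)))

  Σ-const : ∀ (xs : List A) c → Σ xs (λ _ → c) ≡ ι (length xs) * c
  Σ-const [] c = sym (ℚₚ.*-zeroˡ c)
  Σ-const (x ∷ xs) c = trans (cong (λ t → c + t) (Σ-const xs c)) (lem c (ι (length xs)))
    where
    lem : ∀ c a → c + a * c ≡ (1ℚ + a) * c
    lem = solve-∀ ℚ-ring

  Σ-swap : ∀ (xs : List A) (ys : List B) (f : A → B → ℚ) →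
    Σ xs (λ x → Σ ys (f x)) ≡ Σ ys (λ y → Σ xs (λ x → f x y))
  Σ-swap [] ys f = sym (trans (Σ-const ys 0ℚ) (ℚₚ.*-zeroʳ (ι (length ys))))
  Σ-swap (x ∷ xs) ys f = trans (cong (λ t → Σ ys (f x) + t) (Σ-swap xs ys f))
    (sym (Σ-+ ys (f x) (λ y → Σ xs (λ x → f x y))))

  Σ-++ : ∀ (xs ys : List A) (f : A → ℚ) → Σ (xs ++ ys) f ≡ Σ xs f + Σ ys f
  Σ-++ [] ys f = sym (ℚₚ.+-identityˡ _)
  Σ-++ (x ∷ xs) ys f = trans (cong (λ t → f x + t) (Σ-++ xs ys f)) (sym (ℚₚ.+-assoc (f x) (Σ xs f) (Σ ys f)))

  Σ-map : ∀ (h : A → B) (xs : List A) (f : B → ℚ) → Σ (map h xs) f ≡ Σ xs (λ x → f (h x))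
  Σ-map h [] f = refl
  Σ-map h (x ∷ xs) f = cong (λ t → f (h x) + t) (Σ-map h xs f)

  Σ-product : ∀ (h : A → B → C) (xs : List A) (ys : List B) (f : C → ℚ) →
    Σ (cartesianProductWith h xs ys) f ≡ Σ xs (λ x → Σ ys (λ y → f (h x y)))
  Σ-product h [] ys f = refl
  Σ-product h (x ∷ xs) ys f = trans (Σ-++ (map (h x) ys) _ f)
    (cong₂ _+_ (Σ-map (h x) ys f) (Σ-product h xs ys f))

  0≤Σ : ∀ (xs : List A) {f : A → ℚ} → (∀ x → 0ℚ ≤ f x) → 0ℚ ≤ Σ xs f
  0≤Σ [] h = ℚₚ.≤-refl
  0≤Σ (x ∷ xs) h = 0≤-+ (h x) (0≤Σ xs h)

  E : List A → (A → ℚ) → ℚ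
  E xs f = inv (length xs) * Σ xs f

  Nonempty : List A → Set
  Nonempty xs = 1 ℕ.≤ length xs

  E-mono : ∀ (xs : List A) {f g : A → ℚ} → (∀ x → x ∈ xs → f x ≤ g x) → E xs f ≤ E xs g
  E-mono xs h = *-monoˡ (0≤inv (length xs)) (Σ-mono xs h)

  E-cong : ∀ (xs : List A) {f g : A → ℚ} → (∀ x → f x ≡ g x) → E xs f ≡ E xs g
  E-cong xs h = cong (λ t → inv (length xs) * t) (Σ-cong xs h)

  E-+ : ∀ (xs : List A) (f g : A → ℚ) → E xs (λ x → f x + g x) ≡ E xs f + E xs g
  E-+ xs f g = trans (cong (λ t → inv (length xs) * t) (Σ-+ xs f g)) (ℚₚ.*-distribˡ-+ (inv (length xs)) _ _)

  E-* : ∀ (xs : List A) c (f : A → ℚ) → E xs (λ x → c * f x) ≡ c * E xs f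
  E-* xs c f = trans (cong (λ t → inv (length xs) * t) (Σ-* xs c f)) (lem (inv (length xs)) c (Σ xs f))
    where
    lem : ∀ a b c → a * (b * c) ≡ b * (a * c)
    lem = solve-∀ ℚ-ring

  E-const : ∀ (xs : List A) → Nonempty xs → ∀ c → E xs (λ _ → c) ≡ c
  E-const (x ∷ xs) _ c = trans (cong (λ t → inv (suc (length xs)) * t) (Σ-const (x ∷ xs) c))
    (trans (sym (ℚₚ.*-assoc (inv (suc (length xs))) (ι (suc (length xs))) c))
    (trans (cong (_* c) (inv-inverse (length xs))) (ℚₚ.*-identityˡ c)))

  -- For the empty list, whose average is 0, the sign of c decides.
  E-const-≤ : ∀ (xs : List A) {c} → 0ℚ ≤ c → E xs (λ _ → c) ≤ c
  E-const-≤ [] {c} h = subst (_≤ c) (sym (ℚₚ.*-zeroˡ 0ℚ)) h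
  E-const-≤ (x ∷ xs) {c} h = ℚₚ.≤-reflexive (E-const (x ∷ xs) (ℕ.s≤s ℕ.z≤n) c)

  E-bound : ∀ (xs : List A) {f : A → ℚ} {c} → 0ℚ ≤ c → (∀ x → x ∈ xs → f x ≤ c) → E xs f ≤ c
  E-bound xs 0≤c h = ℚₚ.≤-trans (E-mono xs h) (E-const-≤ xs 0≤c)

  length-product : ∀ (h : A → B → C) (xs : List A) (ys : List B) →
    length (cartesianProductWith h xs ys) ≡ length xs ℕ.* length ys
  length-product h [] ys = refl
  length-product h (x ∷ xs) ys = trans (Listₚ.length-++ (map (h x) ys))
    (cong₂ ℕ._+_ (Listₚ.length-map (h x) ys) (length-product h xs ys))

  E-product : ∀ (h : A → B → C) (xs : List A) (ys : List B) (f : C → ℚ) →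
    E (cartesianProductWith h xs ys) f ≡ E xs (λ x → E ys (λ y → f (h x y)))
  E-product h xs ys f = begin
    inv (length (cartesianProductWith h xs ys)) * Σ (cartesianProductWith h xs ys) f
      ≡⟨ cong₂ (λ a b → inv a * b) (length-product h xs ys) (Σ-product h xs ys f) ⟩
    inv (length xs ℕ.* length ys) * S ≡⟨ cong (_* S) (inv-* (length xs) (length ys)) ⟩
    inv (length xs) * inv (length ys) * S ≡⟨ ℚₚ.*-assoc (inv (length xs)) (inv (length ys)) S ⟩
    inv (length xs) * (inv (length ys) * S) ≡⟨ cong (λ t → inv (length xs) * t) (sym (Σ-* xs (inv (length ys)) _)) ⟩
    E xs (λ x → E ys (λ y → f (h x y))) ∎
    where
    open ≡-Reasoning
    S = Σ xs (λ x → Σ ys (λ y → f (h x y)))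

  E-swap : ∀ (xs : List A) (ys : List B) (f : A → B → ℚ) →
    E xs (λ x → E ys (f x)) ≡ E ys (λ y → E xs (λ x → f x y))
  E-swap xs ys f = begin
    a * Σ xs (λ x → b * Σ ys (f x)) ≡⟨ cong (λ t → a * t) (Σ-* xs b _) ⟩
    a * (b * Σ xs (λ x → Σ ys (f x))) ≡⟨ cong (λ t → a * (b * t)) (Σ-swap xs ys f) ⟩
    a * (b * Σ ys (λ y → Σ xs (λ x → f x y))) ≡⟨ lem a b _ ⟩
    b * (a * Σ ys (λ y → Σ xs (λ x → f x y))) ≡⟨ cong (λ t → b * t) (sym (Σ-* ys a _)) ⟩
    b * Σ ys (λ y → a * Σ xs (λ x → f x y)) ∎
    where
    open ≡-Reasoning
    a = inv (length xs)
    b = inv (length ys)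
    lem : ∀ a b c → a * (b * c) ≡ b * (a * c)
    lem = solve-∀ ℚ-ring

-- Unitary actions of ℤ^I and averages of shifts.

module InnerProductSpaces where
  open import Data.Rational using (_+_; _*_; _-_; -_; _≤_)
  open import Tactic.RingSolver using (solve-∀)
  open RationalSums

  -- No equality on V is assumed: T is a unitary action of ℤ^I only as far as ⟨_,_⟩ can tell, and ⟨_,_⟩ may be degenerate.
  record IPS (I : Set) : Set₁ where
    infixl 6 _⊕_
    infixl 7 _·_
    field
      V : Set
      0V : V
      _⊕_ : V → V → V
      _·_ : ℚ → V → V
      T : (I → ℤ) → V → V
      ⟨_,_⟩ : V → V → ℚ
      ip-sym : ∀ u v → ⟨ u , v ⟩ ≡ ⟨ v , u ⟩
      ip-0 : ∀ w → ⟨ 0V , w ⟩ ≡ 0ℚ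
      ip-⊕ : ∀ u v w → ⟨ u ⊕ v , w ⟩ ≡ ⟨ u , w ⟩ + ⟨ v , w ⟩
      ip-· : ∀ c u w → ⟨ c · u , w ⟩ ≡ c * ⟨ u , w ⟩
      psd : ∀ u → 0ℚ ≤ ⟨ u , u ⟩
      T-iso : ∀ a b u w → ⟨ T a u , T b w ⟩ ≡ ⟨ u , T (λ i → b i ℤ.- a i) w ⟩
      T-cong : ∀ {a b} → (∀ i → a i ≡ b i) → ∀ u → T a u ≡ T b u
      T-0 : ∀ u w → ⟨ T (λ _ → + 0) u , w ⟩ ≡ ⟨ u , w ⟩

  module Shift (I : Set) where
    Λ : Set
    Λ = I → ℤ

    infixl 6 _⊞_
    infix 8 ⊟_
    infixl 7 _⊠_

    0Λ : Λ
    0Λ _ = + 0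

    _⊞_ : Λ → Λ → Λ
    (a ⊞ b) i = a i ℤ.+ b i

    ⊟_ : Λ → Λ
    (⊟ a) i = ℤ.- a i

    _⊠_ : ℤ → Λ → Λ
    (m ⊠ a) i = m ℤ.* a i

    infixr 9 _∘_

    -- Averages are syntax, independent of any space: the same formal average can be chosen before
    -- the space is given, and its displacement can be measured (`ShiftBound`).
    data Avg : Set where
      one : Avg
      av : List Λ → Avg
      _∘_ : Avg → Avg → Avg

    infix 10 _†

    _† : Avg → Avg
    one † = one
    av as † = av (map ⊟_ as)
    (X ∘ Y) † = X † ∘ Y †

  module Operators {I : Set} (H : IPS I) where
    open Shift I public
    open IPS H public

    N : V → ℚ
    N v = ⟨ v , v ⟩

    infix 4 _≈_
    record _≈_ (u v : V) : Set where
      constructor eq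
      field ip : ∀ w → ⟨ u , w ⟩ ≡ ⟨ v , w ⟩
    open _≈_ public

    ≈-refl : ∀ {u} → u ≈ u
    ≈-refl = eq λ w → refl

    ≈-sym : ∀ {u v} → u ≈ v → v ≈ u
    ≈-sym p = eq λ w → sym (ip p w)

    ≈-trans : ∀ {u v w} → u ≈ v → v ≈ w → u ≈ w
    ≈-trans p q = eq λ w → trans (ip p w) (ip q w)

    ≡⇒≈ : ∀ {u v} → u ≡ v → u ≈ v
    ≡⇒≈ refl = ≈-refl

    ip-congˡ : ∀ {u v w} → u ≈ v → ⟨ u , w ⟩ ≡ ⟨ v , w ⟩
    ip-congˡ p = ip p _

    ip-congʳ : ∀ {u v w} → u ≈ v → ⟨ w , u ⟩ ≡ ⟨ w , v ⟩
    ip-congʳ {u} {v} {w} p = trans (ip-sym w u) (trans (ip p w) (ip-sym v w))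

    N-cong : ∀ {u v} → u ≈ v → N u ≡ N v
    N-cong p = trans (ip-congˡ p) (ip-congʳ p)

    ip-⊕ʳ : ∀ u v w → ⟨ w , u ⊕ v ⟩ ≡ ⟨ w , u ⟩ + ⟨ w , v ⟩
    ip-⊕ʳ u v w = trans (ip-sym w (u ⊕ v)) (trans (ip-⊕ u v w) (cong₂ _+_ (ip-sym u w) (ip-sym v w)))

    ip-·ʳ : ∀ c u w → ⟨ w , c · u ⟩ ≡ c * ⟨ w , u ⟩
    ip-·ʳ c u w = trans (ip-sym w (c · u)) (trans (ip-· c u w) (cong (λ t → c * t) (ip-sym u w)))

    infixl 6 _⊖_
    _⊖_ : V → V → V
    u ⊖ v = u ⊕ (- 1ℚ) · v

    ip-⊖ : ∀ u v w → ⟨ u ⊖ v , w ⟩ ≡ ⟨ u , w ⟩ - ⟨ v , w ⟩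
    ip-⊖ u v w = trans (ip-⊕ u _ w) (trans (cong (λ t → ⟨ u , w ⟩ + t) (ip-· (- 1ℚ) v w)) (lem ⟨ u , w ⟩ ⟨ v , w ⟩))
      where
      lem : ∀ a b → a + (- 1ℚ) * b ≡ a - b
      lem = solve-∀ ℚ-ring

    ⊕-cong : ∀ {u u′ v v′} → u ≈ u′ → v ≈ v′ → u ⊕ v ≈ u′ ⊕ v′
    ⊕-cong {u} {u′} {v} {v′} p q = eq λ w → trans (ip-⊕ u v w) (trans (cong₂ _+_ (ip p w) (ip q w)) (sym (ip-⊕ u′ v′ w)))

    ·-cong : ∀ {u v} c → u ≈ v → c · u ≈ c · v
    ·-cong {u} {v} c p = eq λ w → trans (ip-· c u w) (trans (cong (λ t → c * t) (ip p w)) (sym (ip-· c v w)))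

    ⊖-cong : ∀ {u u′ v v′} → u ≈ u′ → v ≈ v′ → u ⊖ v ≈ u′ ⊖ v′
    ⊖-cong p q = ⊕-cong p (·-cong (- 1ℚ) q)

    N-· : ∀ c u → N (c · u) ≡ c * c * N u
    N-· c u = trans (ip-· c u (c · u)) (trans (cong (λ t → c * t) (ip-·ʳ c u u)) (sym (ℚₚ.*-assoc c c (N u))))

    N-⊕ : ∀ u v → N (u ⊕ v) ≡ N u + (1ℚ + 1ℚ) * ⟨ u , v ⟩ + N v
    N-⊕ u v = trans (ip-⊕ u v _) (trans (cong₂ _+_ (ip-⊕ʳ u v u) (ip-⊕ʳ u v v))
      (trans (cong (λ t → N u + ⟨ u , v ⟩ + (t + N v)) (ip-sym v u)) (lem (N u) ⟨ u , v ⟩ (N v))))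
      where
      lem : ∀ a b c → a + b + (b + c) ≡ a + (1ℚ + 1ℚ) * b + c
      lem = solve-∀ ℚ-ring

    N-⊖ : ∀ u v → N (u ⊖ v) ≡ N u - (1ℚ + 1ℚ) * ⟨ u , v ⟩ + N v
    N-⊖ u v = trans (N-⊕ u _) (trans (cong₂ (λ a b → N u + (1ℚ + 1ℚ) * a + b) (ip-·ʳ (- 1ℚ) v u) (N-· (- 1ℚ) v)) (lem (N u) ⟨ u , v ⟩ (N v)))
      where
      lem : ∀ a b c → a + (1ℚ + 1ℚ) * (- 1ℚ * b) + - 1ℚ * - 1ℚ * c ≡ a - (1ℚ + 1ℚ) * b + c
      lem = solve-∀ ℚ-ring

    N-⊕-≤ : ∀ u v → N (u ⊕ v) ≤ (1ℚ + 1ℚ) * N u + (1ℚ + 1ℚ) * N v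
    N-⊕-≤ u v = ≤-by (N (u ⊖ v)) (psd (u ⊖ v)) (trans (lem (N u) ⟨ u , v ⟩ (N v)) (sym (cong₂ _+_ (N-⊕ u v) (N-⊖ u v))))
      where
      lem : ∀ a b c → (1ℚ + 1ℚ) * a + (1ℚ + 1ℚ) * c ≡ (a + (1ℚ + 1ℚ) * b + c) + (a - (1ℚ + 1ℚ) * b + c)
      lem = solve-∀ ℚ-ring

    N-⊖-≤ : ∀ u v → N (u ⊖ v) ≤ (1ℚ + 1ℚ) * N u + (1ℚ + 1ℚ) * N v
    N-⊖-≤ u v = ℚₚ.≤-trans (N-⊕-≤ u _) (ℚₚ.≤-reflexive (cong (λ t → (1ℚ + 1ℚ) * N u + (1ℚ + 1ℚ) * t) (trans (N-· (- 1ℚ) v) (lem (N v)))))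
      where
      lem : ∀ a → - 1ℚ * - 1ℚ * a ≡ a
      lem = solve-∀ ℚ-ring

    -- Expand 0 ≤ ‖k u - v‖².
    am-gm : ∀ k u v → (1ℚ + 1ℚ) * (k * ⟨ u , v ⟩) ≤ k * k * N u + N v
    am-gm k u v = ≤-by (N (k · u ⊖ v)) (psd _) (trans (lem (k * k * N u) (k * ⟨ u , v ⟩) (N v))
      (cong (λ t → (1ℚ + 1ℚ) * (k * ⟨ u , v ⟩) + t) (sym (trans (N-⊖ (k · u) v) (cong₂ (λ a b → a - (1ℚ + 1ℚ) * b + N v) (N-· k u) (ip-· k u v))))))
      where
      lem : ∀ a b c → a + c ≡ (1ℚ + 1ℚ) * b + (a - (1ℚ + 1ℚ) * b + c)
      lem = solve-∀ ℚ-ring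

    halve : ∀ {x y} → (1ℚ + 1ℚ) * x ≤ y + y → x ≤ y
    halve {x} {y} p = *-cancelˡ 1 (subst₂ _≤_ (lem₁ x) (lem₂ y) p)
      where
      lem₁ : ∀ x → (1ℚ + 1ℚ) * x ≡ ι 2 * x
      lem₁ = solve-∀ ℚ-ring
      lem₂ : ∀ y → y + y ≡ ι 2 * y
      lem₂ = solve-∀ ℚ-ring

    -- Cauchy-Schwarz without square roots: one bound ν serves both vectors, and the gain k in the
    -- inner product is paid for by k² in the hypothesis on u.
    cauchy-schwarz : ∀ k {ν} u v → k * k * N u ≤ ν → N v ≤ ν → k * ⟨ u , v ⟩ ≤ ν
    cauchy-schwarz k u v p q = halve (ℚₚ.≤-trans (am-gm k u v) (ℚₚ.+-mono-≤ p q))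

    T-N : ∀ a u → N (T a u) ≡ N u
    T-N a u = trans (T-iso a a u u) (trans (cong (λ t → ⟨ u , t ⟩) (T-cong (λ i → ℤₚ.+-inverseʳ (a i)) u))
      (trans (ip-sym u _) (T-0 u u)))

    T-adj : ∀ a u w → ⟨ T a u , w ⟩ ≡ ⟨ u , T (⊟ a) w ⟩
    T-adj a u w = trans (ip-sym _ w) (trans (sym (T-0 w (T a u))) (trans (ip-sym _ _) (trans (T-iso a 0Λ u w)
      (cong (λ t → ⟨ u , t ⟩) (T-cong (λ i → ℤₚ.+-identityˡ (ℤ.- a i)) w)))))

    T-≈ : ∀ a {u v} → u ≈ v → T a u ≈ T a v
    T-≈ a {u} {v} p = eq λ w → trans (T-adj a u w) (trans (ip p _) (sym (T-adj a v w)))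

    T-∘ : ∀ a b u → T a (T b u) ≈ T (a ⊞ b) u
    T-∘ a b u = eq λ w → trans (T-adj a (T b u) w) (trans (T-iso b (⊟ a) u w)
      (trans (cong (λ t → ⟨ u , t ⟩) (T-cong (λ i → lem (a i) (b i)) w)) (sym (T-adj (a ⊞ b) u w))))
      where
      lem : ∀ a b → ℤ.- a ℤ.- b ≡ ℤ.- (a ℤ.+ b)
      lem = ℤ-Solver.solve-∀

    T-comm : ∀ a b u → T a (T b u) ≈ T b (T a u)
    T-comm a b u = ≈-trans (T-∘ a b u) (≈-trans (≡⇒≈ (T-cong (λ i → ℤₚ.+-comm (a i) (b i)) u)) (≈-sym (T-∘ b a u)))

    T-⊕ : ∀ a u v → T a (u ⊕ v) ≈ T a u ⊕ T a v
    T-⊕ a u v = eq λ w → trans (T-adj a _ w) (trans (ip-⊕ u v _) (trans (cong₂ _+_ (sym (T-adj a u w)) (sym (T-adj a v w))) (sym (ip-⊕ _ _ w))))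

    T-· : ∀ a c u → T a (c · u) ≈ c · T a u
    T-· a c u = eq λ w → trans (T-adj a _ w) (trans (ip-· c u _) (trans (cong (λ t → c * t) (sym (T-adj a u w))) (sym (ip-· c _ w))))

    private variable
      A B C : Set

    ΣV : List A → (A → V) → V
    ΣV [] f = 0V
    ΣV (x ∷ xs) f = f x ⊕ ΣV xs f

    EV : List A → (A → V) → V
    EV xs f = inv (length xs) · ΣV xs f

    ip-ΣV : ∀ (xs : List A) f w → ⟨ ΣV xs f , w ⟩ ≡ Σ xs (λ x → ⟨ f x , w ⟩)
    ip-ΣV [] f w = ip-0 w
    ip-ΣV (x ∷ xs) f w = trans (ip-⊕ (f x) _ w) (cong (λ t → ⟨ f x , w ⟩ + t) (ip-ΣV xs f w))

    ip-EV : ∀ (xs : List A) f w → ⟨ EV xs f , w ⟩ ≡ E xs (λ x → ⟨ f x , w ⟩)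
    ip-EV xs f w = trans (ip-· _ _ w) (cong (λ t → inv (length xs) * t) (ip-ΣV xs f w))

    ip-EVʳ : ∀ (xs : List A) f w → ⟨ w , EV xs f ⟩ ≡ E xs (λ x → ⟨ w , f x ⟩)
    ip-EVʳ xs f w = trans (ip-sym w _) (trans (ip-EV xs f w) (E-cong xs λ x → ip-sym (f x) w))

    EV-cong : ∀ (xs : List A) {f g} → (∀ x → f x ≈ g x) → EV xs f ≈ EV xs g
    EV-cong xs {f} {g} h = eq λ w → trans (ip-EV xs f w) (trans (E-cong xs λ x → ip (h x) w) (sym (ip-EV xs g w)))

    EV-⊕ : ∀ (xs : List A) f g → EV xs (λ x → f x ⊕ g x) ≈ EV xs f ⊕ EV xs g
    EV-⊕ xs f g = eq λ w → trans (ip-EV xs _ w) (trans (E-cong xs λ x → ip-⊕ (f x) (g x) w)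
      (trans (E-+ xs _ _) (trans (cong₂ _+_ (sym (ip-EV xs f w)) (sym (ip-EV xs g w))) (sym (ip-⊕ _ _ w)))))

    EV-· : ∀ (xs : List A) c f → EV xs (λ x → c · f x) ≈ c · EV xs f
    EV-· xs c f = eq λ w → trans (ip-EV xs _ w) (trans (E-cong xs λ x → ip-· c (f x) w)
      (trans (E-* xs c _) (trans (cong (λ t → c * t) (sym (ip-EV xs f w))) (sym (ip-· c _ w)))))

    EV-T : ∀ (xs : List A) a f → EV xs (λ x → T a (f x)) ≈ T a (EV xs f)
    EV-T xs a f = eq λ w → trans (ip-EV xs _ w) (trans (E-cong xs λ x → T-adj a (f x) w)
      (trans (sym (ip-EV xs f _)) (sym (T-adj a _ w))))

    EV-swap : ∀ (xs : List A) (ys : List B) (f : A → B → V) →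
      EV xs (λ x → EV ys (f x)) ≈ EV ys (λ y → EV xs (λ x → f x y))
    EV-swap xs ys f = eq λ w → trans (ip-EV xs _ w) (trans (E-cong xs λ x → ip-EV ys (f x) w)
      (trans (E-swap xs ys _) (trans (E-cong ys λ y → sym (ip-EV xs (λ x → f x y) w)) (sym (ip-EV ys _ w)))))

    EV-product : ∀ (h : A → B → C) (xs : List A) (ys : List B) (f : C → V) →
      EV (cartesianProductWith h xs ys) f ≈ EV xs (λ x → EV ys (λ y → f (h x y)))
    EV-product h xs ys f = eq λ w → trans (ip-EV (cartesianProductWith h xs ys) f w) (trans (E-product h xs ys _)
      (trans (E-cong xs λ x → sym (ip-EV ys (λ y → f (h x y)) w)) (sym (ip-EV xs _ w))))

    EV-const : ∀ (xs : List A) → Nonempty xs → ∀ v → EV xs (λ _ → v) ≈ v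
    EV-const xs ne v = eq λ w → trans (ip-EV xs _ w) (E-const xs ne _)

    -- The two sides differ by the variance, the average of ‖f x - m‖² about the mean m.
    jensen : ∀ (xs : List A) f → N (EV xs f) ≤ E xs (λ x → N (f x))
    jensen [] f = ℚₚ.≤-reflexive (trans (ip-EV [] f (EV [] f)) refl)
    jensen xs@(_ ∷ _) f = ≤-by (E xs (λ x → N (f x ⊖ m))) 0≤ (begin
      E xs (λ x → N (f x)) ≡⟨ lem (E xs (λ x → N (f x))) (N m) ⟩
      N m + (E xs (λ x → N (f x)) + - (1ℚ + 1ℚ) * N m + N m)
        ≡⟨ cong (λ t → N m + (E xs (λ x → N (f x)) + - (1ℚ + 1ℚ) * t + N m)) (ip-EV xs f m) ⟩
      N m + (E xs (λ x → N (f x)) + - (1ℚ + 1ℚ) * E xs (λ x → ⟨ f x , m ⟩) + N m)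
        ≡⟨ cong₂ (λ s t → N m + (E xs (λ x → N (f x)) + s + t)) (sym (E-* xs (- (1ℚ + 1ℚ)) (λ x → ⟨ f x , m ⟩))) (sym (E-const xs (ℕ.s≤s ℕ.z≤n) (N m))) ⟩
      N m + (E xs (λ x → N (f x)) + E xs (λ x → - (1ℚ + 1ℚ) * ⟨ f x , m ⟩) + E xs (λ _ → N m))
        ≡⟨ cong (λ t → N m + t) (sym (trans (E-+ xs (λ x → N (f x) + - (1ℚ + 1ℚ) * ⟨ f x , m ⟩) (λ _ → N m)) (cong (_+ E xs (λ _ → N m)) (E-+ xs (λ x → N (f x)) (λ x → - (1ℚ + 1ℚ) * ⟨ f x , m ⟩))))) ⟩
      N m + E xs (λ x → N (f x) + - (1ℚ + 1ℚ) * ⟨ f x , m ⟩ + N m)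
        ≡⟨ cong (λ t → N m + t) (E-cong xs λ x → trans (lem₂ (N (f x)) ⟨ f x , m ⟩ (N m)) (sym (N-⊖ (f x) m))) ⟩
      N m + E xs (λ x → N (f x ⊖ m)) ∎)
      where
      open ≡-Reasoning
      m = EV xs f
      0≤ : 0ℚ ≤ E xs (λ x → N (f x ⊖ m))
      0≤ = 0≤-* (0≤inv (length xs)) (0≤Σ xs λ x → psd _)
      lem : ∀ a b → a ≡ b + (a + - (1ℚ + 1ℚ) * b + b)
      lem = solve-∀ ℚ-ring
      lem₂ : ∀ a b c → a + - (1ℚ + 1ℚ) * b + c ≡ a - (1ℚ + 1ℚ) * b + c
      lem₂ = solve-∀ ℚ-ring

    jensen-≤ : ∀ (xs : List A) f {k ν} → 0ℚ ≤ k → 0ℚ ≤ ν → (∀ x → x ∈ xs → k * N (f x) ≤ ν) → k * N (EV xs f) ≤ ν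
    jensen-≤ xs f {k} 0≤k 0≤ν h = ℚₚ.≤-trans (*-monoˡ 0≤k (jensen xs f))
      (subst (_≤ _) (E-* xs k _) (E-bound xs 0≤ν h))

    ⟦_⟧ : Avg → V → V
    ⟦ one ⟧ v = v
    ⟦ av as ⟧ v = EV as (λ a → T a v)
    ⟦ X ∘ Y ⟧ v = ⟦ X ⟧ (⟦ Y ⟧ v)

    op-cong : ∀ X {u v} → u ≈ v → ⟦ X ⟧ u ≈ ⟦ X ⟧ v
    op-cong one p = p
    op-cong (av as) p = EV-cong as λ a → T-≈ a p
    op-cong (X ∘ Y) p = op-cong X (op-cong Y p)

    op-⊕ : ∀ X u v → ⟦ X ⟧ (u ⊕ v) ≈ ⟦ X ⟧ u ⊕ ⟦ X ⟧ v
    op-⊕ one u v = ≈-refl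
    op-⊕ (av as) u v = ≈-trans (EV-cong as λ a → T-⊕ a u v) (EV-⊕ as _ _)
    op-⊕ (X ∘ Y) u v = ≈-trans (op-cong X (op-⊕ Y u v)) (op-⊕ X _ _)

    op-· : ∀ X c u → ⟦ X ⟧ (c · u) ≈ c · ⟦ X ⟧ u
    op-· one c u = ≈-refl
    op-· (av as) c u = ≈-trans (EV-cong as λ a → T-· a c u) (EV-· as c _)
    op-· (X ∘ Y) c u = ≈-trans (op-cong X (op-· Y c u)) (op-· X c _)

    op-⊖ : ∀ X u v → ⟦ X ⟧ (u ⊖ v) ≈ ⟦ X ⟧ u ⊖ ⟦ X ⟧ v
    op-⊖ X u v = ≈-trans (op-⊕ X u _) (⊕-cong ≈-refl (op-· X (- 1ℚ) v))

    op-T : ∀ X a u → ⟦ X ⟧ (T a u) ≈ T a (⟦ X ⟧ u)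
    op-T one a u = ≈-refl
    op-T (av as) a u = ≈-trans (EV-cong as λ b → T-comm b a u) (EV-T as a _)
    op-T (X ∘ Y) a u = ≈-trans (op-cong X (op-T Y a u)) (op-T X a _)

    op-ΣV : ∀ X (xs : List A) f → ⟦ X ⟧ (ΣV xs f) ≈ ΣV xs (λ x → ⟦ X ⟧ (f x))
    op-ΣV X [] f = ≈-trans (op-cong X 0≈) (≈-trans (op-· X 0ℚ 0V) 0·)
      where
      0≈ : 0V ≈ 0ℚ · 0V
      0≈ = eq λ w → trans (ip-0 w) (sym (trans (ip-· 0ℚ 0V w) (ℚₚ.*-zeroˡ ⟨ 0V , w ⟩)))
      0· : ∀ {u} → 0ℚ · u ≈ 0V
      0· {u} = eq λ w → trans (ip-· 0ℚ u w) (trans (ℚₚ.*-zeroˡ ⟨ u , w ⟩) (sym (ip-0 w)))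
    op-ΣV X (x ∷ xs) f = ≈-trans (op-⊕ X _ _) (⊕-cong ≈-refl (op-ΣV X xs f))

    op-EV : ∀ X (xs : List A) f → ⟦ X ⟧ (EV xs f) ≈ EV xs (λ x → ⟦ X ⟧ (f x))
    op-EV X xs f = ≈-trans (op-· X _ _) (·-cong _ (op-ΣV X xs f))

    -- ℤ^I is abelian. Later arguments use this to bring any factor of a composite to the place
    -- where it is estimated.
    op-comm : ∀ X Y u → ⟦ X ⟧ (⟦ Y ⟧ u) ≈ ⟦ Y ⟧ (⟦ X ⟧ u)
    op-comm X one u = ≈-refl
    op-comm X (av as) u = ≈-trans (op-EV X as _) (EV-cong as λ a → op-T X a u)
    op-comm X (Y ∘ Z) u = ≈-trans (op-comm X Y (⟦ Z ⟧ u)) (op-cong Y (op-comm X Z u))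

    contraction : ∀ X u → N (⟦ X ⟧ u) ≤ N u
    contraction one u = ℚₚ.≤-refl
    contraction (av as) u = ℚₚ.≤-trans (jensen as _) (E-bound as (psd u) λ a _ → ℚₚ.≤-reflexive (T-N a u))
    contraction (X ∘ Y) u = ℚₚ.≤-trans (contraction X _) (contraction Y u)

    op-adj : ∀ X u w → ⟨ ⟦ X ⟧ u , w ⟩ ≡ ⟨ u , ⟦ X † ⟧ w ⟩
    op-adj one u w = refl
    op-adj (av as) u w = trans (ip-EV as _ w) (trans (E-cong as λ a → T-adj a u w) (trans step (sym (ip-EVʳ (map ⊟_ as) _ u))))
      where
      step : E as (λ a → ⟨ u , T (⊟ a) w ⟩) ≡ E (map ⊟_ as) (λ a → ⟨ u , T a w ⟩)
      step = cong₂ (λ l s → inv l * s) (sym (Listₚ.length-map ⊟_ as)) (sym (Σ-map ⊟_ as _))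
    op-adj (X ∘ Y) u w = trans (op-adj X _ w) (trans (op-adj Y u _) (ip-congʳ (op-comm (Y †) (X †) w)))

    energy : ∀ X u → ⟨ ⟦ X † ∘ X ⟧ u , u ⟩ ≡ N (⟦ X ⟧ u)
    energy X u = trans (ip-sym _ u) (sym (op-adj X u (⟦ X ⟧ u)))

    -- Up to the relative error 1/K, composing with the average Y absorbs Q (Near) or the single shift T a (Abs).
    Near : Avg → ℕ → Avg → Set
    Near Y K Q = ∀ v → ι K * N (⟦ Y ⟧ (v ⊖ ⟦ Q ⟧ v)) ≤ N v

    Abs : Avg → ℕ → Λ → Set
    Abs Y K a = ∀ v → ι K * N (⟦ Y ⟧ (v ⊖ T a v)) ≤ N v

-- Absorption of shifts by long averages.

module AlmostInvariance where
  open import Data.Rational using (_+_; _*_; _-_; -_; _≤_)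
  open import Tactic.RingSolver using (solve-∀)
  open RationalSums
  open InnerProductSpaces

  module Progression (I : Set) where
    open Shift I public

    ap : Λ → ℕ → Avg
    ap g Y = av (map (λ j → (+ j) ⊠ g) (downFrom Y))

  module Nearness {I : Set} (H : IPS I) where
    open Operators H public
    open Progression I using (ap) public

    -- ‖x + y‖² ≤ 2‖x‖² + 2‖y‖². This is the source of the factor 4 that each sum of shifts and each
    -- composition of averages costs below.
    split-bound : ∀ K {ν} x y → ι (4 ℕ.* K) * N x ≤ ν → ι (4 ℕ.* K) * N y ≤ ν → ι K * N (x ⊕ y) ≤ ν
    split-bound K {ν} x y p q = halve (ℚₚ.≤-trans
      (ℚₚ.≤-trans (*-monoˡ 0≤2 (*-monoˡ (0≤ι K) (N-⊕-≤ x y))) (ℚₚ.≤-reflexive e))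
      (ℚₚ.+-mono-≤ p q))
      where
      0≤2 : 0ℚ ≤ 1ℚ + 1ℚ
      0≤2 = 0≤-+ 0≤1 0≤1
      lem : ∀ k a b → (1ℚ + 1ℚ) * (k * ((1ℚ + 1ℚ) * a + (1ℚ + 1ℚ) * b)) ≡ (ι 4 * k) * a + (ι 4 * k) * b
      lem = solve-∀ ℚ-ring
      e : (1ℚ + 1ℚ) * (ι K * ((1ℚ + 1ℚ) * N x + (1ℚ + 1ℚ) * N y)) ≡ ι (4 ℕ.* K) * N x + ι (4 ℕ.* K) * N y
      e = trans (lem (ι K) (N x) (N y)) (cong (λ t → t * N x + t * N y) (sym (ι-* 4 K)))

    N-flip : ∀ u v → N (u ⊖ v) ≡ N (v ⊖ u)
    N-flip u v = trans (N-⊖ u v) (trans (cong (λ t → N u - (1ℚ + 1ℚ) * t + N v) (ip-sym u v))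
      (trans (lem (N u) ⟨ v , u ⟩ (N v)) (sym (N-⊖ v u))))
      where
      lem : ∀ a b c → a - (1ℚ + 1ℚ) * b + c ≡ c - (1ℚ + 1ℚ) * b + a
      lem = solve-∀ ℚ-ring

    telescope : ∀ u v w → u ⊖ w ≈ (u ⊖ v) ⊕ (v ⊖ w)
    telescope u v w = eq λ t → trans (ip-⊖ u w t) (trans (lem ⟨ u , t ⟩ ⟨ v , t ⟩ ⟨ w , t ⟩)
      (sym (trans (ip-⊕ _ _ t) (cong₂ _+_ (ip-⊖ u v t) (ip-⊖ v w t)))))
      where
      lem : ∀ a b c → a - c ≡ (a - b) + (b - c)
      lem = solve-∀ ℚ-ring

    private
      weaken : ∀ {K K′} x {ν} → K ℕ.≤ K′ → ι K′ * N x ≤ ν → ι K * N x ≤ ν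
      weaken x K≤ p = ℚₚ.≤-trans (*-monoʳ (psd x) (ι-mono K≤)) p

    Abs-weaken : ∀ {Y K K′ a} → K ℕ.≤ K′ → Abs Y K′ a → Abs Y K a
    Abs-weaken K≤ p v = weaken _ K≤ (p v)

    Near-weaken : ∀ {Y K K′ Q} → K ℕ.≤ K′ → Near Y K′ Q → Near Y K Q
    Near-weaken K≤ p v = weaken _ K≤ (p v)

    Abs-cong : ∀ {Y K a b} → (∀ i → a i ≡ b i) → Abs Y K a → Abs Y K b
    Abs-cong {Y} {K} h p v = subst (λ t → ι K * N (⟦ Y ⟧ (v ⊖ t)) ≤ N v) (T-cong h v) (p v)

    -- v - T^(a+b) v = (v - T^a v) + T^a (v - T^b v), and T^a is an isometry that commutes with Y.
    Abs-⊞ : ∀ {Y K a b} → Abs Y (4 ℕ.* K) a → Abs Y (4 ℕ.* K) b → Abs Y K (a ⊞ b)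
    Abs-⊞ {Y} {K} {a} {b} p q v = subst (λ t → ι K * t ≤ N v) (sym e) (split-bound K x y (p v) q′)
      where
      x = ⟦ Y ⟧ (v ⊖ T a v)
      y = ⟦ Y ⟧ (T a (v ⊖ T b v))
      e : N (⟦ Y ⟧ (v ⊖ T (a ⊞ b) v)) ≡ N (x ⊕ y)
      e = N-cong (≈-trans (op-cong Y (≈-trans (⊖-cong ≈-refl (≈-sym (T-∘ a b v))) (≈-trans (telescope v (T a v) _)
        (⊕-cong ≈-refl (≈-sym (≈-trans (T-⊕ a v _) (⊕-cong ≈-refl (T-· a _ _)))))))) (op-⊕ Y _ _))
      q′ : ι (4 ℕ.* K) * N y ≤ N v
      q′ = subst (λ t → ι (4 ℕ.* K) * t ≤ N v) (sym (trans (N-cong (op-T Y a _)) (T-N a _))) (q v)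

    Abs-⊟ : ∀ {Y K a} → Abs Y K a → Abs Y K (⊟ a)
    Abs-⊟ {Y} {K} {a} p v = subst₂ (λ s t → ι K * s ≤ t) e (T-N (⊟ a) v) (p (T (⊟ a) v))
      where
      back : T a (T (⊟ a) v) ≈ v
      back = ≈-trans (T-∘ a (⊟ a) v) (≈-trans (≡⇒≈ (T-cong (λ i → ℤₚ.+-inverseʳ (a i)) v)) (eq λ w → T-0 v w))
      e : N (⟦ Y ⟧ (T (⊟ a) v ⊖ T a (T (⊟ a) v))) ≡ N (⟦ Y ⟧ (v ⊖ T (⊟ a) v))
      e = trans (N-cong (≈-trans (op-cong Y (⊖-cong ≈-refl back)) (op-⊖ Y _ _)))
        (trans (N-flip _ _) (N-cong (≈-sym (op-⊖ Y _ _))))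

    Abs-0 : ∀ {Y K} → Abs Y K 0Λ
    Abs-0 {Y} {K} v = ℚₚ.≤-trans (*-monoˡ (0≤ι K) (contraction Y _))
      (subst (_≤ N v) (sym (trans (cong (λ t → ι K * t) z) (ℚₚ.*-zeroʳ (ι K)))) (psd v))
      where
      lem : ∀ a → a - (1ℚ + 1ℚ) * a + a ≡ 0ℚ
      lem = solve-∀ ℚ-ring
      z : N (v ⊖ T 0Λ v) ≡ 0ℚ
      z = trans (N-cong (⊖-cong ≈-refl (eq λ w → T-0 v w))) (trans (N-⊖ v v) (lem (N v)))

    Abs-∘ˡ : ∀ {X Y K a} → Abs Y K a → Abs (X ∘ Y) K a
    Abs-∘ˡ {X} {Y} {K} p v = ℚₚ.≤-trans (*-monoˡ (0≤ι K) (contraction X _)) (p v)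

    Abs-∘ʳ : ∀ {X Y K a} → Abs Y K a → Abs (Y ∘ X) K a
    Abs-∘ʳ {X} {Y} {K} p v = subst (λ t → ι K * t ≤ N v) (N-cong (op-comm X Y _)) (Abs-∘ˡ {X} {Y} {K} p v)

    Near-∘ˡ : ∀ {X Y K Q} → Near Y K Q → Near (X ∘ Y) K Q
    Near-∘ˡ {X} {Y} {K} p v = ℚₚ.≤-trans (*-monoˡ (0≤ι K) (contraction X _)) (p v)

    Near-∘ʳ : ∀ {X Y K Q} → Near Y K Q → Near (Y ∘ X) K Q
    Near-∘ʳ {X} {Y} {K} {Q} p v = subst (λ t → ι K * t ≤ N v) (N-cong (op-comm X Y _)) (Near-∘ˡ {X} {Y} {K} {Q} p v)

    Near-one : ∀ {Y K} → Near Y K one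
    Near-one {Y} {K} v = subst (λ t → ι K * t ≤ N v) (N-cong (op-cong Y (⊖-cong ≈-refl (eq λ w → T-0 v w)))) (Abs-0 {Y} {K} v)

    Near-av : ∀ {Y K as} → Nonempty as → (∀ a → a ∈ as → Abs Y K a) → Near Y K (av as)
    Near-av {Y} {K} {as} ne h v = subst (λ t → ι K * t ≤ N v) (sym (N-cong e))
      (jensen-≤ as _ (0≤ι K) (psd v) λ a a∈ → h a a∈ v)
      where
      e : ⟦ Y ⟧ (v ⊖ EV as (λ a → T a v)) ≈ EV as (λ a → ⟦ Y ⟧ (v ⊖ T a v))
      e = ≈-trans (op-cong Y (≈-trans (⊕-cong (≈-sym (EV-const as ne v)) (≈-sym (EV-· as (- 1ℚ) _))) (≈-sym (EV-⊕ as _ _)))) (op-EV Y as _)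

    -- v - QRv = (v - Qv) + Q(v - Rv). In the second term Q comes to the aid of Y, so R need only be
    -- absorbed by the composite; this is how a stage profits from the stages before it.
    Near-step : ∀ {Y K Q R} → Near Y (4 ℕ.* K) Q → Near (Y ∘ Q) (4 ℕ.* K) R → Near Y K (Q ∘ R)
    Near-step {Y} {K} {Q} {R} p q v = subst (λ t → ι K * t ≤ N v) (sym e) (split-bound K _ _ (p v) (q v))
      where
      e : N (⟦ Y ⟧ (v ⊖ ⟦ Q ⟧ (⟦ R ⟧ v))) ≡ N (⟦ Y ⟧ (v ⊖ ⟦ Q ⟧ v) ⊕ ⟦ Y ⟧ (⟦ Q ⟧ (v ⊖ ⟦ R ⟧ v)))
      e = N-cong (≈-trans (op-cong Y (≈-trans (telescope v (⟦ Q ⟧ v) _) (⊕-cong ≈-refl (≈-sym (op-⊖ Q v _))))) (op-⊕ Y _ _))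

    Near-∘ : ∀ {Y K Q R} → Near Y (4 ℕ.* K) Q → Near Y (4 ℕ.* K) R → Near Y K (Q ∘ R)
    Near-∘ {Y} {K} {Q} {R} p q = Near-step {Y} {K} {Q} {R} p (Near-∘ʳ {Q} {Y} {4 ℕ.* K} {R} q)

    ΣV-telescope : ∀ n (h : ℕ → V) → ΣV (downFrom n) (λ j → h j ⊖ h (suc j)) ≈ h 0 ⊖ h n
    ΣV-telescope zero h = eq λ w → trans (ip-0 w) (sym (trans (ip-⊖ (h 0) (h 0) w) (ℚₚ.+-inverseʳ ⟨ h 0 , w ⟩)))
    ΣV-telescope (suc n) h = ≈-trans (⊕-cong ≈-refl (ΣV-telescope n h)) (eq λ w →
      trans (ip-⊕ _ _ w) (trans (cong₂ _+_ (ip-⊖ (h n) (h (suc n)) w) (ip-⊖ (h 0) (h n) w))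
        (trans (lem ⟨ h n , w ⟩ ⟨ h (suc n) , w ⟩ ⟨ h 0 , w ⟩) (sym (ip-⊖ (h 0) (h (suc n)) w)))))
      where
      lem : ∀ a b c → (a - b) + (c - a) ≡ c - b
      lem = solve-∀ ℚ-ring

    ΣV-cong : ∀ {A : Set} (xs : List A) {f g : A → V} → (∀ x → f x ≈ g x) → ΣV xs f ≈ ΣV xs g
    ΣV-cong [] h = ≈-refl
    ΣV-cong (x ∷ xs) h = ⊕-cong (h x) (ΣV-cong xs h)

    N-ΣV : ∀ {A : Set} (xs : List A) (f : A → V) c → 0ℚ ≤ c → (∀ x → N (f x) ≤ c) →
      N (ΣV xs f) ≤ ι (length xs) * ι (length xs) * c
    N-ΣV [] f c 0≤c h = ℚₚ.≤-reflexive (trans (ip-0 0V) (sym (lem c)))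
      where
      lem : ∀ c → 0ℚ * 0ℚ * c ≡ 0ℚ
      lem = solve-∀ ℚ-ring
    N-ΣV xs@(_ ∷ ys) f c 0≤c h = subst (_≤ ι n * ι n * c) (trans (sym (N-· (ι n) (EV xs f))) (N-cong e))
      (*-monoˡ (0≤-sq (ι n)) (ℚₚ.≤-trans (jensen xs f) (E-bound xs 0≤c λ x _ → h x)))
      where
      n = length xs
      e : ι n · EV xs f ≈ ΣV xs f
      e = eq λ w → trans (ip-· (ι n) _ w) (trans (cong (λ t → ι n * t) (ip-· (inv n) _ w))
        (trans (sym (ℚₚ.*-assoc (ι n) (inv n) _)) (trans (cong (_* ⟨ ΣV xs f , w ⟩) (trans (ℚₚ.*-comm (ι n) (inv n)) (inv-inverse (length ys))))
          (ℚₚ.*-identityˡ _))))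

    -- With n = Y + 1 the sum over the progression telescopes: n A(v - T^g v) = v - T^(ng) v, of
    -- squared norm at most 4‖v‖².
    N-ap-step : ∀ g Y v → ι (suc Y) * ι (suc Y) * N (⟦ ap g (suc Y) ⟧ (v ⊖ T g v)) ≤ ι 4 * N v
    N-ap-step g Y v = ℚₚ.≤-trans (ℚₚ.≤-reflexive (trans (sym (N-· (ι n) _)) (N-cong e)))
      (ℚₚ.≤-trans (N-⊖-≤ v (T ((+ n) ⊠ g) v)) (ℚₚ.≤-reflexive (trans (cong (λ t → (1ℚ + 1ℚ) * N v + (1ℚ + 1ℚ) * t) (T-N _ v)) (lem (N v)))))
      where
      n = suc Y
      js = downFrom n
      lem : ∀ a → (1ℚ + 1ℚ) * a + (1ℚ + 1ℚ) * a ≡ ι 4 * a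
      lem = solve-∀ ℚ-ring
      h : ℕ → V
      h j = T ((+ j) ⊠ g) v
      cancel : ∀ u → ι n · (inv n · u) ≈ u
      cancel u = eq λ w → trans (ip-· (ι n) _ w) (trans (cong (λ t → ι n * t) (ip-· (inv n) u w))
        (trans (sym (ℚₚ.*-assoc (ι n) (inv n) _)) (trans (cong (_* ⟨ u , w ⟩) (trans (ℚₚ.*-comm (ι n) (inv n)) (inv-inverse Y))) (ℚₚ.*-identityˡ _))))
      mapΣ : ∀ (js : List ℕ) f → ΣV (map (λ j → (+ j) ⊠ g) js) f ≈ ΣV js (λ j → f ((+ j) ⊠ g))
      mapΣ [] f = ≈-refl
      mapΣ (j ∷ js) f = ⊕-cong ≈-refl (mapΣ js f)
      term : ∀ j → T ((+ j) ⊠ g) (v ⊖ T g v) ≈ h j ⊖ h (suc j)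
      term j = ≈-trans (T-⊕ _ v _) (⊕-cong ≈-refl (≈-trans (T-· _ _ _) (·-cong _
        (≈-trans (T-∘ _ _ v) (≡⇒≈ (T-cong (λ i → lem₂ (+ j) (g i)) v))))))
        where
        lem₂ : ∀ j x → j ℤ.* x ℤ.+ x ≡ (+ 1 ℤ.+ j) ℤ.* x
        lem₂ = ℤ-Solver.solve-∀
      e : ι n · ⟦ ap g n ⟧ (v ⊖ T g v) ≈ v ⊖ T ((+ n) ⊠ g) v
      e = ≈-trans (≡⇒≈ (cong (λ k → ι n · (inv k · ΣV (map (λ j → (+ j) ⊠ g) js) (λ a → T a (v ⊖ T g v)))) (trans (Listₚ.length-map _ js) (Listₚ.length-downFrom n))))
        (≈-trans (cancel _) (≈-trans (mapΣ js _) (≈-trans (ΣV-cong js term) (≈-trans (ΣV-telescope n h)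
          (⊖-cong (≈-trans (≡⇒≈ (T-cong (λ i → ℤₚ.*-zeroˡ (g i)) v)) (eq λ w → T-0 v w)) ≈-refl)))))

    -- v - T^(mg) v is a sum of m shifts of v - T^g v, so that its average has squared norm at most
    -- m² · 4/Y² · ‖v‖². Since 4 K m² ≤ (2 K m)² ≤ Y², the condition can be stated without roots.
    Abs-ap : ∀ {g Y K} m → 1 ℕ.≤ Y → 2 ℕ.* K ℕ.* m ℕ.≤ Y → Abs (ap g Y) K ((+ m) ⊠ g)
    Abs-ap {g} {Y} {zero} m 1≤Y small v = subst (_≤ N v) (sym (ℚₚ.*-zeroˡ (N (⟦ ap g Y ⟧ (v ⊖ T ((+ m) ⊠ g) v))))) (psd v)
    Abs-ap {g} {suc Y} {K@(suc K′)} m 1≤Y small v = *-cancelˡ 3 (ℚₚ.≤-trans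
      (subst₂ _≤_ (ℚₚ.*-assoc (ι 4) (ι K) (N (⟦ A ⟧ (v ⊖ h m)))) (lem₂ (ι 4) (ι K) (ι m) Bv) (*-monoˡ 0≤4K bound))
      (ℚₚ.≤-trans (*-monoʳ (psd _) count) (N-ap-step g Y v)))
      where
      A = ap g (suc Y)
      Bv = N (⟦ A ⟧ (v ⊖ T g v))
      js = downFrom m
      h : ℕ → V
      h j = T ((+ j) ⊠ g) v
      0≤4K : 0ℚ ≤ ι 4 * ι K
      0≤4K = 0≤-* (0≤ι 4) (0≤ι K)
      term : ∀ j → T ((+ j) ⊠ g) (v ⊖ T g v) ≈ h j ⊖ h (suc j)
      term j = ≈-trans (T-⊕ _ v _) (⊕-cong ≈-refl (≈-trans (T-· _ _ _) (·-cong _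
        (≈-trans (T-∘ _ _ v) (≡⇒≈ (T-cong (λ i → lem₃ (+ j) (g i)) v))))))
        where
        lem₃ : ∀ j x → j ℤ.* x ℤ.+ x ≡ (+ 1 ℤ.+ j) ℤ.* x
        lem₃ = ℤ-Solver.solve-∀
      e : ⟦ A ⟧ (v ⊖ h m) ≈ ΣV js (λ j → ⟦ A ⟧ (T ((+ j) ⊠ g) (v ⊖ T g v)))
      e = ≈-trans (op-cong A (≈-trans (⊖-cong (≈-sym (≈-trans (≡⇒≈ (T-cong (λ i → ℤₚ.*-zeroˡ (g i)) v)) (eq λ w → T-0 v w))) ≈-refl)
        (≈-trans (≈-sym (ΣV-telescope m h)) (≈-sym (ΣV-cong js term))))) (op-ΣV A js _)
      bound : N (⟦ A ⟧ (v ⊖ h m)) ≤ ι m * ι m * Bv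
      bound = subst₂ _≤_ (sym (N-cong e)) (cong (λ k → ι k * ι k * Bv) (Listₚ.length-downFrom m))
        (N-ΣV js _ Bv (psd _) λ j → ℚₚ.≤-reflexive (trans (N-cong (op-T A _ _)) (T-N _ _)))
      lem₂ : ∀ f k m b → f * k * (m * m * b) ≡ (f * k * (m * m)) * b
      lem₂ = solve-∀ ℚ-ring
      count : ι 4 * ι K * (ι m * ι m) ≤ ι (suc Y) * ι (suc Y)
      count = subst₂ _≤_ (trans (ι-* (4 ℕ.* K) (m ℕ.* m)) (cong₂ _*_ (ι-* 4 K) (ι-* m m))) (ι-* (suc Y) (suc Y))
        (ι-mono (ℕₚ.≤-trans (ℕₚ.≤-trans (ℕₚ.m≤m+n _ (4 ℕ.* K ℕ.* (m ℕ.* m) ℕ.* K′)) (ℕₚ.≤-reflexive (lem₄ K′ m))) (ℕₚ.*-mono-≤ small small)))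
        where
        lem₄ : ∀ k m → 4 ℕ.* suc k ℕ.* (m ℕ.* m) ℕ.+ 4 ℕ.* suc k ℕ.* (m ℕ.* m) ℕ.* k ≡ (2 ℕ.* suc k ℕ.* m) ℕ.* (2 ℕ.* suc k ℕ.* m)
        lem₄ = ℕ-solve

-- Van der Corput differencing.

module VanDerCorput where
  open import Data.Rational using (_+_; _*_; _-_; -_; _≤_)
  open import Tactic.RingSolver using (solve-∀)
  open RationalSums
  open InnerProductSpaces
  open AlmostInvariance

  module CauchySchwarz {I : Set} (H : IPS I) where
    open Nearness H public

    private variable
      A B : Set

    E-E-bound : ∀ (xs : List A) (ys : List B) {k ν β} {X bad : A → B → ℚ} → 0ℚ ≤ ν → 0ℚ ≤ k →
      (∀ a b → a ∈ xs → b ∈ ys → k * X a b ≤ ν + k * ν * bad a b) →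
      E xs (λ a → E ys (bad a)) ≤ β → k * E xs (λ a → E ys (X a)) ≤ ν + k * ν * β
    E-E-bound xs ys {k} {ν} {β} {X} {bad} 0≤ν 0≤k h hβ = begin
      k * E xs (λ a → E ys (X a)) ≡⟨ sym (E-* xs k _) ⟩
      E xs (λ a → k * E ys (X a)) ≡⟨ E-cong xs (λ a → sym (E-* ys k _)) ⟩
      E xs (λ a → E ys (λ b → k * X a b)) ≤⟨ E-mono xs (λ a a∈ → E-mono ys λ b b∈ → h a b a∈ b∈) ⟩
      E xs (λ a → E ys (λ b → ν + k * ν * bad a b)) ≡⟨ E-cong xs (λ a → trans (E-+ ys (λ _ → ν) _) (cong (λ t → E ys (λ _ → ν) + t) (E-* ys (k * ν) (bad a)))) ⟩
      E xs (λ a → E ys (λ _ → ν) + k * ν * E ys (bad a)) ≡⟨ trans (E-+ xs _ _) (cong (λ t → E xs (λ _ → E ys (λ _ → ν)) + t) (E-* xs (k * ν) _)) ⟩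
      E xs (λ _ → E ys (λ _ → ν)) + k * ν * E xs (λ a → E ys (bad a))
        ≤⟨ ℚₚ.+-mono-≤ (E-bound xs 0≤ν λ _ _ → E-const-≤ ys 0≤ν) (*-monoˡ (0≤-* 0≤k 0≤ν) hβ) ⟩
      ν + k * ν * β ∎
      where open ℚₚ.≤-Reasoning

    -- Cauchy–Schwarz in z; the pairs (a, b) that are not controlled are paid for by their density.
    van-der-corput : ∀ (ys : List A) (zs : List B) (p : A → B → Λ) (bad : A → A → ℚ) κ {ν} v → 0ℚ ≤ ν → N v ≤ ν →
      (∀ a b → a ∈ ys → b ∈ ys → 0ℚ ≤ bad a b ×
        (1ℚ ≤ bad a b ⊎ ι ((2 ℕ.* κ) ℕ.* (2 ℕ.* κ)) * N (EV zs (λ z → T (p b z ⊞ ⊟ p a z) v)) ≤ ν)) →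
      ι (2 ℕ.* κ) * E ys (λ a → E ys (bad a)) ≤ 1ℚ →
      ι κ * N (EV ys (λ a → EV zs (λ z → T (p a z) v))) ≤ ν
    van-der-corput ys zs p bad κ {ν} v 0≤ν Nv h few = halve (ℚₚ.≤-trans step₁ step₂)
      where
      k = ι (2 ℕ.* κ)
      k≡ : k ≡ (1ℚ + 1ℚ) * ι κ
      k≡ = trans (ι-* 2 κ) refl
      X : _ → _ → ℚ
      X a b = ⟨ EV zs (λ z → T (p b z ⊞ ⊟ p a z) v) , v ⟩
      -- Squaring the average over a gives a double average over (a, b), and isometry leaves only
      -- the difference p(b, z) - p(a, z).
      expand : E zs (λ z → N (EV ys (λ a → T (p a z) v))) ≡ E ys (λ a → E ys (X a))
      expand = begin
        E zs (λ z → N (EV ys (λ a → T (p a z) v)))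
          ≡⟨ E-cong zs (λ z → trans (ip-EV ys _ _) (E-cong ys λ a → trans (ip-EVʳ ys _ _) (E-cong ys λ b →
               trans (T-iso (p a z) (p b z) v v) (ip-sym v _)))) ⟩
        E zs (λ z → E ys (λ a → E ys (λ b → ⟨ T (p b z ⊞ ⊟ p a z) v , v ⟩)))
          ≡⟨ E-swap zs ys _ ⟩
        E ys (λ a → E zs (λ z → E ys (λ b → ⟨ T (p b z ⊞ ⊟ p a z) v , v ⟩)))
          ≡⟨ E-cong ys (λ a → trans (E-swap zs ys _) (E-cong ys λ b → sym (ip-EV zs _ v))) ⟩
        E ys (λ a → E ys (X a)) ∎
        where open ≡-Reasoning
      Xle : ∀ a b → X a b ≤ ν
      Xle a b = subst (_≤ ν) (ℚₚ.*-identityˡ (X a b)) (cauchy-schwarz 1ℚ _ v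
        (subst (_≤ ν) (sym (trans (cong (_* Nw) (ℚₚ.*-identityˡ 1ℚ)) (ℚₚ.*-identityˡ Nw)))
          (ℚₚ.≤-trans (jensen zs _) (E-bound zs 0≤ν λ z _ → subst (_≤ ν) (sym (T-N _ v)) Nv))) Nv)
        where Nw = N (EV zs (λ z → T (p b z ⊞ ⊟ p a z) v))
      0≤k = 0≤ι (2 ℕ.* κ)
      pair : ∀ a b → a ∈ ys → b ∈ ys → k * X a b ≤ ν + k * ν * bad a b
      pair a b a∈ b∈ with h a b a∈ b∈
      ... | 0≤bad , inj₁ isBad = ℚₚ.≤-trans (*-monoˡ 0≤k (Xle a b))
        (≤-by (ν + k * ν * (bad a b - 1ℚ)) (0≤-+ 0≤ν (0≤-* (0≤-* 0≤k 0≤ν) (0≤-diff isBad))) (lem k ν (bad a b)))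
        where
        lem : ∀ k n b → n + k * n * b ≡ k * n + (n + k * n * (b - 1ℚ))
        lem = solve-∀ ℚ-ring
      ... | 0≤bad , inj₂ good = ℚₚ.≤-trans
        (cauchy-schwarz k _ v (subst (λ t → t * N (EV zs (λ z → T (p b z ⊞ ⊟ p a z) v)) ≤ ν) (ι-* (2 ℕ.* κ) (2 ℕ.* κ)) good) Nv)
        (≤-by (k * ν * bad a b) (0≤-* (0≤-* 0≤k 0≤ν) 0≤bad) refl)
      β = E ys (λ a → E ys (bad a))
      step₁ : (1ℚ + 1ℚ) * (ι κ * N (EV ys (λ a → EV zs (λ z → T (p a z) v)))) ≤ ν + k * ν * β
      step₁ = begin
        (1ℚ + 1ℚ) * (ι κ * N (EV ys (λ a → EV zs (λ z → T (p a z) v)))) ≡⟨ sym (ℚₚ.*-assoc (1ℚ + 1ℚ) (ι κ) (N (EV ys (λ a → EV zs (λ z → T (p a z) v))))) ⟩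
        (1ℚ + 1ℚ) * ι κ * N (EV ys (λ a → EV zs (λ z → T (p a z) v))) ≡⟨ cong₂ _*_ (sym k≡) (N-cong (EV-swap ys zs _)) ⟩
        k * N (EV zs (λ z → EV ys (λ a → T (p a z) v))) ≤⟨ *-monoˡ 0≤k (jensen zs _) ⟩
        k * E zs (λ z → N (EV ys (λ a → T (p a z) v))) ≡⟨ cong (λ t → k * t) expand ⟩
        k * E ys (λ a → E ys (X a)) ≤⟨ E-E-bound ys ys 0≤ν 0≤k pair ℚₚ.≤-refl ⟩
        ν + k * ν * β ∎
        where open ℚₚ.≤-Reasoning
      step₂ : ν + k * ν * β ≤ ν + ν
      step₂ = ℚₚ.+-monoʳ-≤ ν (subst₂ _≤_ (lem k ν β) (ℚₚ.*-identityʳ ν) (*-monoˡ 0≤ν few))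
        where
        lem : ∀ k n b → n * (k * b) ≡ k * n * b
        lem = solve-∀ ℚ-ring

  between : ℕ → ℕ → ℕ → ℕ
  between lo w b with lo ℕ.≤? b | b ℕ.<? lo ℕ.+ w
  ... | yes _ | yes _ = 1
  ... | yes _ | no _ = 0
  ... | no _ | _ = 0

  Σ-between : ∀ lo w n → Σ (downFrom n) (λ b → ι (between lo w b)) ≤ ι ((n ℕ.⊓ (lo ℕ.+ w)) ∸ lo)
  Σ-between lo w zero = 0≤ι (0 ∸ lo)
  Σ-between lo w (suc n) with lo ℕ.≤? n | n ℕ.<? lo ℕ.+ w
  ... | yes p | yes q = ℚₚ.≤-trans (ℚₚ.+-monoʳ-≤ (ι 1) (Σ-between lo w n))
    (ℚₚ.≤-reflexive (trans (sym (ι-+ 1 (n ℕ.⊓ (lo ℕ.+ w) ∸ lo))) (cong ι e)))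
    where
    e : 1 ℕ.+ (n ℕ.⊓ (lo ℕ.+ w) ∸ lo) ≡ suc n ℕ.⊓ (lo ℕ.+ w) ∸ lo
    e rewrite ℕₚ.m≤n⇒m⊓n≡m (ℕₚ.<⇒≤ q) | ℕₚ.m≤n⇒m⊓n≡m q = sym (ℕₚ.+-∸-assoc 1 p)
  ... | yes p | no _ = ℚₚ.≤-trans (ℚₚ.≤-reflexive (ℚₚ.+-identityˡ _)) (ℚₚ.≤-trans (Σ-between lo w n) (ι-mono (ℕₚ.∸-monoˡ-≤ lo (ℕₚ.⊓-monoˡ-≤ _ (ℕₚ.n≤1+n n)))))
  ... | no _ | _ = ℚₚ.≤-trans (ℚₚ.≤-reflexive (ℚₚ.+-identityˡ _)) (ℚₚ.≤-trans (Σ-between lo w n) (ι-mono (ℕₚ.∸-monoˡ-≤ lo (ℕₚ.⊓-monoˡ-≤ _ (ℕₚ.n≤1+n n)))))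

  -- The indicator of an interval of 2γ integers that contains every b with |b - a| < γ. For a < γ
  -- the truncated subtraction only lengthens it on the right.
  close : ℕ → ℕ → ℕ → ℕ
  close γ a b = between (a ∸ γ) (2 ℕ.* γ) b

  E-close : ∀ γ n → E (downFrom n) (λ a → E (downFrom n) (λ b → ι (close γ a b))) ≤ inv n * ι (2 ℕ.* γ)
  E-close γ n = E-bound (downFrom n) (0≤-* (0≤inv n) (0≤ι (2 ℕ.* γ))) λ a _ →
    subst (λ k → inv k * Σ (downFrom n) (λ b → ι (close γ a b)) ≤ inv n * ι (2 ℕ.* γ)) (sym (Listₚ.length-downFrom n))
      (*-monoˡ (0≤inv n) (ℚₚ.≤-trans (Σ-between (a ∸ γ) (2 ℕ.* γ) n)
        (ι-mono (ℕₚ.≤-trans (ℕₚ.∸-monoˡ-≤ (a ∸ γ) (ℕₚ.m⊓n≤n n _)) (ℕₚ.≤-reflexive (ℕₚ.m+n∸m≡n (a ∸ γ) (2 ℕ.* γ)))))))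

  ∣+-+∣-≤ : ∀ {a b} → a ℕ.≤ b → ℤ.∣ (+ b) ℤ.- (+ a) ∣ ≡ b ∸ a
  ∣+-+∣-≤ {a} {b} h = trans (cong ℤ.∣_∣ (ℤₚ.m-n≡m⊖n b a)) (trans (ℤₚ.∣m⊖n∣≡∣n⊖m∣ b a) (ℤₚ.∣⊖∣-≤ h))

  ∣+-+∣-≥ : ∀ {a b} → b ℕ.≤ a → ℤ.∣ (+ b) ℤ.- (+ a) ∣ ≡ a ∸ b
  ∣+-+∣-≥ {a} {b} h = trans (cong ℤ.∣_∣ (ℤₚ.m-n≡m⊖n b a)) (ℤₚ.∣⊖∣-≤ h)

  close⊎far : ∀ γ a b → 1ℚ ≤ ι (close γ a b) ⊎ γ ℕ.≤ ℤ.∣ (+ b) ℤ.- (+ a) ∣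
  close⊎far γ a b with (a ∸ γ) ℕ.≤? b | b ℕ.<? (a ∸ γ) ℕ.+ 2 ℕ.* γ
  ... | yes p | yes q = inj₁ (ℚₚ.≤-reflexive refl)
  ... | yes p | no q = inj₂ (ℕₚ.≤-trans (ℕₚ.m+n≤o⇒m≤o∸n γ le) (ℕₚ.≤-reflexive e))
    where
    le : γ ℕ.+ a ℕ.≤ b
    le = ℕₚ.≤-trans (ℕₚ.+-monoʳ-≤ γ (ℕₚ.m≤n+m∸n a γ)) (ℕₚ.≤-trans (ℕₚ.≤-reflexive (lem γ (a ∸ γ))) (ℕₚ.≮⇒≥ q))
      where
      lem : ∀ g x → g ℕ.+ (g ℕ.+ x) ≡ x ℕ.+ 2 ℕ.* g
      lem = ℕ-solve
    e : b ∸ a ≡ ℤ.∣ (+ b) ℤ.- (+ a) ∣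
    e = sym (∣+-+∣-≤ (ℕₚ.m+n≤o⇒n≤o γ le))
  ... | no p | _ = inj₂ (ℕₚ.≤-trans (ℕₚ.m+n≤o⇒m≤o∸n γ le) (ℕₚ.≤-reflexive e))
    where
    lt : b ℕ.< a ∸ γ
    lt = ℕₚ.≰⇒> p
    le : γ ℕ.+ b ℕ.≤ a
    le = ℕₚ.≤-trans (ℕₚ.+-monoʳ-≤ γ (ℕₚ.<⇒≤ lt)) (ℕₚ.≤-reflexive (ℕₚ.m+[n∸m]≡n γ≤a))
      where
      γ≤a : γ ℕ.≤ a
      γ≤a with ℕₚ.≤-total γ a
      ... | inj₁ h = h
      ... | inj₂ h = ⊥-elim (ℕₚ.n≮0 (ℕₚ.≤-trans lt (ℕₚ.≤-reflexive (ℕₚ.m≤n⇒m∸n≡0 h))))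
    e : a ∸ b ≡ ℤ.∣ (+ b) ℤ.- (+ a) ∣
    e = sym (∣+-+∣-≥ (ℕₚ.m+n≤o⇒n≤o γ le))

  difference-< : ∀ {m a b} → a ℕ.< m → b ℕ.< m → ℤ.∣ (+ b) ℤ.- (+ a) ∣ ℕ.< m
  difference-< {m} {a} {b} a< b< with ℕₚ.≤-total a b
  ... | inj₁ h = ℕₚ.≤-<-trans (ℕₚ.≤-trans (ℕₚ.≤-reflexive (∣+-+∣-≤ h)) (ℕₚ.m∸n≤m b a)) b<
  ... | inj₂ h = ℕₚ.≤-<-trans (ℕₚ.≤-trans (ℕₚ.≤-reflexive (∣+-+∣-≥ h)) (ℕₚ.m∸n≤m a b)) a<

-- Averages over boxes of differenced variables.

module BoxEstimates where
  open import Data.Rational using (_+_; _*_; _≤_)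
  open import Tactic.RingSolver using (solve-∀)
  open RationalSums
  open InnerProductSpaces
  open AlmostInvariance
  open VanDerCorput

  bump : ∀ {n} → Fin n → ℤ → Vec ℤ n → Vec ℤ n
  bump i x z = Vec.updateAt z i (λ t → x ℤ.+ t)

  tuples : ∀ {k} → Vec ℕ k → List (Vec ℕ k)
  tuples [] = [ [] ]
  tuples (m ∷ ms) = cartesianProductWith _∷_ (downFrom m) (tuples ms)

  place : ∀ {n k} → Vec (Fin n) k → Vec ℕ k → Vec ℤ n → Vec ℤ n
  place [] [] z = z
  place (i ∷ is) (a ∷ as) z = bump i (+ a) (place is as z)

  module Differences (n : ℕ) (I : Set) where
    open Shift I public

    -- Repeated differencing in the variables js leaves c times the product of the increments, as
    -- for a polynomial of degree |js|. Stated by recursion, the property passes to each difference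
    -- of q by definition, as the induction in `box` requires.
    Diff : ∀ {k} → Vec (Fin n) k → (Vec ℤ n → Λ) → Λ → Set
    Diff [] q c = ∀ z i → q z i ≡ c i
    Diff (j ∷ js) q c = ∀ a b → Diff js (λ z → q (bump j b z) ⊞ ⊟ q (bump j a z)) ((b ℤ.- a) ⊠ c)

    Diff-cong : ∀ {k} (js : Vec (Fin n) k) {q q′ c c′} → (∀ z i → q z i ≡ q′ z i) → (∀ i → c i ≡ c′ i) →
      Diff js q c → Diff js q′ c′
    Diff-cong [] hq hc h z i = trans (sym (hq z i)) (trans (h z i) (hc i))
    Diff-cong (j ∷ js) hq hc h a b = Diff-cong js
      (λ z i → cong₂ (λ s t → s ℤ.+ ℤ.- t) (hq _ i) (hq _ i)) (λ i → cong ((b ℤ.- a) ℤ.*_) (hc i)) (h a b)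

  ι*inv≤1 : ∀ {a b} → a ℕ.≤ b → ι a * inv b ≤ 1ℚ
  ι*inv≤1 {a} {zero} h = subst (_≤ 1ℚ) (sym (ℚₚ.*-zeroʳ (ι a))) 0≤1
  ι*inv≤1 {a} {suc b} h = ℚₚ.≤-trans (*-monoʳ (0≤inv (suc b)) (ι-mono h))
    (ℚₚ.≤-reflexive (trans (ℚₚ.*-comm (ι (suc b)) _) (inv-inverse b)))

  -- The precision needed after k differencings in order to have κ before them: one use of
  -- `van-der-corput` asks for (2κ)².
  κ-iter : ℕ → ℕ → ℕ
  κ-iter zero κ = κ
  κ-iter (suc k) κ = κ-iter k ((2 ℕ.* κ) ℕ.* (2 ℕ.* κ))

  κ≤κ-iter : ∀ k κ → κ ℕ.≤ κ-iter k κ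
  κ≤κ-iter zero κ = ℕₚ.≤-refl
  κ≤κ-iter (suc k) zero = ℕ.z≤n
  κ≤κ-iter (suc k) (suc κ) = ℕₚ.≤-trans
    (ℕₚ.≤-trans (ℕₚ.m≤m+n (suc κ) (3 ℕ.+ 7 ℕ.* κ ℕ.+ 4 ℕ.* κ ℕ.* κ)) (ℕₚ.≤-reflexive (lem κ))) (κ≤κ-iter k _)
    where
    lem : ∀ κ → suc κ ℕ.+ (3 ℕ.+ 7 ℕ.* κ ℕ.+ 4 ℕ.* κ ℕ.* κ) ≡ (2 ℕ.* suc κ) ℕ.* (2 ℕ.* suc κ)
    lem = ℕ-solve

  prod : ∀ {k} → Vec ℕ k → ℕ
  prod [] = 1
  prod (x ∷ xs) = x ℕ.* prod xs

  boxLengths : ∀ {k} → ℕ → ℕ → Vec ℕ k → Vec ℕ (suc k)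
  boxLengths width Y [] = Y ∷ []
  boxLengths width Y (γ ∷ γs) = width ℕ.* γ ∷ boxLengths width Y γs

  module Block {I : Set} (H : IPS I) (n : ℕ) where
    open CauchySchwarz H public
    open Differences n I using (Diff; Diff-cong)

    private variable
      A B : Set

    EV-map : ∀ (f : A → B) (xs : List A) (F : B → V) → EV (map f xs) F ≈ EV xs (λ x → F (f x))
    EV-map f xs F = eq λ w → trans (ip-EV (map f xs) F w) (trans
      (cong₂ (λ l s → inv l * s) (Listₚ.length-map f xs) (Σ-map f xs _)) (sym (ip-EV xs _ w)))

    EV-singleton : ∀ (x : A) (F : A → V) → EV [ x ] F ≈ F x
    EV-singleton x F = ≈-trans (·-cong (inv 1) (eq λ w → trans (ip-⊕ (F x) 0V w) (trans (cong (λ t → ⟨ F x , w ⟩ + t) (ip-0 w)) (ℚₚ.+-identityʳ _))))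
      (eq λ w → trans (ip-· (inv 1) (F x) w) (ℚₚ.*-identityˡ _))

    op-ap-cong : ∀ {g g′} Y v → (∀ i → g i ≡ g′ i) → ⟦ ap g Y ⟧ v ≈ ⟦ ap g′ Y ⟧ v
    op-ap-cong {g} {g′} Y v h = ≈-trans (EV-map _ (downFrom Y) _) (≈-trans
      (EV-cong (downFrom Y) λ j → ≡⇒≈ (T-cong (λ i → cong (+ j ℤ.*_) (h i)) v)) (≈-sym (EV-map _ (downFrom Y) _)))

    module Box (width : ℕ) (c₀ : Λ) (Y : ℕ) (v : V) (ν : ℚ) (0≤ν : 0ℚ ≤ ν) (Nv : N v ≤ ν) where

      lengths : ∀ {k} → Vec ℕ k → Vec ℕ (suc k)
      lengths = boxLengths width Y

      -- What is left when all variables but the last have been differenced: q is affine in the last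
      -- one, with slope D c₀ times the increments x. Pairs whose increment is below γ have been
      -- discarded, so the slope is bounded from both sides.
      Linear : ∀ {k} → Vec ℕ k → ℕ → ℤ → Set
      Linear [] κ D = ι κ * N (⟦ ap (D ⊠ c₀) Y ⟧ v) ≤ ν
      Linear (γ ∷ γs) κ D = ∀ x → γ ℕ.≤ ℤ.∣ x ∣ → ℤ.∣ x ∣ ℕ.< width ℕ.* γ → Linear γs ((2 ℕ.* κ) ℕ.* (2 ℕ.* κ)) (x ℤ.* D)

      -- One application of `van-der-corput` per variable except the last. The discarded pairs have
      -- density at most 2/width, and `wide` makes this small enough for every precision met on the
      -- way.
      box : ∀ {k} (is : Vec (Fin n) (suc k)) (γs : Vec ℕ k) κ D q z → 4 ℕ.* κ-iter k κ ℕ.≤ width →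
        Diff is q (D ⊠ c₀) → Linear γs κ D →
        ι κ * N (EV (tuples (lengths γs)) (λ as → T (q (place is as z)) v)) ≤ ν
      box (i ∷ []) [] κ D q z wide hq lin = subst (λ t → ι κ * t ≤ ν) (sym (trans (N-cong e) (T-N _ _))) lin
        where
        q₀ = q (bump i (+ 0) z)
        shift : ∀ y u → q (bump i (+ y) z) u ≡ (q₀ ⊞ (+ y) ⊠ (D ⊠ c₀)) u
        shift y u = trans (lem (q (bump i (+ y) z) u) (q₀ u)) (cong (λ t → q₀ u ℤ.+ t)
          (trans (hq (+ 0) (+ y) z u) (cong (ℤ._* (D ℤ.* c₀ u)) (ℤₚ.+-identityʳ (+ y)))))
          where
          lem : ∀ a b → a ≡ b ℤ.+ (a ℤ.+ ℤ.- b)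
          lem = ℤ-Solver.solve-∀
        e : EV (tuples (Y ∷ [])) (λ as → T (q (place (i ∷ []) as z)) v) ≈ T q₀ (⟦ ap (D ⊠ c₀) Y ⟧ v)
        e = ≈-trans (EV-product _∷_ (downFrom Y) [ [] ] _) (≈-trans (EV-cong (downFrom Y) λ y →
              ≈-trans (EV-singleton {A = Vec ℕ 0} [] (λ as → T (q (place (i ∷ []) (y ∷ as) z)) v)) (≈-trans (≡⇒≈ (T-cong (shift y) v)) (≈-sym (T-∘ q₀ _ v))))
            (≈-trans (EV-T (downFrom Y) q₀ _) (T-≈ q₀ (≈-sym (EV-map _ (downFrom Y) _)))))
      box {suc k} (i ∷ is) (γ ∷ γs) κ D q z wide hq lin = subst (λ t → ι κ * t ≤ ν)
        (sym (N-cong (EV-product _∷_ (downFrom (width ℕ.* γ)) (tuples (lengths γs)) _)))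
        (van-der-corput (downFrom (width ℕ.* γ)) (tuples (lengths γs)) (λ a as → q (bump i (+ a) (place is as z)))
          (λ a b → ι (close γ a b)) κ v 0≤ν Nv pair few)
        where
        κ′ = (2 ℕ.* κ) ℕ.* (2 ℕ.* κ)
        pair : ∀ a b → a ∈ downFrom (width ℕ.* γ) → b ∈ downFrom (width ℕ.* γ) → 0ℚ ≤ ι (close γ a b) ×
          (1ℚ ≤ ι (close γ a b) ⊎ ι κ′ * N (EV (tuples (lengths γs)) (λ as →
            T (q (bump i (+ b) (place is as z)) ⊞ ⊟ q (bump i (+ a) (place is as z))) v)) ≤ ν)
        pair a b a∈ b∈ with close⊎far γ a b
        ... | inj₁ p = 0≤ι (close γ a b) , inj₁ p
        ... | inj₂ p = 0≤ι (close γ a b) , inj₂ (box is γs κ′ (x ℤ.* D) q′ z wide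
            (Diff-cong is {q = q′} {q′ = q′} (λ _ _ → refl) (λ u → sym (ℤₚ.*-assoc x D (c₀ u))) (hq (+ a) (+ b)))
            (lin x p (difference-< {a = a} {b = b} (∈-downFrom⁻ a∈) (∈-downFrom⁻ b∈))))
          where
          x = (+ b) ℤ.- (+ a)
          q′ : Vec ℤ n → Λ
          q′ w = q (bump i (+ b) w) ⊞ ⊟ q (bump i (+ a) w)
        few : ι (2 ℕ.* κ) * E (downFrom (width ℕ.* γ)) (λ a → E (downFrom (width ℕ.* γ)) (λ b → ι (close γ a b))) ≤ 1ℚ
        few = ℚₚ.≤-trans (*-monoˡ (0≤ι (2 ℕ.* κ)) (E-close γ (width ℕ.* γ)))
          (ℚₚ.≤-trans (ℚₚ.≤-reflexive (trans (lem (ι (2 ℕ.* κ)) (inv (width ℕ.* γ)) (ι (2 ℕ.* γ)))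
              (cong (_* inv (width ℕ.* γ)) (sym (ι-* (2 ℕ.* κ) (2 ℕ.* γ))))))
            (ι*inv≤1 (ℕₚ.≤-trans (ℕₚ.≤-reflexive (lem₂ κ γ)) (ℕₚ.*-monoˡ-≤ γ (ℕₚ.≤-trans (ℕₚ.*-monoʳ-≤ 4 (κ≤κ-iter (suc k) κ)) wide)))))
          where
          lem : ∀ a b c → a * (b * c) ≡ a * c * b
          lem = solve-∀ ℚ-ring
          lem₂ : ∀ κ γ → 2 ℕ.* κ ℕ.* (2 ℕ.* γ) ≡ 4 ℕ.* κ ℕ.* γ
          lem₂ = ℕ-solve

      -- Replaces the nested quantifiers over the increments by one over their product with D: only
      -- its size will matter.
      linear : ∀ {k} (γs : Vec ℕ k) κ D →
        (∀ D′ → prod γs ℕ.* ℤ.∣ D ∣ ℕ.≤ ℤ.∣ D′ ∣ → ℤ.∣ D′ ∣ ℕ.≤ prod (Vec.map (width ℕ.*_) γs) ℕ.* ℤ.∣ D ∣ →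
          ι (κ-iter k κ) * N (⟦ ap (D′ ⊠ c₀) Y ⟧ v) ≤ ν) →
        Linear γs κ D
      linear [] κ D h = h D (ℕₚ.≤-reflexive (ℕₚ.*-identityˡ _)) (ℕₚ.≤-reflexive (sym (ℕₚ.*-identityˡ _)))
      linear (γ ∷ γs) κ D h x lo hi = linear γs _ (x ℤ.* D) λ D′ lo′ hi′ → h D′
        (ℕₚ.≤-trans (ℕₚ.≤-reflexive (lem γ (prod γs) ℤ.∣ D ∣)) (ℕₚ.≤-trans (ℕₚ.*-monoʳ-≤ (prod γs)
          (ℕₚ.≤-trans (ℕₚ.*-monoˡ-≤ ℤ.∣ D ∣ lo) (ℕₚ.≤-reflexive (sym (ℤₚ.abs-* x D))))) lo′))
        (ℕₚ.≤-trans hi′ (ℕₚ.≤-trans (ℕₚ.*-monoʳ-≤ P (ℕₚ.≤-trans (ℕₚ.≤-reflexive (ℤₚ.abs-* x D)) (ℕₚ.*-monoˡ-≤ ℤ.∣ D ∣ (ℕₚ.<⇒≤ hi))))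
          (ℕₚ.≤-reflexive (sym (lem (width ℕ.* γ) P ℤ.∣ D ∣)))))
        where
        P = prod (Vec.map (width ℕ.*_) γs)
        lem : ∀ a b c → a ℕ.* b ℕ.* c ≡ b ℕ.* (a ℕ.* c)
        lem = ℕ-solve

    -- The average over differences of two members of a progression, with triangular weights. The
    -- form A†A is kept throughout, because its quadratic form at g is the energy ‖A g‖².
    fejér : Λ → ℕ → Avg
    fejér g L = ap g L † ∘ ap g L

    ap-nonempty : ∀ (g : Λ) {L} → 1 ℕ.≤ L → Nonempty (map (λ j → (+ j) ⊠ g) (downFrom L))
    ap-nonempty g {L} h = ℕₚ.≤-trans h (ℕₚ.≤-reflexive (sym (trans (Listₚ.length-map _ (downFrom L)) (Listₚ.length-downFrom L))))

    Near-fejér : ∀ {Y K g L} → 1 ℕ.≤ L → (∀ m → m ℕ.< L → Abs Y (4 ℕ.* K) ((+ m) ⊠ g)) → Near Y K (fejér g L)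
    Near-fejér {Y} {K} {g} {L} 1≤L h = Near-∘ {Y} {K} {ap g L †} {ap g L}
      (Near-av {Y} {4 ℕ.* K} {map ⊟_ as} (ℕₚ.≤-trans (ap-nonempty g 1≤L) (ℕₚ.≤-reflexive (sym (Listₚ.length-map ⊟_ as)))) neg)
      (Near-av {Y} {4 ℕ.* K} {as} (ap-nonempty g 1≤L) pos)
      where
      as = map (λ j → (+ j) ⊠ g) (downFrom L)
      pos : ∀ a → a ∈ as → Abs Y (4 ℕ.* K) a
      pos a a∈ with ∈-map⁻ _ a∈
      ... | m , m∈ , refl = h m (∈-downFrom⁻ m∈)
      neg : ∀ a → a ∈ map ⊟_ as → Abs Y (4 ℕ.* K) a
      neg a a∈ with ∈-map⁻ ⊟_ a∈
      ... | b , b∈ , refl = Abs-⊟ {Y} {4 ℕ.* K} {b} (pos b b∈)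

    Abs-signed : ∀ {Y K} {g : Λ} {m : ℕ} (x : ℤ) → Abs Y K ((+ m) ⊠ (x ⊠ g)) → Abs Y K ((+ (m ℕ.* ℤ.∣ x ∣)) ⊠ g)
    Abs-signed {Y} {K} {g} {m} (+ k) p = Abs-cong {Y} {K} (λ i → sym (trans (cong (ℤ._* g i) (ℤₚ.pos-* m k)) (ℤₚ.*-assoc (+ m) (+ k) (g i)))) p
    Abs-signed {Y} {K} {g} {m} -[1+ k ] p = Abs-cong {Y} {K} (λ i → trans (lem (+ m) (+ suc k) (g i)) (cong (ℤ._* g i) (sym (ℤₚ.pos-* m (suc k))))) (Abs-⊟ {Y} {K} p)
      where
      lem : ∀ m k g → ℤ.- (m ℤ.* ((ℤ.- k) ℤ.* g)) ≡ m ℤ.* k ℤ.* g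
      lem = ℤ-Solver.solve-∀

-- Plans: blocks of box variables and the progressions they produce.

module AveragingPlans where
  open import Data.Rational using (_+_; _*_; _≤_)
  open import Tactic.RingSolver using (solve-∀)
  open import Data.Nat.Divisibility using (_∣_; ∣n⇒∣m*n; m∣m*n)
  open RationalSums
  open InnerProductSpaces
  open AlmostInvariance
  open VanDerCorput
  open BoxEstimates

  -- The coefficient that has to divide the modulus is known only by a bound on its size, so the
  -- modulus is taken to be a factorial.
  ≤⇒∣! : ∀ {m n} → 1 ℕ.≤ m → m ℕ.≤ n → m ∣ n !
  ≤⇒∣! {suc m} {zero} 1≤m ()
  ≤⇒∣! {m} {suc n} 1≤m m≤ with m ℕ.≟ suc n
  ... | yes refl = m∣m*n (n !)
  ... | no m≢ = ∣n⇒∣m*n (suc n) (≤⇒∣! 1≤m (ℕₚ.≤-pred (ℕₚ.≤∧≢⇒< m≤ m≢)))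

  *-pos : ∀ {m n} → 1 ℕ.≤ m → 1 ℕ.≤ n → 1 ℕ.≤ m ℕ.* n
  *-pos = ℕₚ.*-mono-≤

  ^-pos : ∀ {m} n → 1 ℕ.≤ m → 1 ℕ.≤ m ℕ.^ n
  ^-pos zero h = ℕₚ.≤-refl
  ^-pos (suc n) h = *-pos h (^-pos n h)

  ≤-*ˡ : ∀ {m} n → 1 ℕ.≤ m → n ℕ.≤ m ℕ.* n
  ≤-*ˡ n h = ℕₚ.≤-trans (ℕₚ.≤-reflexive (sym (ℕₚ.*-identityˡ n))) (ℕₚ.*-monoˡ-≤ n h)

  ≤-*ʳ : ∀ {m} n → 1 ℕ.≤ m → n ℕ.≤ n ℕ.* m
  ≤-*ʳ n h = ℕₚ.≤-trans (ℕₚ.≤-reflexive (sym (ℕₚ.*-identityʳ n))) (ℕₚ.*-monoʳ-≤ n h)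

  *-^ : ∀ a b n → (a ℕ.* b) ℕ.^ n ≡ a ℕ.^ n ℕ.* b ℕ.^ n
  *-^ a b zero = refl
  *-^ a b (suc n) = trans (cong (a ℕ.* b ℕ.*_) (*-^ a b n)) (lem a b (a ℕ.^ n) (b ℕ.^ n))
    where
    lem : ∀ a b c d → a ℕ.* b ℕ.* (c ℕ.* d) ≡ a ℕ.* c ℕ.* (b ℕ.* d)
    lem = ℕ-solve

  longs : ∀ k → ℕ → ℕ → Vec ℕ k
  longs zero j γ = []
  longs (suc k) zero γ = 1 ∷ longs k zero γ
  longs (suc k) (suc j) γ = γ ∷ longs k j γ

  prod-longs : ∀ {k j} γ → j ℕ.≤ k → prod (longs k j γ) ≡ γ ℕ.^ j
  prod-longs {zero} {zero} γ h = refl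
  prod-longs {suc k} {zero} γ h = trans (ℕₚ.+-identityʳ _) (prod-longs {k} γ ℕ.z≤n)
  prod-longs {suc k} {suc j} γ (ℕ.s≤s h) = cong (γ ℕ.*_) (prod-longs γ h)

  prod-wide : ∀ {k j} w γ → j ℕ.≤ k → prod (Vec.map (w ℕ.*_) (longs k j γ)) ≡ w ℕ.^ k ℕ.* γ ℕ.^ j
  prod-wide {zero} {zero} w γ h = refl
  prod-wide {suc k} {zero} w γ h = trans (cong (w ℕ.* 1 ℕ.*_) (prod-wide {k} w γ ℕ.z≤n)) (lem w (w ℕ.^ k))
    where
    lem : ∀ w x → w ℕ.* 1 ℕ.* (x ℕ.* 1) ≡ w ℕ.* x ℕ.* 1
    lem = ℕ-solve
  prod-wide {suc k} {suc j} w γ (ℕ.s≤s h) = trans (cong (w ℕ.* γ ℕ.*_) (prod-wide w γ h)) (lem w γ (w ℕ.^ k) (γ ℕ.^ j))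
    where
    lem : ∀ w g x y → w ℕ.* g ℕ.* (x ℕ.* y) ≡ w ℕ.* x ℕ.* (g ℕ.* y)
    lem = ℕ-solve

  extend : ∀ {n k} → Vec (Fin n) k → Vec ℕ k → List (Vec ℤ n) → List (Vec ℤ n)
  extend is ms = cartesianProductWith (place is) (tuples ms)

  cube : ∀ n → ℕ → List (Vec ℤ n)
  cube zero u = [ [] ]
  cube (suc n) u = cartesianProductWith _∷_ (map (λ j → + suc j) (downFrom u)) (cube n u)

  module Constants (k : ℕ) (c : ℤ) (κ : ℕ) where
    -- 4 κ, because the vector X(v - R v) to which the box estimate is applied may have squared norm
    -- 4‖v‖².
    κ̂ = κ-iter k (4 ℕ.* κ)
    width = 4 ℕ.* κ̂
    -- Bounds the coefficients |D c| that differencing leaves at stage 0, where all ranges are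
    -- bounded; hence they divide `W′`.
    B = ℤ.∣ c ∣ ℕ.* width ℕ.^ k
    W′ = B !
    -- 32 = 2 · 4 · 4: the 2 of `Abs-ap`, a 4 for composing an average with its adjoint, and a 4 for
    -- adding the two parts of a shift in `next-stage`.
    K̂ = 32 ℕ.* κ̂
    M = K̂ ℕ.* W′
    C = K̂ ℕ.* B ℕ.* M

    -- In stage j, j of the k differenced box variables have ranges of order γ and the others bounded ones, so differencing leaves
    -- coefficients of order γʲ; γ ≈ M σ then gives absorption up to length L ≈ γʲ σ, and σ decreases with j fast enough (gap) that the next
    -- stage's coefficients are still below L. For j = k this is the full degree: L is of order u^(k+1).
    σ γ L Y : ℕ → ℕ → ℕ
    σ u j = C ℕ.^ (k ∸ j) ℕ.* u
    γ u j = M ℕ.* σ u j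
    L u j = γ u j ℕ.^ j ℕ.* σ u j
    Y u j = width ℕ.* γ u j

    module Positive (1≤∣c∣ : 1 ℕ.≤ ℤ.∣ c ∣) (1≤κ : 1 ℕ.≤ κ) where
      1≤κ̂ : 1 ℕ.≤ κ̂
      1≤κ̂ = ℕₚ.≤-trans (*-pos {4} (ℕ.s≤s ℕ.z≤n) 1≤κ) (κ≤κ-iter k (4 ℕ.* κ))
      1≤width : 1 ℕ.≤ width
      1≤width = *-pos {4} (ℕ.s≤s ℕ.z≤n) 1≤κ̂
      1≤B : 1 ℕ.≤ B
      1≤B = *-pos 1≤∣c∣ (^-pos k 1≤width)
      1≤W′ : 1 ℕ.≤ W′
      1≤W′ = ℕₚ.1≤n! B
      1≤K̂ : 1 ℕ.≤ K̂
      1≤K̂ = *-pos {32} (ℕ.s≤s ℕ.z≤n) 1≤κ̂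
      1≤M : 1 ℕ.≤ M
      1≤M = *-pos 1≤K̂ 1≤W′
      1≤C : 1 ℕ.≤ C
      1≤C = *-pos (*-pos 1≤K̂ 1≤B) 1≤M
      1≤σ : ∀ {u} j → 1 ℕ.≤ u → 1 ℕ.≤ σ u j
      1≤σ j h = *-pos (^-pos (k ∸ j) 1≤C) h
      1≤γ : ∀ {u} j → 1 ℕ.≤ u → 1 ℕ.≤ γ u j
      1≤γ j h = *-pos 1≤M (1≤σ j h)
      1≤L : ∀ {u} j → 1 ℕ.≤ u → 1 ℕ.≤ L u j
      1≤L j h = *-pos (^-pos j (1≤γ j h)) (1≤σ j h)

      M*L : ∀ u j → M ℕ.* L u j ≡ γ u j ℕ.^ j ℕ.* γ u j
      M*L u j = lem M (γ u j ℕ.^ j) (σ u j)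
        where
        lem : ∀ m g s → m ℕ.* (g ℕ.* s) ≡ g ℕ.* (m ℕ.* s)
        lem = ℕ-solve

      σ-step : ∀ u {j} → suc j ℕ.≤ k → σ u j ≡ C ℕ.* σ u (suc j)
      σ-step u {j} h = trans (cong (λ e → C ℕ.^ e ℕ.* u) (ℕₚ.+-∸-assoc 1 h)) (ℕₚ.*-assoc C _ u)

      -- Bounds the remainder in `next-stage`, where |x| ≤ B γ^(j+1). The constant C = K̂ B M is
      -- made for this: (C σ_(j+1))^(j+1) = σ_j^(j+1), which is at most L_j.
      gap : ∀ u {j} → 1 ℕ.≤ u → suc j ℕ.≤ k → K̂ ℕ.* (B ℕ.* γ u (suc j) ℕ.^ suc j) ℕ.≤ L u j
      gap u {j} 1≤u h = begin
        K̂ ℕ.* (B ℕ.* (M ℕ.* s) ℕ.^ suc j) ≡⟨ sym (ℕₚ.*-assoc K̂ B _) ⟩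
        K̂ ℕ.* B ℕ.* (M ℕ.* s) ℕ.^ suc j ≤⟨ ℕₚ.*-monoˡ-≤ _ (≤-*ʳ (K̂ ℕ.* B) (^-pos j (*-pos 1≤K̂ 1≤B))) ⟩
        (K̂ ℕ.* B) ℕ.^ suc j ℕ.* (M ℕ.* s) ℕ.^ suc j ≡⟨ sym (*-^ (K̂ ℕ.* B) (M ℕ.* s) (suc j)) ⟩
        (K̂ ℕ.* B ℕ.* (M ℕ.* s)) ℕ.^ suc j ≡⟨ cong (ℕ._^ suc j) (sym (ℕₚ.*-assoc (K̂ ℕ.* B) M s)) ⟩
        (C ℕ.* s) ℕ.^ suc j ≡⟨ cong (ℕ._^ suc j) (sym (σ-step u h)) ⟩
        σ u j ℕ.* σ u j ℕ.^ j ≡⟨ ℕₚ.*-comm (σ u j) _ ⟩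
        σ u j ℕ.^ j ℕ.* σ u j ≤⟨ ℕₚ.*-monoˡ-≤ (σ u j) (ℕₚ.^-monoˡ-≤ j (≤-*ˡ (σ u j) 1≤M)) ⟩
        L u j ∎
        where
        open ℕₚ.≤-Reasoning
        s = σ u (suc j)

  module Plan (n k : ℕ) (I : Set) (S : Vec (Fin n) (suc k) → I → ℤ) (c : ℤ) (κ u : ℕ) where
    open Progression I public
    open Constants k c κ public

    direction : Vec (Fin n) (suc k) → Λ
    direction is = (+ W′) ⊠ S is

    lens : ℕ → Vec ℕ (suc k)
    lens j = boxLengths width (Y u j) (longs k j (γ u j))

    stageY : Vec (Fin n) (suc k) → ℕ → List (Vec ℤ n) → List (Vec ℤ n)
    stageY is zero 𝒴 = extend is (lens zero) 𝒴
    stageY is (suc j) 𝒴 = extend is (lens (suc j)) (stageY is j 𝒴)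

    stageA : Vec (Fin n) (suc k) → ℕ → Avg → Avg
    stageA is zero A = A ∘ ap (direction is) (L u zero)
    stageA is (suc j) A = stageA is j A ∘ ap (direction is) (L u (suc j))

    stageQ : Vec (Fin n) (suc k) → ℕ → Avg → Avg
    stageQ is zero Q = Q ∘ (ap (direction is) (L u zero) † ∘ ap (direction is) (L u zero))
    stageQ is (suc j) Q = stageQ is j Q ∘ (ap (direction is) (L u (suc j)) † ∘ ap (direction is) (L u (suc j)))

    -- A point consists of a base point of a cube and an independent block of displacements in the
    -- coordinates `is` for every tuple and every stage. Each block is spent on one progression
    -- factor of `planQ`.
    planY : List (Vec (Fin n) (suc k)) → List (Vec ℤ n)
    planY [] = cube n u
    planY (is ∷ iss) = stageY is k (planY iss)

    planA planQ : List (Vec (Fin n) (suc k)) → Avg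
    planA [] = one
    planA (is ∷ iss) = stageA is k (planA iss)
    planQ [] = one
    planQ (is ∷ iss) = stageQ is k (planQ iss)

  bump-comm : ∀ {n} (i j : Fin n) x y (z : Vec ℤ n) → bump i x (bump j y z) ≡ bump j y (bump i x z)
  bump-comm zero zero x y (t ∷ z) = cong (_∷ z) (lem x y t)
    where
    lem : ∀ x y t → x ℤ.+ (y ℤ.+ t) ≡ y ℤ.+ (x ℤ.+ t)
    lem = ℤ-Solver.solve-∀
  bump-comm zero (suc j) x y (t ∷ z) = refl
  bump-comm (suc i) zero x y (t ∷ z) = refl
  bump-comm (suc i) (suc j) x y (t ∷ z) = cong (t ∷_) (bump-comm i j x y z)

  module Killing {I : Set} (H : IPS I) (n k : ℕ) (S : Vec (Fin n) (suc k) → I → ℤ) (c : ℤ) (κ u : ℕ)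
    (1≤∣c∣ : 1 ℕ.≤ ℤ.∣ c ∣) (1≤κ : 1 ℕ.≤ κ) (1≤u : 1 ℕ.≤ u) where
    open Block H n
    open Differences n I using (Diff; Diff-cong)
    open Plan n k I S c κ u hiding (Λ; 0Λ; _⊞_; ⊟_; _⊠_; Avg; one; av; _∘_; _†; ap)
    open Positive 1≤∣c∣ 1≤κ

    Class : (Vec ℤ n → Λ) → Set
    Class q = ∀ is → Diff is q (c ⊠ S is)

    Diff-bump : ∀ {m} (js : Vec (Fin n) m) {q d} i x → Diff js q d → Diff js (λ z → q (bump i x z)) d
    Diff-bump [] i x h z = h (bump i x z)
    Diff-bump (j ∷ js) {q} i x h a b = Diff-cong js
      (λ z t → cong₂ (λ s r → q s t ℤ.+ ℤ.- q r t) (bump-comm j i b x z) (bump-comm j i a x z)) (λ _ → refl)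
      (Diff-bump js i x (h a b))

    Class-place : ∀ {m} (js : Vec (Fin n) m) as {q} → Class q → Class (λ z → q (place js as z))
    Class-place [] [] h = h
    Class-place (j ∷ js) (a ∷ as) {q} h = Class-place js as {λ z → q (bump j (+ a) z)} (λ is → Diff-bump is j (+ a) (h is))

    -- Quantified over the whole class, since q with the variables of one block held fixed is
    -- another member of it; thus what one block has achieved survives the addition of further
    -- blocks.
    Kill : List (Vec ℤ n) → ℕ → Avg → Set
    Kill 𝒴 K Q = ∀ q → Class q → Near (av (map q 𝒴)) K Q

    av-map : ∀ (q : Vec ℤ n → Λ) 𝒴 x → ⟦ av (map q 𝒴) ⟧ x ≈ EV 𝒴 (λ z → T (q z) x)
    av-map q 𝒴 x = EV-map q 𝒴 _

    kill-extend : ∀ {m} (js : Vec (Fin n) m) ms {𝒴 K Q} → Kill 𝒴 K Q → Kill (extend js ms 𝒴) K Q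
    kill-extend js ms {𝒴} {K} {Q} h q hq v = subst (λ t → ι K * t ≤ N v)
      (sym (N-cong (≈-trans (av-map q (extend js ms 𝒴) x) (EV-product (place js) (tuples ms) 𝒴 _))))
      (jensen-≤ (tuples ms) _ (0≤ι K) (psd v) λ as _ →
        subst (λ t → ι K * t ≤ N v) (N-cong (av-map (λ z → q (place js as z)) 𝒴 x)) (h _ (Class-place js as hq) v))
      where x = v ⊖ ⟦ Q ⟧ v

    module Stage (is : Vec (Fin n) (suc k)) (j : ℕ) (j≤k : j ℕ.≤ k) (X : Avg)
      (absorbs : ∀ D → γ u j ℕ.^ j ℕ.≤ ℤ.∣ D ∣ → ℤ.∣ D ∣ ℕ.≤ width ℕ.^ k ℕ.* γ u j ℕ.^ j → ∀ m → m ℕ.< L u j →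
        Abs (ap (D ⊠ (c ⊠ S is)) (Y u j) ∘ X) (4 ℕ.* κ̂) ((+ m) ⊠ direction is)) where

      R : Avg
      R = fejér (direction is) (L u j)

      -- Every progression that differencing can produce absorbs R in company with X, and so makes
      -- X(v - R v) small. The box estimate carries this back to the average over the block.
      box-kills : ∀ q z → Class q → ∀ v →
        ι κ * N (EV (tuples (lens j)) (λ as → T (q (place is as z)) (⟦ X ⟧ (v ⊖ ⟦ R ⟧ v)))) ≤ N v
      box-kills q z hq v = *-cancelˡ 3 (subst (_≤ ι 4 * N v) (trans (cong (_* Nx) (ι-* 4 κ)) (ℚₚ.*-assoc (ι 4) (ι κ) Nx))
        (box is (longs k j (γ u j)) (4 ℕ.* κ) (+ 1) q z ℕₚ.≤-refl
          (Diff-cong is {q = q} {q′ = q} (λ _ _ → refl) (λ i → sym (ℤₚ.*-identityˡ (c ℤ.* S is i))) (hq is))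
          (linear (longs k j (γ u j)) (4 ℕ.* κ) (+ 1) lin)))
        where
        x = ⟦ X ⟧ (v ⊖ ⟦ R ⟧ v)
        Nx = N (EV (tuples (lens j)) (λ as → T (q (place is as z)) x))
        lem : ∀ a → (1ℚ + 1ℚ) * a + (1ℚ + 1ℚ) * a ≡ ι 4 * a
        lem = solve-∀ ℚ-ring
        lem₂ : ∀ a → ι 4 * a ≡ a + ι 3 * a
        lem₂ = solve-∀ ℚ-ring
        0≤2 : 0ℚ ≤ 1ℚ + 1ℚ
        0≤2 = 0≤-+ 0≤1 0≤1
        small : N x ≤ ι 4 * N v
        small = ℚₚ.≤-trans (contraction X _) (ℚₚ.≤-trans (N-⊖-≤ v _) (ℚₚ.≤-trans
          (ℚₚ.+-monoʳ-≤ ((1ℚ + 1ℚ) * N v) (*-monoˡ 0≤2 (contraction R v))) (ℚₚ.≤-reflexive (lem (N v)))))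
        open Box width (c ⊠ S is) (Y u j) x (ι 4 * N v) (0≤-* (0≤ι 4) (psd v)) small
        lin : ∀ D → prod (longs k j (γ u j)) ℕ.* 1 ℕ.≤ ℤ.∣ D ∣ → ℤ.∣ D ∣ ℕ.≤ prod (Vec.map (width ℕ.*_) (longs k j (γ u j))) ℕ.* 1 →
          ι κ̂ * N (⟦ ap (D ⊠ (c ⊠ S is)) (Y u j) ⟧ x) ≤ ι 4 * N v
        lin D lo hi = ℚₚ.≤-trans
          (Near-fejér {ap (D ⊠ (c ⊠ S is)) (Y u j) ∘ X} {κ̂} {direction is} {L u j} (1≤L j 1≤u)
            (absorbs D (subst (ℕ._≤ ℤ.∣ D ∣) (trans (ℕₚ.*-identityʳ _) (prod-longs (γ u j) j≤k)) lo)
              (subst (ℤ.∣ D ∣ ℕ.≤_) (trans (ℕₚ.*-identityʳ _) (prod-wide width (γ u j) j≤k)) hi)) v)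
          (≤-by (ι 3 * N v) (0≤-* (0≤ι 3) (psd v)) (lem₂ (N v)))

      stage-kills : ∀ {𝒴} q → Class q → Near (av (map q (extend is (lens j) 𝒴)) ∘ X) κ R
      stage-kills {𝒴} q hq v = subst (λ t → ι κ * t ≤ N v) (sym (N-cong (≈-trans (av-map q (extend is (lens j) 𝒴) x)
        (≈-trans (EV-product (place is) (tuples (lens j)) 𝒴 _) (EV-swap (tuples (lens j)) 𝒴 _)))))
        (jensen-≤ 𝒴 _ (0≤ι κ) (psd v) λ z _ → box-kills q z hq v)
        where x = ⟦ X ⟧ (v ⊖ ⟦ R ⟧ v)

    ap-assoc : ∀ {X} is D j {K m} → Abs (ap ((D ℤ.* c) ⊠ S is) (Y u j)) K m → Abs (ap (D ⊠ (c ⊠ S is)) (Y u j) ∘ X) K m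
    ap-assoc {X} is D j {K} {m} p = Abs-∘ʳ {X} {ap (D ⊠ (c ⊠ S is)) (Y u j)} {K} {m} λ v →
      subst (λ t → ι K * t ≤ N v) (N-cong (op-ap-cong (Y u j) _ (λ i → ℤₚ.*-assoc D c (S is i)))) (p v)

    -- Here all differenced ranges are bounded, so x = D c is at most B in absolute value and
    -- divides `W′` = B!: steps of `W′` are multiples of the step of the progression that appears.
    first-stage : ∀ is → ∀ D → 1 ℕ.≤ ℤ.∣ D ∣ → ℤ.∣ D ∣ ℕ.≤ width ℕ.^ k ℕ.* 1 → ∀ m → m ℕ.< L u 0 →
      Abs (ap (D ⊠ (c ⊠ S is)) (Y u 0) ∘ one) (4 ℕ.* κ̂) ((+ m) ⊠ direction is)
    first-stage is D lo hi m m< = ap-assoc {one} is D 0 {4 ℕ.* κ̂} (Abs-cong {ap (x ⊠ S is) (Y u 0)} {4 ℕ.* κ̂} shift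
      (Abs-signed {ap (x ⊠ S is) (Y u 0)} {4 ℕ.* κ̂} {S is} {m ℕ.* m₀} x
        (Abs-ap {x ⊠ S is} {Y u 0} {4 ℕ.* κ̂} (m ℕ.* m₀) (*-pos 1≤width (1≤γ 0 1≤u)) small)))
      where
      x = D ℤ.* c
      1≤∣x∣ : 1 ℕ.≤ ℤ.∣ x ∣
      1≤∣x∣ = ℕₚ.≤-trans (*-pos lo 1≤∣c∣) (ℕₚ.≤-reflexive (sym (ℤₚ.abs-* D c)))
      ∣x∣≤B : ℤ.∣ x ∣ ℕ.≤ B
      ∣x∣≤B = ℕₚ.≤-trans (ℕₚ.≤-reflexive (trans (ℤₚ.abs-* D c) (ℕₚ.*-comm ℤ.∣ D ∣ ℤ.∣ c ∣)))
        (ℕₚ.*-monoʳ-≤ ℤ.∣ c ∣ (ℕₚ.≤-trans hi (ℕₚ.≤-reflexive (ℕₚ.*-identityʳ _))))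
      x∣W′ = ≤⇒∣! 1≤∣x∣ ∣x∣≤B
      m₀ = _∣_.quotient x∣W′
      W′≡ : W′ ≡ m₀ ℕ.* ℤ.∣ x ∣
      W′≡ = _∣_.equality x∣W′
      shift : ∀ i → (+ (m ℕ.* m₀ ℕ.* ℤ.∣ x ∣)) ℤ.* S is i ≡ (+ m) ℤ.* ((+ W′) ℤ.* S is i)
      shift i = trans (cong (λ t → + t ℤ.* S is i) (trans (ℕₚ.*-assoc m m₀ ℤ.∣ x ∣) (cong (m ℕ.*_) (sym W′≡))))
        (trans (cong (ℤ._* S is i) (ℤₚ.pos-* m W′)) (ℤₚ.*-assoc (+ m) (+ W′) (S is i)))
      m₀≤W′ : m₀ ℕ.≤ W′
      m₀≤W′ = ℕₚ.≤-trans (≤-*ʳ m₀ 1≤∣x∣) (ℕₚ.≤-reflexive (sym W′≡))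
      small : 2 ℕ.* (4 ℕ.* κ̂) ℕ.* (m ℕ.* m₀) ℕ.≤ Y u 0
      small = begin
        2 ℕ.* (4 ℕ.* κ̂) ℕ.* (m ℕ.* m₀) ≤⟨ ℕₚ.*-mono-≤ (ℕₚ.≤-trans (ℕₚ.m≤m+n (2 ℕ.* (4 ℕ.* κ̂)) (24 ℕ.* κ̂)) (ℕₚ.≤-reflexive (lem κ̂))) (ℕₚ.*-mono-≤ (ℕₚ.<⇒≤ m<) m₀≤W′) ⟩
        K̂ ℕ.* (L u 0 ℕ.* W′) ≡⟨ lem₂ K̂ (L u 0) W′ ⟩
        M ℕ.* L u 0 ≡⟨ M*L u 0 ⟩
        1 ℕ.* γ u 0 ≤⟨ ℕₚ.*-monoˡ-≤ (γ u 0) 1≤width ⟩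
        Y u 0 ∎
        where
        open ℕₚ.≤-Reasoning
        lem : ∀ a → 2 ℕ.* (4 ℕ.* a) ℕ.+ 24 ℕ.* a ≡ 32 ℕ.* a
        lem = ℕ-solve
        lem₂ : ∀ a b c → a ℕ.* (b ℕ.* c) ≡ a ℕ.* c ℕ.* b
        lem₂ = ℕ-solve

    -- Divide m by ∣x∣: the multiple of ∣x∣ is absorbed by the progression that the box variables produce, of step x S,
    -- and the remainder by the progression of the previous stage, which is longer than ∣x∣.
    next-stage : ∀ is j → suc j ℕ.≤ k → ∀ D → γ u (suc j) ℕ.^ suc j ℕ.≤ ℤ.∣ D ∣ →
      ℤ.∣ D ∣ ℕ.≤ width ℕ.^ k ℕ.* γ u (suc j) ℕ.^ suc j → ∀ m → m ℕ.< L u (suc j) →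
      Abs (ap (D ⊠ (c ⊠ S is)) (Y u (suc j)) ∘ fejér (direction is) (L u j)) (4 ℕ.* κ̂) ((+ m) ⊠ direction is)
    next-stage is j j<k D lo hi m m< = Abs-cong {Z} {4 ℕ.* κ̂} shift
      (Abs-⊞ {Z} {4 ℕ.* κ̂} {(+ (W′ ℕ.* m″ ℕ.* ℤ.∣ x ∣)) ⊠ S is} {(+ ρ) ⊠ direction is}
        (ap-assoc {X} is D (suc j) {16κ̂} (Abs-signed {ap (x ⊠ S is) (Y u (suc j))} {16κ̂} {S is} {W′ ℕ.* m″} x
          (Abs-ap {x ⊠ S is} {Y u (suc j)} {16κ̂} (W′ ℕ.* m″) (*-pos 1≤width (1≤γ (suc j) 1≤u)) small)))
        (Abs-∘ˡ {ap (D ⊠ (c ⊠ S is)) (Y u (suc j))} {X} {16κ̂} {(+ ρ) ⊠ direction is}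
          (Abs-∘ˡ {ap (direction is) (L u j) †} {ap (direction is) (L u j)} {16κ̂} {(+ ρ) ⊠ direction is}
            (Abs-ap {direction is} {L u j} {16κ̂} ρ (1≤L j 1≤u) small-ρ))))
      where
      16κ̂ = 4 ℕ.* (4 ℕ.* κ̂)
      X = fejér (direction is) (L u j)
      Z = ap (D ⊠ (c ⊠ S is)) (Y u (suc j)) ∘ X
      g = γ u (suc j) ℕ.^ suc j
      x = D ℤ.* c
      g≤∣x∣ : g ℕ.≤ ℤ.∣ x ∣
      g≤∣x∣ = ℕₚ.≤-trans lo (ℕₚ.≤-trans (≤-*ʳ ℤ.∣ D ∣ 1≤∣c∣) (ℕₚ.≤-reflexive (sym (ℤₚ.abs-* D c))))
      1≤∣x∣ : 1 ℕ.≤ ℤ.∣ x ∣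
      1≤∣x∣ = ℕₚ.≤-trans (^-pos (suc j) (1≤γ (suc j) 1≤u)) g≤∣x∣
      ∣x∣≤ : ℤ.∣ x ∣ ℕ.≤ B ℕ.* g
      ∣x∣≤ = ℕₚ.≤-trans (ℕₚ.≤-reflexive (ℤₚ.abs-* D c)) (ℕₚ.≤-trans (ℕₚ.*-monoˡ-≤ ℤ.∣ c ∣ hi) (ℕₚ.≤-reflexive (lem (width ℕ.^ k) g ℤ.∣ c ∣)))
        where
        lem : ∀ a b c → a ℕ.* b ℕ.* c ≡ c ℕ.* a ℕ.* b
        lem = ℕ-solve
      instance
        x≢0 : ℕ.NonZero ℤ.∣ x ∣
        x≢0 = ℕ.>-nonZero 1≤∣x∣
      m″ = m DivMod./ ℤ.∣ x ∣
      ρ = m DivMod.% ℤ.∣ x ∣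
      m≡ : m ≡ ρ ℕ.+ m″ ℕ.* ℤ.∣ x ∣
      m≡ = DivMod.m≡m%n+[m/n]*n m ℤ.∣ x ∣
      shift : ∀ i → (+ (W′ ℕ.* m″ ℕ.* ℤ.∣ x ∣)) ℤ.* S is i ℤ.+ (+ ρ) ℤ.* ((+ W′) ℤ.* S is i) ≡ (+ m) ℤ.* ((+ W′) ℤ.* S is i)
      shift i = trans (cong (λ t → t ℤ.* S is i ℤ.+ (+ ρ) ℤ.* ((+ W′) ℤ.* S is i))
          (trans (cong +_ (ℕₚ.*-assoc W′ m″ ℤ.∣ x ∣)) (ℤₚ.pos-* W′ (m″ ℕ.* ℤ.∣ x ∣))))
        (trans (lem (+ W′) (+ (m″ ℕ.* ℤ.∣ x ∣)) (+ ρ) (S is i)) (cong (λ t → t ℤ.* ((+ W′) ℤ.* S is i))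
          (cong +_ (sym m≡))))
        where
        lem : ∀ w a r s → w ℤ.* a ℤ.* s ℤ.+ r ℤ.* (w ℤ.* s) ≡ (r ℤ.+ a) ℤ.* (w ℤ.* s)
        lem = ℤ-Solver.solve-∀
      32≡ : ∀ a → 2 ℕ.* (4 ℕ.* (4 ℕ.* a)) ≡ 32 ℕ.* a
      32≡ = ℕ-solve
      small : 2 ℕ.* 16κ̂ ℕ.* (W′ ℕ.* m″) ℕ.≤ Y u (suc j)
      small = ℕₚ.*-cancelʳ-≤ _ _ ℤ.∣ x ∣ (begin
        2 ℕ.* 16κ̂ ℕ.* (W′ ℕ.* m″) ℕ.* ℤ.∣ x ∣ ≡⟨ cong (λ t → t ℕ.* (W′ ℕ.* m″) ℕ.* ℤ.∣ x ∣) (32≡ κ̂) ⟩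
        K̂ ℕ.* (W′ ℕ.* m″) ℕ.* ℤ.∣ x ∣ ≡⟨ lem K̂ W′ m″ ℤ.∣ x ∣ ⟩
        M ℕ.* (m″ ℕ.* ℤ.∣ x ∣) ≤⟨ ℕₚ.*-monoʳ-≤ M (ℕₚ.≤-trans (ℕₚ.≤-trans (ℕₚ.m≤n+m _ ρ) (ℕₚ.≤-reflexive (sym m≡))) (ℕₚ.<⇒≤ m<)) ⟩
        M ℕ.* L u (suc j) ≡⟨ M*L u (suc j) ⟩
        g ℕ.* γ u (suc j) ≤⟨ ℕₚ.*-mono-≤ g≤∣x∣ (≤-*ˡ (γ u (suc j)) 1≤width) ⟩
        ℤ.∣ x ∣ ℕ.* Y u (suc j) ≡⟨ ℕₚ.*-comm ℤ.∣ x ∣ _ ⟩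
        Y u (suc j) ℕ.* ℤ.∣ x ∣ ∎)
        where
        open ℕₚ.≤-Reasoning
        lem : ∀ a b c d → a ℕ.* (b ℕ.* c) ℕ.* d ≡ a ℕ.* b ℕ.* (c ℕ.* d)
        lem = ℕ-solve
      small-ρ : 2 ℕ.* 16κ̂ ℕ.* ρ ℕ.≤ L u j
      small-ρ = ℕₚ.≤-trans (ℕₚ.≤-reflexive (cong (ℕ._* ρ) (32≡ κ̂)))
        (ℕₚ.≤-trans (ℕₚ.*-monoʳ-≤ K̂ (ℕₚ.≤-trans (ℕₚ.<⇒≤ (DivMod.m%n<n m ℤ.∣ x ∣)) ∣x∣≤)) (gap u 1≤u j<k))

    Near-rearrange : ∀ {P Q X K R} → Near (P ∘ X) K R → Near (P ∘ (Q ∘ X)) K R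
    Near-rearrange {P} {Q} {X} {K} {R} p v = subst (λ t → ι K * t ≤ N v) (N-cong (op-comm Q P _))
      (Near-∘ˡ {Q} {P ∘ X} {K} {R} p v)

    -- By `Near-step` the factor of stage j + 1 has to be absorbed only in company with the factors
    -- already gained. The one that `next-stage` calls for is the last of them, the Fejér average of
    -- length L_j; the rest are contractions that commute past it.
    stage-killing : ∀ is j → j ℕ.≤ k → ∀ {𝒴 Q} K → K ℕ.* 4 ℕ.^ suc j ℕ.≤ κ → Kill 𝒴 (K ℕ.* 4 ℕ.^ suc j) Q →
      Kill (stageY is j 𝒴) K (stageQ is j Q)
    stage-killing is zero j≤k {𝒴} {Q} K K≤ h q hq = Near-step {av (map q 𝒴′)} {K} {Q} {R}
      (Near-weaken {av (map q 𝒴′)} {Q = Q} (ℕₚ.≤-reflexive (lem K)) (kill-extend is (lens 0) {𝒴} {K ℕ.* 4 ℕ.^ 1} {Q} h q hq))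
      (Near-weaken {av (map q 𝒴′) ∘ Q} {Q = R} (ℕₚ.≤-trans (ℕₚ.≤-reflexive (lem K)) K≤)
        (Near-∘ʳ {Q} {av (map q 𝒴′)} {κ} {R} (stage-kills {𝒴} q hq)))
      where
      open Stage is 0 j≤k one (first-stage is)
      𝒴′ = stageY is 0 𝒴
      lem : ∀ K → 4 ℕ.* K ≡ K ℕ.* 4 ℕ.^ 1
      lem = ℕ-solve
    stage-killing is (suc j) j<k {𝒴} {Q} K K≤ h q hq = Near-step {av (map q 𝒴′)} {K} {Q′} {R}
      (kill-extend is (lens (suc j)) {stageY is j 𝒴} {4 ℕ.* K} {Q′}
        (stage-killing is j (ℕₚ.<⇒≤ j<k) {𝒴} {Q} (4 ℕ.* K) (subst (ℕ._≤ κ) (lem K (4 ℕ.^ suc j)) K≤)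
          (λ q hq → subst (λ t → Near (av (map q 𝒴)) t Q) (lem K (4 ℕ.^ suc j)) (h q hq))) q hq)
      (Near-weaken {av (map q 𝒴′) ∘ Q′} {Q = R} (ℕₚ.≤-trans (ℕₚ.≤-trans (≤-*ʳ (4 ℕ.* K) (^-pos (suc j) (ℕ.s≤s ℕ.z≤n))) (ℕₚ.≤-reflexive (sym (lem K (4 ℕ.^ suc j))))) K≤)
        (last j (stage-kills {stageY is j 𝒴} q hq)))
      where
      open Stage is (suc j) j<k (fejér (direction is) (L u j)) (next-stage is j j<k)
      𝒴′ = stageY is (suc j) 𝒴
      Q′ = stageQ is j Q
      lem : ∀ K x → K ℕ.* (4 ℕ.* x) ≡ 4 ℕ.* K ℕ.* x
      lem = ℕ-solve
      last : ∀ j → Near (av (map q 𝒴′) ∘ fejér (direction is) (L u j)) κ R → Near (av (map q 𝒴′) ∘ stageQ is j Q) κ R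
      last zero = Near-rearrange {av (map q 𝒴′)} {Q} {fejér (direction is) (L u 0)} {κ} {R}
      last (suc j) = Near-rearrange {av (map q 𝒴′)} {stageQ is j Q} {fejér (direction is) (L u (suc j))} {κ} {R}

    plan-killing : ∀ iss K → K ℕ.* (4 ℕ.^ suc k) ℕ.^ length iss ℕ.≤ κ → Kill (planY iss) K (planQ iss)
    plan-killing [] K K≤ q hq = Near-one {av (map q (planY []))} {K}
    plan-killing (is ∷ iss) K K≤ = stage-killing is k ℕₚ.≤-refl {planY iss} {planQ iss} K
      (ℕₚ.≤-trans (≤-*ʳ (K ℕ.* 4 ℕ.^ suc k) (^-pos (length iss) (^-pos (suc k) (ℕ.s≤s ℕ.z≤n)))) K≤′)
      (plan-killing iss (K ℕ.* 4 ℕ.^ suc k) K≤′)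
      where
      K≤′ = ℕₚ.≤-trans (ℕₚ.≤-reflexive (ℕₚ.*-assoc K (4 ℕ.^ suc k) _)) K≤

    †-∘ : ∀ A a v → ⟦ (A ∘ a) † ∘ (A ∘ a) ⟧ v ≈ ⟦ A † ∘ A ⟧ (⟦ a † ∘ a ⟧ v)
    †-∘ A a v = op-cong (A †) (op-comm (a †) A _)

    stageQ≈ : ∀ is j {A Q} → (∀ v → ⟦ Q ⟧ v ≈ ⟦ A † ∘ A ⟧ v) → ∀ v → ⟦ stageQ is j Q ⟧ v ≈ ⟦ stageA is j A † ∘ stageA is j A ⟧ v
    stageQ≈ is zero {A} h v = ≈-trans (h _) (≈-sym (†-∘ A (ap (direction is) (L u 0)) v))
    stageQ≈ is (suc j) {A} {Q} h v = ≈-trans (stageQ≈ is j {A} {Q} h _) (≈-sym (†-∘ (stageA is j A) (ap (direction is) (L u (suc j))) v))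

    -- Commuting the factors brings all adjoints together, which identifies `planQ` as a positive
    -- operator whose quadratic form is the energy of `planA`.
    planQ≈ : ∀ iss v → ⟦ planQ iss ⟧ v ≈ ⟦ planA iss † ∘ planA iss ⟧ v
    planQ≈ [] v = ≈-refl
    planQ≈ (is ∷ iss) v = stageQ≈ is k {planA iss} {planQ iss} (planQ≈ iss) v

-- Differences of polynomials, and values of polynomials as forms.

module PolynomialDifferences where
  open import Data.Integer using (_+_; _*_; _-_; -_)
  open import Data.Integer.Tactic.RingSolver using (solve-∀)
  open BoxEstimates using (bump; module Differences)

  -- Records the top coefficient only: k differencings leave s times the product of the increments.
  -- A polynomial of degree k with leading coefficient a has s = k! a (`Deg-eval`).
  data Deg : ℕ → (ℤ → ℤ) → ℤ → Set where
    base : ∀ {g s} → (∀ x → g x ≡ s) → Deg zero g s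
    step : ∀ {k g s} → (∀ a b → Deg k (λ x → g (x + b) - g (x + a)) ((b - a) * s)) → Deg (suc k) g s

  Deg-cong : ∀ {k g h s t} → (∀ x → g x ≡ h x) → s ≡ t → Deg k g s → Deg k h t
  Deg-cong e refl (base p) = base λ x → trans (sym (e x)) (p x)
  Deg-cong e refl (step p) = step λ a b → Deg-cong (λ x → cong₂ _-_ (e (x + b)) (e (x + a))) refl (p a b)

  Deg-+ : ∀ {k g h s t} → Deg k g s → Deg k h t → Deg k (λ x → g x + h x) (s + t)
  Deg-+ (base p) (base q) = base λ x → cong₂ _+_ (p x) (q x)
  Deg-+ {g = g} {h} {s} {t} (step p) (step q) = step λ a b →
    Deg-cong (λ x → lem₁ (g (x + b)) (g (x + a)) (h (x + b)) (h (x + a))) (lem₂ (b - a) s t) (Deg-+ (p a b) (q a b))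
    where
    lem₁ : ∀ a b c d → (a - b) + (c - d) ≡ (a + c) - (b + d)
    lem₁ = solve-∀
    lem₂ : ∀ a s t → a * s + a * t ≡ a * (s + t)
    lem₂ = solve-∀

  Deg-* : ∀ {k} c {g s} → Deg k g s → Deg k (λ x → c * g x) (c * s)
  Deg-* c (base p) = base λ x → cong (λ t → c * t) (p x)
  Deg-* c {g} {s} (step p) = step λ a b → Deg-cong (λ x → lem₁ c (g (x + b)) (g (x + a))) (lem₂ c (b - a) s) (Deg-* c (p a b))
    where
    lem₁ : ∀ c a b → c * (a - b) ≡ c * a - c * b
    lem₁ = solve-∀
    lem₂ : ∀ c a s → c * (a * s) ≡ a * (c * s)
    lem₂ = solve-∀

  Deg-affine : ∀ {k} o w {g s} → Deg k g s → Deg k (λ x → g (o + w * x)) (w ℤ.^ k * s)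
  Deg-affine o w {s = s} (base p) = base λ x → trans (p _) (sym (ℤₚ.*-identityˡ s))
  Deg-affine {suc k} o w {g} {s} (step p) = step λ a b → Deg-cong
    (λ x → cong₂ (λ s t → g s - g t) (lem₁ o w x b) (lem₁ o w x a)) (lem₂ w a b s (w ℤ.^ k)) (Deg-affine o w (p (w * a) (w * b)))
    where
    lem₁ : ∀ o w x b → (o + w * x) + w * b ≡ o + w * (x + b)
    lem₁ = solve-∀
    lem₂ : ∀ w a b s v → v * ((w * b - w * a) * s) ≡ (b - a) * (w * v * s)
    lem₂ = solve-∀

  Deg-shift : ∀ {k} a {g s} → Deg k g s → Deg k (λ x → g (x + a)) s
  Deg-shift {k} a {g} {s} p = Deg-cong (λ x → cong g (lem x a)) (trans (cong (_* s) (ℤₚ.^-zeroˡ k)) (ℤₚ.*-identityˡ s)) (Deg-affine a (+ 1) p)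
    where
    lem : ∀ x a → a + + 1 * x ≡ x + a
    lem = solve-∀

  Deg-up : ∀ {k g s} → Deg k g s → Deg (suc k) g (+ 0)
  Deg-up {s = s} (base p) = step λ a b → base λ x → trans (cong₂ _-_ (p _) (p _)) (trans (ℤₚ.+-inverseʳ s) (sym (ℤₚ.*-zeroʳ (b - a))))
  Deg-up (step p) = step λ a b → Deg-cong (λ _ → refl) (sym (ℤₚ.*-zeroʳ (b - a))) (Deg-up (p a b))

  Deg-const : ∀ k c → Deg (suc k) (λ _ → c) (+ 0)
  Deg-const zero c = Deg-up (base λ _ → refl)
  Deg-const (suc k) c = Deg-up (Deg-const k c)

  -- Leibniz rule: (x + b) g(x + b) - (x + a) g(x + a) is x (g(x + b) - g(x + a)) plus b g(x + b) -
  -- a g(x + a). Induction treats the first part, and the second adds one more copy of (b - a) s.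
  Deg-X : ∀ {k g s} → Deg k g s → Deg (suc k) (λ x → x * g x) (+ suc k * s)
  Deg-X {g = g} {s} (base p) = step λ a b → base λ x → trans (cong₂ (λ u v → (x + b) * u - (x + a) * v) (p _) (p _)) (lem x a b s)
    where
    lem : ∀ x a b s → (x + b) * s - (x + a) * s ≡ (b - a) * (+ 1 * s)
    lem = solve-∀
  Deg-X {suc k} {g} {s} (step p) = step λ a b → Deg-cong
    (λ x → lem₁ x a b (g (x + b)) (g (x + a))) (lem₂ (+ suc k) a b s)
    (Deg-+ (Deg-X (p a b)) (Deg-+ (Deg-* b (Deg-shift b {g} (step p))) (Deg-* (- a) (Deg-shift a {g} (step p)))))
    where
    lem₁ : ∀ x a b u v → x * (u - v) + (b * u + (- a) * v) ≡ (x + b) * u - (x + a) * v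
    lem₁ = solve-∀
    lem₂ : ∀ k a b s → k * ((b - a) * s) + (b * s + (- a) * s) ≡ (b - a) * ((+ 1 + k) * s)
    lem₂ = solve-∀

  Deg-eval : ∀ cs a → Deg (length cs) (eval (cs ++ [ a ])) (+ (length cs !) * a)
  Deg-eval [] a = base λ x → trans (cong (λ t → a + t) (ℤₚ.*-zeroʳ x)) (trans (ℤₚ.+-identityʳ a) (sym (ℤₚ.*-identityˡ a)))
  Deg-eval (c ∷ cs) a = Deg-cong (λ _ → refl) e
    (Deg-+ (Deg-const (length cs) c) (Deg-X (Deg-eval cs a)))
    where
    e : + 0 + + suc (length cs) * (+ (length cs !) * a) ≡ + (suc (length cs) !) * a
    e = trans (ℤₚ.+-identityˡ _) (trans (sym (ℤₚ.*-assoc (+ suc (length cs)) (+ (length cs !)) a))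
      (cong (_* a) (sym (ℤₚ.pos-* (suc (length cs)) (length cs !)))))

  dot : ∀ {n} → Vec ℤ n → Vec ℤ n → ℤ
  dot [] [] = + 0
  dot (f ∷ fs) (z ∷ zs) = f * z + dot fs zs

  monomial : ∀ {n k} → Vec (Fin n) k → Vec ℤ n → ℤ
  monomial [] f = + 1
  monomial (j ∷ js) f = lookup f j * monomial js f

  dot-bump : ∀ {n} (f : Vec ℤ n) j x z → dot f (bump j x z) ≡ dot f z + lookup f j * x
  dot-bump (f ∷ fs) zero x (z ∷ zs) = lem f x z (dot fs zs)
    where
    lem : ∀ f x z r → f * (x + z) + r ≡ f * z + r + f * x
    lem = solve-∀
  dot-bump (f ∷ fs) (suc j) x (z ∷ zs) = trans (cong (λ τ → f * z + τ) (dot-bump fs j x zs)) (sym (ℤₚ.+-assoc (f * z) (dot fs zs) _))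

  linear-sum : ∀ {n} → (Vec ℤ n → ℤ) → List (ℤ × Vec ℤ n) → ℤ
  linear-sum F [] = + 0
  linear-sum F ((e , f) ∷ fs) = e * F f + linear-sum F fs

  linear-sum-cong : ∀ {n} {F G : Vec ℤ n → ℤ} fs → ListAll.All (λ ef → F (proj₂ ef) ≡ G (proj₂ ef)) fs → linear-sum F fs ≡ linear-sum G fs
  linear-sum-cong [] ListAll.[] = refl
  linear-sum-cong ((e , f) ∷ fs) (p ListAll.∷ ps) = cong₂ (λ s t → e * s + t) p (linear-sum-cong fs ps)

  linear-sum-+ : ∀ {n} (F G : Vec ℤ n → ℤ) fs → linear-sum (λ f → F f + G f) fs ≡ linear-sum F fs + linear-sum G fs
  linear-sum-+ F G [] = refl
  linear-sum-+ F G ((e , f) ∷ fs) = trans (cong (λ t → e * (F f + G f) + t) (linear-sum-+ F G fs)) (lem e (F f) (G f) _ _)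
    where
    lem : ∀ e a b c d → e * (a + b) + (c + d) ≡ (e * a + c) + (e * b + d)
    lem = solve-∀

  linear-sum-* : ∀ {n} c (F : Vec ℤ n → ℤ) fs → linear-sum (λ f → c * F f) fs ≡ c * linear-sum F fs
  linear-sum-* c F [] = sym (ℤₚ.*-zeroʳ c)
  linear-sum-* c F ((e , f) ∷ fs) = trans (cong (λ t → e * (c * F f) + t) (linear-sum-* c F fs)) (lem e c (F f) _)
    where
    lem : ∀ e c a b → e * (c * a) + c * b ≡ c * (e * a + b)
    lem = solve-∀

  DiffS : ∀ {n k} → Vec (Fin n) k → (Vec ℤ n → ℤ) → ℤ → Set
  DiffS [] q c = ∀ z → q z ≡ c
  DiffS (j ∷ js) q c = ∀ a b → DiffS js (λ z → q (bump j b z) - q (bump j a z)) ((b - a) * c)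

  DiffS-cong : ∀ {n k} (js : Vec (Fin n) k) {q q′ c c′} → (∀ z → q z ≡ q′ z) → c ≡ c′ → DiffS js q c → DiffS js q′ c′
  DiffS-cong [] hq refl h z = trans (sym (hq z)) (h z)
  DiffS-cong (j ∷ js) hq refl h a b = DiffS-cong js (λ z → cong₂ _-_ (hq _) (hq _)) refl (h a b)

  DiffS-0 : ∀ {n k} (js : Vec (Fin n) k) → DiffS js (λ _ → + 0) (+ 0)
  DiffS-0 [] z = refl
  DiffS-0 (j ∷ js) a b = DiffS-cong js (λ _ → refl) (sym (ℤₚ.*-zeroʳ (b - a))) (DiffS-0 js)

  DiffS-lin : ∀ {n k} (js : Vec (Fin n) k) e {q r c d} → DiffS js q c → DiffS js r d → DiffS js (λ z → e * q z + r z) (e * c + d)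
  DiffS-lin [] e p q z = cong₂ (λ s t → e * s + t) (p z) (q z)
  DiffS-lin (j ∷ js) e {q} {r} {c} {d} hp hq a b = DiffS-cong js
    (λ z → lem₁ e (q (bump j b z)) (q (bump j a z)) (r (bump j b z)) (r (bump j a z))) (lem₂ e (b - a) c d) (DiffS-lin js e (hp a b) (hq a b))
    where
    lem₁ : ∀ e a b c d → e * (a - b) + (c - d) ≡ (e * a + c) - (e * b + d)
    lem₁ = solve-∀
    lem₂ : ∀ e x c d → e * (x * c) + x * d ≡ x * (e * c + d)
    lem₂ = solve-∀

  -- An increment in coordinate j moves f · z by f_j times that increment, so each differencing
  -- contributes one entry of f.
  DiffS-dot : ∀ {n k} (js : Vec (Fin n) k) f {g s} → Deg k g s → DiffS js (λ z → g (dot f z)) (s * monomial js f)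
  DiffS-dot [] f {s = s} (base p) z = trans (p _) (sym (ℤₚ.*-identityʳ s))
  DiffS-dot (j ∷ js) f {g} {s} (step p) a b = DiffS-cong js
    (λ z → cong₂ (λ s t → g s - g t) (sym (dot-bump f j b z)) (sym (dot-bump f j a z)))
    (lem (lookup f j) a b s (monomial js f)) (DiffS-dot js f (p (lookup f j * a) (lookup f j * b)))
    where
    lem : ∀ f a b s m → (f * b - f * a) * s * m ≡ (b - a) * (s * (f * m))
    lem = solve-∀

  DiffS-sum : ∀ {n k} (js : Vec (Fin n) k) (F : Vec ℤ n → Vec ℤ n → ℤ) (c : Vec ℤ n → ℤ) fs → (∀ f → DiffS js (F f) (c f)) →
    DiffS js (λ z → linear-sum (λ f → F f z) fs) (linear-sum c fs)
  DiffS-sum js F c [] h = DiffS-0 js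
  DiffS-sum js F c ((e , f) ∷ fs) h = DiffS-lin js e (h f) (DiffS-sum js F c fs h)

  module _ {n : ℕ} {I : Set} where
    open Differences n I using (Diff; Λ)

    pointwise⇒Diff : ∀ {k} (js : Vec (Fin n) k) {q : Vec ℤ n → Λ} {c : Λ} → (∀ i → DiffS js (λ z → q z i) (c i)) → Diff js q c
    pointwise⇒Diff [] h z i = h i z
    pointwise⇒Diff (j ∷ js) h a b = pointwise⇒Diff js λ i → h i a b

  scale : ∀ {n} → ℤ → ℤ → Vec ℤ n → Vec ℤ n
  scale w o = Vec.map (λ t → w * (o + t))

  -- The map z ↦ w (o + z) + ξ e₀. For every f with f₀ = 1 the product f · y is then ξ modulo w, so
  -- one root ξ serves all forms at once. The shift o will be |ξ|, which keeps all coordinates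
  -- positive.
  act : ∀ {l} → ℤ → ℤ → ℤ → Vec ℤ (suc l) → Vec ℤ (suc l)
  act ξ w o z = bump zero ξ (scale w o z)

  dot-scale : ∀ {n} w o (f z : Vec ℤ n) → dot f (scale w o z) ≡ w * dot f (Vec.map (λ τ → o + τ) z)
  dot-scale w o [] [] = sym (ℤₚ.*-zeroʳ w)
  dot-scale w o (f ∷ fs) (z ∷ zs) = trans (cong (λ t → f * (w * (o + z)) + t) (dot-scale w o fs zs)) (lem f w o z _)
    where
    lem : ∀ f w o z r → f * (w * (o + z)) + w * r ≡ w * (f * (o + z) + r)
    lem = solve-∀

  dot-act : ∀ {l} ξ w o (f z : Vec ℤ (suc l)) → dot f (act ξ w o z) ≡ w * dot f (Vec.map (λ τ → o + τ) z) + lookup f zero * ξ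
  dot-act ξ w o f z = trans (dot-bump f zero ξ (scale w o z)) (cong (_+ lookup f zero * ξ) (dot-scale w o f z))

  dot-shift : ∀ {n} o (f z : Vec ℤ n) → dot f (Vec.map (λ τ → o + τ) z) ≡ dot f (Vec.map (λ τ → o + τ) (Vec.replicate n (+ 0))) + dot f z
  dot-shift o [] [] = refl
  dot-shift o (f ∷ fs) (z ∷ zs) = trans (cong (λ t → f * (o + z) + t) (dot-shift o fs zs)) (lem f o z _ _)
    where
    lem : ∀ f o z r s → f * (o + z) + (r + s) ≡ f * (o + + 0) + r + (f * z + s)
    lem = solve-∀

  -- Coefficients of a homogeneous form by ordered index tuples, neither symmetric nor unique; the
  -- tuples are those that index the directions `S is`.
  Form : ℕ → ℕ → Set
  Form n k = Vec (Fin n) k → ℤ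

  Σᶠ : ∀ {n} → (Fin n → ℤ) → ℤ
  Σᶠ {zero} g = + 0
  Σᶠ {suc n} g = g zero + Σᶠ (λ i → g (suc i))

  Σᶠ-cong : ∀ {n} {g h : Fin n → ℤ} → (∀ i → g i ≡ h i) → Σᶠ g ≡ Σᶠ h
  Σᶠ-cong {zero} e = refl
  Σᶠ-cong {suc n} e = cong₂ _+_ (e zero) (Σᶠ-cong λ i → e (suc i))

  Σᶠ-+ : ∀ {n} (g h : Fin n → ℤ) → Σᶠ (λ i → g i + h i) ≡ Σᶠ g + Σᶠ h
  Σᶠ-+ {zero} g h = refl
  Σᶠ-+ {suc n} g h = trans (cong (λ t → g zero + h zero + t) (Σᶠ-+ (λ i → g (suc i)) (λ i → h (suc i)))) (lem (g zero) (h zero) _ _)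
    where
    lem : ∀ a b c d → a + b + (c + d) ≡ a + c + (b + d)
    lem = solve-∀

  Σᶠ-* : ∀ {n} c (g : Fin n → ℤ) → Σᶠ (λ i → c * g i) ≡ c * Σᶠ g
  Σᶠ-* {zero} c g = sym (ℤₚ.*-zeroʳ c)
  Σᶠ-* {suc n} c g = trans (cong (λ τ → c * g zero + τ) (Σᶠ-* c (λ i → g (suc i)))) (sym (ℤₚ.*-distribˡ-+ c (g zero) _))

  dot-Σᶠ : ∀ {n} (f z : Vec ℤ n) → dot f z ≡ Σᶠ (λ i → lookup f i * lookup z i)
  dot-Σᶠ [] [] = refl
  dot-Σᶠ (f ∷ fs) (z ∷ zs) = cong (λ τ → f * z + τ) (dot-Σᶠ fs zs)

  evalF : ∀ {n k} → Form n k → Vec ℤ n → ℤ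
  evalF {k = zero} φ f = φ []
  evalF {k = suc k} φ f = Σᶠ (λ i → lookup f i * evalF (λ is → φ (i ∷ is)) f)

  evalF-+ : ∀ {n k} (φ ψ : Form n k) f → evalF (λ is → φ is + ψ is) f ≡ evalF φ f + evalF ψ f
  evalF-+ {k = zero} φ ψ f = refl
  evalF-+ {k = suc k} φ ψ f = trans (Σᶠ-cong λ i → trans (cong (lookup f i *_) (evalF-+ (λ is → φ (i ∷ is)) (λ is → ψ (i ∷ is)) f))
    (ℤₚ.*-distribˡ-+ (lookup f i) (evalF (λ is → φ (i ∷ is)) f) (evalF (λ is → ψ (i ∷ is)) f)))
    (Σᶠ-+ (λ i → lookup f i * evalF (λ is → φ (i ∷ is)) f) (λ i → lookup f i * evalF (λ is → ψ (i ∷ is)) f))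

  evalF-* : ∀ {n k} c (φ : Form n k) f → evalF (λ is → c * φ is) f ≡ c * evalF φ f
  evalF-* {k = zero} c φ f = refl
  evalF-* {k = suc k} c φ f = trans (Σᶠ-cong λ i → trans (cong (lookup f i *_) (evalF-* c (λ is → φ (i ∷ is)) f))
    (lem (lookup f i) c (evalF (λ is → φ (i ∷ is)) f))) (Σᶠ-* c (λ i → lookup f i * evalF (λ is → φ (i ∷ is)) f))
    where
    lem : ∀ a c b → a * (c * b) ≡ c * (a * b)
    lem = solve-∀

  multiply : ∀ {n k} → Vec ℤ n → Form n k → Form n (suc k)
  multiply z φ (i ∷ is) = lookup z i * φ is

  evalF-multiply : ∀ {n k} (z : Vec ℤ n) (φ : Form n k) f → evalF (multiply z φ) f ≡ dot f z * evalF φ f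
  evalF-multiply z φ f = trans (Σᶠ-cong λ i → trans (cong (lookup f i *_) (evalF-* (lookup z i) φ f)) (lem (lookup f i) (lookup z i) (evalF φ f)))
    (trans (Σᶠ-* (evalF φ f) (λ i → lookup f i * lookup z i)) (trans (ℤₚ.*-comm (evalF φ f) (Σᶠ (λ i → lookup f i * lookup z i))) (cong (_* evalF φ f) (sym (dot-Σᶠ f z)))))
    where
    lem : ∀ a b c → a * (b * c) ≡ c * (a * b)
    lem = solve-∀

  constant : ∀ {l} k → ℤ → Form (suc l) k
  constant zero c is = c
  constant (suc k) c (zero ∷ is) = constant k c is
  constant (suc k) c (suc i ∷ is) = + 0

  evalF-0 : ∀ {n} k f → evalF {n} {k} (λ _ → + 0) f ≡ + 0
  evalF-0 zero f = refl
  evalF-0 (suc k) f = trans (Σᶠ-cong {g = λ i → lookup f i * evalF {k = k} (λ _ → + 0) f} λ i → cong (lookup f i *_) (evalF-0 k f))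
    (trans (trans (Σᶠ-cong λ i → ℤₚ.*-comm (lookup f i) (+ 0)) (Σᶠ-* (+ 0) (lookup f))) (ℤₚ.*-zeroˡ (Σᶠ (lookup f))))

  -- The first coordinate of f is 1, so multiplying by it pads a form to a higher degree.
  evalF-constant : ∀ {l} k c (f : Vec ℤ (suc l)) → lookup f zero ≡ + 1 → evalF (constant k c) f ≡ c
  evalF-constant zero c f h = refl
  evalF-constant {l} (suc k) c f h = trans (cong₂ _+_ (trans (cong₂ _*_ h (evalF-constant k c f h)) (ℤₚ.*-identityˡ c)) rest) (ℤₚ.+-identityʳ c)
    where
    rest : Σᶠ {l} (λ i → lookup f (suc i) * evalF {k = k} (λ _ → + 0) f) ≡ + 0
    rest = trans (Σᶠ-cong λ i → trans (cong (lookup f (suc i) *_) (evalF-0 k f)) (ℤₚ.*-comm (lookup f (suc i)) (+ 0)))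
      (trans (Σᶠ-* {l} (+ 0) (λ i → lookup f (suc i))) (ℤₚ.*-zeroˡ (Σᶠ (λ i → lookup f (suc i)))))

  -- P(ξ + w Z) = P(ξ) + w · quotient, with Z = f · z, as a form of degree deg P in f.
  quotient-form : ∀ {l} (P : List ℤ) a → ℤ → ℤ → Vec ℤ (suc l) → Vec ℤ (suc l) → Form (suc l) (length P)
  quotient-form [] a ξ w z y is = + 0
  quotient-form (a′ ∷ P) a ξ w z y is = multiply z (constant (length P) (eval (a′ ∷ P) ξ)) is + multiply y (quotient-form P a′ ξ w z y) is

  quotient-eval : ∀ {l} (P : List ℤ) a ξ w (z y f : Vec ℤ (suc l)) → lookup f zero ≡ + 1 → dot f y ≡ w * dot f z + ξ →
    eval (a ∷ P) (dot f y) ≡ eval (a ∷ P) ξ + w * evalF (quotient-form P a ξ w z y) f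
  quotient-eval [] a ξ w z y f h e = lem a ξ w (dot f y)
    where
    lem : ∀ a ξ w y → a + y * + 0 ≡ a + ξ * + 0 + w * + 0
    lem = solve-∀
  quotient-eval (a′ ∷ P) a ξ w z y f h e = begin
    a + Z * eval (a′ ∷ P) Z ≡⟨ cong (λ t → a + Z * t) (quotient-eval P a′ ξ w z y f h e) ⟩
    a + Z * (v + w * ψ) ≡⟨ lem₁ a Z v w ψ ⟩
    a + Z * v + w * (Z * ψ) ≡⟨ cong (λ t → a + t * v + w * (Z * ψ)) e ⟩
    a + (w * X + ξ) * v + w * (Z * ψ) ≡⟨ lem₂ a w X ξ v (Z * ψ) ⟩
    a + ξ * v + w * (X * v + Z * ψ) ≡⟨ cong (λ t → a + ξ * v + w * t) (sym (trans (evalF-+ (multiply z (constant (length P) v)) (multiply y (quotient-form P a′ ξ w z y)) f)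
        (cong₂ _+_ (trans (evalF-multiply z (constant (length P) v) f) (cong (X *_) (evalF-constant (length P) v f h)))
          (evalF-multiply y (quotient-form P a′ ξ w z y) f)))) ⟩
    a + ξ * v + w * evalF (λ is → multiply z (constant (length P) v) is + multiply y (quotient-form P a′ ξ w z y) is) f ∎
    where
    open ≡-Reasoning
    Z = dot f y
    X = dot f z
    v = eval (a′ ∷ P) ξ
    ψ = evalF (quotient-form P a′ ξ w z y) f
    lem₁ : ∀ a Z v w p → a + Z * (v + w * p) ≡ a + Z * v + w * (Z * p)
    lem₁ = solve-∀
    lem₂ : ∀ a w X ξ v q → a + (w * X + ξ) * v + w * q ≡ a + ξ * v + w * (X * v + q)
    lem₂ = solve-∀

  ∣constant∣ : ∀ {l} k c is → ℤ.∣ constant {l} k c is ∣ ℕ.≤ ℤ.∣ c ∣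
  ∣constant∣ zero c is = ℕₚ.≤-refl
  ∣constant∣ (suc k) c (zero ∷ is) = ∣constant∣ k c is
  ∣constant∣ (suc k) c (suc i ∷ is) = ℕ.z≤n

  quotient-constant : List ℤ → ℤ → ℤ → ℕ → ℕ
  quotient-constant [] a ξ b = 0
  quotient-constant (a′ ∷ P) a ξ b = b ℕ.* (ℤ.∣ eval (a′ ∷ P) ξ ∣ ℕ.+ quotient-constant P a′ ξ b)

  -- At points of size u the coefficients have order u^d. This is also the order of the progressions
  -- that a plan produces, and only for that reason can one level of the recurrence argument absorb
  -- the next.
  ∣quotient-form∣ : ∀ {l} (P : List ℤ) a ξ w b u (z y : Vec ℤ (suc l)) → 1 ℕ.≤ u →
    (∀ i → ℤ.∣ lookup z i ∣ ℕ.≤ b ℕ.* u) → (∀ i → ℤ.∣ lookup y i ∣ ℕ.≤ b ℕ.* u) → ∀ is →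
    ℤ.∣ quotient-form P a ξ w z y is ∣ ℕ.≤ quotient-constant P a ξ b ℕ.* u ℕ.^ length P
  ∣quotient-form∣ [] a ξ w b u z y 1≤u hz hy is = ℕ.z≤n
  ∣quotient-form∣ (a′ ∷ P) a ξ w b u z y 1≤u hz hy (i ∷ is) = begin
    ℤ.∣ lookup z i * κ + lookup y i * ψ ∣ ≤⟨ ℤₚ.∣i+j∣≤∣i∣+∣j∣ (lookup z i * κ) (lookup y i * ψ) ⟩
    ℤ.∣ lookup z i * κ ∣ ℕ.+ ℤ.∣ lookup y i * ψ ∣ ≡⟨ cong₂ ℕ._+_ (ℤₚ.abs-* (lookup z i) κ) (ℤₚ.abs-* (lookup y i) ψ) ⟩
    ℤ.∣ lookup z i ∣ ℕ.* ℤ.∣ κ ∣ ℕ.+ ℤ.∣ lookup y i ∣ ℕ.* ℤ.∣ ψ ∣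
      ≤⟨ ℕₚ.+-mono-≤ (ℕₚ.*-mono-≤ (hz i) (ℕₚ.≤-trans (∣constant∣ (length P) v is) v≤)) (ℕₚ.*-mono-≤ (hy i) (∣quotient-form∣ P a′ ξ w b u z y 1≤u hz hy is)) ⟩
    b ℕ.* u ℕ.* (ℤ.∣ v ∣ ℕ.* u ℕ.^ length P) ℕ.+ b ℕ.* u ℕ.* (quotient-constant P a′ ξ b ℕ.* u ℕ.^ length P)
      ≡⟨ lem b u ℤ.∣ v ∣ (quotient-constant P a′ ξ b) (u ℕ.^ length P) ⟩
    b ℕ.* (ℤ.∣ v ∣ ℕ.+ quotient-constant P a′ ξ b) ℕ.* (u ℕ.* u ℕ.^ length P) ∎
    where
    open ℕₚ.≤-Reasoning
    v = eval (a′ ∷ P) ξ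
    κ = constant (length P) v is
    ψ = quotient-form P a′ ξ w z y is
    1≤u^ : ∀ k → 1 ℕ.≤ u ℕ.^ k
    1≤u^ zero = ℕₚ.≤-refl
    1≤u^ (suc k) = ℕₚ.*-mono-≤ 1≤u (1≤u^ k)
    v≤ : ℤ.∣ v ∣ ℕ.≤ ℤ.∣ v ∣ ℕ.* u ℕ.^ length P
    v≤ = ℕₚ.≤-trans (ℕₚ.≤-reflexive (sym (ℕₚ.*-identityʳ _))) (ℕₚ.*-monoʳ-≤ ℤ.∣ v ∣ (1≤u^ (length P)))
    lem : ∀ b u v q x → b ℕ.* u ℕ.* (v ℕ.* x) ℕ.+ b ℕ.* u ℕ.* (q ℕ.* x) ≡ b ℕ.* (v ℕ.+ q) ℕ.* (u ℕ.* x)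
    lem = ℕ-solve

-- Absorption of polynomial values.

module FormAbsorption where
  open import Data.Rational using (_+_)
  open RationalSums
  open InnerProductSpaces
  open AlmostInvariance
  open BoxEstimates
  open AveragingPlans
  open PolynomialDifferences

  Direction : ∀ {n k} {I : Set} → (I → List (ℤ × Vec ℤ n)) → Vec (Fin n) k → I → ℤ
  Direction forms is i = linear-sum (monomial is) (forms i)

  module Absorption {I : Set} (H : IPS I) (n : ℕ) (forms : I → List (ℤ × Vec ℤ n)) where
    open Nearness H

    -- K is quantified inside: one average A serves all precisions, with the admissible multiples m
    -- shrinking in proportion.
    Good : ℕ → Avg → ℕ → ℕ → Set
    Good k A W L = ∀ (is : Vec (Fin n) k) m K → 2 ℕ.* K ℕ.* m ℕ.≤ L → Abs A K ((+ m) ⊠ ((+ W) ⊠ Direction forms is))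

    Abs-Σᶠ : ∀ {A m} K (g : Fin m → Λ) → (∀ i → Abs A (K ℕ.* 4 ℕ.^ m) (g i)) → Abs A K (λ t → Σᶠ (λ i → g i t))
    Abs-Σᶠ {A} {zero} K g h = Abs-0 {A} {K}
    Abs-Σᶠ {A} {suc m} K g h = Abs-⊞ {A} {K} {g zero} {λ t → Σᶠ (λ i → g (suc i) t)}
      (Abs-weaken {A} {a = g zero} (ℕₚ.≤-trans (≤-*ʳ (4 ℕ.* K) (^-pos m (ℕ.s≤s ℕ.z≤n))) (ℕₚ.≤-reflexive (lem K (4 ℕ.^ m)))) (h zero))
      (Abs-Σᶠ {A} {m} (4 ℕ.* K) (λ i → g (suc i)) λ i → Abs-weaken {A} {a = g (suc i)} (ℕₚ.≤-reflexive (lem K (4 ℕ.^ m))) (h (suc i)))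
      where
      lem : ∀ K x → 4 ℕ.* K ℕ.* x ≡ K ℕ.* (4 ℕ.* x)
      lem = ℕ-solve

    linear-sum-≗ : ∀ {F G : Vec ℤ n → ℤ} → (∀ f → F f ≡ G f) → ∀ fs → linear-sum F fs ≡ linear-sum G fs
    linear-sum-≗ h fs = linear-sum-cong fs (ListAll.tabulate λ {ef} _ → h (proj₂ ef))

    linear-sum-Σᶠ : ∀ {m} (F : Fin m → Vec ℤ n → ℤ) fs → linear-sum (λ f → Σᶠ (λ i → F i f)) fs ≡ Σᶠ (λ i → linear-sum (F i) fs)
    linear-sum-Σᶠ {zero} F fs = linear-sum-0 fs
      where
      linear-sum-0 : ∀ fs → linear-sum (λ _ → + 0) fs ≡ + 0
      linear-sum-0 [] = refl
      linear-sum-0 ((e , f) ∷ fs) = trans (cong₂ ℤ._+_ (ℤₚ.*-zeroʳ e) (linear-sum-0 fs)) refl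
    linear-sum-Σᶠ {suc m} F fs = trans (linear-sum-+ (F zero) (λ f → Σᶠ (λ i → F (suc i) f)) fs)
      (cong (λ t → linear-sum (F zero) fs ℤ.+ t) (linear-sum-Σᶠ (λ i → F (suc i)) fs))

    -- Expands φ one index at a time, each sum over `Fin n` costing 4^n. The factor h accumulates
    -- the entries of f that belong to indices already chosen.
    Abs-form : ∀ {A} k (φ : Form n k) (h : Vec ℤ n → ℤ) K →
      (∀ is → Abs A (K ℕ.* (4 ℕ.^ n) ℕ.^ k) (λ t → linear-sum (λ f → h f ℤ.* (φ is ℤ.* monomial is f)) (forms t))) →
      Abs A K (λ t → linear-sum (λ f → h f ℤ.* evalF φ f) (forms t))
    Abs-form {A} zero φ h K hyp = Abs-cong {A} {K}
      (λ t → linear-sum-≗ (λ f → cong (λ x → h f ℤ.* x) (ℤₚ.*-identityʳ (φ []))) (forms t))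
      (Abs-weaken {A} {a = λ t → linear-sum (λ f → h f ℤ.* (φ [] ℤ.* + 1)) (forms t)} (ℕₚ.≤-reflexive (sym (ℕₚ.*-identityʳ K))) (hyp []))
    Abs-form {A} (suc k) φ h K hyp = Abs-cong {A} {K}
      (λ t → trans (sym (linear-sum-Σᶠ (λ i f → h f ℤ.* lookup f i ℤ.* evalF (λ is → φ (i ∷ is)) f) (forms t)))
        (linear-sum-≗ (λ f → trans (Σᶠ-cong λ i → ℤₚ.*-assoc (h f) (lookup f i) (evalF (λ is → φ (i ∷ is)) f)) (Σᶠ-* (h f) (λ i → lookup f i ℤ.* evalF (λ is → φ (i ∷ is)) f))) (forms t)))
      (Abs-Σᶠ {A} K (λ i t → linear-sum (λ f → h f ℤ.* lookup f i ℤ.* evalF (λ is → φ (i ∷ is)) f) (forms t)) λ i →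
        Abs-form {A} k (λ is → φ (i ∷ is)) (λ f → h f ℤ.* lookup f i) (K ℕ.* 4 ℕ.^ n) λ is →
          Abs-cong {A} {K ℕ.* 4 ℕ.^ n ℕ.* (4 ℕ.^ n) ℕ.^ k}
            (λ t → linear-sum-≗ (λ f → lem (h f) (φ (i ∷ is)) (lookup f i) (monomial is f)) (forms t))
            (Abs-weaken {A} {a = λ t → linear-sum (λ f → h f ℤ.* (φ (i ∷ is) ℤ.* monomial (i ∷ is) f)) (forms t)} (ℕₚ.≤-reflexive (ℕₚ.*-assoc K _ _)) (hyp (i ∷ is))))
      where
      lem : ∀ h p f m → h ℤ.* (p ℤ.* (f ℤ.* m)) ≡ h ℤ.* f ℤ.* (p ℤ.* m)
      lem = ℤ-Solver.solve-∀

    Abs-integer : ∀ {A K} {g : Λ} (x : ℤ) → Abs A K ((+ ℤ.∣ x ∣) ⊠ g) → Abs A K (x ⊠ g)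
    Abs-integer (+ m) p = p
    Abs-integer {A} {K} {g} -[1+ m ] p = Abs-cong {A} {K} (λ i → ℤₚ.neg-distribˡ-* (+ suc m) (g i)) (Abs-⊟ {A} {K} p)

    Good⇒Abs-form : ∀ {A k W L} (φ : Form n k) K b → Good k A W L → (∀ is → ℤ.∣ φ is ∣ ℕ.≤ b) →
      2 ℕ.* (K ℕ.* (4 ℕ.^ n) ℕ.^ k) ℕ.* b ℕ.≤ L → Abs A K (λ t → linear-sum (λ f → (+ W) ℤ.* evalF φ f) (forms t))
    Good⇒Abs-form {A} {k} {W} φ K b good hb small = Abs-form {A} k φ (λ _ → + W) K λ is →
      Abs-cong {A} {K ℕ.* (4 ℕ.^ n) ℕ.^ k}
        (λ t → sym (trans (linear-sum-≗ (λ f → lem (+ W) (φ is) (monomial is f)) (forms t))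
          (trans (linear-sum-* (φ is) (λ f → (+ W) ℤ.* monomial is f) (forms t)) (cong (λ x → φ is ℤ.* x) (linear-sum-* (+ W) (monomial is) (forms t))))))
        (Abs-integer {A} {K ℕ.* (4 ℕ.^ n) ℕ.^ k} (φ is) (good is ℤ.∣ φ is ∣ (K ℕ.* (4 ℕ.^ n) ℕ.^ k)
          (ℕₚ.≤-trans (ℕₚ.*-monoʳ-≤ (2 ℕ.* (K ℕ.* (4 ℕ.^ n) ℕ.^ k)) (hb is)) small)))
      where
      lem : ∀ w p m → w ℤ.* (p ℤ.* m) ≡ p ℤ.* (w ℤ.* m)
      lem = ℤ-Solver.solve-∀

  Between : ∀ {n} → ℕ → Vec ℤ n → Set
  Between b = All (λ t → + 1 ℤ.≤ t × t ℤ.≤ + b)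

  Between-bump : ∀ {n b m a} (i : Fin n) {z} → a ℕ.≤ m → Between b z → Between (m ℕ.+ b) (bump i (+ a) z)
  Between-bump {b = b} {m} {a} zero a≤ ((lo , hi) ∷ ps) = (ℤₚ.≤-trans lo (ℤₚ.i≤j+i _ (+ a)) , ℤₚ.+-mono-≤ (ℤ.+≤+ a≤) hi)
    ∷ All.map (λ (l , h) → l , ℤₚ.≤-trans h (ℤ.+≤+ (ℕₚ.m≤n+m b m))) ps
  Between-bump {b = b} {m} (suc i) a≤ ((lo , hi) ∷ ps) = (lo , ℤₚ.≤-trans hi (ℤ.+≤+ (ℕₚ.m≤n+m b m))) ∷ Between-bump i a≤ ps

  Between-weaken : ∀ {n b b′} {z : Vec ℤ n} → b ℕ.≤ b′ → Between b z → Between b′ z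
  Between-weaken le = All.map λ (l , h) → l , ℤₚ.≤-trans h (ℤ.+≤+ le)

  Between-place : ∀ {n k b m} (is : Vec (Fin n) k) {as} {z : Vec ℤ n} → All (ℕ._≤ m) as → Between b z → Between (k ℕ.* m ℕ.+ b) (place is as z)
  Between-place [] [] p = p
  Between-place {k = suc k} {b} {m} (i ∷ is) {a ∷ as} (q ∷ qs) p = Between-weaken (ℕₚ.≤-reflexive (sym (ℕₚ.+-assoc m (k ℕ.* m) b)))
    (Between-bump i q (Between-place is qs p))

  Between-extend : ∀ {n k b m} (is : Vec (Fin n) k) ms {𝒴 : List (Vec ℤ n)} → All (ℕ._≤ m) ms → (∀ z → z ∈ 𝒴 → Between b z) →
    ∀ z → z ∈ extend is ms 𝒴 → Between (k ℕ.* m ℕ.+ b) z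
  Between-extend is ms {𝒴} hm h z z∈ with ∈-cartesianProductWith⁻ (place is) (tuples ms) 𝒴 z∈
  ... | as , y , as∈ , y∈ , refl = Between-place is (entries ms hm as∈) (h y y∈)
    where
    entries : ∀ {k m} (ms : Vec ℕ k) {as} → All (ℕ._≤ m) ms → as ∈ tuples ms → All (ℕ._≤ m) as
    entries [] [] (here refl) = []
    entries (m₁ ∷ ms) (q ∷ qs) as∈ with ∈-cartesianProductWith⁻ _∷_ (downFrom m₁) (tuples ms) as∈
    ... | a , as , a∈ , as∈ , refl = ℕₚ.≤-trans (ℕₚ.<⇒≤ (∈-downFrom⁻ a∈)) q ∷ entries ms qs as∈

  ∈-cube⁻ : ∀ n {u z} → z ∈ cube n u → Between u z
  ∈-cube⁻ zero (here refl) = []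
  ∈-cube⁻ (suc n) {u} z∈ with ∈-cartesianProductWith⁻ _∷_ (map (λ j → + suc j) (downFrom u)) (cube n u) z∈
  ... | t , z , t∈ , z∈ , refl with ∈-map⁻ _ t∈
  ... | j , j∈ , refl = (ℤ.+≤+ (ℕ.s≤s ℕ.z≤n) , ℤ.+≤+ (∈-downFrom⁻ j∈)) ∷ ∈-cube⁻ n z∈

  ∈-cube⁺ : ∀ {n u} {z : Vec ℤ n} → Between u z → z ∈ cube n u
  ∈-cube⁺ [] = here refl
  ∈-cube⁺ {suc n} {u} {+ suc j ∷ z} ((lo , ℤ.+≤+ hi) ∷ ps) = ∈-cartesianProductWith⁺ _∷_ (∈-map⁺ (λ j → + suc j) (∈-downFrom⁺ hi)) (∈-cube⁺ ps)
  ∈-cube⁺ {suc n} {u} {+ zero ∷ z} ((ℤ.+≤+ () , _) ∷ ps)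
  ∈-cube⁺ {suc n} {u} { -[1+ _ ] ∷ z} ((() , _) ∷ ps)

  length-cube : ∀ n u → length (cube n u) ≡ u ℕ.^ n
  length-cube zero u = refl
  length-cube (suc n) u = trans (length-product _∷_ (map (λ j → + suc j) (downFrom u)) (cube n u))
    (cong₂ ℕ._*_ (trans (Listₚ.length-map _ (downFrom u)) (Listₚ.length-downFrom u)) (length-cube n u))

-- Size and distribution of the points of a plan.

module PlanBoundsAndSpread where
  open import Data.Rational using (_+_; _*_; _≤_)
  open import Tactic.RingSolver using (solve-∀)
  open RationalSums
  open InnerProductSpaces
  open AlmostInvariance
  open BoxEstimates
  open AveragingPlans
  open PolynomialDifferences
  open FormAbsorption

  Injective : {A B : Set} → (A → B) → Set
  Injective f = ∀ {x y} → f x ≡ f y → x ≡ y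

  Σ-injection : {A B : Set} (xs : List A) (ys : List B) (h : A → B) (F : B → ℚ) → Unique xs →
    (∀ {x y} → x ∈ xs → y ∈ xs → h x ≡ h y → x ≡ y) → (∀ x → x ∈ xs → h x ∈ ys) → (∀ y → 0ℚ ≤ F y) → Σ xs (λ x → F (h x)) ≤ Σ ys F
  Σ-injection [] ys h F u inj into F≥0 = 0≤Σ ys F≥0
  Σ-injection (x ∷ xs) ys h F (x∉ ∷ u) inj into F≥0 with ∈-∃++ (into x (here refl))
  ... | as , bs , refl = begin
    F (h x) + Σ xs (λ x → F (h x)) ≤⟨ ℚₚ.+-monoʳ-≤ (F (h x)) (Σ-injection xs (as ++ bs) h F u (λ p q → inj (there p) (there q)) rest F≥0) ⟩
    F (h x) + Σ (as ++ bs) F ≡⟨ cong (λ t → F (h x) + t) (Σ-++ as bs F) ⟩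
    F (h x) + (Σ as F + Σ bs F) ≡⟨ lem (F (h x)) (Σ as F) (Σ bs F) ⟩
    Σ as F + (F (h x) + Σ bs F) ≡⟨ sym (Σ-++ as (h x ∷ bs) F) ⟩
    Σ (as ++ h x ∷ bs) F ∎
    where
    open ℚₚ.≤-Reasoning
    lem : ∀ a b c → a + (b + c) ≡ b + (a + c)
    lem = solve-∀ ℚ-ring
    rest : ∀ y → y ∈ xs → h y ∈ as ++ bs
    rest y y∈ with ∈-++⁻ as (into y (there y∈))
    ... | inj₁ p = ∈-++⁺ˡ p
    ... | inj₂ (here e) = ⊥-elim (ListAll.lookup x∉ y∈ (sym (inj (there y∈) (here refl) e)))
    ... | inj₂ (there p) = ∈-++⁺ʳ as p

  cube-unique : ∀ n u → Unique (cube n u)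
  cube-unique zero u = ListAll.[] ∷ []
  cube-unique (suc n) u = Uniqueₚ.cartesianProductWith⁺ _∷_ Vecₚ.∷-injective
    (Uniqueₚ.map⁺ (λ e → ℕₚ.suc-injective (ℤₚ.+-injective e)) (Uniqueₚ.downFrom⁺ u)) (cube-unique n u)

  Σ-cube-mono : ∀ n {u v} (F : Vec ℤ n → ℚ) → u ℕ.≤ v → (∀ z → 0ℚ ≤ F z) → Σ (cube n u) F ≤ Σ (cube n v) F
  Σ-cube-mono n {u} {v} F u≤v F≥0 = Σ-injection (cube n u) (cube n v) id F (cube-unique n u) (λ _ _ e → e)
    (λ z z∈ → ∈-cube⁺ (Between-weaken u≤v (∈-cube⁻ n z∈))) F≥0

  ℤ-cancelˡ : ∀ x {y z} → x ℤ.+ y ≡ x ℤ.+ z → y ≡ z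
  ℤ-cancelˡ x {y} {z} e = trans (sym (lem x y)) (trans (cong (λ t → ℤ.- x ℤ.+ t) e) (lem x z))
    where
    lem : ∀ x y → ℤ.- x ℤ.+ (x ℤ.+ y) ≡ y
    lem = ℤ-Solver.solve-∀

  bump-injective : ∀ {n} (i : Fin n) x → Injective (bump i x)
  bump-injective zero x {y ∷ ys} {z ∷ zs} e = cong₂ _∷_ (ℤ-cancelˡ x (Vecₚ.∷-injectiveˡ e)) (Vecₚ.∷-injectiveʳ e)
  bump-injective (suc i) x {y ∷ ys} {z ∷ zs} e = cong₂ _∷_ (Vecₚ.∷-injectiveˡ e) (bump-injective i x (Vecₚ.∷-injectiveʳ e))

  place-injective : ∀ {n k} (is : Vec (Fin n) k) as → Injective (place is as)
  place-injective [] [] e = e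
  place-injective (i ∷ is) (a ∷ as) e = place-injective is as (bump-injective i (+ a) e)

  scale-injective : ∀ {n} w o → Injective (scale {n} (+ suc w) o)
  scale-injective w o {[]} {[]} e = refl
  scale-injective w o {y ∷ ys} {z ∷ zs} e = cong₂ _∷_
    (ℤ-cancelˡ o (ℤₚ.*-cancelˡ-≡ (+ suc w) _ _ (Vecₚ.∷-injectiveˡ e))) (scale-injective w o (Vecₚ.∷-injectiveʳ e))

  -- With all blocks held fixed, a plan is a translate of a cube: its u^n points go injectively into
  -- the target, so the average is at most u^(-n) times the whole sum. Repetitions caused by
  -- different blocks therefore do no harm.
  Spread : ∀ {n} → ℕ → List (Vec ℤ n) → List (Vec ℤ n) → Set
  Spread {n} u target 𝒴 = ∀ τ → Injective τ → (∀ z → z ∈ 𝒴 → τ z ∈ target) → ∀ F → (∀ z → 0ℚ ≤ F z) →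
    E 𝒴 (λ z → F (τ z)) ≤ inv (u ℕ.^ n) * Σ target F

  spread-cube : ∀ {n} u target → Spread {n} u target (cube n u)
  spread-cube {n} u target τ inj into F F≥0 = subst (λ m → inv m * Σ (cube n u) (λ z → F (τ z)) ≤ inv (u ℕ.^ n) * Σ target F)
    (sym (length-cube n u)) (*-monoˡ (0≤inv (u ℕ.^ n)) (Σ-injection (cube n u) target τ F (cube-unique n u) (λ _ _ → inj) into F≥0))

  spread-extend : ∀ {n k u target 𝒴} (is : Vec (Fin n) k) ms → Spread u target 𝒴 → Spread u target (extend is ms 𝒴)
  spread-extend {n} {u = u} {target} {𝒴} is ms h τ inj into F F≥0 = subst (_≤ inv (u ℕ.^ n) * Σ target F)
    (sym (E-product (place is) (tuples ms) 𝒴 (λ z → F (τ z))))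
    (E-bound (tuples ms) (0≤-* (0≤inv (u ℕ.^ n)) (0≤Σ target F≥0)) λ as as∈ →
      h (λ z → τ (place is as z)) (λ e → place-injective is as (inj e)) (λ z z∈ → into _ (∈-cartesianProductWith⁺ (place is) as∈ z∈)) F F≥0)

  indices : ∀ n k → List (Vec (Fin n) k)
  indices n zero = [ [] ]
  indices n (suc k) = cartesianProductWith _∷_ (allFin n) (indices n k)

  ∈-indices : ∀ {n k} (is : Vec (Fin n) k) → is ∈ indices n k
  ∈-indices [] = here refl
  ∈-indices (i ∷ is) = ∈-cartesianProductWith⁺ _∷_ (∈-allFin i) (∈-indices is)

  module PlanBounds (n k : ℕ) (I : Set) (S : Vec (Fin n) (suc k) → I → ℤ) (c : ℤ) (κ u : ℕ)
    (1≤∣c∣ : 1 ℕ.≤ ℤ.∣ c ∣) (1≤κ : 1 ℕ.≤ κ) (1≤u : 1 ℕ.≤ u) where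
    open Plan n k I S c κ u
    open Positive 1≤∣c∣ 1≤κ

    Γ X-constant : ℕ
    Γ = M ℕ.* C ℕ.^ k
    X-constant = width ℕ.* Γ

    σ≤ : ∀ j → σ u j ℕ.≤ C ℕ.^ k ℕ.* u
    σ≤ j = ℕₚ.*-monoˡ-≤ u (ℕₚ.^-monoʳ-≤ C {{ℕ.>-nonZero 1≤C}} (ℕₚ.m∸n≤m k j))

    γ≤ : ∀ j → γ u j ℕ.≤ Γ ℕ.* u
    γ≤ j = ℕₚ.≤-trans (ℕₚ.*-monoʳ-≤ M (σ≤ j)) (ℕₚ.≤-reflexive (sym (ℕₚ.*-assoc M (C ℕ.^ k) u)))

    1≤Γu : 1 ℕ.≤ Γ ℕ.* u
    1≤Γu = ℕₚ.≤-trans (1≤γ 0 1≤u) (γ≤ 0)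

    L≤ : ∀ j → j ℕ.≤ k → L u j ℕ.≤ Γ ℕ.^ suc k ℕ.* u ℕ.^ suc k
    L≤ j j≤k = begin
      γ u j ℕ.^ j ℕ.* σ u j ≤⟨ ℕₚ.*-mono-≤ (ℕₚ.^-monoˡ-≤ j (γ≤ j)) (ℕₚ.≤-trans (≤-*ˡ (σ u j) 1≤M) (γ≤ j)) ⟩
      (Γ ℕ.* u) ℕ.^ j ℕ.* (Γ ℕ.* u) ≡⟨ ℕₚ.*-comm _ (Γ ℕ.* u) ⟩
      (Γ ℕ.* u) ℕ.^ suc j ≤⟨ ℕₚ.^-monoʳ-≤ (Γ ℕ.* u) {{ℕ.>-nonZero 1≤Γu}} (ℕ.s≤s j≤k) ⟩
      (Γ ℕ.* u) ℕ.^ suc k ≡⟨ *-^ Γ u (suc k) ⟩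
      Γ ℕ.^ suc k ℕ.* u ℕ.^ suc k ∎
      where open ℕₚ.≤-Reasoning

    u^≤L : u ℕ.^ suc k ℕ.≤ L u k
    u^≤L = ℕₚ.≤-trans (ℕₚ.≤-reflexive (ℕₚ.*-comm u (u ℕ.^ k))) (ℕₚ.*-mono-≤ (ℕₚ.^-monoˡ-≤ k (ℕₚ.≤-trans u≤σ (≤-*ˡ (σ u k) 1≤M))) u≤σ)
      where
      u≤σ : u ℕ.≤ σ u k
      u≤σ = ≤-*ˡ u (^-pos (k ∸ k) 1≤C)

    lens≤ : ∀ j → All (ℕ._≤ X-constant ℕ.* u) (lens j)
    lens≤ j = entries k j
      where
      wide : ∀ {x} → x ℕ.≤ Γ ℕ.* u → width ℕ.* x ℕ.≤ X-constant ℕ.* u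
      wide h = ℕₚ.≤-trans (ℕₚ.*-monoʳ-≤ width h) (ℕₚ.≤-reflexive (sym (ℕₚ.*-assoc width Γ u)))
      entries : ∀ k′ j′ → All (ℕ._≤ X-constant ℕ.* u) (boxLengths width (Y u j) (longs k′ j′ (γ u j)))
      entries zero j′ = wide (γ≤ j) ∷ []
      entries (suc k′) zero = wide 1≤Γu ∷ entries k′ zero
      entries (suc k′) (suc j′) = wide (γ≤ j) ∷ entries k′ j′

    step-size : ℕ
    step-size = suc k ℕ.* (X-constant ℕ.* u)

    stageY-between : ∀ is j {𝒴 b} → (∀ z → z ∈ 𝒴 → Between b z) → ∀ z → z ∈ stageY is j 𝒴 → Between (suc j ℕ.* step-size ℕ.+ b) z
    stageY-between is zero {b = b} h z z∈ = Between-weaken (ℕₚ.≤-reflexive (cong (ℕ._+ b) (sym (ℕₚ.*-identityˡ step-size)))) (Between-extend is (lens 0) (lens≤ 0) h z z∈)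
    stageY-between is (suc j) {b = b} h z z∈ = Between-weaken (ℕₚ.≤-reflexive (sym (ℕₚ.+-assoc step-size (suc j ℕ.* step-size) b)))
      (Between-extend is (lens (suc j)) (lens≤ (suc j)) (stageY-between is j h) z z∈)

    planY-between : ∀ iss z → z ∈ planY iss → Between (length iss ℕ.* (suc k ℕ.* step-size) ℕ.+ u) z
    planY-between [] z z∈ = ∈-cube⁻ n z∈
    planY-between (is ∷ iss) z z∈ = Between-weaken (ℕₚ.≤-reflexive (sym (ℕₚ.+-assoc (suc k ℕ.* step-size) (length iss ℕ.* (suc k ℕ.* step-size)) u)))
      (stageY-between is k (planY-between iss) z z∈)

    stageY-spread : ∀ is j {𝒴 target} → Spread u target 𝒴 → Spread u target (stageY is j 𝒴)
    stageY-spread is zero {target = target} h = spread-extend {u = u} {target} is (lens 0) h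
    stageY-spread is (suc j) {target = target} h = spread-extend {u = u} {target} is (lens (suc j)) (stageY-spread is j {target = target} h)

    planY-spread : ∀ iss {target} → Spread u target (planY iss)
    planY-spread [] {target} = spread-cube u target
    planY-spread (is ∷ iss) {target} = stageY-spread is k {target = target} (planY-spread iss {target})

    extend-nonempty : ∀ {m} (js : Vec (Fin n) m) ms {𝒴} → All (1 ℕ.≤_) ms → Nonempty 𝒴 → Nonempty (extend js ms 𝒴)
    extend-nonempty js ms {𝒴} hm h = ℕₚ.≤-trans (*-pos (tuples-nonempty ms hm) h) (ℕₚ.≤-reflexive (sym (length-product (place js) (tuples ms) 𝒴)))
      where
      tuples-nonempty : ∀ {m} (ms : Vec ℕ m) → All (1 ℕ.≤_) ms → Nonempty (tuples ms)
      tuples-nonempty [] [] = ℕₚ.≤-refl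
      tuples-nonempty (m ∷ ms) (p ∷ ps) = ℕₚ.≤-trans (*-pos p (tuples-nonempty ms ps)) (ℕₚ.≤-reflexive (sym
        (trans (length-product _∷_ (downFrom m) (tuples ms)) (cong (ℕ._* length (tuples ms)) (Listₚ.length-downFrom m)))))

    1≤lens : ∀ j → All (1 ℕ.≤_) (lens j)
    1≤lens j = entries k j
      where
      entries : ∀ k′ j′ → All (1 ℕ.≤_) (boxLengths width (Y u j) (longs k′ j′ (γ u j)))
      entries zero j′ = *-pos 1≤width (1≤γ j 1≤u) ∷ []
      entries (suc k′) zero = *-pos 1≤width (ℕₚ.≤-refl {1}) ∷ entries k′ zero
      entries (suc k′) (suc j′) = *-pos 1≤width (1≤γ j 1≤u) ∷ entries k′ j′

    stageY-nonempty : ∀ is j {𝒴} → Nonempty 𝒴 → Nonempty (stageY is j 𝒴)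
    stageY-nonempty is zero h = extend-nonempty is (lens 0) (1≤lens 0) h
    stageY-nonempty is (suc j) h = extend-nonempty is (lens (suc j)) (1≤lens (suc j)) (stageY-nonempty is j h)

    planY-nonempty : ∀ iss → Nonempty (planY iss)
    planY-nonempty [] = ℕₚ.≤-trans (^-pos n 1≤u) (ℕₚ.≤-reflexive (sym (length-cube n u)))
    planY-nonempty (is ∷ iss) = stageY-nonempty is k (planY-nonempty iss)

    module Nearby (H : IPS I) where
      open Block H n hiding (Λ; 0Λ; _⊞_; ⊟_; _⊠_; Avg; one; av; _∘_; _†; ap)

      stageA-base : ∀ is j {A K a} → Abs A K a → Abs (stageA is j A) K a
      stageA-base is zero {A} {K} {a} p = Abs-∘ʳ {ap (direction is) (L u 0)} {A} {K} {a} p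
      stageA-base is (suc j) {A} {K} {a} p = Abs-∘ʳ {ap (direction is) (L u (suc j))} {stageA is j A} {K} {a} (stageA-base is j {A} {K} {a} p)

      stageA-last : ∀ is j {A K a} → Abs (ap (direction is) (L u j)) K a → Abs (stageA is j A) K a
      stageA-last is zero {A} {K} {a} p = Abs-∘ˡ {A} {ap (direction is) (L u 0)} {K} {a} p
      stageA-last is (suc j) {A} {K} {a} p = Abs-∘ˡ {stageA is j A} {ap (direction is) (L u (suc j))} {K} {a} p

      -- The last stage for `is` contributes a progression of length at least u^(k+1), and the other
      -- factors are contractions.
      planA-good : ∀ iss is → is ∈ iss → ∀ m K → 2 ℕ.* K ℕ.* m ℕ.≤ u ℕ.^ suc k → Abs (planA iss) K ((+ m) ⊠ direction is)
      planA-good (is ∷ iss) .is (here refl) m K small = stageA-last is k {planA iss} {K} {(+ m) ⊠ direction is}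
        (Abs-ap {direction is} {L u k} {K} m (1≤L k 1≤u) (ℕₚ.≤-trans small u^≤L))
      planA-good (js ∷ iss) is (there is∈) m K small = stageA-base js k {planA iss} {K} {(+ m) ⊠ direction is} (planA-good iss is is∈ m K small)

      -- The adjoint is carried along because the energy argument has to absorb A†A.
      Both : Avg → ℕ → Avg → Set
      Both Z K A = Near Z K A × Near Z K (A †)

      module _ (Z : Avg) (κ₀ : ℕ) (h : ∀ is j m → j ℕ.≤ k → m ℕ.< L u j → Abs Z κ₀ ((+ m) ⊠ direction is)) where

        ap-both : ∀ is j {K} → j ℕ.≤ k → K ℕ.≤ κ₀ → Both Z K (ap (direction is) (L u j))
        ap-both is j {K} j≤k K≤ =
          Near-weaken {Z} {Q = ap (direction is) (L u j)} K≤ (Near-av {Z} {κ₀} (ap-nonempty (direction is) (1≤L j 1≤u)) pos) ,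
          Near-weaken {Z} {Q = ap (direction is) (L u j) †} K≤ (Near-av {Z} {κ₀} (ℕₚ.≤-trans (ap-nonempty (direction is) (1≤L j 1≤u)) (ℕₚ.≤-reflexive (sym (Listₚ.length-map ⊟_ as)))) neg)
          where
          as = map (λ j → (+ j) ⊠ direction is) (downFrom (L u j))
          pos : ∀ a → a ∈ as → Abs Z κ₀ a
          pos a a∈ with ∈-map⁻ _ a∈
          ... | m , m∈ , refl = h is j m j≤k (∈-downFrom⁻ m∈)
          neg : ∀ a → a ∈ map ⊟_ as → Abs Z κ₀ a
          neg a a∈ with ∈-map⁻ ⊟_ a∈
          ... | b , b∈ , refl = Abs-⊟ {Z} {κ₀} {b} (pos b b∈)

        ∘-both : ∀ {K A B} → Both Z (4 ℕ.* K) A → Both Z (4 ℕ.* K) B → Both Z K (A ∘ B)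
        ∘-both {K} {A} {B} (p , p†) (q , q†) = Near-∘ {Z} {K} {A} {B} p q , Near-∘ {Z} {K} {A †} {B †} p† q†

        stageA-both : ∀ is j → j ℕ.≤ k → ∀ {A} K → K ℕ.* 4 ℕ.^ suc j ℕ.≤ κ₀ → Both Z (K ℕ.* 4 ℕ.^ suc j) A → Both Z K (stageA is j A)
        stageA-both is zero j≤k {A} K K≤ p = ∘-both {K} {A} {ap (direction is) (L u 0)}
          (subst (λ t → Both Z t A) (lem K) p) (ap-both is 0 j≤k (subst (ℕ._≤ κ₀) (lem K) K≤))
          where
          lem : ∀ K → K ℕ.* 4 ℕ.^ 1 ≡ 4 ℕ.* K
          lem = ℕ-solve
        stageA-both is (suc j) j<k {A} K K≤ p = ∘-both {K} {stageA is j A} {ap (direction is) (L u (suc j))}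
          (stageA-both is j (ℕₚ.<⇒≤ j<k) {A} (4 ℕ.* K) (subst (ℕ._≤ κ₀) (lem K (4 ℕ.^ suc j)) K≤) (subst (λ t → Both Z t A) (lem K (4 ℕ.^ suc j)) p))
          (ap-both is (suc j) j<k (ℕₚ.≤-trans (≤-*ʳ (4 ℕ.* K) (^-pos (suc j) (ℕ.s≤s ℕ.z≤n))) (subst (ℕ._≤ κ₀) (lem K (4 ℕ.^ suc j)) K≤)))
          where
          lem : ∀ K x → K ℕ.* (4 ℕ.* x) ≡ 4 ℕ.* K ℕ.* x
          lem = ℕ-solve

        planA-both : ∀ iss K → K ℕ.* (4 ℕ.^ suc k) ℕ.^ length iss ℕ.≤ κ₀ → Both Z K (planA iss)
        planA-both [] K K≤ = Near-one {Z} {K} , Near-one {Z} {K}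
        planA-both (is ∷ iss) K K≤ = stageA-both is k ℕₚ.≤-refl {planA iss} K
          (ℕₚ.≤-trans (≤-*ʳ (K ℕ.* 4 ℕ.^ suc k) (^-pos (length iss) (^-pos (suc k) (ℕ.s≤s ℕ.z≤n)))) K≤′)
          (planA-both iss (K ℕ.* 4 ℕ.^ suc k) K≤′)
          where
          K≤′ = ℕₚ.≤-trans (ℕₚ.≤-reflexive (ℕₚ.*-assoc K (4 ℕ.^ suc k) _)) K≤

-- The dichotomy between large return and energy increment.

module EnergyIncrement where
  open import Data.Rational using (_+_; _*_; _-_; -_; _≤_)
  open import Tactic.RingSolver using (solve-∀)
  open RationalSums
  open InnerProductSpaces
  open AlmostInvariance
  open BoxEstimates
  open AveragingPlans
  open PolynomialDifferences
  open FormAbsorption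
  open PlanBoundsAndSpread

  act-injective : ∀ {l} ξ w o → Injective (act {l} ξ (+ suc w) o)
  act-injective ξ w o e = scale-injective w o (bump-injective zero ξ e)

  -- A negative ξ in the first coordinate is outweighed by the shift: ξ + W(|ξ| + z₀) ≥ 1.
  act-between : ∀ {l b} ξ w {z : Vec ℤ (suc l)} → Between b z →
    Between (suc w ℕ.* (ℤ.∣ ξ ∣ ℕ.+ b) ℕ.+ ℤ.∣ ξ ∣) (act ξ (+ suc w) (+ ℤ.∣ ξ ∣) z)
  act-between {b = b} ξ w {z₀ ∷ z} ((lo , hi) ∷ ps) =
    (lower , ℤₚ.≤-trans (ℤₚ.+-mono-≤ (ξ≤ ξ) (upper hi)) (ℤₚ.≤-reflexive (cong +_ (ℕₚ.+-comm ℤ.∣ ξ ∣ _))))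
    ∷ rest ps
    where
    ξ≤ : ∀ ξ → ξ ℤ.≤ + ℤ.∣ ξ ∣
    ξ≤ (+ m) = ℤₚ.≤-refl
    ξ≤ -[1+ m ] = ℤ.-≤+
    -ξ≤ : ∀ ξ → ℤ.- (+ ℤ.∣ ξ ∣) ℤ.≤ ξ
    -ξ≤ (+ zero) = ℤₚ.≤-refl
    -ξ≤ (+ suc m) = ℤ.-≤+
    -ξ≤ -[1+ m ] = ℤₚ.≤-refl
    value : ∀ {t} → + 1 ℤ.≤ t → + suc ℤ.∣ ξ ∣ ℤ.≤ + suc w ℤ.* (+ ℤ.∣ ξ ∣ ℤ.+ t)
    value {+ t} (ℤ.+≤+ 1≤t) = ℤₚ.≤-trans (ℤ.+≤+ (ℕₚ.≤-trans (ℕₚ.≤-trans (ℕₚ.≤-reflexive (ℕₚ.+-comm 1 ℤ.∣ ξ ∣)) (ℕₚ.+-monoʳ-≤ ℤ.∣ ξ ∣ 1≤t)) (≤-*ˡ {suc w} (ℤ.∣ ξ ∣ ℕ.+ t) (ℕ.s≤s ℕ.z≤n))))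
      (ℤₚ.≤-reflexive (ℤₚ.pos-* (suc w) (ℤ.∣ ξ ∣ ℕ.+ t)))
    upper : ∀ {t} → t ℤ.≤ + b → + suc w ℤ.* (+ ℤ.∣ ξ ∣ ℤ.+ t) ℤ.≤ + (suc w ℕ.* (ℤ.∣ ξ ∣ ℕ.+ b))
    upper h = ℤₚ.≤-trans (ℤₚ.*-monoˡ-≤-nonNeg (+ suc w) (ℤₚ.+-monoʳ-≤ (+ ℤ.∣ ξ ∣) h)) (ℤₚ.≤-reflexive (sym (ℤₚ.pos-* (suc w) (ℤ.∣ ξ ∣ ℕ.+ b))))
    lower : + 1 ℤ.≤ ξ ℤ.+ + suc w ℤ.* (+ ℤ.∣ ξ ∣ ℤ.+ z₀)
    lower = ℤₚ.≤-trans (ℤₚ.≤-reflexive (lem (+ ℤ.∣ ξ ∣))) (ℤₚ.+-mono-≤ (-ξ≤ ξ) (value lo))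
      where
      lem : ∀ x → + 1 ≡ ℤ.- x ℤ.+ (+ 1 ℤ.+ x)
      lem = ℤ-Solver.solve-∀
    rest : ∀ {m} {z : Vec ℤ m} → Between b z → Between (suc w ℕ.* (ℤ.∣ ξ ∣ ℕ.+ b) ℕ.+ ℤ.∣ ξ ∣) (scale (+ suc w) (+ ℤ.∣ ξ ∣) z)
    rest [] = []
    rest ((lo , hi) ∷ ps) = (ℤₚ.≤-trans (ℤ.+≤+ (ℕ.s≤s ℕ.z≤n)) (value lo) , ℤₚ.≤-trans (upper hi) (ℤ.+≤+ (ℕₚ.m≤m+n _ ℤ.∣ ξ ∣))) ∷ rest ps

  Between⇒∣∣ : ∀ {n b} {z : Vec ℤ n} → Between b z → ∀ i → ℤ.∣ lookup z i ∣ ℕ.≤ b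
  Between⇒∣∣ {b = b} p i = bound (Allₚ.lookup⁺ p i)
    where
    bound : ∀ {t} → + 1 ℤ.≤ t × t ℤ.≤ + b → ℤ.∣ t ∣ ℕ.≤ b
    bound {+ t} (_ , ℤ.+≤+ h) = h
    bound { -[1+ t ]} (() , _)

  module Energy {I : Set} (H : IPS I) where
    open Nearness H

    cauchy-schwarz⁻ : ∀ k {ν} u v → k * k * N u ≤ ν → N v ≤ ν → - ν ≤ k * ⟨ u , v ⟩
    cauchy-schwarz⁻ k {ν} u v p q = subst (- ν ≤_) (trans (cong (λ t → - (k * t)) (ip-· (- 1ℚ) u v)) (lem k ⟨ u , v ⟩))
      (ℚₚ.neg-antimono-≤ (cauchy-schwarz k ((- 1ℚ) · u) v (subst (λ t → k * k * t ≤ ν) (sym (trans (N-· (- 1ℚ) u) (lem₂ (N u)))) p) q))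
      where
      lem : ∀ k x → - (k * (- 1ℚ * x)) ≡ k * x
      lem = solve-∀ ℚ-ring
      lem₂ : ∀ x → - 1ℚ * - 1ℚ * x ≡ x
      lem₂ = solve-∀ ℚ-ring

    module EnergyStep (D : ℕ) (A A′ Π : Avg) (g : V) (large : N g ≤ ι D * N (⟦ A ⟧ g)) where
      -- With 8 D the main term satisfies k q ≥ 8 ν, and the errors in `large-return` leave 2 k x ≥
      -- 16 ν - 6 ν.
      κ = 8 ℕ.* D
      k = ι κ
      ν = N g
      Q Q′ : Avg
      Q = A † ∘ A
      Q′ = A′ † ∘ A′
      e = ⟦ Q′ ⟧ g ⊖ ⟦ Q ⟧ g
      x = ⟨ ⟦ Π ⟧ g , g ⟩
      q = N (⟦ A ⟧ g)
      q′ = N (⟦ A′ ⟧ g)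
      t₁ = ⟨ ⟦ Π ⟧ (g ⊖ ⟦ Q′ ⟧ g) , g ⟩
      t₂ = ⟨ ⟦ Π ⟧ e , g ⟩
      t₃ = ⟨ ⟦ Q ⟧ (g ⊖ ⟦ Π ⟧ g) , g ⟩
      t₄ = ⟨ ⟦ A ⟧ (g ⊖ ⟦ Q′ ⟧ g) , ⟦ A ⟧ g ⟩

      kk : ι (κ ℕ.* κ) ≡ k * k
      kk = ι-* κ κ

      neg-neg : ∀ x → - 1ℚ * - 1ℚ * x ≡ x
      neg-neg = solve-∀ ℚ-ring

      -- Inside Π, replace g by Q′g and then by Qg; since Π and Q commute, Π can afterwards be
      -- dropped. The energy q is the main term, t₁ and t₃ are errors of absorption, and t₂ alone
      -- depends on the distance of Q′g from Qg.
      decompose : x ≡ t₁ + t₂ - t₃ + q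
      decompose = begin
        x ≡⟨ lem x ⟨ ⟦ Π ⟧ (⟦ Q′ ⟧ g) , g ⟩ ⟨ ⟦ Π ⟧ (⟦ Q ⟧ g) , g ⟩ ⟨ ⟦ Q ⟧ g , g ⟩ ⟩
        (x - ⟨ ⟦ Π ⟧ (⟦ Q′ ⟧ g) , g ⟩) + (⟨ ⟦ Π ⟧ (⟦ Q′ ⟧ g) , g ⟩ - ⟨ ⟦ Π ⟧ (⟦ Q ⟧ g) , g ⟩) - (⟨ ⟦ Q ⟧ g , g ⟩ - ⟨ ⟦ Π ⟧ (⟦ Q ⟧ g) , g ⟩) + ⟨ ⟦ Q ⟧ g , g ⟩
          ≡⟨ cong₂ _+_ (cong₂ _-_ (cong₂ _+_ (sym (expand Π g _)) (sym (expand Π _ _)))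
               (sym (trans (expand Q g (⟦ Π ⟧ g)) (cong (λ t → ⟨ ⟦ Q ⟧ g , g ⟩ - t) (ip-congˡ (op-comm Q Π g)))))) (energy A g) ⟩
        t₁ + t₂ - t₃ + q ∎
        where
        open ≡-Reasoning
        expand : ∀ X u v → ⟨ ⟦ X ⟧ (u ⊖ v) , g ⟩ ≡ ⟨ ⟦ X ⟧ u , g ⟩ - ⟨ ⟦ X ⟧ v , g ⟩
        expand X u v = trans (ip-congˡ (op-⊖ X u v)) (ip-⊖ _ _ g)
        lem : ∀ a b c d → a ≡ (a - b) + (b - c) - (d - c) + d
        lem = solve-∀ ℚ-ring

      large-return : Near Π (κ ℕ.* κ) Q′ → Near A (κ ℕ.* κ) Π → k * k * N e ≤ ν → ν ≤ ι (2 ℕ.* κ) * x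
      large-return h₁ h₂ small = ≤-by (s₁ + s₁ + (s₃ + s₃) + (s₄ + s₄) + s₅ + ι 9 * ν)
        (0≤-+ (0≤-+ (0≤-+ (0≤-+ (0≤-+ 0≤s₁ 0≤s₁) (0≤-+ 0≤s₃ 0≤s₃)) (0≤-+ 0≤s₄ 0≤s₄)) 0≤s₅) (0≤-* (0≤ι 9) (psd g))) total
        where
        s₁ = ν + k * t₁
        s₃ = ν - k * t₃
        s₄ = k * q - ι 8 * ν
        s₅ = (ν + ν) + (1ℚ + 1ℚ) * (k * t₂)
        0≤s₁ : 0ℚ ≤ s₁
        0≤s₁ = subst (0ℚ ≤_) (lem (k * t₁) ν) (0≤-diff (cauchy-schwarz⁻ k (⟦ Π ⟧ (g ⊖ ⟦ Q′ ⟧ g)) g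
          (subst (λ t → t * N (⟦ Π ⟧ (g ⊖ ⟦ Q′ ⟧ g)) ≤ ν) kk (h₁ g)) ℚₚ.≤-refl))
          where
          lem : ∀ a b → a - (- b) ≡ b + a
          lem = solve-∀ ℚ-ring
        0≤s₃ : 0ℚ ≤ s₃
        0≤s₃ = 0≤-diff (cauchy-schwarz k (⟦ Q ⟧ (g ⊖ ⟦ Π ⟧ g)) g (ℚₚ.≤-trans
          (*-monoˡ (0≤-sq k) (contraction (A †) _)) (subst (λ t → t * N (⟦ A ⟧ (g ⊖ ⟦ Π ⟧ g)) ≤ ν) kk (h₂ g))) ℚₚ.≤-refl)
        0≤s₄ : 0ℚ ≤ s₄
        0≤s₄ = 0≤-diff (ℚₚ.≤-trans (*-monoˡ (0≤ι 8) large) (ℚₚ.≤-reflexive (trans (sym (ℚₚ.*-assoc (ι 8) (ι D) q)) (cong (_* q) (sym (ι-* 8 D))))))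
        0≤s₅ : 0ℚ ≤ s₅
        0≤s₅ = subst (0ℚ ≤_) (trans (cong (λ t → ν + ν - (1ℚ + 1ℚ) * (k * t)) (ip-· (- 1ℚ) (⟦ Π ⟧ e) g)) (lem k t₂ ν))
          (0≤-diff (ℚₚ.≤-trans (am-gm k ((- 1ℚ) · ⟦ Π ⟧ e) g) (ℚₚ.+-monoˡ-≤ ν (ℚₚ.≤-trans
            (*-monoˡ (0≤-sq k) (ℚₚ.≤-trans (ℚₚ.≤-reflexive (trans (N-· (- 1ℚ) (⟦ Π ⟧ e)) (neg-neg (N (⟦ Π ⟧ e))))) (contraction Π e))) small))))
          where
          lem : ∀ k x n → n + n - (1ℚ + 1ℚ) * (k * (- 1ℚ * x)) ≡ (n + n) + (1ℚ + 1ℚ) * (k * x)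
          lem = solve-∀ ℚ-ring
        total : ι (2 ℕ.* κ) * x ≡ ν + (s₁ + s₁ + (s₃ + s₃) + (s₄ + s₄) + s₅ + ι 9 * ν)
        total = trans (cong₂ _*_ (ι-* 2 κ) decompose) (lem k t₁ t₂ t₃ q ν)
          where
          lem : ∀ k a b c q n → ι 2 * k * (a + b - c + q) ≡
            n + (n + k * a + (n + k * a) + (n - k * c + (n - k * c)) + (k * q - ι 8 * n + (k * q - ι 8 * n)) + ((n + n) + (1ℚ + 1ℚ) * (k * b)) + ι 9 * n)
          lem = solve-∀ ℚ-ring

      -- For nested projections ‖Q′g - Qg‖² would equal q′ - q. Here ‖Q′g‖² ≤ q′ and ‖Qg‖² ≤ q,
      -- while the inner product of Q′g and Qg is q - t₄ with t₄ small, because A nearly absorbs Q′;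
      -- hence q′ - q ≥ ‖e‖² - 2 t₄.
      energy-increment : Near A ((4 ℕ.* (κ ℕ.* κ)) ℕ.* (4 ℕ.* (κ ℕ.* κ))) Q′ → ν ≤ k * k * N e →
        ι (2 ℕ.* (κ ℕ.* κ)) * q + ν ≤ ι (2 ℕ.* (κ ℕ.* κ)) * q′
      energy-increment h₃ big = ≤-by (ι 2 * (k * k) * slack + ι 2 * (k * k * N e - ν) + (ν - ι 4 * (k * k) * t₄))
        (0≤-+ (0≤-+ (0≤-* (0≤-* (0≤ι 2) (0≤-sq k)) 0≤slack) (0≤-* (0≤ι 2) (0≤-diff big))) (0≤-diff t₄≤))
        (trans (cong (_* q′) 2kk) (trans (lem (k * k) q q′ (N e) t₄ ν) (cong (λ t → t * q + ν + (ι 2 * (k * k) * slack + ι 2 * (k * k * N e - ν) + (ν - ι 4 * (k * k) * t₄))) (sym 2kk))))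
        where
        2kk : ι (2 ℕ.* (κ ℕ.* κ)) ≡ ι 2 * (k * k)
        2kk = trans (ι-* 2 (κ ℕ.* κ)) (cong (λ t → ι 2 * t) kk)
        slack = q′ + q - ι 2 * (q - t₄) - N e
        inner : ⟨ ⟦ Q′ ⟧ g , ⟦ Q ⟧ g ⟩ ≡ q - t₄
        inner = trans (sym (op-adj A (⟦ Q′ ⟧ g) (⟦ A ⟧ g))) (trans (lem₂ q ⟨ ⟦ A ⟧ (⟦ Q′ ⟧ g) , ⟦ A ⟧ g ⟩)
          (cong (λ t → q - t) (sym (trans (ip-congˡ (op-⊖ A g (⟦ Q′ ⟧ g))) (ip-⊖ _ _ _)))))
          where
          lem₂ : ∀ a b → b ≡ a - (a - b)
          lem₂ = solve-∀ ℚ-ring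
        0≤slack : 0ℚ ≤ slack
        0≤slack = subst (0ℚ ≤_) (trans (lem₃ q′ q (N (⟦ Q′ ⟧ g)) (N (⟦ Q ⟧ g)) (q - t₄))
            (cong (λ t → q′ + q - ι 2 * (q - t₄) - t) (sym (trans (N-⊖ (⟦ Q′ ⟧ g) (⟦ Q ⟧ g)) (cong (λ t → N (⟦ Q′ ⟧ g) - (1ℚ + 1ℚ) * t + N (⟦ Q ⟧ g)) inner)))))
          (0≤-+ (0≤-diff (contraction (A′ †) (⟦ A′ ⟧ g))) (0≤-diff (contraction (A †) (⟦ A ⟧ g))))
          where
          lem₃ : ∀ a b c d i → (a - c) + (b - d) ≡ a + b - ι 2 * i - (c - (1ℚ + 1ℚ) * i + d)
          lem₃ = solve-∀ ℚ-ring
        t₄≤ : ι 4 * (k * k) * t₄ ≤ ν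
        t₄≤ = subst (λ t → t * t₄ ≤ ν) 4kk (cauchy-schwarz (ι K₄) (⟦ A ⟧ (g ⊖ ⟦ Q′ ⟧ g)) (⟦ A ⟧ g)
          (subst (λ t → t * N (⟦ A ⟧ (g ⊖ ⟦ Q′ ⟧ g)) ≤ ν) (ι-* K₄ K₄) (h₃ g)) (contraction A g))
          where
          K₄ = 4 ℕ.* (κ ℕ.* κ)
          4kk : ι K₄ ≡ ι 4 * (k * k)
          4kk = trans (ι-* 4 (κ ℕ.* κ)) (cong (λ t → ι 4 * t) kk)
        lem : ∀ kk q q′ e t n → ι 2 * kk * q′ ≡ ι 2 * kk * q + n + (ι 2 * kk * (q′ + q - ι 2 * (q - t) - e) + ι 2 * (kk * e - n) + (n - ι 4 * kk * t))
        lem = solve-∀ ℚ-ring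

      dichotomy : Near Π (κ ℕ.* κ) Q′ → Near A (κ ℕ.* κ) Π → Near A ((4 ℕ.* (κ ℕ.* κ)) ℕ.* (4 ℕ.* (κ ℕ.* κ))) Q′ →
        ν ≤ ι (2 ℕ.* κ) * x ⊎ ι (2 ℕ.* (κ ℕ.* κ)) * q + ν ≤ ι (2 ℕ.* (κ ℕ.* κ)) * q′
      dichotomy h₁ h₂ h₃ with ℚₚ.≤-total (k * k * N e) ν
      ... | inj₁ small = inj₁ (large-return h₁ h₂ small)
      ... | inj₂ big = inj₂ (energy-increment h₃ big)

-- One level of the recurrence theorem: a modulus W, a root ξ and a plan.

module RecurrenceLevels where
  open import Data.Rational using (_+_; _*_; _≤_)
  open RationalSums
  open InnerProductSpaces
  open AlmostInvariance
  open BoxEstimates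
  open AveragingPlans
  open PolynomialDifferences
  open FormAbsorption
  open PlanBoundsAndSpread
  open EnergyIncrement

  -- Bounds the total displacement. Lists of shifts must be nonempty, since the average over an
  -- empty list is 0 and would lose mass.
  ShiftBound : ∀ {I : Set} → Shift.Avg I → ℕ → Set
  ShiftBound Shift.one b = ⊤
  ShiftBound (Shift.av as) b = Nonempty as × (∀ a → a ∈ as → ∀ i → ℤ.∣ a i ∣ ℕ.≤ b)
  ShiftBound (A Shift.∘ B) b = Σ[ b₁ ∈ ℕ ] Σ[ b₂ ∈ ℕ ] (ShiftBound A b₁ × ShiftBound B b₂ × b₁ ℕ.+ b₂ ℕ.≤ b)

  ∣pos^∣ : ∀ w k → ℤ.∣ (+ suc w) ℤ.^ k ∣ ≡ suc w ℕ.^ k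
  ∣pos^∣ w zero = refl
  ∣pos^∣ w (suc k) = trans (ℤₚ.abs-* (+ suc w) ((+ suc w) ℤ.^ k)) (cong (suc w ℕ.*_) (∣pos^∣ w k))

  module Recurrence (l : ℕ) (I : Set) (forms : I → List (ℤ × Vec ℤ (suc l)))
    (monic : ∀ i → ListAll.All (λ ef → lookup (proj₂ ef) zero ≡ + 1) (forms i))
    (a₀ a₁ : ℤ) (P : List ℤ) (s : ℤ) (deg : Deg (suc (length P)) (eval (a₀ ∷ a₁ ∷ P)) s) (1≤∣s∣ : 1 ℕ.≤ ℤ.∣ s ∣)
    (intersective : Intersective (a₀ ∷ a₁ ∷ P)) where

    n k : ℕ
    n = suc l
    k = length P

    pol : List ℤ
    pol = a₀ ∷ a₁ ∷ P

    open Shift I public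

    p : Vec ℤ n → Λ
    p z i = linear-sum (λ f → eval pol (dot f z)) (forms i)

    S : Vec (Fin n) (suc k) → Λ
    S = Direction forms

    iss : List (Vec (Fin n) (suc k))
    iss = indices n (suc k)

    -- A factor 4 for each of the k + 1 stages of each index tuple.
    loss : ℕ
    loss = (4 ℕ.^ suc k) ℕ.^ length iss

    1≤loss : 1 ℕ.≤ loss
    1≤loss = ^-pos (length iss) (^-pos (suc k) (ℕ.s≤s ℕ.z≤n))

    module Level (w K : ℕ) (1≤K : 1 ℕ.≤ K) where
      W = suc w

      -- The place where intersectivity enters: a residue class modulo W on which P vanishes.
      root : ∃[ ξ ] ((+ W) Signed.∣ eval pol ξ)
      root = let ξ , W∣ = intersective W (ℕ.s≤s ℕ.z≤n) in ξ , Signed.∣ᵤ⇒∣ W∣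

      ξ c₀ o : ℤ
      ξ = proj₁ root
      c₀ = Signed._∣_.quotient (proj₂ root)
      o = + ℤ.∣ ξ ∣

      eval-ξ : eval pol ξ ≡ (+ W) ℤ.* c₀
      eval-ξ = trans (Signed._∣_.equality (proj₂ root)) (ℤₚ.*-comm c₀ (+ W))

      embed : Vec ℤ n → Vec ℤ n
      embed = act ξ (+ W) o

      c : ℤ
      c = (+ W) ℤ.^ suc k ℤ.* s

      ∣c∣ : ℤ.∣ c ∣ ≡ W ℕ.* (W ℕ.^ k ℕ.* ℤ.∣ s ∣)
      ∣c∣ = trans (ℤₚ.abs-* ((+ W) ℤ.^ suc k) s) (trans (cong (ℕ._* ℤ.∣ s ∣) (∣pos^∣ w (suc k))) (ℕₚ.*-assoc W (W ℕ.^ k) ℤ.∣ s ∣))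

      W≤∣c∣ : W ℕ.≤ ℤ.∣ c ∣
      W≤∣c∣ = ℕₚ.≤-trans (≤-*ʳ W (*-pos (^-pos k (ℕ.s≤s ℕ.z≤n)) 1≤∣s∣)) (ℕₚ.≤-reflexive (sym ∣c∣))

      1≤∣c∣ : 1 ℕ.≤ ℤ.∣ c ∣
      1≤∣c∣ = ℕₚ.≤-trans (ℕ.s≤s ℕ.z≤n) W≤∣c∣

      κ : ℕ
      κ = K ℕ.* loss

      1≤κ : 1 ℕ.≤ κ
      1≤κ = *-pos 1≤K 1≤loss

      open Constants k c κ public using (W′; B; width; M; C)
      open Constants.Positive k c κ 1≤∣c∣ 1≤κ public using (1≤W′; 1≤width)

      -- W ≤ |c| ≤ B and `W′` = B!. Thus the old average, whose steps are multiples of W, can absorb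
      -- the new one, whose steps are multiples of `W′`.
      W∣W′ : W ℕ∣.∣ W′
      W∣W′ = ≤⇒∣! (ℕ.s≤s ℕ.z≤n) (ℕₚ.≤-trans W≤∣c∣ (≤-*ʳ ℤ.∣ c ∣ (^-pos k 1≤width)))

      ratio : ℕ
      ratio = ℕ∣.quotient W∣W′

      Γ X-constant box-constant size Φ spread-constant : ℕ
      Γ = M ℕ.* C ℕ.^ k
      X-constant = width ℕ.* Γ
      box-constant = length iss ℕ.* (suc k ℕ.* (suc k ℕ.* X-constant)) ℕ.+ 1
      size = W ℕ.* (ℤ.∣ ξ ∣ ℕ.+ box-constant) ℕ.+ ℤ.∣ ξ ∣
      Φ = ℤ.∣ c₀ ∣ ℕ.+ quotient-constant (a₁ ∷ P) a₀ ξ size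
      -- The first summand lets A absorb the polynomial values in `near-Π`, the second the
      -- progressions of the new average in `near-A′`.
      spread-constant = 2 ℕ.* (K ℕ.* (4 ℕ.^ n) ℕ.^ suc k) ℕ.* Φ ℕ.+ 2 ℕ.* κ ℕ.* (Γ ℕ.^ suc k ℕ.* ratio)

      module At (u : ℕ) (1≤u : 1 ℕ.≤ u) where
        open Plan n k I S c κ u public using (planY; planA; planQ; direction; L)
        open PlanBounds n k I S c κ u 1≤∣c∣ 1≤κ 1≤u public using (planY-between; planY-spread; planY-nonempty; L≤; module Nearby)

        𝒴 : List (Vec ℤ n)
        𝒴 = planY iss

        A′ Π : Avg
        A′ = planA iss
        Π = av (map (λ z → p (embed z)) 𝒴)

        𝒴-between : ∀ z → z ∈ 𝒴 → Between (box-constant ℕ.* u) z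
        𝒴-between z z∈ = Between-weaken (ℕₚ.≤-reflexive (lem (length iss) (suc k) X-constant u)) (planY-between iss z z∈)
          where
          lem : ∀ i k x u → i ℕ.* (k ℕ.* (k ℕ.* (x ℕ.* u))) ℕ.+ u ≡ (i ℕ.* (k ℕ.* (k ℕ.* x)) ℕ.+ 1) ℕ.* u
          lem = ℕ-solve

        ∣ξ∣≤ : ℤ.∣ ξ ∣ ℕ.≤ ℤ.∣ ξ ∣ ℕ.* u
        ∣ξ∣≤ = ≤-*ʳ ℤ.∣ ξ ∣ 1≤u

        size≤ : W ℕ.* (ℤ.∣ ξ ∣ ℕ.+ box-constant ℕ.* u) ℕ.+ ℤ.∣ ξ ∣ ℕ.≤ size ℕ.* u
        size≤ = ℕₚ.≤-trans (ℕₚ.+-mono-≤ (ℕₚ.*-monoʳ-≤ W (ℕₚ.+-monoˡ-≤ (box-constant ℕ.* u) ∣ξ∣≤)) ∣ξ∣≤) (ℕₚ.≤-reflexive (lem W ℤ.∣ ξ ∣ box-constant u))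
          where
          lem : ∀ w x b u → w ℕ.* (x ℕ.* u ℕ.+ b ℕ.* u) ℕ.+ x ℕ.* u ≡ (w ℕ.* (x ℕ.+ b) ℕ.+ x) ℕ.* u
          lem = ℕ-solve

        embed-between : ∀ z → z ∈ 𝒴 → Between (size ℕ.* u) (embed z)
        embed-between z z∈ = Between-weaken size≤ (act-between ξ w (𝒴-between z z∈))

        average : ∀ F → (∀ z → 0ℚ ≤ F z) → E 𝒴 (λ z → F (embed z)) ≤ inv (u ℕ.^ n) * Σ (cube n (size ℕ.* u)) F
        average = planY-spread iss {cube n (size ℕ.* u)} embed (act-injective ξ w o) (λ z z∈ → ∈-cube⁺ (embed-between z z∈))

        module _ (H : IPS I) where
          open Nearness H using (Near; Near-av; Near-∘; Near-weaken; Abs; Abs-cong; Abs-weaken; N; N-cong; op-cong; ⊖-cong; ≈-refl; ≈-sym; ⟦_⟧; _⊖_)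
          open Absorption H n forms
          open Killing H n k S c κ u 1≤∣c∣ 1≤κ 1≤u
          open Nearby H

          -- On the class each f · y is an affine function of f · z with slope W, so the top
          -- coefficient is just multiplied by W^(k+1).
          embed-class : Class (λ z → p (embed z))
          embed-class is = pointwise⇒Diff is λ i → DiffS-cong is (λ _ → refl)
            (linear-sum-* c (monomial is) (forms i))
            (DiffS-sum is (λ f z → eval pol (dot f (embed z))) (λ f → c ℤ.* monomial is f) (forms i) λ f →
              DiffS-cong is (λ z → cong (eval pol) (sym (affine f z))) refl
                (DiffS-dot is f (Deg-affine (offset f) (+ W) deg)))
            where
            offset : Vec ℤ n → ℤ
            offset f = (+ W) ℤ.* dot f (Vec.map (λ τ → o ℤ.+ τ) (Vec.replicate n (+ 0))) ℤ.+ lookup f zero ℤ.* ξ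
            affine : ∀ f z → dot f (embed z) ≡ offset f ℤ.+ (+ W) ℤ.* dot f z
            affine f z = trans (dot-act ξ (+ W) o f z) (trans (cong (λ t → (+ W) ℤ.* t ℤ.+ lookup f zero ℤ.* ξ) (dot-shift o f z)) (lem (+ W) (dot f (Vec.map (λ τ → o ℤ.+ τ) (Vec.replicate n (+ 0)))) (dot f z) (lookup f zero ℤ.* ξ)))
              where
              lem : ∀ w a b c → w ℤ.* (a ℤ.+ b) ℤ.+ c ≡ w ℤ.* a ℤ.+ c ℤ.+ w ℤ.* b
              lem = ℤ-Solver.solve-∀

          kill : Near Π K (A′ † ∘ A′)
          kill v = subst (λ t → ι K * t ≤ N v) (N-cong (op-cong Π (⊖-cong ≈-refl (planQ≈ iss v))))
            (plan-killing iss K ℕₚ.≤-refl _ embed-class v)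

          good : Good (suc k) A′ W′ (u ℕ.^ suc k)
          good is m K′ small = planA-good iss is (∈-indices is) m K′ small

          module _ (A : Avg) (R : ℕ) (goodA : Good (suc k) A W R) (wide : spread-constant ℕ.* u ℕ.^ suc k ℕ.≤ R) where

            near-A′ : Near A K A′ × Near A K (A′ †)
            near-A′ = planA-both A κ absorb iss K ℕₚ.≤-refl
              where
              absorb : ∀ is j m → j ℕ.≤ k → m ℕ.< L u j → Abs A κ ((+ m) ⊠ direction is)
              absorb is j m j≤k m< = Abs-cong {A} {κ}
                (λ i → trans (cong (ℤ._* ((+ W) ℤ.* S is i)) (ℤₚ.pos-* m ratio)) (trans (lem (+ m) (+ ratio) (+ W) (S is i))
                  (cong (λ t → (+ m) ℤ.* (t ℤ.* S is i)) (trans (sym (ℤₚ.pos-* ratio W)) (cong +_ (sym (ℕ∣._∣_.equality W∣W′)))))))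
                (goodA is (m ℕ.* ratio) κ (begin
                  2 ℕ.* κ ℕ.* (m ℕ.* ratio) ≤⟨ ℕₚ.*-monoʳ-≤ (2 ℕ.* κ) (ℕₚ.*-monoˡ-≤ ratio (ℕₚ.≤-trans (ℕₚ.<⇒≤ m<) (L≤ j j≤k))) ⟩
                  2 ℕ.* κ ℕ.* (Γ ℕ.^ suc k ℕ.* u ℕ.^ suc k ℕ.* ratio) ≡⟨ lem₂ (2 ℕ.* κ) (Γ ℕ.^ suc k) (u ℕ.^ suc k) ratio ⟩
                  2 ℕ.* κ ℕ.* (Γ ℕ.^ suc k ℕ.* ratio) ℕ.* u ℕ.^ suc k ≤⟨ ℕₚ.*-monoˡ-≤ (u ℕ.^ suc k) (ℕₚ.m≤n+m _ (2 ℕ.* (K ℕ.* (4 ℕ.^ n) ℕ.^ suc k) ℕ.* Φ)) ⟩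
                  spread-constant ℕ.* u ℕ.^ suc k ≤⟨ wide ⟩
                  R ∎))
                where
                open ℕₚ.≤-Reasoning
                lem : ∀ m r w s → m ℤ.* r ℤ.* (w ℤ.* s) ≡ m ℤ.* (r ℤ.* w ℤ.* s)
                lem = ℤ-Solver.solve-∀
                lem₂ : ∀ a g u r → a ℕ.* (g ℕ.* u ℕ.* r) ≡ a ℕ.* (g ℕ.* r) ℕ.* u
                lem₂ = ℕ-solve

            -- On the class P(f · y) = W φ(f) with one form φ for all f: P(ξ) = W c₀, and the
            -- constant c₀ is raised to degree k + 1 by means of f₀ = 1. So p(y) combines the steps
            -- W S with coefficients of order u^(k+1).
            near-Π : Near A K Π
            near-Π = Near-av {A} {K} (ℕₚ.≤-trans (planY-nonempty iss) (ℕₚ.≤-reflexive (sym (Listₚ.length-map _ 𝒴)))) λ a a∈ → absorb a (∈-map⁻ _ a∈)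
              where
              absorb : ∀ a → ∃[ z ] (z ∈ 𝒴 × a ≡ p (embed z)) → Abs A K a
              absorb a (z , z∈ , refl) = Abs-cong {A} {K}
                (λ i → linear-sum-cong (forms i) (ListAll.map (λ {ef} h → sym (value (proj₂ ef) h)) (monic i)))
                (Good⇒Abs-form {A} {suc k} {W} {R} φ K (Φ ℕ.* u ℕ.^ suc k) goodA bound (ℕₚ.≤-trans
                  (ℕₚ.≤-trans (ℕₚ.≤-reflexive (sym (ℕₚ.*-assoc (2 ℕ.* (K ℕ.* (4 ℕ.^ n) ℕ.^ suc k)) Φ (u ℕ.^ suc k)))) (ℕₚ.*-monoˡ-≤ (u ℕ.^ suc k) (ℕₚ.m≤m+n (2 ℕ.* (K ℕ.* (4 ℕ.^ n) ℕ.^ suc k) ℕ.* Φ) (2 ℕ.* κ ℕ.* (Γ ℕ.^ suc k ℕ.* ratio))))) wide))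
                where
                x = Vec.map (λ τ → o ℤ.+ τ) z
                y = embed z
                ψ φ : Form n (suc k)
                ψ = quotient-form (a₁ ∷ P) a₀ ξ (+ W) x y
                φ is = constant (suc k) c₀ is ℤ.+ ψ is
                dot-y : ∀ f → lookup f zero ≡ + 1 → dot f y ≡ (+ W) ℤ.* dot f x ℤ.+ ξ
                dot-y f h = trans (dot-act ξ (+ W) o f z) (cong (λ t → (+ W) ℤ.* dot f x ℤ.+ t) (trans (cong (ℤ._* ξ) h) (ℤₚ.*-identityˡ ξ)))
                value : ∀ f → lookup f zero ≡ + 1 → eval pol (dot f y) ≡ (+ W) ℤ.* evalF φ f
                value f h = trans (quotient-eval (a₁ ∷ P) a₀ ξ (+ W) x y f h (dot-y f h))
                  (trans (cong (λ t → t ℤ.+ (+ W) ℤ.* evalF ψ f) eval-ξ) (trans (sym (ℤₚ.*-distribˡ-+ (+ W) c₀ (evalF ψ f)))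
                    (cong ((+ W) ℤ.*_) (trans (cong (ℤ._+ evalF ψ f) (sym (evalF-constant (suc k) c₀ f h))) (sym (evalF-+ (constant (suc k) c₀) ψ f))))))
                x≤ : ∀ i → ℤ.∣ lookup x i ∣ ℕ.≤ size ℕ.* u
                x≤ i = ℕₚ.≤-trans (ℕₚ.≤-reflexive (cong ℤ.∣_∣ (Vecₚ.lookup-map i (λ τ → o ℤ.+ τ) z)))
                  (ℕₚ.≤-trans (ℤₚ.∣i+j∣≤∣i∣+∣j∣ o (lookup z i)) (ℕₚ.≤-trans (ℕₚ.+-monoʳ-≤ ℤ.∣ ξ ∣ (Between⇒∣∣ (𝒴-between z z∈) i))
                    (ℕₚ.≤-trans (ℕₚ.≤-trans (≤-*ˡ {W} _ (ℕ.s≤s ℕ.z≤n)) (ℕₚ.m≤m+n _ ℤ.∣ ξ ∣)) size≤)))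
                bound : ∀ is → ℤ.∣ φ is ∣ ℕ.≤ Φ ℕ.* u ℕ.^ suc k
                bound is = ℕₚ.≤-trans (ℤₚ.∣i+j∣≤∣i∣+∣j∣ (constant (suc k) c₀ is) (ψ is)) (ℕₚ.≤-trans
                  (ℕₚ.+-mono-≤ (ℕₚ.≤-trans (∣constant∣ (suc k) c₀ is) (≤-*ʳ ℤ.∣ c₀ ∣ (^-pos (suc k) 1≤u)))
                    (∣quotient-form∣ (a₁ ∷ P) a₀ ξ (+ W) size u x y 1≤u x≤ (Between⇒∣∣ (embed-between z z∈)) is))
                  (ℕₚ.≤-reflexive (sym (ℕₚ.*-distribʳ-+ (u ℕ.^ suc k) ℤ.∣ c₀ ∣ (quotient-constant (a₁ ∷ P) a₀ ξ size)))))

-- Iterating the dichotomy: the polynomial recurrence theorem.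

module PolynomialRecurrence where
  open import Data.Rational using (_+_; _*_; _-_; -_; _≤_)
  open import Tactic.RingSolver using (solve-∀)
  open RationalSums
  open InnerProductSpaces
  open AlmostInvariance
  open BoxEstimates
  open AveragingPlans
  open PolynomialDifferences
  open FormAbsorption
  open PlanBoundsAndSpread
  open EnergyIncrement
  open RecurrenceLevels

  ShiftBound-weaken : ∀ {I : Set} (A : Shift.Avg I) {b b′} → b ℕ.≤ b′ → ShiftBound A b → ShiftBound A b′
  ShiftBound-weaken Shift.one le h = tt
  ShiftBound-weaken (Shift.av as) le (ne , h) = ne , λ a a∈ i → ℕₚ.≤-trans (h a a∈ i) le
  ShiftBound-weaken (A Shift.∘ B) le (b₁ , b₂ , h₁ , h₂ , s) = b₁ , b₂ , h₁ , h₂ , ℕₚ.≤-trans s le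

  module _ (l : ℕ) (I : Set) (forms : I → List (ℤ × Vec ℤ (suc l)))
    (monic : ∀ i → ListAll.All (λ ef → lookup (proj₂ ef) zero ≡ + 1) (forms i))
    (a₀ a₁ : ℤ) (P : List ℤ) (s : ℤ) (deg : Deg (suc (length P)) (eval (a₀ ∷ a₁ ∷ P)) s) (1≤∣s∣ : 1 ℕ.≤ ℤ.∣ s ∣)
    (intersective : Intersective (a₀ ∷ a₁ ∷ P)) where
    open Recurrence l I forms monic a₀ a₁ P s deg 1≤∣s∣ intersective

    module Returns (H : IPS I) where
      open Operators H public using (V; N; ⟨_,_⟩; T; ⟦_⟧; psd; ip-EV; contraction)

      return : V → Vec ℤ n → ℚ
      return g z = ⟨ T (p z) g , g ⟩

      -- True for indicator functions. It allows the sum of returns to be enlarged from the points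
      -- of a plan to a full cube.
      Positive : V → Set
      Positive g = ∀ a → 0ℚ ≤ ⟨ T a g , g ⟩

      Conclusion : ℕ → ℕ → V → Set
      Conclusion C u g = ι (u ℕ.^ n) * N g ≤ ι C * Σ (cube n (C ℕ.* u)) (return g)

      conclusion-mono : ∀ {C C′} u g → Positive g → C ℕ.≤ C′ → Conclusion C u g → Conclusion C′ u g
      conclusion-mono {C} {C′} u g pos le h = ℚₚ.≤-trans h (ℚₚ.≤-trans
        (*-monoʳ (0≤Σ (cube n (C ℕ.* u)) λ z → pos (p z)) (ι-mono le))
        (*-monoˡ (0≤ι C′) (Σ-cube-mono n (return g) (ℕₚ.*-monoˡ-≤ u le) (λ z → pos (p z)))))

      return-average : ∀ g (𝒴 : List (Vec ℤ n)) (embed : Vec ℤ n → Vec ℤ n) →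
        ⟨ ⟦ av (map (λ z → p (embed z)) 𝒴) ⟧ g , g ⟩ ≡ E 𝒴 (λ z → return g (embed z))
      return-average g 𝒴 embed = trans (ip-EV (map (λ z → p (embed z)) 𝒴) _ g)
        (cong₂ (λ m t → inv m * t) (Listₚ.length-map _ 𝒴) (Σ-map (λ z → p (embed z)) 𝒴 _))

      conclude : ∀ g → Positive g → ∀ {D size u v} {x : ℚ} → 1 ℕ.≤ v → u ℕ.≤ v → N g ≤ ι D * x →
        x ≤ inv (v ℕ.^ n) * Σ (cube n (size ℕ.* v)) (return g) →
        ι (u ℕ.^ n) * N g ≤ ι D * Σ (cube n (size ℕ.* v)) (return g)
      conclude g pos {D} {size} {u} {v} {x} 1≤v u≤v h₁ h₂ = begin
        ι (u ℕ.^ n) * N g ≤⟨ *-monoʳ (psd g) (ι-mono (ℕₚ.^-monoˡ-≤ n u≤v)) ⟩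
        ι (v ℕ.^ n) * N g ≤⟨ *-monoˡ (0≤ι (v ℕ.^ n)) (ℚₚ.≤-trans h₁ (*-monoˡ (0≤ι D) h₂)) ⟩
        ι (v ℕ.^ n) * (ι D * (inv (v ℕ.^ n) * R)) ≡⟨ lem (ι (v ℕ.^ n)) (ι D) (inv (v ℕ.^ n)) R ⟩
        (inv (v ℕ.^ n) * ι (v ℕ.^ n)) * (ι D * R) ≡⟨ cong (_* (ι D * R)) (inverse (^-pos n 1≤v)) ⟩
        1ℚ * (ι D * R) ≡⟨ ℚₚ.*-identityˡ (ι D * R) ⟩
        ι D * R ∎
        where
        open ℚₚ.≤-Reasoning
        R = Σ (cube n (size ℕ.* v)) (return g)
        lem : ∀ a b c d → a * (b * (c * d)) ≡ (c * a) * (b * d)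
        lem = solve-∀ ℚ-ring
        inverse : ∀ {m} → 1 ℕ.≤ m → inv m * ι m ≡ 1ℚ
        inverse {suc m} _ = inv-inverse m

    module _ (D : ℕ) (1≤D : 1 ℕ.≤ D) where
      κ κ² K : ℕ
      κ = 8 ℕ.* D
      κ² = κ ℕ.* κ
      -- (4κ²)² is the strongest precision that `dichotomy` asks for, namely for the absorption of
      -- A′†A′; the 4 pays for its two factors.
      K = 4 ℕ.* ((4 ℕ.* κ²) ℕ.* (4 ℕ.* κ²))

      1≤κ² : 1 ℕ.≤ κ²
      1≤κ² = *-pos (*-pos {8} (ℕ.s≤s ℕ.z≤n) 1≤D) (*-pos {8} (ℕ.s≤s ℕ.z≤n) 1≤D)

      1≤4κ² : 1 ℕ.≤ 4 ℕ.* κ²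
      1≤4κ² = *-pos {4} (ℕ.s≤s ℕ.z≤n) 1≤κ²

      1≤K : 1 ℕ.≤ K
      1≤K = *-pos {4} (ℕ.s≤s ℕ.z≤n) (*-pos 1≤4κ² 1≤4κ²)

      κ²≤K : κ² ℕ.≤ K
      κ²≤K = ℕₚ.≤-trans (≤-*ˡ {4} κ² (ℕ.s≤s ℕ.z≤n)) (ℕₚ.≤-trans (≤-*ʳ (4 ℕ.* κ²) 1≤4κ²) (≤-*ˡ {4} ((4 ℕ.* κ²) ℕ.* (4 ℕ.* κ²)) (ℕ.s≤s ℕ.z≤n)))

      -- The energy hypothesis says 2κ²(‖g‖² - ‖A g‖²) ≤ (m - 1)‖g‖²: there is room for at most m -
      -- 1 increments of size ‖g‖²/(2κ²). G and C may depend on the modulus but not on u, the space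
      -- or g.
      Claim : ℕ → ℕ → Set₁
      Claim m w = Σ[ G ∈ ℕ ] Σ[ C ∈ ℕ ] (1 ℕ.≤ G × (∀ u → 1 ℕ.≤ u → ∀ (H : IPS I) g (A : Avg) →
        Absorption.Good H n forms (suc k) A (suc w) ((G ℕ.* u) ℕ.^ suc k) →
        Returns.N H g ≤ ι D * Returns.N H (Returns.⟦_⟧ H A g) →
        ι (2 ℕ.* κ² ℕ.+ 1) * Returns.N H g ≤ ι (2 ℕ.* κ²) * Returns.N H (Returns.⟦_⟧ H A g) + ι m * Returns.N H g →
        Returns.Positive H g → Returns.Conclusion H C u g))

      claim : ∀ m w → Claim m w
      -- No room is left: the hypothesis and contraction give (2κ² + 1)‖g‖² ≤ 2κ²‖g‖², so ‖g‖² = 0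
      -- and any constants do.
      claim zero w = 1 , 1 , ℕₚ.≤-refl , λ u 1≤u H g A good large full pos →
        let open Returns H
            ν≤0 : N g ≤ 0ℚ
            ν≤0 = ≤-by (ι (2 ℕ.* κ²) * (N g - N (⟦ A ⟧ g)) + (ι (2 ℕ.* κ²) * N (⟦ A ⟧ g) + ι 0 * N g - ι (2 ℕ.* κ² ℕ.+ 1) * N g))
              (0≤-+ (0≤-* (0≤ι (2 ℕ.* κ²)) (0≤-diff (contraction A g))) (0≤-diff full))
              (trans (lem (ι (2 ℕ.* κ²)) (N g) (N (⟦ A ⟧ g))) (cong (λ t → N g + (ι (2 ℕ.* κ²) * (N g - N (⟦ A ⟧ g)) + (ι (2 ℕ.* κ²) * N (⟦ A ⟧ g) + ι 0 * N g - t * N g))) (sym (ι-+ (2 ℕ.* κ²) 1))))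
        in ℚₚ.≤-trans (*-monoˡ (0≤ι (u ℕ.^ n)) ν≤0) (ℚₚ.≤-trans (ℚₚ.≤-reflexive (ℚₚ.*-zeroʳ (ι (u ℕ.^ n))))
          (0≤-* (0≤ι 1) (0≤Σ (cube n (1 ℕ.* u)) λ z → pos (p z))))
        where
        lem : ∀ a n q → 0ℚ ≡ n + (a * (n - q) + (a * q + ι 0 * n - (a + ι 1) * n))
        lem = solve-∀ ℚ-ring
      claim (suc m) w = G , C , 1≤G , proof
        where
        open Level w K 1≤K using (W; W′; 1≤W′; size; spread-constant; module At)
        w′ = ℕ.pred W′
        W′≡ : suc w′ ≡ W′
        W′≡ = ℕₚ.suc-pred W′ {{ℕ.>-nonZero 1≤W′}}
        rec = claim m w′
        G₀ G₁ C₁ G C : ℕ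
        G₀ = spread-constant ℕ.+ 1
        G₁ = proj₁ rec
        C₁ = proj₁ (proj₂ rec)
        -- The plan is made at scale v = G₁ u, as the next level requires of its average, while the
        -- given A has scale G₀ v, longer by the factor that `near-A′` and `near-Π` need.
        G = G₀ ℕ.* G₁
        C = 2 ℕ.* κ ℕ.+ size ℕ.* G₁ ℕ.+ C₁
        1≤G₀ : 1 ℕ.≤ G₀
        1≤G₀ = ℕₚ.m≤n+m 1 spread-constant
        1≤G₁ = proj₁ (proj₂ (proj₂ rec))
        1≤G = *-pos 1≤G₀ 1≤G₁
        module Step (u : ℕ) (1≤u : 1 ℕ.≤ u) (H : IPS I) (g : Returns.V H) (A : Avg)
          (goodA : Absorption.Good H n forms (suc k) A (suc w) ((G ℕ.* u) ℕ.^ suc k))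
          (large : Returns.N H g ≤ ι D * Returns.N H (Returns.⟦_⟧ H A g))
          (full : ι (2 ℕ.* κ² ℕ.+ 1) * Returns.N H g ≤ ι (2 ℕ.* κ²) * Returns.N H (Returns.⟦_⟧ H A g) + ι (suc m) * Returns.N H g)
          (pos : Returns.Positive H g) where
          open Nearness H using (Near-weaken; Near-∘)
          open Returns H
          v = G₁ ℕ.* u
          1≤v = *-pos 1≤G₁ 1≤u
          u≤v : u ℕ.≤ v
          u≤v = ≤-*ˡ u 1≤G₁
          open At v 1≤v using (𝒴; A′; Π; average; kill; good; near-A′; near-Π)
          open Energy.EnergyStep H D A A′ Π g large using (ν; x; q; q′; dichotomy)
          R = (G ℕ.* u) ℕ.^ suc k
          wide : spread-constant ℕ.* v ℕ.^ suc k ℕ.≤ R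
          wide = ℕₚ.≤-trans (ℕₚ.*-monoˡ-≤ (v ℕ.^ suc k) (ℕₚ.≤-trans (ℕₚ.m≤m+n spread-constant 1) (≤-*ʳ G₀ (^-pos k 1≤G₀))))
            (ℕₚ.≤-reflexive (trans (sym (*-^ G₀ v (suc k))) (cong (ℕ._^ suc k) (sym (ℕₚ.*-assoc G₀ G₁ u)))))
          decide : ν ≤ ι (2 ℕ.* κ) * x ⊎ ι (2 ℕ.* κ²) * q + ν ≤ ι (2 ℕ.* κ²) * q′ → Conclusion C u g
          decide (inj₁ big) = ℚₚ.≤-trans (conclude g pos {2 ℕ.* κ} {size} 1≤v u≤v big
              (subst (_≤ inv (v ℕ.^ n) * Σ (cube n (size ℕ.* v)) (return g)) (sym (return-average g 𝒴 _)) (average (return g) λ z → pos (p z))))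
            (ℚₚ.≤-trans (*-monoʳ (0≤Σ (cube n (size ℕ.* v)) λ z → pos (p z)) (ι-mono (ℕₚ.≤-trans (ℕₚ.m≤m+n (2 ℕ.* κ) (size ℕ.* G₁)) (ℕₚ.m≤m+n _ C₁))))
              (*-monoˡ (0≤ι C) (Σ-cube-mono n (return g) size≤ λ z → pos (p z))))
            where
            size≤ : size ℕ.* v ℕ.≤ C ℕ.* u
            size≤ = ℕₚ.≤-trans (ℕₚ.≤-reflexive (sym (ℕₚ.*-assoc size G₁ u))) (ℕₚ.*-monoˡ-≤ u (ℕₚ.≤-trans (ℕₚ.m≤n+m (size ℕ.* G₁) (2 ℕ.* κ)) (ℕₚ.m≤m+n _ C₁)))
          decide (inj₂ more) = conclusion-mono {C₁} {C} u g pos (ℕₚ.m≤n+m C₁ (2 ℕ.* κ ℕ.+ size ℕ.* G₁))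
            (proj₂ (proj₂ (proj₂ rec)) u 1≤u H g A′
              (λ is → subst (λ t → ∀ m K → 2 ℕ.* K ℕ.* m ℕ.≤ v ℕ.^ suc k → Nearness.Abs H A′ K ((+ m) ⊠ ((+ t) ⊠ S is))) (sym W′≡) (good H is))
              (ℚₚ.≤-trans large (*-monoˡ (0≤ι D) q≤q′))
              (ℚₚ.≤-trans full (≤-by (ι (2 ℕ.* κ²) * q′ - (ι (2 ℕ.* κ²) * q + ν)) (0≤-diff more) (lem (ι (2 ℕ.* κ²) * q′) (ι (2 ℕ.* κ²) * q) ν (ι m)))) pos)
            where
            lem : ∀ a b n m → a + m * n ≡ b + (1ℚ + m) * n + (a - (b + n))
            lem = solve-∀ ℚ-ring
            cancel : ∀ {N x y} → 1 ℕ.≤ N → ι N * x ≤ ι N * y → x ≤ y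
            cancel {suc N} _ = *-cancelˡ N
            q≤q′ : q ≤ q′
            q≤q′ = cancel (*-pos {2} (ℕ.s≤s ℕ.z≤n) 1≤κ²) (ℚₚ.≤-trans (≤-by ν (psd g) refl) more)
          result : Conclusion C u g
          result = decide (dichotomy
            (Near-weaken {Π} {Q = A′ † ∘ A′} κ²≤K (kill H))
            (Near-weaken {A} {Q = Π} κ²≤K (near-Π H A R goodA wide))
            (Near-∘ {A} {(4 ℕ.* κ²) ℕ.* (4 ℕ.* κ²)} {A′ †} {A′} (proj₂ (near-A′ H A R goodA wide)) (proj₁ (near-A′ H A R goodA wide))))
        proof = Step.result

      initial : ℕ → List (Vec (Fin n) (suc k)) → Avg
      initial R [] = one
      initial R (is ∷ js) = initial R js ∘ Progression.ap I ((+ 1) ⊠ S is) R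

      initial-good : ∀ (H : IPS I) R → 1 ℕ.≤ R → Absorption.Good H n forms (suc k) (initial R iss) 1 R
      initial-good H R 1≤R is m K small = absorb iss (∈-indices is)
        where
        open Nearness H using (Abs; Abs-∘ˡ; Abs-∘ʳ; Abs-ap; ap)
        a = (+ m) ⊠ ((+ 1) ⊠ S is)
        absorb : ∀ js → is ∈ js → Abs (initial R js) K a
        absorb (.is ∷ js) (here refl) = Abs-∘ˡ {initial R js} {ap ((+ 1) ⊠ S is) R} {K} {a} (Abs-ap {(+ 1) ⊠ S is} {R} {K} m 1≤R small)
        absorb (j ∷ js) (there is∈) = Abs-∘ʳ {ap ((+ 1) ⊠ S j) R} {initial R js} {K} {a} (absorb js is∈)

      initial-bound : ∀ R b → 1 ℕ.≤ R → (∀ is i → ℤ.∣ S is i ∣ ℕ.≤ b) → ∀ js → ShiftBound (initial R js) (length js ℕ.* (R ℕ.* b))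
      initial-bound R b 1≤R hb [] = tt
      initial-bound R b 1≤R hb (is ∷ js) = length js ℕ.* (R ℕ.* b) , R ℕ.* b , initial-bound R b 1≤R hb js ,
        (ℕₚ.≤-trans 1≤R (ℕₚ.≤-reflexive (sym (trans (Listₚ.length-map _ (downFrom R)) (Listₚ.length-downFrom R)))) , bound) ,
        ℕₚ.≤-reflexive (ℕₚ.+-comm (length js ℕ.* (R ℕ.* b)) (R ℕ.* b))
        where
        bound : ∀ a → a ∈ map (λ j → (+ j) ⊠ ((+ 1) ⊠ S is)) (downFrom R) → ∀ i → ℤ.∣ a i ∣ ℕ.≤ R ℕ.* b
        bound a a∈ i with ∈-map⁻ _ a∈
        ... | j , j∈ , refl = ℕₚ.≤-trans (ℕₚ.≤-reflexive (trans (cong (λ t → ℤ.∣ + j ℤ.* t ∣) (ℤₚ.*-identityˡ (S is i))) (ℤₚ.abs-* (+ j) (S is i))))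
          (ℕₚ.*-mono-≤ (ℕₚ.<⇒≤ (∈-downFrom⁻ j∈)) (hb is i))

      recurrence : ∀ b → (∀ is i → ℤ.∣ S is i ∣ ℕ.≤ b) → Σ[ E′ ∈ ℕ ] Σ[ C ∈ ℕ ] (∀ u → 1 ℕ.≤ u → ∀ (H : IPS I) g →
        (∀ A → ShiftBound A (E′ ℕ.* u ℕ.^ suc k) → Returns.N H g ≤ ι D * Returns.N H (Returns.⟦_⟧ H A g)) →
        Returns.Positive H g → Returns.Conclusion H C u g)
      recurrence b hb = E′ , C , proof
        where
        -- With this m the energy hypothesis of `Claim` holds for every A.
        m = 2 ℕ.* κ² ℕ.+ 1
        rec = claim m 0
        G C E′ : ℕ
        G = proj₁ rec
        C = proj₁ (proj₂ rec)
        1≤G = proj₁ (proj₂ (proj₂ rec))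
        E′ = length iss ℕ.* (G ℕ.^ suc k ℕ.* b)
        proof : ∀ u → 1 ℕ.≤ u → ∀ (H : IPS I) g →
          (∀ A → ShiftBound A (E′ ℕ.* u ℕ.^ suc k) → Returns.N H g ≤ ι D * Returns.N H (Returns.⟦_⟧ H A g)) →
          Returns.Positive H g → Returns.Conclusion H C u g
        proof u 1≤u H g dense pos = proj₂ (proj₂ (proj₂ rec)) u 1≤u H g A₀ (initial-good H R 1≤R) (dense A₀ bound)
          (≤-by (ι (2 ℕ.* κ²) * Returns.N H (Returns.⟦_⟧ H A₀ g)) (0≤-* (0≤ι (2 ℕ.* κ²)) (Returns.psd H _)) (ℚₚ.+-comm (ι (2 ℕ.* κ²) * Returns.N H (Returns.⟦_⟧ H A₀ g)) (ι m * Returns.N H g))) pos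
          where
          R = (G ℕ.* u) ℕ.^ suc k
          1≤R = ^-pos (suc k) (*-pos 1≤G 1≤u)
          A₀ = initial R iss
          bound : ShiftBound A₀ (E′ ℕ.* u ℕ.^ suc k)
          bound = ShiftBound-weaken A₀ (ℕₚ.≤-reflexive (trans (cong (λ t → length iss ℕ.* (t ℕ.* b)) (*-^ G u (suc k))) (lem (length iss) (G ℕ.^ suc k) (u ℕ.^ suc k) b)))
            (initial-bound R b 1≤R hb iss)
            where
            lem : ∀ i g u b → i ℕ.* (g ℕ.* u ℕ.* b) ≡ i ℕ.* (g ℕ.* b) ℕ.* u
            lem = ℕ-solve

-- Gallai's theorem by colour focusing.

module GallaiTheorem where
  open import Data.Nat using (_+_; _*_; _^_; _≤_; z≤n; s≤s)
  open import Data.Fin using (funToFin; finToFun)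

  module Gallai (l : ℕ) where
    Point : Set
    Point = Vec ℕ l

    infixl 6 _⊹_
    infixl 7 _⊛_

    _⊹_ : ∀ {l} → Vec ℕ l → Vec ℕ l → Vec ℕ l
    _⊹_ = Vec.zipWith _+_

    _⊛_ : ∀ {l} → ℕ → Vec ℕ l → Vec ℕ l
    e ⊛ f = Vec.map (e *_) f

    interchange : ∀ {l} (x a : Vec ℕ l) e e′ f → (x ⊹ a) ⊹ (e + e′) ⊛ f ≡ (x ⊹ e ⊛ f) ⊹ (a ⊹ e′ ⊛ f)
    interchange [] [] e e′ [] = refl
    interchange (x ∷ xs) (a ∷ as) e e′ (f ∷ fs) = cong₂ _∷_ (lem x a e e′ f) (interchange xs as e e′ fs)
      where
      lem : ∀ x a e e′ f → x + a + (e + e′) * f ≡ x + e * f + (a + e′ * f)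
      lem = ℕ-solve

    move : ∀ {l} (x a y : Vec ℕ l) → (x ⊹ a) ⊹ y ≡ (x ⊹ y) ⊹ a
    move [] [] [] = refl
    move (x ∷ xs) (a ∷ as) (y ∷ ys) = cong₂ _∷_ (lem x a y) (move xs as ys)
      where
      lem : ∀ x a y → x + a + y ≡ x + y + a
      lem = ℕ-solve

    assoc : ∀ {l} (x a y : Vec ℕ l) → (x ⊹ a) ⊹ y ≡ x ⊹ (a ⊹ y)
    assoc [] [] [] = refl
    assoc (x ∷ xs) (a ∷ as) (y ∷ ys) = cong₂ _∷_ (ℕₚ.+-assoc x a y) (assoc xs as ys)

    Bounded : ∀ {l} → ℕ → Vec ℕ l → Set
    Bounded K = All (_≤ K)

    Bounded-⊹ : ∀ {l K K′} {x y : Vec ℕ l} → Bounded K x → Bounded K′ y → Bounded (K + K′) (x ⊹ y)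
    Bounded-⊹ {x = []} {[]} [] [] = []
    Bounded-⊹ {x = _ ∷ _} {_ ∷ _} (p ∷ ps) (q ∷ qs) = ℕₚ.+-mono-≤ p q ∷ Bounded-⊹ ps qs

    Bounded-⊛ : ∀ {l K K′ e} {f : Vec ℕ l} → e ≤ K → Bounded K′ f → Bounded (K * K′) (e ⊛ f)
    Bounded-⊛ e≤ [] = []
    Bounded-⊛ e≤ (p ∷ ps) = ℕₚ.*-mono-≤ e≤ p ∷ Bounded-⊛ e≤ ps

    Bounded-weaken : ∀ {l K K′} {x : Vec ℕ l} → K ≤ K′ → Bounded K x → Bounded K′ x
    Bounded-weaken le = All.map λ p → ℕₚ.≤-trans p le

    box : ∀ l → ℕ → List (Vec ℕ l)
    box zero K = [ [] ]
    box (suc l) K = cartesianProductWith _∷_ (downFrom (suc K)) (box l K)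

    ∈-box : ∀ {l K} {x : Vec ℕ l} → Bounded K x → x ∈ box l K
    ∈-box [] = here refl
    ∈-box (p ∷ ps) = ∈-cartesianProductWith⁺ _∷_ (∈-downFrom⁺ (s≤s p)) (∈-box ps)

    Mono : ∀ {r} → (Point → Fin r) → List Point → Point → ℕ → Set
    Mono χ F a e = ∀ f f′ → f ∈ F → f′ ∈ F → χ (a ⊹ e ⊛ f) ≡ χ (a ⊹ e ⊛ f′)

    Homothet : ∀ {r} → ℕ → (Point → Fin r) → List Point → Set
    Homothet K χ F = Σ[ a ∈ Point ] Σ[ e ∈ ℕ ] (Bounded K a × 1 ≤ e × e ≤ K × Mono χ F a e)

    module Focusing (f₀ f₁ : Point) (F : List Point) (b : ℕ) (f₀≤ : Bounded b f₀) (F≤ : ∀ f → f ∈ (f₁ ∷ F) → Bounded b f)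
      (IH : ∀ r → ∃[ K ] ∀ χ → Homothet {r} K χ (f₁ ∷ F)) (r : ℕ) where

      -- s monochromatic copies of f₁ ∷ F of distinct colours whose copies of f₀ all sit at the point focus.
      record Focused (K s : ℕ) (χ : Point → Fin r) : Set where
        field
          focus : Point
          base : Fin s → Point
          step : Fin s → ℕ
          colour : Fin s → Fin r
          focus≤ : Bounded K focus
          base≤ : ∀ i → Bounded K (base i)
          step≤ : ∀ i → step i ≤ K
          1≤step : ∀ i → 1 ≤ step i
          meets : ∀ i → base i ⊹ step i ⊛ f₀ ≡ focus
          mono : ∀ i f → f ∈ (f₁ ∷ F) → χ (base i ⊹ step i ⊛ f) ≡ colour i
          distinct : ∀ i j → colour i ≡ colour j → i ≡ j

      Outcome : ℕ → ℕ → (Point → Fin r) → Set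
      Outcome K s χ = Homothet K χ (f₀ ∷ f₁ ∷ F) ⊎ Focused K s χ

      focused⇒mono : ∀ {K s χ} (φ : Focused K s χ) i → χ (Focused.focus φ) ≡ Focused.colour φ i → Homothet K χ (f₀ ∷ f₁ ∷ F)
      focused⇒mono {χ = χ} φ i e = base i , step i , base≤ i , 1≤step i , step≤ i , λ f f′ f∈ f′∈ → trans (value f f∈) (sym (value f′ f′∈))
        where
        open Focused φ
        value : ∀ f → f ∈ (f₀ ∷ f₁ ∷ F) → χ (base i ⊹ step i ⊛ f) ≡ colour i
        value f (here refl) = trans (cong χ (meets i)) e
        value f (there f∈) = mono i f f∈

      module Extend (K s : ℕ) (outcome : ∀ χ → Outcome K s χ) where
        window : List Point
        window = box l (K + K * b)

        blocks : ℕ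
        blocks = r ^ length window

        K₁ K′ : ℕ
        K₁ = proj₁ (IH blocks)
        K′ = K₁ + K₁ * b + K

        module _ (χ : Point → Fin r) where
          -- The block colour of x is the whole pattern of χ on x + window, a window that contains
          -- the focus and all copies of the families that `outcome` may find near x.
          block : Point → Fin blocks
          block x = funToFin (λ i → χ (x ⊹ List.lookup window i))

          block-agree : ∀ {x y} → block x ≡ block y → ∀ w → w ∈ window → χ (x ⊹ w) ≡ χ (y ⊹ w)
          block-agree {x} {y} e w w∈ = subst (λ v → χ (x ⊹ v) ≡ χ (y ⊹ v)) (sym (Anyₚ.lookup-index w∈))
            (trans (sym (Finₚ.finToFun-funToFin (λ i → χ (x ⊹ List.lookup window i)) (Any.index w∈)))
              (trans (cong (λ c → finToFun c (Any.index w∈)) e) (Finₚ.finToFun-funToFin (λ i → χ (y ⊹ List.lookup window i)) (Any.index w∈))))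

          homothet : Homothet K₁ block (f₁ ∷ F)
          homothet = proj₂ (IH blocks) block

          x = proj₁ homothet
          e = proj₁ (proj₂ homothet)
          x≤ : Bounded K₁ x
          x≤ = proj₁ (proj₂ (proj₂ homothet))
          1≤e = proj₁ (proj₂ (proj₂ (proj₂ homothet)))
          e≤ = proj₁ (proj₂ (proj₂ (proj₂ (proj₂ homothet))))
          same : Mono block (f₁ ∷ F) x e
          same = proj₂ (proj₂ (proj₂ (proj₂ (proj₂ homothet))))

          x₁ : Point
          x₁ = x ⊹ e ⊛ f₁

          x₁≤ : Bounded (K₁ + K₁ * b) x₁
          x₁≤ = Bounded-⊹ x≤ (Bounded-⊛ e≤ (F≤ f₁ (here refl)))

          local : Point → Fin r
          local y = χ (x₁ ⊹ y)

          at : ∀ f → f ∈ (f₁ ∷ F) → ∀ w → w ∈ window → χ ((x ⊹ e ⊛ f) ⊹ w) ≡ local w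
          at f f∈ = block-agree (same f f₁ f∈ (here refl))

          globalise : Homothet K local (f₀ ∷ f₁ ∷ F) → Homothet K′ χ (f₀ ∷ f₁ ∷ F)
          globalise (a , d , a≤ , 1≤d , d≤ , mono) = x₁ ⊹ a , d , Bounded-⊹ x₁≤ a≤ , 1≤d , ℕₚ.≤-trans d≤ (ℕₚ.m≤n+m K (K₁ + K₁ * b)) ,
            λ f f′ f∈ f′∈ → trans (cong χ (assoc x₁ a (d ⊛ f))) (trans (mono f f′ f∈ f′∈) (cong χ (sym (assoc x₁ a (d ⊛ f′)))))

          -- The blocks at x + e f look alike for f in f₁ ∷ F. Moving through the blocks while
          -- moving inside them gives copies of step e + step i, all focused at (x + e f₀) + focus;
          -- the old focus, repeated through the blocks with step e, supplies the family of the new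
          -- colour.
          refocus : (φ : Focused K s local) → (∀ i → ¬ (local (Focused.focus φ) ≡ Focused.colour φ i)) → Focused K′ (suc s) χ
          refocus φ new = record
            { focus = (x ⊹ e ⊛ f₀) ⊹ focus
            ; base = λ { zero → x ⊹ focus ; (suc i) → x ⊹ base i }
            ; step = λ { zero → e ; (suc i) → e + step i }
            ; colour = λ { zero → local focus ; (suc i) → colour i }
            ; focus≤ = Bounded-⊹ (Bounded-⊹ x≤ (Bounded-⊛ e≤ f₀≤)) focus≤
            ; base≤ = λ { zero → Bounded-weaken le (Bounded-⊹ x≤ focus≤) ; (suc i) → Bounded-weaken le (Bounded-⊹ x≤ (base≤ i)) }
            ; step≤ = λ { zero → ℕₚ.≤-trans e≤ (ℕₚ.≤-trans (ℕₚ.m≤m+n K₁ K) le) ; (suc i) → ℕₚ.≤-trans (ℕₚ.+-mono-≤ e≤ (step≤ i)) le }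
            ; 1≤step = λ { zero → 1≤e ; (suc i) → ℕₚ.≤-trans 1≤e (ℕₚ.m≤m+n e (step i)) }
            ; meets = λ { zero → move x focus (e ⊛ f₀)
                        ; (suc i) → trans (interchange x (base i) e (step i) f₀) (cong ((x ⊹ e ⊛ f₀) ⊹_) (meets i)) }
            ; mono = λ { zero f f∈ → trans (cong χ (move x focus (e ⊛ f))) (at f f∈ focus (∈-box (Bounded-weaken (ℕₚ.m≤m+n K (K * b)) focus≤)))
                       ; (suc i) f f∈ → trans (cong χ (interchange x (base i) e (step i) f))
                           (trans (at f f∈ _ (∈-box (Bounded-⊹ (base≤ i) (Bounded-⊛ (step≤ i) (F≤ f f∈))))) (mono i f f∈)) }
            ; distinct = λ { zero zero eq → refl ; zero (suc j) eq → ⊥-elim (new j eq) ; (suc i) zero eq → ⊥-elim (new i (sym eq))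
                           ; (suc i) (suc j) eq → cong suc (distinct i j eq) }
            }
            where
            open Focused φ
            le : K₁ + K ≤ K′
            le = ℕₚ.+-monoˡ-≤ K (ℕₚ.m≤m+n K₁ (K₁ * b))

          extended : Outcome K′ (suc s) χ
          extended with outcome local
          ... | inj₁ h = inj₁ (globalise h)
          ... | inj₂ φ with Finₚ.any? (λ i → local (Focused.focus φ) Fin.≟ Focused.colour φ i)
          ...   | yes (i , e) = inj₁ (globalise (focused⇒mono φ i e))
          ...   | no new = inj₂ (refocus φ λ i e → new (i , e))

      focusing : ∀ s → ∃[ K ] ∀ χ → Outcome K s χ
      focusing zero = 0 , λ χ → inj₂ (record
        { focus = Vec.replicate l 0 ; base = λ () ; step = λ () ; colour = λ () ; focus≤ = zeros l ; base≤ = λ () ; step≤ = λ ()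
        ; 1≤step = λ () ; meets = λ () ; mono = λ () ; distinct = λ () })
        where
        zeros : ∀ l → Bounded 0 (Vec.replicate l 0)
        zeros zero = []
        zeros (suc l) = z≤n ∷ zeros l
      focusing (suc s) = Extend.K′ (proj₁ prev) s (proj₂ prev) , Extend.extended (proj₁ prev) s (proj₂ prev)
        where prev = focusing s

      conclusion : ∃[ K ] ∀ (χ : Point → Fin r) → Homothet K χ (f₀ ∷ f₁ ∷ F)
      conclusion = proj₁ (focusing (suc r)) , λ χ → resolve χ (proj₂ (focusing (suc r)) χ)
        where
        resolve : ∀ {K} (χ : Point → Fin r) → Outcome K (suc r) χ → Homothet K χ (f₀ ∷ f₁ ∷ F)
        resolve χ (inj₁ h) = h
        resolve χ (inj₂ φ) = let i , j , i<j , e = Finₚ.pigeonhole (ℕₚ.n<1+n r) (Focused.colour φ) in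
          ⊥-elim (ℕₚ.<-irrefl (cong Fin.toℕ (Focused.distinct φ i j e)) i<j)

    gallai : ∀ b (F : List Point) → (∀ f → f ∈ F → Bounded b f) → ∀ r → ∃[ K ] ∀ (χ : Point → Fin r) → Homothet K χ F
    gallai b [] F≤ r = 1 , λ χ → Vec.replicate l 0 , 1 , zeros l , s≤s z≤n , s≤s z≤n , λ f f′ ()
      where
      zeros : ∀ l → Bounded 1 (Vec.replicate l 0)
      zeros zero = []
      zeros (suc l) = z≤n ∷ zeros l
    gallai b (f ∷ []) F≤ r = 1 , λ χ → Vec.replicate l 0 , 1 , zeros l , s≤s z≤n , s≤s z≤n , λ { _ _ (here refl) (here refl) → refl }
      where
      zeros : ∀ l → Bounded 1 (Vec.replicate l 0)
      zeros zero = []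
      zeros (suc l) = z≤n ∷ zeros l
    gallai b (f₀ ∷ f₁ ∷ F) F≤ = Focusing.conclusion f₀ f₁ F b (F≤ f₀ (here refl)) (λ f f∈ → F≤ f (there f∈))
      (gallai b (f₁ ∷ F) (λ f f∈ → F≤ f (there f∈)))

-- Finitely supported functions as an inner product space.

module FiniteSpaces where
  open import Data.Rational using (_+_; _*_; _-_; -_; _≤_)
  open import Tactic.RingSolver using (solve-∀)
  open RationalSums
  open InnerProductSpaces
  open AlmostInvariance
  open BoxEstimates
  open PlanBoundsAndSpread
  open RecurrenceLevels
  open PolynomialRecurrence

  indicator : {P : Set} → Dec P → ℚ
  indicator (yes _) = 1ℚ
  indicator (no _) = 0ℚ

  indicator-cong : {P Q : Set} → (P → Q) → (Q → P) → (p : Dec P) (q : Dec Q) → indicator p ≡ indicator q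
  indicator-cong f g (yes p) (yes q) = refl
  indicator-cong f g (yes p) (no ¬q) = ⊥-elim (¬q (f p))
  indicator-cong f g (no ¬p) (yes q) = ⊥-elim (¬p (g q))
  indicator-cong f g (no ¬p) (no ¬q) = refl

  0≤indicator : {P : Set} (p : Dec P) → 0ℚ ≤ indicator p
  0≤indicator (yes _) = 0≤1
  0≤indicator (no _) = ℚₚ.≤-refl

  indicator-yes : {P : Set} → P → (p : Dec P) → indicator p ≡ 1ℚ
  indicator-yes p (yes _) = refl
  indicator-yes p (no ¬p) = ⊥-elim (¬p p)

  indicator-no : {P : Set} → ¬ P → (p : Dec P) → indicator p ≡ 0ℚ
  indicator-no ¬p (yes p) = ⊥-elim (¬p p)
  indicator-no ¬p (no _) = refl

  module Indicator {X : Set} (_≟_ : DecidableEquality X) where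
    δ : X → X → ℚ
    δ x y = indicator (x ≟ y)

    δ-sym : ∀ x y → δ x y ≡ δ y x
    δ-sym x y = indicator-cong sym sym (x ≟ y) (y ≟ x)

    Σ-∉ : ∀ {x} ys (F : X → ℚ) → ListAll.All (λ y → ¬ x ≡ y) ys → Σ ys (λ y → δ x y * F y) ≡ 0ℚ
    Σ-∉ [] F h = refl
    Σ-∉ {x} (y ∷ ys) F (x≢y ListAll.∷ h) = trans (cong₂ _+_ (trans (cong (_* F y) (indicator-no x≢y (x ≟ y))) (ℚₚ.*-zeroˡ (F y))) (Σ-∉ ys F h)) (ℚₚ.+-identityˡ 0ℚ)

    Σ-∈ : ∀ {x ys} (F : X → ℚ) → Unique ys → x ∈ ys → Σ ys (λ y → δ x y * F y) ≡ F x
    Σ-∈ {x} {y ∷ ys} F (y∉ ∷ u) (here refl) = trans (cong₂ _+_ (trans (cong (_* F x) (indicator-yes refl (x ≟ x))) (ℚₚ.*-identityˡ (F x)))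
      (Σ-∉ ys F y∉)) (ℚₚ.+-identityʳ (F x))
    Σ-∈ {x} {y ∷ ys} F (y∉ ∷ u) (there x∈) = trans (cong₂ _+_ (trans (cong (_* F y) (indicator-no (λ e → ListAll.lookup y∉ x∈ (sym e)) (x ≟ y))) (ℚₚ.*-zeroˡ (F y)))
      (Σ-∈ F u x∈)) (ℚₚ.+-identityˡ (F x))

    Σδ≡1 : ∀ {x ys} → Unique ys → x ∈ ys → Σ ys (δ x) ≡ 1ℚ
    Σδ≡1 {x} {ys} u x∈ = trans (Σ-cong ys λ y → sym (ℚₚ.*-identityʳ (δ x y))) (Σ-∈ (λ _ → 1ℚ) u x∈)

    Σδ≤1 : ∀ x {ys} → Unique ys → Σ ys (δ x) ≤ 1ℚ
    Σδ≤1 x {[]} u = 0≤1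
    Σδ≤1 x {y ∷ ys} (y∉ ∷ u) with x ≟ y
    ... | yes refl = ℚₚ.≤-reflexive (trans (cong (λ t → 1ℚ + t) (trans (Σ-cong ys λ z → sym (ℚₚ.*-identityʳ (δ x z))) (Σ-∉ ys (λ _ → 1ℚ) y∉))) (ℚₚ.+-identityʳ 1ℚ))
    ... | no _ = subst (_≤ 1ℚ) (sym (ℚₚ.+-identityˡ (Σ ys (δ x)))) (Σδ≤1 x u)

  module ListSpace {I X : Set} (_≟_ : DecidableEquality X) (shift : (I → ℤ) → X → X)
    (shift-cong : ∀ {a b} → (∀ i → a i ≡ b i) → ∀ x → shift a x ≡ shift b x)
    (shift-0 : ∀ x → shift (λ _ → + 0) x ≡ x)
    (shift-⁺ : ∀ a b x y → shift a x ≡ shift b y → x ≡ shift (λ i → b i ℤ.- a i) y)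
    (shift-⁻ : ∀ a b x y → x ≡ shift (λ i → b i ℤ.- a i) y → shift a x ≡ shift b y) where
    open Indicator _≟_ public

    -- Finitely supported functions as lists of weighted points, repetitions allowed: as no equality
    -- of vectors is demanded, no normal form is needed.
    V : Set
    V = List (ℚ × X)

    form : V → V → ℚ
    form u v = Σ u λ { (c , x) → Σ v λ { (d , y) → c * d * δ x y } }

    translate : (I → ℤ) → V → V
    translate a = map λ { (c , x) → c , shift a x }

    ip-symmetric : ∀ u v → form u v ≡ form v u
    ip-symmetric u v = trans (Σ-swap u v _) (Σ-cong v λ { (d , y) → Σ-cong u λ { (c , x) → cong₂ _*_ (ℚₚ.*-comm c d) (δ-sym x y) } })

    coefficient : V → X → ℚ
    coefficient u k = Σ u λ { (c , x) → c * δ x k }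

    support : V → List X
    support u = deduplicate _≟_ (map proj₂ u)

    -- Collecting equal points makes the form a sum of products of coefficients, so that positivity
    -- is visible. The support is that of a fixed u₀ while u shrinks in the induction.
    ip-support : ∀ u v {u₀} → (∀ {cx} → cx ∈ u → cx ∈ u₀) → form u v ≡ Σ (support u₀) (λ k → coefficient u k * coefficient v k)
    ip-support [] v {u₀} sub = sym (trans (Σ-cong (support u₀) λ k → ℚₚ.*-zeroˡ (coefficient v k)) (trans (Σ-const (support u₀) 0ℚ) (ℚₚ.*-zeroʳ (ι (length (support u₀))))))
    ip-support ((c , x) ∷ u) v {u₀} sub = begin
      Σ v (λ { (d , y) → c * d * δ x y }) + form u v
        ≡⟨ cong₂ _+_ first (ip-support u v {u₀} (λ m → sub (there m))) ⟩
      Σ (support u₀) (λ k → δ x k * (c * coefficient v k)) + Σ (support u₀) (λ k → coefficient u k * coefficient v k)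
        ≡⟨ sym (Σ-+ (support u₀) _ _) ⟩
      Σ (support u₀) (λ k → δ x k * (c * coefficient v k) + coefficient u k * coefficient v k)
        ≡⟨ Σ-cong (support u₀) (λ k → lem (δ x k) c (coefficient v k) (coefficient u k)) ⟩
      Σ (support u₀) (λ k → (c * δ x k + coefficient u k) * coefficient v k) ∎
      where
      open ≡-Reasoning
      lem : ∀ a b c d → a * (b * c) + d * c ≡ (b * a + d) * c
      lem = solve-∀ ℚ-ring
      first : Σ v (λ { (d , y) → c * d * δ x y }) ≡ Σ (support u₀) (λ k → δ x k * (c * coefficient v k))
      first = trans (Σ-cong v λ { (d , y) → trans (ℚₚ.*-assoc c d (δ x y)) (cong (λ t → c * (d * t)) (δ-sym x y)) })
        (trans (Σ-* v c _) (sym (Σ-∈ (λ k → c * coefficient v k) (UniqueDec.deduplicate-! _≟_ (map proj₂ u₀))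
          (∈-deduplicate⁺ _≟_ (∈-map⁺ proj₂ (sub (here refl)))))))

    space : IPS I
    space = record
      { V = V
      ; 0V = []
      ; _⊕_ = _++_
      ; _·_ = λ c → map λ { (d , x) → c * d , x }
      ; T = translate
      ; ⟨_,_⟩ = form
      ; ip-sym = ip-symmetric
      ; ip-0 = λ w → refl
      ; ip-⊕ = λ u v w → Σ-++ u v _
      ; ip-· = λ c u w → trans (Σ-map _ u _) (trans (Σ-cong u λ { (d , x) →
          trans (Σ-cong w λ { (e , y) → lem c d e (δ x y) }) (Σ-* w c _) }) (Σ-* u c _))
      ; psd = λ u → subst (0ℚ ≤_) (sym (ip-support u u (λ m → m))) (0≤Σ (support u) λ k → 0≤-sq (coefficient u k))
      ; T-iso = λ a b u w → trans (Σ-map _ u _) (Σ-cong u λ { (c , x) → trans (Σ-map _ w _) (trans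
          (Σ-cong w λ { (d , y) → cong (λ t → c * d * t) (indicator-cong (shift-⁺ a b x y) (shift-⁻ a b x y) (shift a x ≟ shift b y) (x ≟ shift (λ i → b i ℤ.- a i) y)) })
          (sym (Σ-map _ w _))) })
      ; T-cong = λ h u → Listₚ.map-cong (λ { (c , x) → cong (c ,_) (shift-cong h x) }) u
      ; T-0 = λ u w → trans (Σ-map _ u _) (Σ-cong u λ { (c , x) → Σ-cong w λ { (d , y) → cong (λ t → c * d * δ t y) (shift-0 x) } })
      }
      where
      lem : ∀ c d e x → c * d * e * x ≡ c * (d * e * x)
      lem = solve-∀ ℚ-ring

    point : X → ℚ × X
    point x = 1ℚ , x

    unit : List X → V
    unit = map point

    ip-unit : ∀ xs ys → form (unit xs) (unit ys) ≡ Σ xs (λ x → Σ ys (δ x))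
    ip-unit xs ys = trans (Σ-map point xs _) (Σ-cong xs λ x → trans (Σ-map point ys _) (Σ-cong ys λ y → lem (δ x y)))
      where
      lem : ∀ t → 1ℚ * 1ℚ * t ≡ t
      lem = solve-∀ ℚ-ring

    ip-translate : ∀ a xs ys → form (translate a (unit xs)) (unit ys) ≡ Σ xs (λ x → Σ ys (δ (shift a x)))
    ip-translate a xs ys = trans (cong (λ u → form u (unit ys)) (trans (sym (Listₚ.map-∘ xs)) (Listₚ.map-∘ xs)))
      (trans (ip-unit (map (shift a) xs) ys) (Σ-map (shift a) xs _))

    norm-unit : ∀ {xs} → Unique xs → form (unit xs) (unit xs) ≡ ι (length xs)
    norm-unit {xs} u = trans (ip-unit xs xs) (trans (constant xs (λ x∈ → x∈)) (ℚₚ.*-identityʳ (ι (length xs))))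
      where
      constant : ∀ zs → (∀ {x} → x ∈ zs → x ∈ xs) → Σ zs (λ x → Σ xs (δ x)) ≡ ι (length zs) * 1ℚ
      constant [] h = sym (ℚₚ.*-zeroˡ 1ℚ)
      constant (z ∷ zs) h = trans (cong₂ _+_ (Σδ≡1 u (h (here refl))) (constant zs (λ m → h (there m)))) (lem (ι (length zs)))
        where
        lem : ∀ t → 1ℚ + t * 1ℚ ≡ (1ℚ + t) * 1ℚ
        lem = solve-∀ ℚ-ring

    module Dense (xs ys : List X) (uxs : Unique xs) (uys : Unique ys) (b : ℕ)
      (near : ∀ a → (∀ i → ℤ.∣ a i ∣ ℕ.≤ b) → ∀ x → x ∈ xs → shift a x ∈ ys) where
      open Operators space hiding (V)

      -- All translates of v by at most r have their full mass |xs| on ys. An average keeps this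
      -- property at the cost of its displacement (`mass-op`).
      Mass : V → ℕ → Set
      Mass v r = ∀ a → (∀ i → ℤ.∣ a i ∣ ℕ.≤ r) → form (translate a v) (unit ys) ≡ ι (length xs)

      mass-unit : Mass (unit xs) b
      mass-unit a ha = trans (ip-translate a xs ys) (trans (constant xs (λ x∈ → x∈)) (ℚₚ.*-identityʳ (ι (length xs))))
        where
        constant : ∀ zs → (∀ {x} → x ∈ zs → x ∈ xs) → Σ zs (λ x → Σ ys (δ (shift a x))) ≡ ι (length zs) * 1ℚ
        constant [] h = sym (ℚₚ.*-zeroˡ 1ℚ)
        constant (z ∷ zs) h = trans (cong₂ _+_ (Σδ≡1 uys (near a ha z (h (here refl)))) (constant zs (λ m → h (there m)))) (lem (ι (length zs)))
          where
          lem : ∀ t → 1ℚ + t * 1ℚ ≡ (1ℚ + t) * 1ℚ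
          lem = solve-∀ ℚ-ring

      mass-op : ∀ A v r b′ → ShiftBound A b′ → Mass v (b′ ℕ.+ r) → Mass (⟦ A ⟧ v) r
      mass-op one v r b′ sb h a ha = h a λ i → ℕₚ.≤-trans (ha i) (ℕₚ.m≤n+m r b′)
      mass-op (av as) v r b′ (ne , sb) h a ha = trans (sym (_≈_.ip (EV-T as a (λ c → T c v)) (unit ys))) (trans (ip-EV as _ (unit ys))
        (trans (constant as (λ c∈ → c∈)) (E-const as ne (ι (length xs)))))
        where
        each : ∀ c → c ∈ as → form (translate a (translate c v)) (unit ys) ≡ ι (length xs)
        each c c∈ = trans (_≈_.ip (T-∘ a c v) (unit ys)) (h (a ⊞ c) λ i → ℕₚ.≤-trans (ℤₚ.∣i+j∣≤∣i∣+∣j∣ (a i) (c i))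
          (ℕₚ.≤-trans (ℕₚ.+-mono-≤ (ha i) (sb c c∈ i)) (ℕₚ.≤-reflexive (ℕₚ.+-comm r b′))))
        constant : ∀ cs → (∀ {c} → c ∈ cs → c ∈ as) → E cs (λ c → form (translate a (translate c v)) (unit ys)) ≡ E cs (λ _ → ι (length xs))
        constant cs sub = cong (λ t → inv (length cs) * t) (sums cs sub)
          where
          sums : ∀ cs → (∀ {c} → c ∈ cs → c ∈ as) → Σ cs (λ c → form (translate a (translate c v)) (unit ys)) ≡ Σ cs (λ _ → ι (length xs))
          sums [] sub = refl
          sums (c ∷ cs) sub = cong₂ _+_ (each c (sub (here refl))) (sums cs (λ m → sub (there m)))
      mass-op (A ∘ B) v r b′ (b₁ , b₂ , sa , sb , le) h = mass-op A (⟦ B ⟧ v) r b₁ sa (mass-op B v (b₁ ℕ.+ r) b₂ sb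
        λ a ha → h a λ i → ℕₚ.≤-trans (ha i) (ℕₚ.≤-trans (ℕₚ.≤-reflexive (lem b₁ b₂ r)) (ℕₚ.+-monoˡ-≤ r le)))
        where
        lem : ∀ a b r → b ℕ.+ (a ℕ.+ r) ≡ a ℕ.+ b ℕ.+ r
        lem = ℕ-solve

      -- The average of the indicator of xs still has mass |xs| on ys, so by Cauchy-Schwarz |xs|² is
      -- at most |ys| times its squared norm. This supplies the density hypothesis of `recurrence`.
      dense : ∀ D → 1 ℕ.≤ D → length ys ℕ.≤ D ℕ.* length xs → ∀ A b′ → b′ ℕ.≤ b → ShiftBound A b′ →
        form (unit xs) (unit xs) ≤ ι D * N (⟦ A ⟧ (unit xs))
      dense (suc D′) _ h A b′ b′≤b sb = subst (_≤ ι D * N v) (sym (norm-unit uxs)) (*-cancelˡ D′ (≤-by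
        (ι D * ι D * N v + N w - (1ℚ + 1ℚ) * (ι D * ⟨ v , w ⟩) + (ι D * ι (length xs) - N w))
        (0≤-+ (0≤-diff (am-gm (ι D) v w)) (0≤-diff (subst₂ _≤_ (sym (norm-unit uys)) (ι-* D (length xs)) (ι-mono h))))
        (trans (lem (ι D) (N v) (N w) (ι (length xs)))
          (cong (λ t → ι D * ι (length xs) + (ι D * ι D * N v + N w - (1ℚ + 1ℚ) * (ι D * t) + (ι D * ι (length xs) - N w))) (sym mass)))))
        where
        D = suc D′
        v = ⟦ A ⟧ (unit xs)
        w = unit ys
        mass : ⟨ v , w ⟩ ≡ ι (length xs)
        mass = trans (sym (T-0 v w)) (mass-op A (unit xs) 0 b′ sb
          (λ a ha → mass-unit a λ i → ℕₚ.≤-trans (ha i) (ℕₚ.≤-trans (ℕₚ.≤-reflexive (ℕₚ.+-identityʳ b′)) b′≤b)) 0Λ (λ i → ℕ.z≤n))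
        lem : ∀ d n m g → d * (d * n) ≡ d * g + (d * d * n + m - (1ℚ + 1ℚ) * (d * g) + (d * g - m))
        lem = solve-∀ ℚ-ring

-- Products of point sets and simultaneous returns.

module PointSets where
  open import Data.Rational using (_+_; _*_; _≤_)
  open import Tactic.RingSolver using (solve-∀)
  open RationalSums
  open InnerProductSpaces
  open BoxEstimates
  open AveragingPlans
  open PolynomialDifferences
  open FormAbsorption
  open PlanBoundsAndSpread
  open RecurrenceLevels
  open PolynomialRecurrence
  open GallaiTheorem
  open FiniteSpaces

  module Points (n : ℕ) where
    Pt : Set
    Pt = Vec ℤ (suc n)

    _≟ₚ_ : DecidableEquality Pt
    _≟ₚ_ = Vecₚ.≡-dec ℤ._≟_

    open Indicator _≟ₚ_ public using () renaming (δ to δₚ; Σδ≤1 to Σδₚ≤1)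

    _≟ᵥ_ : ∀ {m} → DecidableEquality (Vec Pt m)
    _≟ᵥ_ = Vecₚ.≡-dec _≟ₚ_

    -- Coordinate i of the group moves only the first entry of the i-th point, so a return in the
    -- product is a return in every factor.
    shiftAll : ∀ {m} → (Fin m → ℤ) → Vec Pt m → Vec Pt m
    shiftAll a [] = []
    shiftAll a (x ∷ xs) = bump zero (a zero) x ∷ shiftAll (λ i → a (suc i)) xs

    shiftAll-cong : ∀ {m} {a b : Fin m → ℤ} → (∀ i → a i ≡ b i) → ∀ x → shiftAll a x ≡ shiftAll b x
    shiftAll-cong h [] = refl
    shiftAll-cong h (x ∷ xs) = cong₂ _∷_ (cong (λ t → bump zero t x) (h zero)) (shiftAll-cong (λ i → h (suc i)) xs)

    shiftAll-0 : ∀ {m} (x : Vec Pt m) → shiftAll (λ _ → + 0) x ≡ x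
    shiftAll-0 [] = refl
    shiftAll-0 ((t ∷ x) ∷ xs) = cong₂ _∷_ (cong (_∷ x) (ℤₚ.+-identityˡ t)) (shiftAll-0 xs)

    bump-⁺ : ∀ a b (x y : Pt) → bump zero a x ≡ bump zero b y → x ≡ bump zero (b ℤ.- a) y
    bump-⁺ a b (t ∷ x) (u ∷ y) e = cong₂ _∷_
      (ℤ-cancelˡ a (trans (Vecₚ.∷-injectiveˡ e) (lem a b u))) (Vecₚ.∷-injectiveʳ e)
      where
      lem : ∀ a b u → b ℤ.+ u ≡ a ℤ.+ (b ℤ.- a ℤ.+ u)
      lem = ℤ-Solver.solve-∀

    bump-⁻ : ∀ a b (x y : Pt) → x ≡ bump zero (b ℤ.- a) y → bump zero a x ≡ bump zero b y
    bump-⁻ a b (t ∷ x) (u ∷ y) e = cong₂ _∷_ (trans (cong (λ t → a ℤ.+ t) (Vecₚ.∷-injectiveˡ e)) (lem a b u)) (Vecₚ.∷-injectiveʳ e)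
      where
      lem : ∀ a b u → a ℤ.+ (b ℤ.- a ℤ.+ u) ≡ b ℤ.+ u
      lem = ℤ-Solver.solve-∀

    shiftAll-⁺ : ∀ {m} (a b : Fin m → ℤ) x y → shiftAll a x ≡ shiftAll b y → x ≡ shiftAll (λ i → b i ℤ.- a i) y
    shiftAll-⁺ a b [] [] e = refl
    shiftAll-⁺ a b (x ∷ xs) (y ∷ ys) e = cong₂ _∷_ (bump-⁺ (a zero) (b zero) x y (Vecₚ.∷-injectiveˡ e))
      (shiftAll-⁺ (λ i → a (suc i)) (λ i → b (suc i)) xs ys (Vecₚ.∷-injectiveʳ e))

    shiftAll-⁻ : ∀ {m} (a b : Fin m → ℤ) x y → x ≡ shiftAll (λ i → b i ℤ.- a i) y → shiftAll a x ≡ shiftAll b y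
    shiftAll-⁻ a b [] [] e = refl
    shiftAll-⁻ a b (x ∷ xs) (y ∷ ys) e = cong₂ _∷_ (bump-⁻ (a zero) (b zero) x y (Vecₚ.∷-injectiveˡ e))
      (shiftAll-⁻ (λ i → a (suc i)) (λ i → b (suc i)) xs ys (Vecₚ.∷-injectiveʳ e))

    module Space (m : ℕ) = ListSpace {Fin m} {Vec Pt m} _≟ᵥ_ shiftAll shiftAll-cong shiftAll-0 shiftAll-⁺ shiftAll-⁻

    δᵥ : ∀ {m} → Vec Pt m → Vec Pt m → ℚ
    δᵥ x y = indicator (x ≟ᵥ y)

    δᵥ-∷ : ∀ {m} x y (xs ys : Vec Pt m) → δᵥ (x ∷ xs) (y ∷ ys) ≡ δₚ x y * δᵥ xs ys
    δᵥ-∷ x y xs ys = by-cases ((x ∷ xs) ≟ᵥ (y ∷ ys)) (x ≟ₚ y) (xs ≟ᵥ ys)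
      where
      by-cases : (p : Dec ((x ∷ xs) ≡ (y ∷ ys))) (q : Dec (x ≡ y)) (r : Dec (xs ≡ ys)) → indicator p ≡ indicator q * indicator r
      by-cases (yes p) (yes q) (yes r) = refl
      by-cases (yes p) (yes q) (no ¬r) = ⊥-elim (¬r (Vecₚ.∷-injectiveʳ p))
      by-cases (yes p) (no ¬q) r = ⊥-elim (¬q (Vecₚ.∷-injectiveˡ p))
      by-cases (no ¬p) (yes q) (yes r) = ⊥-elim (¬p (cong₂ _∷_ q r))
      by-cases (no ¬p) (yes q) (no ¬r) = refl
      by-cases (no ¬p) (no ¬q) (yes r) = refl
      by-cases (no ¬p) (no ¬q) (no ¬r) = refl

    pairs : List Pt → ℤ → ℚ
    pairs A h = Σ A (λ x → Σ A (δₚ (bump zero h x)))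

    prodList : ∀ m → (Fin m → List Pt) → List (Vec Pt m)
    prodList zero As = [ [] ]
    prodList (suc m) As = cartesianProductWith _∷_ (As zero) (prodList m (λ i → As (suc i)))

    returns : ∀ m → (Fin m → List Pt) → (Fin m → ℤ) → ℚ
    returns m As a = Σ (prodList m As) (λ x → Σ (prodList m As) (δᵥ (shiftAll a x)))

    Σ-*-Σ : {A B : Set} (xs : List A) (ys : List B) (f : A → ℚ) (g : B → ℚ) → Σ xs (λ x → Σ ys (λ y → f x * g y)) ≡ Σ xs f * Σ ys g
    Σ-*-Σ xs ys f g = trans (Σ-cong xs λ x → trans (Σ-* ys (f x) g) (ℚₚ.*-comm (f x) (Σ ys g))) (trans (Σ-* xs (Σ ys g) f) (ℚₚ.*-comm (Σ ys g) (Σ xs f)))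

    returns-suc : ∀ m As a → returns (suc m) As a ≡ pairs (As zero) (a zero) * returns m (λ i → As (suc i)) (λ i → a (suc i))
    returns-suc m As a = trans (Σ-product _∷_ (As zero) G _) (trans (Σ-cong (As zero) λ x → Σ-cong G λ xs →
        trans (Σ-product _∷_ (As zero) G _) (trans (Σ-cong (As zero) λ y → Σ-cong G λ ys → δᵥ-∷ (bump zero (a zero) x) y _ ys)
          (Σ-*-Σ (As zero) G _ _)))
      (Σ-*-Σ (As zero) G _ _))
      where G = prodList m (λ i → As (suc i))

    length-prodList : ∀ m As → length (prodList (suc m) As) ≡ length (As zero) ℕ.* length (prodList m (λ i → As (suc i)))
    length-prodList m As = length-product _∷_ (As zero) _

    pairs≤ : ∀ {A} h → Unique A → pairs A h ≤ ι (length A)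
    pairs≤ {A} h u = ℚₚ.≤-trans (Σ-mono A {g = λ _ → 1ℚ} λ x _ → Σδₚ≤1 (bump zero h x) u) (ℚₚ.≤-reflexive (trans (Σ-const A 1ℚ) (ℚₚ.*-identityʳ (ι (length A)))))

    0≤pairs : ∀ A h → 0ℚ ≤ pairs A h
    0≤pairs A h = 0≤Σ A λ x → 0≤Σ A λ y → 0≤indicator (bump zero h x ≟ₚ y)

    0≤returns : ∀ m As a → 0ℚ ≤ returns m As a
    0≤returns m As a = 0≤Σ (prodList m As) λ x → 0≤Σ (prodList m As) λ y → 0≤indicator (shiftAll a x ≟ᵥ y)

    returns≤ : ∀ m As a → (∀ i → Unique (As i)) → returns m As a ≤ ι (length (prodList m As))
    returns≤ zero As a u = ℚₚ.≤-reflexive refl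
    returns≤ (suc m) As a u = begin
      returns (suc m) As a ≡⟨ returns-suc m As a ⟩
      pairs (As zero) (a zero) * rest ≤⟨ *-monoʳ (0≤returns m _ _) (pairs≤ (a zero) (u zero)) ⟩
      ι (length (As zero)) * rest ≤⟨ *-monoˡ (0≤ι (length (As zero))) (returns≤ m _ _ λ i → u (suc i)) ⟩
      ι (length (As zero)) * ι (length (prodList m (λ i → As (suc i)))) ≡⟨ trans (sym (ι-* (length (As zero)) _)) (cong ι (sym (length-prodList m As))) ⟩
      ι (length (prodList (suc m) As)) ∎
      where
      open ℚₚ.≤-Reasoning
      rest = returns m (λ i → As (suc i)) (λ i → a (suc i))

    prodList-nonempty : ∀ m As → (∀ i → Nonempty (As i)) → Nonempty (prodList m As)
    prodList-nonempty zero As h = ℕₚ.≤-refl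
    prodList-nonempty (suc m) As h = ℕₚ.≤-trans (*-pos (h zero) (prodList-nonempty m _ λ i → h (suc i))) (ℕₚ.≤-reflexive (sym (length-prodList m As)))

    prodList-unique : ∀ m As → (∀ i → Unique (As i)) → Unique (prodList m As)
    prodList-unique zero As h = ListAll.[] ∷ []
    prodList-unique (suc m) As h = Uniqueₚ.cartesianProductWith⁺ _∷_ Vecₚ.∷-injective (h zero) (prodList-unique m _ λ i → h (suc i))

    cancelʳ : ∀ {x y z} → 1 ℕ.≤ z → x * ι z ≤ y * ι z → x ≤ y
    cancelʳ {x} {y} {suc z} _ h = *-cancelˡ z (subst₂ _≤_ (ℚₚ.*-comm x _) (ℚₚ.*-comm y _) h)

    -- The returns factor over i, and no factor exceeds |As i|. A product within a factor T of its
    -- maximum therefore has each of its factors within T of its own maximum.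
    extract : ∀ T m As a → (∀ i → Unique (As i)) → (∀ i → Nonempty (As i)) → ι (length (prodList m As)) ≤ ι T * returns m As a →
      ∀ i → ι (length (As i)) ≤ ι T * pairs (As i) (a i)
    extract T (suc m) As a u ne h zero = cancelʳ (prodList-nonempty m _ λ i → ne (suc i)) (begin
      ι (length (As zero)) * ι (length G) ≡⟨ trans (sym (ι-* (length (As zero)) _)) (cong ι (sym (length-prodList m As))) ⟩
      ι (length (prodList (suc m) As)) ≤⟨ h ⟩
      ι T * returns (suc m) As a ≡⟨ trans (cong (λ t → ι T * t) (returns-suc m As a)) (sym (ℚₚ.*-assoc (ι T) _ _)) ⟩
      ι T * pairs (As zero) (a zero) * returns m (λ i → As (suc i)) (λ i → a (suc i))
        ≤⟨ *-monoˡ (0≤-* (0≤ι T) (0≤pairs (As zero) (a zero))) (returns≤ m _ _ λ i → u (suc i)) ⟩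
      ι T * pairs (As zero) (a zero) * ι (length G) ∎)
      where
      open ℚₚ.≤-Reasoning
      G = prodList m (λ i → As (suc i))
    extract T (suc m) As a u ne h (suc i) = extract T m _ _ (λ i → u (suc i)) (λ i → ne (suc i)) (cancelʳ (ne zero) (begin
      ι (length G) * ι (length (As zero)) ≡⟨ ℚₚ.*-comm (ι (length G)) _ ⟩
      ι (length (As zero)) * ι (length G) ≡⟨ trans (sym (ι-* (length (As zero)) _)) (cong ι (sym (length-prodList m As))) ⟩
      ι (length (prodList (suc m) As)) ≤⟨ h ⟩
      ι T * returns (suc m) As a ≡⟨ cong (λ t → ι T * t) (returns-suc m As a) ⟩
      ι T * (pairs (As zero) (a zero) * rest) ≤⟨ *-monoˡ (0≤ι T) (*-monoʳ (0≤returns m _ _) (pairs≤ (a zero) (u zero))) ⟩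
      ι T * (ι (length (As zero)) * rest) ≡⟨ lem (ι T) (ι (length (As zero))) rest ⟩
      ι T * rest * ι (length (As zero)) ∎)) i
      where
      open ℚₚ.≤-Reasoning
      G = prodList m (λ i → As (suc i))
      rest = returns m (λ i → As (suc i)) (λ i → a (suc i))
      lem : ∀ a b c → a * (b * c) ≡ a * c * b
      lem = solve-∀ ℚ-ring

    ∈-prodList⁻ : ∀ m As {x : Vec Pt m} → x ∈ prodList m As → ∀ i → lookup x i ∈ As i
    ∈-prodList⁻ (suc m) As x∈ i with ∈-cartesianProductWith⁻ _∷_ (As zero) (prodList m (λ i → As (suc i))) x∈
    ∈-prodList⁻ (suc m) As x∈ zero | y , ys , y∈ , ys∈ , refl = y∈
    ∈-prodList⁻ (suc m) As x∈ (suc i) | y , ys , y∈ , ys∈ , refl = ∈-prodList⁻ m _ ys∈ i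

    shiftAll-∈ : ∀ m As Bs a (x : Vec Pt m) → (∀ i → ∀ y → y ∈ As i → bump zero (a i) y ∈ Bs i) → x ∈ prodList m As → shiftAll a x ∈ prodList m Bs
    shiftAll-∈ zero As Bs a [] h x∈ = here refl
    shiftAll-∈ (suc m) As Bs a x h x∈ with ∈-cartesianProductWith⁻ _∷_ (As zero) (prodList m (λ i → As (suc i))) x∈
    ... | y , ys , y∈ , ys∈ , refl = ∈-cartesianProductWith⁺ _∷_ (h zero y y∈) (shiftAll-∈ m _ _ _ ys (λ i → h (suc i)) ys∈)

    length-prodList-≤ : ∀ D m As Bs → (∀ i → length (Bs i) ℕ.≤ D ℕ.* length (As i)) → length (prodList m Bs) ℕ.≤ D ℕ.^ m ℕ.* length (prodList m As)
    length-prodList-≤ D zero As Bs h = ℕₚ.≤-refl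
    length-prodList-≤ D (suc m) As Bs h = begin
      length (prodList (suc m) Bs) ≡⟨ length-prodList m Bs ⟩
      length (Bs zero) ℕ.* length (prodList m (λ i → Bs (suc i))) ≤⟨ ℕₚ.*-mono-≤ (h zero) (length-prodList-≤ D m _ _ λ i → h (suc i)) ⟩
      D ℕ.* length (As zero) ℕ.* (D ℕ.^ m ℕ.* length (prodList m (λ i → As (suc i)))) ≡⟨ lem D (length (As zero)) (D ℕ.^ m) _ ⟩
      D ℕ.* D ℕ.^ m ℕ.* (length (As zero) ℕ.* length (prodList m (λ i → As (suc i)))) ≡⟨ cong (D ℕ.^ suc m ℕ.*_) (sym (length-prodList m As)) ⟩
      D ℕ.^ suc m ℕ.* length (prodList (suc m) As) ∎
      where
      open ℕₚ.≤-Reasoning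
      lem : ∀ a b c d → a ℕ.* b ℕ.* (c ℕ.* d) ≡ a ℕ.* c ℕ.* (b ℕ.* d)
      lem = ℕ-solve

    window : ℕ → ℕ → List Pt
    window b R = cartesianProductWith _∷_ (map (λ j → + j ℤ.- + b) (downFrom (suc (2 ℕ.* b)))) (cube n R)

    window-unique : ∀ b R → Unique (window b R)
    window-unique b R = Uniqueₚ.cartesianProductWith⁺ _∷_ Vecₚ.∷-injective
      (Uniqueₚ.map⁺ (λ {i} {j} e → ℤₚ.+-injective (ℤ-cancelˡ (ℤ.- + b) (trans (ℤₚ.+-comm (ℤ.- + b) (+ i)) (trans e (ℤₚ.+-comm (+ j) (ℤ.- + b)))))) (Uniqueₚ.downFrom⁺ (suc (2 ℕ.* b))))
      (cube-unique n R)

    length-window : ∀ b R → length (window b R) ≡ suc (2 ℕ.* b) ℕ.* R ℕ.^ n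
    length-window b R = trans (length-product _∷_ (map (λ j → + j ℤ.- + b) (downFrom (suc (2 ℕ.* b)))) (cube n R))
      (cong₂ ℕ._*_ (trans (Listₚ.length-map _ (downFrom (suc (2 ℕ.* b)))) (Listₚ.length-downFrom (suc (2 ℕ.* b)))) (length-cube n R))

    ∈-window : ∀ {b R t} {x : Vec ℤ n} → ℤ.∣ t ∣ ℕ.≤ b → Between R x → (t ∷ x) ∈ window b R
    ∈-window {b} {R} {t} {x} h hx = ∈-cartesianProductWith⁺ _∷_ (head t h) (∈-cube⁺ hx)
      where
      head : ∀ t → ℤ.∣ t ∣ ℕ.≤ b → t ∈ map (λ j → + j ℤ.- + b) (downFrom (suc (2 ℕ.* b)))
      head (+ t) h = subst (_∈ map (λ j → + j ℤ.- + b) (downFrom (suc (2 ℕ.* b)))) (lem (+ t) (+ b))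
        (∈-map⁺ (λ j → + j ℤ.- + b) (∈-downFrom⁺ (ℕ.s≤s (ℕₚ.≤-trans (ℕₚ.+-monoˡ-≤ b h) (ℕₚ.≤-reflexive (cong (b ℕ.+_) (sym (ℕₚ.+-identityʳ b))))))))
        where
        lem : ∀ t b → t ℤ.+ b ℤ.- b ≡ t
        lem = ℤ-Solver.solve-∀
      head -[1+ t ] h = subst (_∈ map (λ j → + j ℤ.- + b) (downFrom (suc (2 ℕ.* b)))) e
        (∈-map⁺ (λ j → + j ℤ.- + b) (∈-downFrom⁺ {suc (2 ℕ.* b)} {b ℕ.∸ suc t} (ℕ.s≤s (ℕₚ.≤-trans (ℕₚ.m∸n≤m b (suc t)) (ℕₚ.m≤m+n b (b ℕ.+ 0))))))
        where
        e : + (b ℕ.∸ suc t) ℤ.- + b ≡ -[1+ t ]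
        e = trans (cong (ℤ._- + b) (sym (ℤₚ.⊖-≥ h))) (trans (cong (ℤ._- + b) (sym (ℤₚ.m-n≡m⊖n b (suc t)))) (lem (+ b) (+ suc t)))
          where
          lem : ∀ b t → b ℤ.- t ℤ.- b ≡ ℤ.- t
          lem = ℤ-Solver.solve-∀

  length-filter : {A : Set} {Q : A → Set} (Q? : ∀ x → Dec (Q x)) (xs : List A) → ι (length (filter Q? xs)) ≡ Σ xs (λ x → indicator (Q? x))
  length-filter Q? [] = refl
  length-filter Q? (x ∷ xs) with Q? x
  ... | yes _ = cong (λ t → 1ℚ + t) (length-filter Q? xs)
  ... | no _ = trans (length-filter Q? xs) (sym (ℚₚ.+-identityˡ _))

  module Popular {A B : Set} (_≟_ : DecidableEquality B) (class : A → B) where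
    fibre : B → List A → List A
    fibre b = filter (λ x → class x ≟ b)

    others : B → List A → List A
    others b = filter (λ x → ¬? (class x ≟ b))

    split-length : ∀ b xs → length xs ≡ length (fibre b xs) ℕ.+ length (others b xs)
    split-length b [] = refl
    split-length b (x ∷ xs) with class x ≟ b
    ... | yes _ = cong suc (split-length b xs)
    ... | no _ = trans (cong suc (split-length b xs)) (sym (ℕₚ.+-suc _ _))

    fibre-others : ∀ b c xs → length (fibre c (others b xs)) ℕ.≤ length (fibre c xs)
    fibre-others b c [] = ℕ.z≤n
    fibre-others b c (x ∷ xs) with class x ≟ b
    ... | yes _ = ℕₚ.≤-trans (fibre-others b c xs) (cons x)
      where
      cons : ∀ x → length (fibre c xs) ℕ.≤ length (fibre c (x ∷ xs))
      cons x with class x ≟ c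
      ... | yes _ = ℕₚ.n≤1+n _
      ... | no _ = ℕₚ.≤-refl
    ... | no _ with class x ≟ c
    ...   | yes _ = ℕ.s≤s (fibre-others b c xs)
    ...   | no _ = fibre-others b c xs

    popular : ∀ bs xs → B → (∀ x → x ∈ xs → class x ∈ bs) → ∃[ b ] length xs ℕ.≤ length bs ℕ.* length (fibre b xs)
    popular [] [] b₀ h = b₀ , ℕ.z≤n
    popular [] (x ∷ xs) b₀ h with h x (here refl)
    ... | ()
    popular (b ∷ bs) xs b₀ h with popular bs (others b xs) b₀ rest
      where
      rest : ∀ x → x ∈ others b xs → class x ∈ bs
      rest x x∈ with ∈-filter⁻ (λ x → ¬? (class x ≟ b)) {xs = xs} x∈
      ... | x∈xs , ≢b with h x x∈xs
      ...   | here e = ⊥-elim (≢b e)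
      ...   | there p = p
    ... | c , le with ℕₚ.≤-total (length (fibre b xs)) (length (fibre c xs))
    ...   | inj₁ b≤c = c , ℕₚ.≤-trans (ℕₚ.≤-reflexive (split-length b xs)) (ℕₚ.+-mono-≤ b≤c (ℕₚ.≤-trans le (ℕₚ.*-monoʳ-≤ (length bs) (fibre-others b c xs))))
    ...   | inj₂ c≤b = b , ℕₚ.≤-trans (ℕₚ.≤-reflexive (split-length b xs)) (ℕₚ.+-monoʳ-≤ (length (fibre b xs))
      (ℕₚ.≤-trans le (ℕₚ.*-monoʳ-≤ (length bs) (ℕₚ.≤-trans (fibre-others b c xs) c≤b))))

-- Dense monochromatic families at one scale.

module MonochromaticStructures where
  open import Data.Rational using (_+_; _*_; _-_; -_; _≤_)
  open import Tactic.RingSolver using (solve-∀)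
  open RationalSums
  open InnerProductSpaces
  open BoxEstimates
  open AveragingPlans
  open PolynomialDifferences using (Deg; dot; linear-sum)
  open FormAbsorption
  open PlanBoundsAndSpread
  open RecurrenceLevels
  open PolynomialRecurrence using (recurrence; module Returns)
  open GallaiTheorem
  open FiniteSpaces
  open PointSets

  ∈-≤-sum : {A : Set} (f : A → ℕ) {x : A} (xs : List A) → x ∈ xs → f x ℕ.≤ sum (map f xs)
  ∈-≤-sum f (x ∷ xs) (here refl) = ℕₚ.m≤m+n (f x) _
  ∈-≤-sum f (x ∷ xs) (there x∈) = ℕₚ.≤-trans (∈-≤-sum f xs x∈) (ℕₚ.m≤n+m _ (f x))

  vectors : {A : Set} → ∀ t → List A → List (Vec A t)
  vectors zero xs = [ [] ]
  vectors (suc t) xs = cartesianProductWith _∷_ xs (vectors t xs)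

  ∈-vectors : {A : Set} {t : ℕ} {xs : List A} {us : Vec A t} → All (_∈ xs) us → us ∈ vectors t xs
  ∈-vectors [] = here refl
  ∈-vectors (p ∷ ps) = ∈-cartesianProductWith⁺ _∷_ p (∈-vectors ps)

  -- The leading 1 turns z₀ + f · w into a dot product and is the normalisation f₀ = 1 on which the
  -- recurrence theorem rests.
  hat : ∀ {l} → Vec ℕ l → Vec ℤ (suc l)
  hat f = + 1 ∷ Vec.map +_ f

  dot-nonNeg : ∀ {l q R} (f : Vec ℕ l) {w : Vec ℤ l} → All (ℕ._≤ q) f → Between R w →
    + 0 ℤ.≤ dot (Vec.map +_ f) w × dot (Vec.map +_ f) w ℤ.≤ + (l ℕ.* (q ℕ.* R))
  dot-nonNeg [] [] [] = ℤₚ.≤-refl , ℤₚ.≤-refl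
  dot-nonNeg {suc l} {q} {R} (f ∷ fs) {+ w ∷ ws} (p ∷ ps) ((lo , ℤ.+≤+ hi) ∷ qs) with dot-nonNeg fs ps qs
  ... | lower , upper = ℤₚ.+-mono-≤ (ℤₚ.≤-trans (ℤ.+≤+ ℕ.z≤n) (ℤₚ.≤-reflexive (ℤₚ.pos-* f w))) lower ,
    ℤₚ.≤-trans (ℤₚ.+-mono-≤ (ℤₚ.≤-trans (ℤₚ.≤-reflexive (sym (ℤₚ.pos-* f w))) (ℤ.+≤+ (ℕₚ.*-mono-≤ p hi))) upper) ℤₚ.≤-refl
  dot-nonNeg (f ∷ fs) { -[1+ w ] ∷ ws} (p ∷ ps) ((() , _) ∷ qs)

  value-bounds : ∀ {l q R} (f : Vec ℕ l) {y : Vec ℤ (suc l)} → All (ℕ._≤ q) f → Between R y →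
    + 1 ℤ.≤ dot (hat f) y × dot (hat f) y ℤ.≤ + (suc (l ℕ.* q) ℕ.* R)
  value-bounds {l} {q} {R} f {z ∷ w} hf ((lo , hi) ∷ hw) with dot-nonNeg f hf hw
  ... | lower , upper = ℤₚ.+-mono-≤ (ℤₚ.≤-trans lo (ℤₚ.≤-reflexive (sym (ℤₚ.*-identityˡ z)))) lower ,
    ℤₚ.≤-trans (ℤₚ.+-mono-≤ (ℤₚ.≤-trans (ℤₚ.≤-reflexive (ℤₚ.*-identityˡ z)) hi) upper) (ℤₚ.≤-reflexive (cong +_ (cong (R ℕ.+_) (sym (ℕₚ.*-assoc l q R)))))

  value : ∀ {l} → Vec ℤ (suc l) → Vec ℕ l → ℕ
  value y f = ℤ.∣ dot (hat f) y ∣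

  module Structures (a₀ a₁ : ℤ) (P : List ℤ) (s : ℤ) (deg : Deg (suc (length P)) (eval (a₀ ∷ a₁ ∷ P)) s) (1≤∣s∣ : 1 ℕ.≤ ℤ.∣ s ∣)
    (intersective : Intersective (a₀ ∷ a₁ ∷ P)) (l t r β : ℕ) (b₁ : ℤ) (1≤∣b₁∣ : 1 ℕ.≤ ℤ.∣ b₁ ∣) (es : Vec ℤ t) where
    open Gallai l using (Point; Bounded; box; ∈-box; gallai; Homothet; Mono; _⊹_; _⊛_; Bounded-⊹; Bounded-⊛; Bounded-weaken)
    open Points l

    n k : ℕ
    n = suc l
    k = length P

    pol : List ℤ
    pol = a₀ ∷ a₁ ∷ P

    ∈-box⁻ : ∀ {l K} {f : Vec ℕ l} → f ∈ box l K → Bounded K f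
    ∈-box⁻ {zero} {f = []} f∈ = []
    ∈-box⁻ {suc l} {K} f∈ with ∈-cartesianProductWith⁻ _∷_ (downFrom (suc K)) (box l K) f∈
    ... | x , f , x∈ , f∈ , refl = ℕₚ.≤-pred (∈-downFrom⁻ x∈) ∷ ∈-box⁻ f∈

    abstract
      homothets : ∃[ K ] ∀ (χ : Point → Fin r) → Homothet K χ (box l β)
      homothets = gallai β (box l β) (λ f f∈ → ∈-box⁻ f∈) r

    K bound : ℕ
    K = proj₁ homothets
    bound = K ℕ.+ K ℕ.* β

    -- Every position offset + step f′ that Gallai's theorem might select. The selection depends on
    -- the point y, so differences are made popular for all tuples from this list beforehand.
    configuration : List Point
    configuration = box l bound

    -- Shifting the scaled point by L₂(P(z)) moves z₀ by L₂(P(z)) / b₁ without a division.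
    scaled : Pt → Pt
    scaled (z ∷ w) = b₁ ℤ.* z ∷ w

    scaled-injective : Injective scaled
    scaled-injective {z ∷ w} {z′ ∷ w′} e = cong₂ _∷_ (ℤₚ.*-cancelˡ-≡ b₁ z z′ {{ℤ.≢-nonZero nonzero}} (Vecₚ.∷-injectiveˡ e)) (Vecₚ.∷-injectiveʳ e)
      where
      nonzero : ¬ b₁ ≡ + 0
      nonzero e = ℕₚ.<-irrefl refl (ℕₚ.≤-trans 1≤∣b₁∣ (ℕₚ.≤-reflexive (cong ℤ.∣_∣ e)))

    form : Vec Point t → List (ℤ × Vec ℤ n)
    form us = Vec.toList (Vec.zipWith (λ e u → e , hat u) es us)

    form-monic : ∀ us → ListAll.All (λ ef → lookup (proj₂ ef) zero ≡ + 1) (form us)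
    form-monic = monic es
      where
      monic : ∀ {t} (es : Vec ℤ t) us → ListAll.All (λ ef → lookup (proj₂ ef) zero ≡ + 1) (Vec.toList (Vec.zipWith (λ e u → e , hat u) es us))
      monic [] [] = ListAll.[]
      monic (e ∷ es) (u ∷ us) = refl ListAll.∷ monic es us

    target : Vec Point t → Pt → ℤ
    target us y = linear-sum (λ f → eval pol (dot f y)) (form us)

    -- A point y = (z₀ , w) stands for the family z₀ + f · w, f ∈ ℕˡ; the one labelled colour is at f = offset + step f′, f′ bounded by β.
    record Structure (χ : ℕ → Fin r) (D R : ℕ) : Set where
      field
        points : List Pt
        unique : Unique points
        between : ∀ y → y ∈ points → Between R y
        offset : Point
        step : ℕ
        offset≤ : Bounded K offset
        1≤step : 1 ℕ.≤ step
        step≤ : step ℕ.≤ K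
        colour : Fin r
        mono : ∀ y → y ∈ points → ∀ f → Bounded β f → χ (value y (offset ⊹ step ⊛ f)) ≡ colour
        value≤ : ∀ y → y ∈ points → ∀ f → Bounded β f → value y (offset ⊹ step ⊛ f) ℕ.≤ R
        many : R ℕ.^ n ℕ.≤ D ℕ.* length points

    open Structure public

    Recurrent : ∀ {χ D R D′ R′} → ℕ → Structure χ D R → Structure χ D′ R′ → Set
    Recurrent T new old = ∀ y → y ∈ points new → ∀ us → All (_∈ configuration) us →
      ι (length (points old)) ≤ ι T * pairs (map scaled (points old)) (target us y)

    module Step (q D : ℕ) (1≤D : 1 ℕ.≤ D) where
      -- One coordinate of the acting group for each larger scale and each tuple of positions.
      coordinates : List (Fin q × Vec Point t)
      coordinates = cartesianProduct (allFin q) (vectors t configuration)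

      m : ℕ
      m = length coordinates

      coordinate : Fin m → Fin q × Vec Point t
      coordinate = List.lookup coordinates

      forms : Fin m → List (ℤ × Vec ℤ n)
      forms i = form (proj₂ (coordinate i))

      monic : ∀ i → ListAll.All (λ ef → lookup (proj₂ ef) zero ≡ + 1) (forms i)
      monic i = form-monic (proj₂ (coordinate i))

      directions-bound : ℕ
      directions-bound = sum (map (λ is → sum (map (λ i → ℤ.∣ Direction forms is i ∣) (allFin m))) (indices n (suc k)))

      direction≤ : ∀ (is : Vec (Fin n) (suc k)) i → ℤ.∣ Direction forms is i ∣ ℕ.≤ directions-bound
      direction≤ is i = ℕₚ.≤-trans (∈-≤-sum (λ i → ℤ.∣ Direction forms is i ∣) (allFin m) (∈-allFin i))
        (∈-≤-sum (λ is → sum (map (λ i → ℤ.∣ Direction forms is i ∣) (allFin m))) (indices n (suc k)) (∈-indices is))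

      β₁ D₀ Dᵗ : ℕ
      β₁ = suc ℤ.∣ b₁ ∣
      -- The window |t| ≤ β₁ R for first coordinates holds the scaled points and their shifts, and
      -- has at most 3 β₁ R^n elements: |b₁| in `β₁` is for the scaling, 1 for the shift.
      D₀ = 3 ℕ.* β₁ ℕ.* D
      Dᵗ = D₀ ℕ.^ m

      1≤Dᵗ : 1 ℕ.≤ Dᵗ
      1≤Dᵗ = ^-pos m (*-pos {3 ℕ.* β₁} (*-pos {3} {β₁} (ℕ.s≤s ℕ.z≤n) (ℕ.s≤s ℕ.z≤n)) 1≤D)

      module R {X : IPS (Fin m)} = Returns l (Fin m) forms monic a₀ a₁ P s deg 1≤∣s∣ intersective X

      abstract
        theorem : Σ[ E′ ∈ ℕ ] Σ[ C ∈ ℕ ] (∀ u → 1 ℕ.≤ u → ∀ (H : IPS (Fin m)) g →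
          (∀ A → ShiftBound A (E′ ℕ.* u ℕ.^ suc k) → R.N {H} g ≤ ι Dᵗ * R.N {H} (R.⟦_⟧ {H} A g)) →
          R.Positive {H} g → R.Conclusion {H} C u g)
        theorem = recurrence l (Fin m) forms monic a₀ a₁ P s deg 1≤∣s∣ intersective Dᵗ 1≤Dᵗ directions-bound direction≤

      E′ C V 𝔾 T : ℕ
      E′ = proj₁ theorem
      -- The successor makes C ≥ 1, which `markov` uses.
      C = suc (proj₁ (proj₂ theorem))
      V = suc (l ℕ.* bound)
      -- For u = R / 𝔾 the shifts E′ u^d stay within the larger scales, and the values at points of
      -- size C u stay below R.
      𝔾 = E′ ℕ.+ C ℕ.* V ℕ.+ 1
      T = 2 ℕ.* C ℕ.^ suc n

      Classes : Set
      Classes = Point × ℕ × Fin r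

      classes : List Classes
      classes = cartesianProduct (box l K) (cartesianProduct (downFrom (suc K)) (allFin r))

      _≟c_ : DecidableEquality Classes
      _≟c_ = Productₚ.≡-dec (Vecₚ.≡-dec ℕ._≟_) (Productₚ.≡-dec ℕ._≟_ Fin._≟_)

      D′ : ℕ
      D′ = (2 ℕ.* 𝔾) ℕ.^ n ℕ.* (C ℕ.* T ℕ.* length classes)

      p : Vec ℤ n → Fin m → ℤ
      p = Recurrence.p l (Fin m) forms monic a₀ a₁ P s deg 1≤∣s∣ intersective

      module At (R : ℕ) (𝔾≤R : 𝔾 ℕ.≤ R) (χ : ℕ → Fin r) (scale : Fin q → ℕ) (R^d≤ : ∀ j → R ℕ.^ suc k ℕ.≤ scale j)
        (old : ∀ j → Structure χ D (scale j)) where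

        1≤𝔾 : 1 ℕ.≤ 𝔾
        1≤𝔾 = ℕₚ.m≤n+m 1 (E′ ℕ.+ C ℕ.* V)

        instance
          𝔾≢0 : ℕ.NonZero 𝔾
          𝔾≢0 = ℕ.>-nonZero 1≤𝔾

        u : ℕ
        u = R DivMod./ 𝔾

        1≤u : 1 ℕ.≤ u
        1≤u = DivMod.m≥n⇒m/n>0 𝔾≤R

        𝔾u≤R : 𝔾 ℕ.* u ℕ.≤ R
        𝔾u≤R = ℕₚ.≤-trans (ℕₚ.≤-reflexive (ℕₚ.*-comm 𝔾 u)) (DivMod.m/n*n≤m R 𝔾)

        R≤2𝔾u : R ℕ.≤ 2 ℕ.* 𝔾 ℕ.* u
        R≤2𝔾u = begin
          R ≡⟨ DivMod.m≡m%n+[m/n]*n R 𝔾 ⟩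
          R DivMod.% 𝔾 ℕ.+ u ℕ.* 𝔾 ≤⟨ ℕₚ.+-monoˡ-≤ (u ℕ.* 𝔾) (ℕₚ.≤-trans (ℕₚ.<⇒≤ (DivMod.m%n<n R 𝔾)) (≤-*ˡ 𝔾 1≤u)) ⟩
          u ℕ.* 𝔾 ℕ.+ u ℕ.* 𝔾 ≡⟨ lem u 𝔾 ⟩
          2 ℕ.* 𝔾 ℕ.* u ∎
          where
          open ℕₚ.≤-Reasoning
          lem : ∀ u g → u ℕ.* g ℕ.+ u ℕ.* g ≡ 2 ℕ.* g ℕ.* u
          lem = ℕ-solve

        1≤R : 1 ℕ.≤ R
        1≤R = ℕₚ.≤-trans 1≤𝔾 𝔾≤R

        1≤scale : ∀ j → 1 ℕ.≤ scale j
        1≤scale j = ℕₚ.≤-trans (^-pos (suc k) 1≤R) (R^d≤ j)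

        CVu≤R : V ℕ.* (C ℕ.* u) ℕ.≤ R
        CVu≤R = ℕₚ.≤-trans (ℕₚ.≤-reflexive (lem V C u)) (ℕₚ.≤-trans (ℕₚ.*-monoˡ-≤ u (ℕₚ.≤-trans (ℕₚ.m≤n+m (C ℕ.* V) E′) (ℕₚ.m≤m+n _ 1))) 𝔾u≤R)
          where
          lem : ∀ v c u → v ℕ.* (c ℕ.* u) ≡ c ℕ.* v ℕ.* u
          lem = ℕ-solve

        Cu≤R : C ℕ.* u ℕ.≤ R
        Cu≤R = ℕₚ.≤-trans (≤-*ˡ {V} (C ℕ.* u) (ℕ.s≤s ℕ.z≤n)) CVu≤R

        shift≤ : ∀ j → E′ ℕ.* u ℕ.^ suc k ℕ.≤ scale j
        shift≤ j = begin
          E′ ℕ.* u ℕ.^ suc k ≤⟨ ℕₚ.*-monoˡ-≤ (u ℕ.^ suc k) (ℕₚ.≤-trans (ℕₚ.≤-trans (ℕₚ.m≤m+n E′ (C ℕ.* V)) (ℕₚ.m≤m+n _ 1)) (≤-*ʳ 𝔾 (^-pos k 1≤𝔾))) ⟩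
          𝔾 ℕ.^ suc k ℕ.* u ℕ.^ suc k ≡⟨ sym (*-^ 𝔾 u (suc k)) ⟩
          (𝔾 ℕ.* u) ℕ.^ suc k ≤⟨ ℕₚ.^-monoˡ-≤ (suc k) 𝔾u≤R ⟩
          R ℕ.^ suc k ≤⟨ R^d≤ j ⟩
          scale j ∎
          where open ℕₚ.≤-Reasoning

        source : Fin m → Fin q
        source i = proj₁ (coordinate i)

        As Bs : Fin m → List Pt
        As i = map scaled (points (old (source i)))
        Bs i = window (β₁ ℕ.* scale (source i)) (scale (source i))

        As-unique : ∀ i → Unique (As i)
        As-unique i = Uniqueₚ.map⁺ scaled-injective (unique (old (source i)))

        length-As : ∀ i → length (As i) ≡ length (points (old (source i)))
        length-As i = Listₚ.length-map scaled (points (old (source i)))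

        As-nonempty : ∀ i → Nonempty (As i)
        As-nonempty i = ℕₚ.≤-trans (positive (ℕₚ.≤-trans (^-pos n (1≤scale (source i))) (many (old (source i))))) (ℕₚ.≤-reflexive (sym (length-As i)))
          where
          positive : ∀ {x} → 1 ℕ.≤ D ℕ.* x → 1 ℕ.≤ x
          positive {zero} h = ⊥-elim (ℕₚ.<-irrefl refl (ℕₚ.≤-trans h (ℕₚ.≤-reflexive (ℕₚ.*-zeroʳ D))))
          positive {suc x} h = ℕ.s≤s ℕ.z≤n

        Bs-large : ∀ i → length (Bs i) ℕ.≤ D₀ ℕ.* length (As i)
        Bs-large i = begin
          length (Bs i) ≡⟨ length-window (β₁ ℕ.* Rj) Rj ⟩
          suc (2 ℕ.* (β₁ ℕ.* Rj)) ℕ.* Rj ℕ.^ l ≤⟨ ℕₚ.*-monoˡ-≤ (Rj ℕ.^ l) (ℕₚ.+-monoˡ-≤ (2 ℕ.* (β₁ ℕ.* Rj)) (*-pos {β₁} (ℕ.s≤s ℕ.z≤n) (1≤scale j))) ⟩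
          (β₁ ℕ.* Rj ℕ.+ 2 ℕ.* (β₁ ℕ.* Rj)) ℕ.* Rj ℕ.^ l ≡⟨ lem β₁ Rj (Rj ℕ.^ l) ⟩
          3 ℕ.* β₁ ℕ.* Rj ℕ.^ n ≤⟨ ℕₚ.*-monoʳ-≤ (3 ℕ.* β₁) (many (old j)) ⟩
          3 ℕ.* β₁ ℕ.* (D ℕ.* length (points (old j))) ≡⟨ trans (sym (ℕₚ.*-assoc (3 ℕ.* β₁) D _)) (cong (D₀ ℕ.*_) (sym (length-As i))) ⟩
          D₀ ℕ.* length (As i) ∎
          where
          open ℕₚ.≤-Reasoning
          j = source i
          Rj = scale j
          lem : ∀ b r x → (b ℕ.* r ℕ.+ 2 ℕ.* (b ℕ.* r)) ℕ.* x ≡ 3 ℕ.* b ℕ.* (r ℕ.* x)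
          lem = ℕ-solve

        near : ∀ a → (∀ i → ℤ.∣ a i ∣ ℕ.≤ E′ ℕ.* u ℕ.^ suc k) → ∀ x → x ∈ prodList m As → shiftAll a x ∈ prodList m Bs
        near a ha x = shiftAll-∈ m As Bs a x λ i y y∈ → move i y (∈-map⁻ scaled y∈)
          where
          move : ∀ i y → ∃[ y₀ ] (y₀ ∈ points (old (source i)) × y ≡ scaled y₀) → bump zero (a i) y ∈ Bs i
          move i y ((z ∷ w) , y₀∈ , refl) with between (old (source i)) (z ∷ w) y₀∈
          ... | hz ∷ hw = ∈-window (ℕₚ.≤-trans (ℤₚ.∣i+j∣≤∣i∣+∣j∣ (a i) (b₁ ℤ.* z)) (ℕₚ.+-mono-≤ (ℕₚ.≤-trans (ha i) (shift≤ (source i)))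
            (ℕₚ.≤-trans (ℕₚ.≤-reflexive (ℤₚ.abs-* b₁ z)) (ℕₚ.*-monoʳ-≤ ℤ.∣ b₁ ∣ (Between⇒∣∣′ hz))))) hw
            where
            Between⇒∣∣′ : ∀ {b z} → + 1 ℤ.≤ z × z ℤ.≤ + b → ℤ.∣ z ∣ ℕ.≤ b
            Between⇒∣∣′ {z = + z} (_ , ℤ.+≤+ h) = h
            Between⇒∣∣′ {z = -[1+ z ]} (() , _)

        G : List (Vec Pt m)
        G = prodList m As

        open Space m using (space; unit; norm-unit; ip-translate; module Dense)

        ret : Pt → ℚ
        ret y = returns m As (p y)

        recurs : ι (u ℕ.^ n) * ι (length G) ≤ ι C * Σ (cube n (C ℕ.* u)) ret
        recurs = subst₂ (λ a b → ι (u ℕ.^ n) * a ≤ ι C * b) (norm-unit (prodList-unique m As As-unique))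
          (Σ-cong (cube n (C ℕ.* u)) λ y → ip-translate (p y) G G)
          (R.conclusion-mono {space} {proj₁ (proj₂ theorem)} {C} u (unit G) positive (ℕₚ.n≤1+n (proj₁ (proj₂ theorem)))
            (proj₂ (proj₂ theorem) u 1≤u space (unit G)
              (λ A sb → Dense.dense G (prodList m Bs) (prodList-unique m As As-unique) (prodList-unique m Bs (λ i → window-unique (β₁ ℕ.* scale (source i)) (scale (source i))))
                (E′ ℕ.* u ℕ.^ suc k) near Dᵗ 1≤Dᵗ (length-prodList-≤ D₀ m As Bs Bs-large) A (E′ ℕ.* u ℕ.^ suc k) ℕₚ.≤-refl sb)
              positive))
          where
          positive : ∀ a → 0ℚ ≤ _
          positive a = subst (0ℚ ≤_) (sym (ip-translate a G G)) (0≤returns m As a)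

        good? : ∀ y → Dec (ι (length G) ≤ ι T * ret y)
        good? y = ι (length G) ℚ.≤? (ι T * ret y)

        selected : List Pt
        selected = filter good? (cube n (C ℕ.* u))

        -- Times T, `recurs` gives T u^n γ ≤ C T γ |selected| + C^(n+1) u^n γ: a selected point
        -- returns at most γ = |G|, any other less than γ/T. The choice T = 2 C^(n+1) leaves the
        -- last term at half of the left side.
        markov : u ℕ.^ n ℕ.≤ C ℕ.* T ℕ.* length selected
        markov = ι-reflects-≤ (cancelʳ (prodList-nonempty m As As-nonempty) (≤-by
          (ι T * (ι C * Σ cubes ret - ι (u ℕ.^ n) * γ) + ι C * (Σ cubes (λ y → ι T * γ * indicator (good? y) + γ) - Σ cubes (λ y → ι T * ret y)) + rest)
          (0≤-+ (0≤-+ (0≤-* (0≤ι T) (0≤-diff recurs)) (0≤-* (0≤ι C) (0≤-diff (Σ-mono cubes λ y _ → each y)))) 0≤rest)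
          total))
          where
          cubes = cube n (C ℕ.* u)
          γ = ι (length G)
          U = ι (u ℕ.^ n)
          Cn = ι (C ℕ.^ n)
          each : ∀ y → ι T * ret y ≤ ι T * γ * indicator (good? y) + γ
          each y with good? y
          ... | yes _ = ℚₚ.≤-trans (*-monoˡ (0≤ι T) (returns≤ m As (p y) As-unique)) (≤-by γ (0≤ι (length G)) (cong (_+ γ) (ℚₚ.*-identityʳ (ι T * γ))))
          ... | no bad = ℚₚ.≤-trans (ℚₚ.<⇒≤ (ℚₚ.≰⇒> bad)) (ℚₚ.≤-reflexive (sym (trans (cong (_+ γ) (ℚₚ.*-zeroʳ (ι T * γ))) (ℚₚ.+-identityˡ γ))))
          rest = (ι C * Cn - 1ℚ) * U * γ
          0≤rest : 0ℚ ≤ rest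
          0≤rest = 0≤-* (0≤-* (0≤-diff (ℚₚ.≤-trans (ι-mono {1} (^-pos (suc n) (ℕ.s≤s ℕ.z≤n))) (ℚₚ.≤-reflexive (ι-* C (C ℕ.^ n))))) (0≤ι (u ℕ.^ n))) (0≤ι (length G))
          total-mass : Σ cubes (λ y → ι T * γ * indicator (good? y) + γ) ≡ ι T * γ * ι (length selected) + Cn * U * γ
          total-mass = trans (Σ-+ cubes _ _) (cong₂ _+_ (trans (Σ-* cubes (ι T * γ) _) (cong (λ t → ι T * γ * t) (sym (length-filter good? cubes))))
            (trans (Σ-const cubes γ) (cong (_* γ) (trans (cong ι (trans (length-cube n (C ℕ.* u)) (*-^ C u n))) (ι-* (C ℕ.^ n) (u ℕ.^ n))))))
          T≡ : ι T ≡ ι 2 * (ι C * Cn)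
          T≡ = trans (ι-* 2 (C ℕ.^ suc n)) (cong (λ t → ι 2 * t) (ι-* C (C ℕ.^ n)))
          total : ι (C ℕ.* T ℕ.* length selected) * γ ≡ U * γ +
            (ι T * (ι C * Σ cubes ret - U * γ) + ι C * (Σ cubes (λ y → ι T * γ * indicator (good? y) + γ) - Σ cubes (λ y → ι T * ret y)) + rest)
          total = trans (cong (_* γ) (trans (ι-* (C ℕ.* T) (length selected)) (cong (_* ι (length selected)) (ι-* C T))))
            (trans (cong (λ t → ι C * t * ι (length selected) * γ) T≡) (trans (lem (ι C) Cn (ι (length selected)) γ U (Σ cubes ret))
              (sym (cong₂ (λ a b → U * γ + (a * (ι C * Σ cubes ret - U * γ) + ι C * b + rest)) T≡
                (trans (cong₂ _-_ total-mass (Σ-* cubes (ι T) ret)) (cong (λ t → t * γ * ι (length selected) + Cn * U * γ - t * Σ cubes ret) T≡))))))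
            where
            lem : ∀ c d z g u r → c * (ι 2 * (c * d)) * z * g ≡ u * g + (ι 2 * (c * d) * (c * r - u * g) +
              c * (ι 2 * (c * d) * g * z + d * u * g - ι 2 * (c * d) * r) + (c * d - 1ℚ) * u * g)
            lem = solve-∀ ℚ-ring

        homothet : ∀ y → Homothet K (λ f → χ (value y f)) (box l β)
        homothet y = proj₂ homothets (λ f → χ (value y f))

        origin : Point
        origin = Vec.replicate l 0

        origin≤ : Bounded β origin
        origin≤ = zeros l
          where
          zeros : ∀ l → All (ℕ._≤ β) (Vec.replicate l 0)
          zeros zero = []
          zeros (suc l) = ℕ.z≤n ∷ zeros l

        -- Position, step and colour of the monochromatic copy take boundedly many values, so a
        -- positive proportion of the selected points agree in all three.
        class : Pt → Classes
        class y = let a , e , _ = homothet y in a , e , χ (value y (a ⊹ e ⊛ origin))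

        class∈ : ∀ y → class y ∈ classes
        class∈ y = let a , e , a≤ , _ , e≤ , _ = homothet y in
          ∈-cartesianProduct⁺ (∈-box a≤) (∈-cartesianProduct⁺ (∈-downFrom⁺ (ℕ.s≤s e≤)) (∈-allFin _))

        module Pop = Popular _≟c_ class

        chosen = Pop.popular classes selected (class (Vec.replicate n (+ 0))) (λ y _ → class∈ y)

        pts : List Pt
        pts = Pop.fibre (proj₁ chosen) selected

        pts⁻ : ∀ {y} → y ∈ pts → y ∈ cube n (C ℕ.* u) × ι (length G) ≤ ι T * ret y × class y ≡ proj₁ chosen
        pts⁻ {y} y∈ = let y∈s , e = ∈-filter⁻ (λ x → class x ≟c proj₁ chosen) {xs = selected} y∈
                          y∈c , h = ∈-filter⁻ good? {xs = cube n (C ℕ.* u)} y∈s in y∈c , h , e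

        many-pts : R ℕ.^ n ℕ.≤ D′ ℕ.* length pts
        many-pts = begin
          R ℕ.^ n ≤⟨ ℕₚ.^-monoˡ-≤ n R≤2𝔾u ⟩
          (2 ℕ.* 𝔾 ℕ.* u) ℕ.^ n ≡⟨ *-^ (2 ℕ.* 𝔾) u n ⟩
          (2 ℕ.* 𝔾) ℕ.^ n ℕ.* u ℕ.^ n ≤⟨ ℕₚ.*-monoʳ-≤ ((2 ℕ.* 𝔾) ℕ.^ n) (ℕₚ.≤-trans markov (ℕₚ.*-monoʳ-≤ (C ℕ.* T) (proj₂ chosen))) ⟩
          (2 ℕ.* 𝔾) ℕ.^ n ℕ.* (C ℕ.* T ℕ.* (length classes ℕ.* length pts)) ≡⟨ lem ((2 ℕ.* 𝔾) ℕ.^ n) (C ℕ.* T) (length classes) (length pts) ⟩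
          D′ ℕ.* length pts ∎
          where
          open ℕₚ.≤-Reasoning
          lem : ∀ a b c d → a ℕ.* (b ℕ.* (c ℕ.* d)) ≡ a ℕ.* (b ℕ.* c) ℕ.* d
          lem = ℕ-solve

        witness : ∃[ y ] y ∈ pts
        witness = inhabited pts many-pts
          where
          inhabited : ∀ xs → R ℕ.^ n ℕ.≤ D′ ℕ.* length xs → ∃[ y ] y ∈ xs
          inhabited [] h = ⊥-elim (ℕₚ.<-irrefl refl (ℕₚ.≤-trans (^-pos n 1≤R) (ℕₚ.≤-trans h (ℕₚ.≤-reflexive (ℕₚ.*-zeroʳ D′)))))
          inhabited (y ∷ ys) h = y , here refl

        build : ∀ c → (∀ y → y ∈ pts → class y ≡ c) → ∀ y₀ → y₀ ∈ pts → Structure χ D′ R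
        build (a , e , κ) class≡ y₀ y₀∈ = record
          { points = pts
          ; unique = Uniqueₚ.filter⁺ (λ x → class x ≟c proj₁ chosen) (Uniqueₚ.filter⁺ good? (cube-unique n (C ℕ.* u)))
          ; between = λ y y∈ → Between-weaken Cu≤R (∈-cube⁻ n (proj₁ (pts⁻ y∈)))
          ; offset = a
          ; step = e
          ; offset≤ = a≤
          ; 1≤step = subst (1 ℕ.≤_) (cong (λ c → proj₁ (proj₂ c)) (class≡ y₀ y₀∈)) (proj₁ (proj₂ (proj₂ (proj₂ (homothet y₀)))))
          ; step≤ = e≤
          ; colour = κ
          ; mono = λ y y∈ f hf → subst (λ c → χ (value y (proj₁ c ⊹ proj₁ (proj₂ c) ⊛ f)) ≡ proj₂ (proj₂ c)) (class≡ y y∈)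
              (proj₂ (proj₂ (proj₂ (proj₂ (proj₂ (homothet y))))) f origin (∈-box hf) (∈-box origin≤))
          ; value≤ = λ y y∈ f hf → ∣∣≤ (value-bounds (a ⊹ e ⊛ f) (Bounded-⊹ a≤ (Bounded-⊛ e≤ hf)) (∈-cube⁻ n (proj₁ (pts⁻ y∈))))
          ; many = many-pts
          }
          where
          a≤ : Bounded K a
          a≤ = subst (Bounded K) (cong proj₁ (class≡ y₀ y₀∈)) (proj₁ (proj₂ (proj₂ (homothet y₀))))
          e≤ : e ℕ.≤ K
          e≤ = subst (ℕ._≤ K) (cong (λ c → proj₁ (proj₂ c)) (class≡ y₀ y₀∈)) (proj₁ (proj₂ (proj₂ (proj₂ (proj₂ (homothet y₀))))))
          ∣∣≤ : ∀ {v} → + 1 ℤ.≤ v × v ℤ.≤ + (V ℕ.* (C ℕ.* u)) → ℤ.∣ v ∣ ℕ.≤ R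
          ∣∣≤ {+ v} (_ , ℤ.+≤+ h) = ℕₚ.≤-trans h CVu≤R
          ∣∣≤ { -[1+ v ]} (() , _)

        new : Structure χ D′ R
        new = build (proj₁ chosen) (λ y y∈ → proj₂ (proj₂ (pts⁻ y∈))) (proj₁ witness) (proj₂ witness)

        recurrent : ∀ j → Recurrent T new (old j)
        recurrent j y y∈ us us∈ = transfer (Any.index c∈) (Anyₚ.lookup-index c∈)
          where
          c∈ : (j , us) ∈ coordinates
          c∈ = ∈-cartesianProduct⁺ (∈-allFin j) (∈-vectors us∈)
          transfer : ∀ i → (j , us) ≡ coordinate i → ι (length (points (old j))) ≤ ι T * pairs (map scaled (points (old j))) (target us y)
          transfer i e = subst (λ c → ι (length (points (old (proj₁ c)))) ≤ ι T * pairs (map scaled (points (old (proj₁ c)))) (target (proj₂ c) y))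
            (sym e) (subst (λ x → ι x ≤ ι T * pairs (As i) (p y i)) (length-As i)
              (extract T m As (p y) As-unique As-nonempty (proj₁ (proj₂ (pts⁻ y∈))) i))

-- Weights that solve the linear equation.

module Weights where
  open import Data.Integer using (_+_; _*_; _-_; -_)
  open import Data.Integer.Tactic.RingSolver using (solve-∀)
  open import Defs using (applyL; ones; allVecs)
  open RationalSums
  open InnerProductSpaces
  open BoxEstimates
  open AveragingPlans
  open PolynomialDifferences using (Deg; dot; linear-sum)
  open FormAbsorption
  open PlanBoundsAndSpread
  open RecurrenceLevels
  open PolynomialRecurrence using ()
  open GallaiTheorem
  open FiniteSpaces
  open PointSets
  open MonochromaticStructures

  weigh : ∀ {l} → Vec ℕ l → Vec ℤ l → ℤ
  weigh f w = dot (Vec.map +_ f) w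

  weigh-++ : ∀ {l l′} (f : Vec ℕ l) (g : Vec ℕ l′) w v → weigh (f Vec.++ g) (w Vec.++ v) ≡ weigh f w + weigh g v
  weigh-++ [] g [] v = sym (ℤₚ.+-identityˡ (weigh g v))
  weigh-++ (f ∷ fs) g (w ∷ ws) v = trans (cong (λ t → + f * w + t) (weigh-++ fs g ws v)) (sym (ℤₚ.+-assoc (+ f * w) (weigh fs ws) (weigh g v)))

  weigh-0 : ∀ {l} (w : Vec ℤ l) → weigh (replicate l 0) w ≡ + 0
  weigh-0 [] = refl
  weigh-0 (w ∷ ws) = trans (cong (λ t → + 0 * w + t) (weigh-0 ws)) (lem w)
    where
    lem : ∀ w → + 0 * w + + 0 ≡ + 0
    lem = solve-∀

  weigh-update : ∀ {l} (f : Vec ℕ l) i c w → weigh (f Vec.[ i ]≔ c) w ≡ weigh f w + (+ c - + lookup f i) * lookup w i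
  weigh-update (f ∷ fs) zero c (w ∷ ws) = lem (+ f) (+ c) w (weigh fs ws)
    where
    lem : ∀ f c w r → c * w + r ≡ f * w + r + (c - f) * w
    lem = solve-∀
  weigh-update (f ∷ fs) (suc i) c (w ∷ ws) = trans (cong (λ t → + f * w + t) (weigh-update fs i c ws)) (sym (ℤₚ.+-assoc (+ f * w) (weigh fs ws) _))

  weigh-affine : ∀ {l} (a : Vec ℕ l) e f w → weigh (Gallai._⊹_ l a (Gallai._⊛_ l e f)) w ≡ weigh a w + + e * weigh f w
  weigh-affine [] e [] [] = lem (+ e)
    where
    lem : ∀ e → + 0 ≡ + 0 + e * + 0
    lem = solve-∀
  weigh-affine (a ∷ as) e (f ∷ fs) (w ∷ ws) = trans (cong₂ (λ s t → s * w + t) (trans (ℤₚ.pos-+ a (e ℕ.* f)) (cong (λ t → + a + t) (ℤₚ.pos-* e f))) (weigh-affine as e fs ws))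
    (lem (+ a) (+ e) (+ f) w (weigh as ws) (weigh fs ws))
    where
    lem : ∀ a e f w r s → (a + e * f) * w + (r + e * s) ≡ (a * w + r) + e * (f * w + s)
    lem = solve-∀

  applyL-affine : ∀ {m} (bs : Vec ℤ m) Q c (w : Vec ℤ m) →
    applyL bs (tabulate (λ i → Q + c * lookup w i)) ≡ Q * applyL bs (ones m) + c * applyL bs w
  applyL-affine [] Q c [] = lem Q c
    where
    lem : ∀ Q c → + 0 ≡ Q * + 0 + c * + 0
    lem = solve-∀
  applyL-affine (b ∷ bs) Q c (w ∷ ws) = trans (cong (λ t → b * (Q + c * w) + t) (applyL-affine bs Q c ws)) (lem b Q c w _ _)
    where
    lem : ∀ b Q c w x y → b * (Q + c * w) + (Q * x + c * y) ≡ Q * (b * + 1 + x) + c * (b * w + y)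
    lem = solve-∀

  applyL-cong : ∀ {m} (bs : Vec ℤ m) {f g : Fin m → ℤ} → (∀ i → f i ≡ g i) → applyL bs (tabulate f) ≡ applyL bs (tabulate g)
  applyL-cong bs h = cong (applyL bs) (Vecₚ.tabulate-cong h)

  ∣∣-shift : ∀ {b : ℤ} {m} → ℤ.∣ b ∣ ℕ.≤ m → + ℤ.∣ + m + b ∣ ≡ + m + b
  ∣∣-shift {+ b} h = refl
  ∣∣-shift { -[1+ b ]} {m} h = ℤₚ.0≤i⇒+∣i∣≡i (subst (+ 0 ℤ.≤_) (sym (ℤₚ.⊖-≥ h)) (ℤ.+≤+ ℕ.z≤n))

  -- Positions lie in ℕ^l, so the weights -b are raised by a common B to become natural numbers.
  weigh-complement : ∀ {m} B (bs w : Vec ℤ m) → All (λ b → ℤ.∣ b ∣ ℕ.≤ B) bs →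
    weigh (Vec.map (λ b → ℤ.∣ + B + - b ∣) bs) w ≡ weigh (replicate m B) w - applyL bs w
  weigh-complement B [] [] [] = refl
  weigh-complement B (b ∷ bs) (w ∷ ws) (p ∷ ps) = trans (cong₂ (λ s t → s * w + t) (∣∣-shift { - b} (ℕₚ.≤-trans (ℕₚ.≤-reflexive (ℤₚ.∣-i∣≡∣i∣ b)) p)) (weigh-complement B bs ws ps))
    (lem (+ B) b w _ _)
    where
    lem : ∀ B b w x y → (B + - b) * w + (x - y) ≡ (B * w + x) - (b * w + y)
    lem = solve-∀

  ∈-allVecs : ∀ {m N} {xs : Vec ℕ m} → All (λ x → 1 ℕ.≤ x × x ℕ.≤ N) xs → xs ∈ allVecs m N
  ∈-allVecs [] = here refl
  ∈-allVecs {suc m} {N} {suc x ∷ xs} ((_ , x<) ∷ ps) = ∈-concatMap⁺ (λ x → map (x ∷_) (allVecs m N))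
    (Any.map (λ { refl → ∈-map⁺ (suc x ∷_) (∈-allVecs ps) }) (∈-map⁺ suc (∈-upTo⁺ x<)))

  length-injection : {A B : Set} (xs : List A) (ys : List B) (h : A → B) → Unique xs →
    (∀ {x y} → x ∈ xs → y ∈ xs → h x ≡ h y → x ≡ y) → (∀ x → x ∈ xs → h x ∈ ys) → length xs ℕ.≤ length ys
  length-injection xs ys h u inj into = ι-reflects-≤ (subst₂ ℚ._≤_ (trans (Σ-const xs 1ℚ) (ℚₚ.*-identityʳ _)) (trans (Σ-const ys 1ℚ) (ℚₚ.*-identityʳ _))
    (Σ-injection xs ys h (λ _ → 1ℚ) u inj into (λ _ → 0≤1)))

  linear-sum-applyL : ∀ {t n} (es : Vec ℤ t) (F : Vec ℤ n → ℤ) (g : Fin t → Vec ℤ n) (us : Vec (Vec ℤ n) t) → (∀ i → lookup us i ≡ g i) →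
    linear-sum F (Vec.toList (Vec.zipWith (λ e u → e , u) es us)) ≡ applyL es (tabulate (λ i → F (g i)))
  linear-sum-applyL [] F g [] h = refl
  linear-sum-applyL (e ∷ es) F g (u ∷ us) h = cong₂ (λ s t → e * F s + t) (h zero) (linear-sum-applyL es F (λ i → g (suc i)) us (λ i → h (suc i)))

  zipWith-hat : ∀ {t l} (es : Vec ℤ t) (us : Vec (Vec ℕ l) t) → Vec.zipWith (λ e u → e , hat u) es us ≡ Vec.zipWith (λ e u → e , u) es (Vec.map hat us)
  zipWith-hat [] [] = refl
  zipWith-hat (e ∷ es) (u ∷ us) = cong ((e , hat u) ∷_) (zipWith-hat es us)

  weigh-ε : ∀ {t} (i : Fin t) w → weigh (replicate t 0 Vec.[ i ]≔ 1) w ≡ lookup w i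
  weigh-ε {t} i w = trans (weigh-update (replicate t 0) i 1 w) (trans (cong₂ (λ a b → a + (+ 1 - + b) * lookup w i) (weigh-0 w) (Vecₚ.lookup-replicate i 0)) (lem (lookup w i)))
    where
    lem : ∀ x → + 0 + (+ 1 - + 0) * x ≡ x
    lem = solve-∀

  weight-bound : ∀ {m} → Vec ℤ m → ℕ
  weight-bound [] = 0
  weight-bound (b ∷ bs) = ℤ.∣ b ∣ ℕ.+ weight-bound bs

  weight-bound-all : ∀ {m} (bs : Vec ℤ m) → All (λ b → ℤ.∣ b ∣ ℕ.≤ weight-bound bs) bs
  weight-bound-all [] = []
  weight-bound-all (b ∷ bs) = ℕₚ.m≤m+n _ _ ∷ All.map (λ h → ℕₚ.≤-trans h (ℕₚ.m≤n+m _ ℤ.∣ b ∣)) (weight-bound-all bs)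

  All-replicate : ∀ {Q : ℕ → Set} m {x} → Q x → All Q (replicate m x)
  All-replicate zero q = []
  All-replicate (suc m) q = q ∷ All-replicate m q

  All-update : ∀ {Q : ℕ → Set} {m} {xs : Vec ℕ m} i {x} → All Q xs → Q x → All Q (xs Vec.[ i ]≔ x)
  All-update zero (_ ∷ ps) q = q ∷ ps
  All-update (suc i) (p ∷ ps) q = p ∷ All-update i ps q

  All-++ : ∀ {Q : ℕ → Set} {m m′} {xs : Vec ℕ m} {ys : Vec ℕ m′} → All Q xs → All Q ys → All Q (xs Vec.++ ys)
  All-++ [] qs = qs
  All-++ (p ∷ ps) qs = p ∷ All-++ ps qs

  All-tabulate : ∀ {A : Set} {Q : A → Set} {m} {f : Fin m → A} → (∀ i → Q (f i)) → All Q (tabulate f)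
  All-tabulate {m = zero} h = []
  All-tabulate {m = suc m} h = h zero ∷ All-tabulate (λ i → h (suc i))

-- Solutions from two scales that share a colour.

module SolutionCounting where
  open import Data.Integer using (_+_; _*_; _-_; -_)
  open import Data.Integer.Tactic.RingSolver using (solve-∀)
  open import Defs using (applyL; ones; allVecs; toℤ; Good; good?; count)
  open RationalSums
  open InnerProductSpaces
  open BoxEstimates
  open AveragingPlans
  open PolynomialDifferences using (Deg; dot; linear-sum)
  open FormAbsorption
  open PlanBoundsAndSpread
  open RecurrenceLevels
  open PolynomialRecurrence using ()
  open GallaiTheorem
  open FiniteSpaces
  open PointSets
  open MonochromaticStructures
  open Weights

  module Counting (a₀ a₁ : ℤ) (P : List ℤ) (s : ℤ) (deg : Deg (suc (length P)) (eval (a₀ ∷ a₁ ∷ P)) s) (1≤∣s∣ : 1 ℕ.≤ ℤ.∣ s ∣)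
    (intersective : Intersective (a₀ ∷ a₁ ∷ P)) (s′ t r : ℕ) (b₁ b₂ : ℤ) (bs : Vec ℤ s′) (1≤∣b₁∣ : 1 ℕ.≤ ℤ.∣ b₁ ∣) (es : Vec ℤ t)
    (balanced : applyL (b₁ ∷ b₂ ∷ bs) (ones (suc (suc s′))) ≡ + 0) where

    B β l : ℕ
    B = ℤ.∣ b₁ ∣ ℕ.+ weight-bound bs
    -- 2 B bounds the weights B - b and B + b₁ below, and the summand 1 admits the entry 1 of `fε`.
    β = 2 ℕ.* B ℕ.+ 1
    l = s′ ℕ.+ t

    open Gallai l using (Point; Bounded; _⊹_; _⊛_; Bounded-⊹; Bounded-⊛; ∈-box)
    open Points l using (Pt; pairs; _≟ₚ_; δₚ)
    open Structures a₀ a₁ P s deg 1≤∣s∣ intersective l t r β b₁ 1≤∣b₁∣ es public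

    -- Let Y = B Σ w_j and Z = Σ b_j w_j over the coefficients after the second. Up to the common
    -- offset, n₁ = x′₀ + e(Y - Z), n₂ = x₀ + eY and n_j = x₀ + eY + e b₁ w_j. In L₁(n) the terms e
    -- b₁ Z cancel, x₀ + eY is multiplied by L₁(1, ..., 1) = 0, and b₁ x′₀ - b₁ x₀ remains.
    f₁ f₂ origin : Point
    f₁ = Vec.map (λ b → ℤ.∣ + B + - b ∣) bs Vec.++ replicate t 0
    f₂ = replicate s′ B Vec.++ replicate t 0
    origin = replicate l 0

    fⱼ : Fin s′ → Point
    fⱼ i = (replicate s′ B Vec.[ i ]≔ ℤ.∣ + B + b₁ ∣) Vec.++ replicate t 0

    -- Each variable z_i has a coordinate of w to itself, which keeps the t variables independent.
    fε : Fin t → Point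
    fε i = replicate s′ 0 Vec.++ (replicate t 0 Vec.[ i ]≔ 1)

    ∣b₁∣≤B : ℤ.∣ b₁ ∣ ℕ.≤ B
    ∣b₁∣≤B = ℕₚ.m≤m+n ℤ.∣ b₁ ∣ (weight-bound bs)

    bs≤B : All (λ b → ℤ.∣ b ∣ ℕ.≤ B) bs
    bs≤B = All.map (λ h → ℕₚ.≤-trans h (ℕₚ.m≤n+m _ ℤ.∣ b₁ ∣)) (weight-bound-all bs)

    private
      double : ∀ b → ℤ.∣ b ∣ ℕ.≤ B → ℤ.∣ + B + b ∣ ℕ.≤ β
      double b h = ℕₚ.≤-trans (ℤₚ.∣i+j∣≤∣i∣+∣j∣ (+ B) b) (ℕₚ.≤-trans (ℕₚ.+-monoʳ-≤ B (ℕₚ.≤-trans h (ℕₚ.m≤m+n B 0))) (ℕₚ.m≤m+n (2 ℕ.* B) 1))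

      B≤β : B ℕ.≤ β
      B≤β = ℕₚ.≤-trans (ℕₚ.m≤m+n B (B ℕ.+ 0)) (ℕₚ.m≤m+n (2 ℕ.* B) 1)

    f₁≤ : Bounded β f₁
    f₁≤ = All-++ (complement bs bs≤B) (All-replicate t ℕ.z≤n)
      where
      complement : ∀ {m} (bs : Vec ℤ m) → All (λ b → ℤ.∣ b ∣ ℕ.≤ B) bs → All (ℕ._≤ β) (Vec.map (λ b → ℤ.∣ + B + - b ∣) bs)
      complement [] [] = []
      complement (b ∷ bs) (p ∷ ps) = double (- b) (ℕₚ.≤-trans (ℕₚ.≤-reflexive (ℤₚ.∣-i∣≡∣i∣ b)) p) ∷ complement bs ps

    f₂≤ : Bounded β f₂
    f₂≤ = All-++ (All-replicate s′ B≤β) (All-replicate t ℕ.z≤n)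

    fⱼ≤ : ∀ i → Bounded β (fⱼ i)
    fⱼ≤ i = All-++ (All-update i (All-replicate s′ B≤β) (double b₁ ∣b₁∣≤B)) (All-replicate t ℕ.z≤n)

    fε≤ : ∀ i → Bounded β (fε i)
    fε≤ i = All-++ (All-replicate s′ ℕ.z≤n) (All-update i (All-replicate t ℕ.z≤n) (ℕₚ.m≤n+m 1 (2 ℕ.* B)))

    origin≤ : Bounded β origin
    origin≤ = All-replicate l ℕ.z≤n

    first : Vec ℤ l → Vec ℤ s′
    first = Vec.take s′

    last : Vec ℤ l → Vec ℤ t
    last = Vec.drop s′

    weigh-split : ∀ (f : Vec ℕ s′) (g : Vec ℕ t) w → weigh (f Vec.++ g) w ≡ weigh f (first w) + weigh g (last w)
    weigh-split f g w = trans (cong (weigh (f Vec.++ g)) (sym (Vecₚ.take++drop≡id s′ w))) (weigh-++ f g (first w) (last w))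

    weigh-first : ∀ (f : Vec ℕ s′) w → weigh (f Vec.++ replicate t 0) w ≡ weigh f (first w)
    weigh-first f w = trans (weigh-split f (replicate t 0) w) (trans (cong (λ x → weigh f (first w) + x) (weigh-0 (last w))) (ℤₚ.+-identityʳ _))

    Y : Vec ℤ l → ℤ
    Y w = weigh (replicate s′ B) (first w)

    weigh-f₁ : ∀ w → weigh f₁ w ≡ Y w - applyL bs (first w)
    weigh-f₁ w = trans (weigh-first (Vec.map (λ b → ℤ.∣ + B + - b ∣) bs) w) (weigh-complement B bs (first w) bs≤B)

    weigh-fⱼ : ∀ i w → weigh (fⱼ i) w ≡ Y w + b₁ * lookup (first w) i
    weigh-fⱼ i w = trans (weigh-first (replicate s′ B Vec.[ i ]≔ ℤ.∣ + B + b₁ ∣) w) (trans (weigh-update (replicate s′ B) i ℤ.∣ + B + b₁ ∣ (first w))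
      (cong (λ x → Y w + x * lookup (first w) i) (trans (cong₂ (λ a b → a - + b) (∣∣-shift {b₁} ∣b₁∣≤B) (Vecₚ.lookup-replicate i B)) (lem (+ B) b₁))))
      where
      lem : ∀ B b → B + b - B ≡ b
      lem = solve-∀

    weigh-fε : ∀ i w → weigh (fε i) w ≡ lookup (last w) i
    weigh-fε i w = trans (weigh-split (replicate s′ 0) _ w) (trans (cong₂ _+_ (weigh-0 (first w)) (weigh-ε i (last w))) (ℤₚ.+-identityˡ _))

    module Values {χ D R} (σ : Structure χ D R) where
      at : Point → Point
      at f = offset σ ⊹ step σ ⊛ f

      head : Pt → ℤ
      head (z ∷ w) = z + weigh (offset σ) w

      tail : Pt → Vec ℤ l
      tail (z ∷ w) = w

      at≤ : ∀ {f} → Bounded β f → Bounded bound (at f)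
      at≤ h = Bounded-⊹ (offset≤ σ) (Bounded-⊛ (step≤ σ) h)

      bounds : ∀ {y f} → y ∈ points σ → Bounded β f → + 1 ℤ.≤ dot (hat (at f)) y
      bounds {f = f} y∈ hf = proj₁ (value-bounds (at f) (at≤ hf) (between σ _ y∈))

      value≡ : ∀ {y f} → y ∈ points σ → Bounded β f → + value y (at f) ≡ dot (hat (at f)) y
      value≡ y∈ hf = ℤₚ.0≤i⇒+∣i∣≡i (ℤₚ.≤-trans (ℤ.+≤+ ℕ.z≤n) (bounds y∈ hf))

      expand : ∀ y f → dot (hat (at f)) y ≡ head y + + step σ * weigh f (tail y)
      expand (z ∷ w) f = trans (cong (λ x → + 1 * z + x) (weigh-affine (offset σ) (step σ) f w)) (lem z (weigh (offset σ) w) _)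
        where
        lem : ∀ z a b → + 1 * z + (a + b) ≡ z + a + b
        lem = solve-∀

      value-expand : ∀ {y f} → y ∈ points σ → Bounded β f → + value y (at f) ≡ head y + + step σ * weigh f (tail y)
      value-expand {y} {f} y∈ hf = trans (value≡ y∈ hf) (expand y f)

      value-range : ∀ {y f N} → R ℕ.≤ N → y ∈ points σ → Bounded β f → 1 ℕ.≤ value y (at f) × value y (at f) ℕ.≤ N
      value-range {y} {f} R≤N y∈ hf = ℤₚ.drop‿+≤+ (subst (+ 1 ℤ.≤_) (sym (value≡ y∈ hf)) (bounds y∈ hf)) , ℕₚ.≤-trans (value≤ σ y y∈ f hf) R≤N

      value-origin : ∀ {y} → y ∈ points σ → + value y (at origin) ≡ head y
      value-origin {y} y∈ = trans (value-expand y∈ origin≤) (trans (cong (λ x → head y + + step σ * x) (weigh-0 (tail y))) (lem (head y) (+ step σ)))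
        where
        lem : ∀ h e → h + e * + 0 ≡ h
        lem = solve-∀

      step-cancel : ∀ {x y} → + step σ * x ≡ + step σ * y → x ≡ y
      step-cancel {x} {y} e = ℤₚ.*-cancelˡ-≡ (+ step σ) x y {{ℤ.≢-nonZero λ z → ℕₚ.<-irrefl refl (ℕₚ.≤-trans (1≤step σ) (ℕₚ.≤-reflexive (ℤₚ.+-injective z)))}} e

      determined : ∀ {y y′} → head y ≡ head y′ → tail y ≡ tail y′ → y ≡ y′
      determined {z ∷ w} {z′ ∷ .w} e refl = cong (_∷ w) (ℤ-cancelˡ (weigh (offset σ) w) (trans (ℤₚ.+-comm _ z) (trans e (ℤₚ.+-comm z′ _))))

    first-last : ∀ {w w′} → first w ≡ first w′ → last w ≡ last w′ → w ≡ w′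
    first-last {w} {w′} p q = trans (sym (Vecₚ.take++drop≡id s′ w)) (trans (cong₂ Vec._++_ p q) (Vecₚ.take++drop≡id s′ w′))

    lookup-ext : ∀ {A : Set} {m} {xs ys : Vec A m} → (∀ i → lookup xs i ≡ lookup ys i) → xs ≡ ys
    lookup-ext {xs = xs} {ys} h = trans (sym (Vecₚ.tabulate∘lookup xs)) (trans (Vecₚ.tabulate-cong h) (Vecₚ.tabulate∘lookup ys))

    All-first : ∀ {Q : ℤ → Set} {w} → All Q w → All Q (first w)
    All-first {Q} = go s′
      where
      go : ∀ m {w : Vec ℤ (m ℕ.+ t)} → All Q w → All Q (Vec.take m w)
      go zero p = []
      go (suc m) {x ∷ w} (p ∷ ps) = p ∷ go m ps

    All-last : ∀ {Q : ℤ → Set} {w} → All Q w → All Q (last w)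
    All-last {Q} = go s′
      where
      go : ∀ m {w : Vec ℤ (m ℕ.+ t)} → All Q w → All Q (Vec.drop m w)
      go zero p = p
      go (suc m) {x ∷ w} (p ∷ ps) = go m ps

    module Solutions {χ D R D₂ R₂} (new : Structure χ D R) (old : Structure χ D₂ R₂) (same : colour new ≡ colour old)
      (T : ℕ) (recurs : Recurrent T new old) (N : ℕ) (R≤N : R ℕ.≤ N) (R₂≤N : R₂ ℕ.≤ N) (1≤R : 1 ℕ.≤ R) (1≤R₂ : 1 ℕ.≤ R₂) where

      module V = Values new
      module O = Values old

      us : Vec Point t
      us = tabulate (λ i → V.at (fε i))

      h : Pt → ℤ
      h = target us

      Triple : Set
      Triple = Pt × Pt × Pt

      ns : Triple → Vec ℕ (suc (suc s′))
      ns (y , x , x′) = value x′ (O.at f₁) ∷ value x (O.at f₂) ∷ tabulate (λ i → value x (O.at (fⱼ i)))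

      zs : Triple → Vec ℕ t
      zs (y , x , x′) = tabulate (λ i → value y (V.at (fε i)))

      related? : ∀ (τ : Triple) → Dec (bump zero (h (proj₁ τ)) (scaled (proj₁ (proj₂ τ))) ≡ scaled (proj₂ (proj₂ τ)))
      related? (y , x , x′) = bump zero (h y) (scaled x) ≟ₚ scaled x′

      triples : List Triple
      triples = filter related? (cartesianProduct (points new) (cartesianProduct (points old) (points old)))

      triples⁻ : ∀ {y x x′} → (y , x , x′) ∈ triples →
        y ∈ points new × x ∈ points old × x′ ∈ points old × bump zero (h y) (scaled x) ≡ scaled x′
      triples⁻ {y} {x} {x′} τ∈ =
        let p , e = ∈-filter⁻ related? {xs = cartesianProduct (points new) (cartesianProduct (points old) (points old))} τ∈
            y∈ , q = ∈-cartesianProduct⁻ (points new) (cartesianProduct (points old) (points old)) p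
            x∈ , x′∈ = ∈-cartesianProduct⁻ (points old) (points old) q
        in y∈ , x∈ , x′∈ , e

      h-zs : ∀ {y x x′} → y ∈ points new → h y ≡ applyL es (Vec.map (eval pol) (toℤ (zs (y , x , x′))))
      h-zs {y} {x} {x′} y∈ = trans (cong (λ v → linear-sum (λ f → eval pol (dot f y)) (Vec.toList v)) (zipWith-hat es us))
        (trans (linear-sum-applyL es (λ f → eval pol (dot f y)) (λ i → hat (V.at (fε i))) (Vec.map hat us)
            (λ i → trans (Vecₚ.lookup-map i hat us) (cong hat (Vecₚ.lookup∘tabulate (λ i → V.at (fε i)) i))))
          (cong (applyL es) (trans (Vecₚ.tabulate-cong λ i → cong (eval pol) (sym (V.value≡ y∈ (fε≤ i))))
            (trans (Vecₚ.tabulate-∘ (eval pol) (λ i → + value y (V.at (fε i)))) (cong (Vec.map (eval pol)) (Vecₚ.tabulate-∘ +_ (λ i → value y (V.at (fε i)))))))))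

      solves : ∀ {y x x′} → (y , x , x′) ∈ triples →
        applyL (b₁ ∷ b₂ ∷ bs) (toℤ (ns (y , x , x′))) ≡ applyL es (Vec.map (eval pol) (toℤ (zs (y , x , x′))))
      solves {y} {x@(z ∷ w)} {x′@(z′ ∷ w′)} τ∈ = trans (begin
        b₁ * + value x′ (O.at f₁) + (b₂ * + value x (O.at f₂) + applyL bs (toℤ (tabulate (λ i → value x (O.at (fⱼ i))))))
          ≡⟨ cong₂ (λ a b → b₁ * a + b) n₁ (cong₂ (λ a b → b₂ * a + b) n₂ (trans (cong (applyL bs) (sym (Vecₚ.tabulate-∘ +_ (λ i → value x (O.at (fⱼ i))))))
               (trans (applyL-cong bs nⱼ) (applyL-affine bs Q (e * b₁) (first w))))) ⟩
        b₁ * (z′ + X + e * (Y w - Z)) + (b₂ * Q + (Q * applyL bs (ones s′) + e * b₁ * Z)) ≡⟨ lem b₁ b₂ z′ z X e (Y w) Z (applyL bs (ones s′)) ⟩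
        (b₁ * + 1 + (b₂ * + 1 + applyL bs (ones s′))) * Q + (b₁ * z′ - b₁ * z) ≡⟨ cong₂ (λ a b → a * Q + (b - b₁ * z)) balanced (sym (Vecₚ.∷-injectiveˡ rel)) ⟩
        + 0 * Q + (h y + b₁ * z - b₁ * z) ≡⟨ lem₂ Q (h y) (b₁ * z) ⟩
        h y ∎) (h-zs {y} {x} {x′} y∈)
        where
        open ≡-Reasoning
        y∈ = proj₁ (triples⁻ τ∈)
        x∈ = proj₁ (proj₂ (triples⁻ τ∈))
        x′∈ = proj₁ (proj₂ (proj₂ (triples⁻ τ∈)))
        rel : bump zero (h y) (scaled x) ≡ scaled x′
        rel = proj₂ (proj₂ (proj₂ (triples⁻ τ∈)))
        w≡ : w ≡ w′
        w≡ = Vecₚ.∷-injectiveʳ rel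
        e = + step old
        X = weigh (offset old) w
        Z = applyL bs (first w)
        Q = z + X + e * Y w
        n₁ : + value x′ (O.at f₁) ≡ z′ + X + e * (Y w - Z)
        n₁ = trans (O.value-expand x′∈ f₁≤) (trans (cong (λ v → z′ + weigh (offset old) v + e * weigh f₁ v) (sym w≡)) (cong (λ v → z′ + X + e * v) (weigh-f₁ w)))
        n₂ : + value x (O.at f₂) ≡ Q
        n₂ = trans (O.value-expand x∈ f₂≤) (cong (λ v → z + X + e * v) (weigh-first (replicate s′ B) w))
        nⱼ : ∀ i → + value x (O.at (fⱼ i)) ≡ Q + e * b₁ * lookup (first w) i
        nⱼ i = trans (O.value-expand x∈ (fⱼ≤ i)) (trans (cong (λ v → z + X + e * v) (weigh-fⱼ i w)) (lem₃ (z + X) e (Y w) b₁ (lookup (first w) i)))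
          where
          lem₃ : ∀ a e y b v → a + e * (y + b * v) ≡ a + e * y + e * b * v
          lem₃ = solve-∀
        lem : ∀ b₁ b₂ z′ z X e Y Z o → b₁ * (z′ + X + e * (Y - Z)) + (b₂ * (z + X + e * Y) + ((z + X + e * Y) * o + e * b₁ * Z)) ≡
          (b₁ * + 1 + (b₂ * + 1 + o)) * (z + X + e * Y) + (b₁ * z′ - b₁ * z)
        lem = solve-∀
        lem₂ : ∀ Q h x → + 0 * Q + (h + x - x) ≡ h
        lem₂ = solve-∀

      L₁ : Vec ℤ (suc (suc s′))
      L₁ = b₁ ∷ b₂ ∷ bs

      coloured : ∀ τ → τ ∈ triples → Good χ (colour new) pol L₁ es (ns τ , zs τ)
      coloured (y , x , x′) τ∈ =
        (oldc x′∈ f₁≤ ∷ oldc x∈ f₂≤ ∷ All-tabulate (λ i → oldc x∈ (fⱼ≤ i))) ,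
        All-tabulate (λ i → mono new y y∈ (fε i) (fε≤ i)) , solves τ∈
        where
        y∈ = proj₁ (triples⁻ τ∈)
        x∈ = proj₁ (proj₂ (triples⁻ τ∈))
        x′∈ = proj₁ (proj₂ (proj₂ (triples⁻ τ∈)))
        oldc : ∀ {x f} → x ∈ points old → Bounded β f → χ (value x (O.at f)) ≡ colour new
        oldc {x} {f} x∈ hf = trans (mono old x x∈ f hf) (sym same)

      solutions : List (Vec ℕ (suc (suc s′)) × Vec ℕ t)
      solutions = filter (good? χ (colour new) pol L₁ es) (cartesianProduct (allVecs (suc (suc s′)) N) (allVecs t N))

      -- What a solution does not determine: the value of y at the origin and the first s′ entries
      -- of its tail, and the last t entries of the tail of x. The point x′ then follows from y and
      -- x.
      extras : List (Vec ℤ (suc s′) × Vec ℤ t)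
      extras = cartesianProduct (cube (suc s′) R) (cube t R₂)

      encode : Triple → (Vec ℕ (suc (suc s′)) × Vec ℕ t) × (Vec ℤ (suc s′) × Vec ℤ t)
      encode τ@(y , x , x′) = (ns τ , zs τ) , (+ value y (V.at origin) ∷ first (V.tail y)) , last (O.tail x)

      tail-between : ∀ {χ D R} (σ : Structure χ D R) {y} → y ∈ points σ → Between R (Values.tail σ y)
      tail-between σ {z ∷ w} y∈ with between σ (z ∷ w) y∈
      ... | _ ∷ hw = hw

      encode-into : ∀ τ → τ ∈ triples → encode τ ∈ cartesianProduct solutions extras
      encode-into τ@(y , x , x′) τ∈ = ∈-cartesianProduct⁺
        (∈-filter⁺ (good? χ (colour new) pol L₁ es)
          (∈-cartesianProduct⁺
            (∈-allVecs (O.value-range R₂≤N x′∈ f₁≤ ∷ O.value-range R₂≤N x∈ f₂≤ ∷ All-tabulate (λ i → O.value-range R₂≤N x∈ (fⱼ≤ i))))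
            (∈-allVecs (All-tabulate (λ i → V.value-range R≤N y∈ (fε≤ i)))))
          (coloured τ τ∈))
        (∈-cartesianProduct⁺
          (∈-cube⁺ ((ℤ.+≤+ (proj₁ origin-range) , ℤ.+≤+ (proj₂ origin-range)) ∷ All-first (tail-between new y∈)))
          (∈-cube⁺ (All-last (tail-between old x∈))))
        where
        y∈ = proj₁ (triples⁻ τ∈)
        x∈ = proj₁ (proj₂ (triples⁻ τ∈))
        x′∈ = proj₁ (proj₂ (proj₂ (triples⁻ τ∈)))
        origin-range = V.value-range ℕₚ.≤-refl y∈ origin≤

      b₁-cancel : ∀ {x y} → b₁ * x ≡ b₁ * y → x ≡ y
      b₁-cancel {x} {y} e = ℤₚ.*-cancelˡ-≡ b₁ x y {{ℤ.≢-nonZero {b₁} λ z → ℕₚ.<-irrefl refl (ℕₚ.≤-trans 1≤∣b₁∣ (ℕₚ.≤-reflexive (cong ℤ.∣_∣ {x = b₁} z)))}} e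

      -- Given its head, the zs determine the last t tail entries of y. From n₂ and the n_j one
      -- recovers the first s′ tail entries of x and then its head, as b₁ and the step are not zero.
      encode-injective : ∀ {τ τ′} → τ ∈ triples → τ′ ∈ triples → encode τ ≡ encode τ′ → τ ≡ τ′
      encode-injective {y , x , x′} {v , w , w′} τ∈ τ′∈ e = cong₂ _,_ y≡v (cong₂ _,_ x≡w x′≡w′)
        where
        y∈ = proj₁ (triples⁻ τ∈)
        x∈ = proj₁ (proj₂ (triples⁻ τ∈))
        v∈ = proj₁ (triples⁻ τ′∈)
        w∈ = proj₁ (proj₂ (triples⁻ τ′∈))
        ns≡ : ns (y , x , x′) ≡ ns (v , w , w′)
        ns≡ = cong (λ c → proj₁ (proj₁ c)) e
        zs≡ : zs (y , x , x′) ≡ zs (v , w , w′)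
        zs≡ = cong (λ c → proj₂ (proj₁ c)) e
        head≡ : V.head y ≡ V.head v
        head≡ = trans (sym (V.value-origin y∈)) (trans (Vecₚ.∷-injectiveˡ (cong (λ c → proj₁ (proj₂ c)) e)) (V.value-origin v∈))
        z≡ : ∀ i → value y (V.at (fε i)) ≡ value v (V.at (fε i))
        z≡ i = trans (sym (Vecₚ.lookup∘tabulate _ i)) (trans (cong (λ c → lookup c i) zs≡) (Vecₚ.lookup∘tabulate _ i))
        last≡ : last (V.tail y) ≡ last (V.tail v)
        last≡ = lookup-ext λ i → trans (sym (weigh-fε i (V.tail y))) (trans (V.step-cancel (ℤ-cancelˡ (V.head v)
          (trans (cong (_+ + step new * weigh (fε i) (V.tail y)) (sym head≡)) (trans (sym (V.value-expand y∈ (fε≤ i))) (trans (cong +_ (z≡ i)) (V.value-expand v∈ (fε≤ i)))))))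
          (weigh-fε i (V.tail v)))
        y≡v : y ≡ v
        y≡v = V.determined head≡ (first-last (Vecₚ.∷-injectiveʳ (cong (λ c → proj₁ (proj₂ c)) e)) last≡)
        n₂≡ : O.head x + + step old * Y (O.tail x) ≡ O.head w + + step old * Y (O.tail w)
        n₂≡ = trans (sym (trans (O.value-expand x∈ f₂≤) (cong (λ a → O.head x + + step old * a) (weigh-first (replicate s′ B) (O.tail x)))))
          (trans (cong +_ (Vecₚ.∷-injectiveˡ (Vecₚ.∷-injectiveʳ ns≡))) (trans (O.value-expand w∈ f₂≤) (cong (λ a → O.head w + + step old * a) (weigh-first (replicate s′ B) (O.tail w)))))
        nⱼ≡ : ∀ i → value x (O.at (fⱼ i)) ≡ value w (O.at (fⱼ i))
        nⱼ≡ i = trans (sym (Vecₚ.lookup∘tabulate _ i)) (trans (cong (λ c → lookup c i) (Vecₚ.∷-injectiveʳ (Vecₚ.∷-injectiveʳ ns≡))) (Vecₚ.lookup∘tabulate _ i))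
        nⱼ-expand : ∀ {x} → x ∈ points old → ∀ i → + value x (O.at (fⱼ i)) ≡ O.head x + + step old * Y (O.tail x) + + step old * (b₁ * lookup (first (O.tail x)) i)
        nⱼ-expand {x} x∈ i = trans (O.value-expand x∈ (fⱼ≤ i)) (trans (cong (λ a → O.head x + + step old * a) (weigh-fⱼ i (O.tail x))) (lem (O.head x) (+ step old) (Y (O.tail x)) _))
          where
          lem : ∀ a e y v → a + e * (y + v) ≡ a + e * y + e * v
          lem = solve-∀
        first≡ : first (O.tail x) ≡ first (O.tail w)
        first≡ = lookup-ext λ i → b₁-cancel (O.step-cancel (ℤ-cancelˡ (O.head w + + step old * Y (O.tail w))
          (trans (cong (_+ + step old * (b₁ * lookup (first (O.tail x)) i)) (sym n₂≡)) (trans (sym (nⱼ-expand x∈ i)) (trans (cong +_ (nⱼ≡ i)) (nⱼ-expand w∈ i))))))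
        tail≡ : O.tail x ≡ O.tail w
        tail≡ = first-last first≡ (cong (λ c → proj₂ (proj₂ c)) e)
        x≡w : x ≡ w
        x≡w = O.determined (ℤ-cancelˡ (+ step old * Y (O.tail w)) (trans (ℤₚ.+-comm _ (O.head x))
          (trans (trans (cong (λ a → O.head x + + step old * Y a) (sym tail≡)) n₂≡) (ℤₚ.+-comm (O.head w) _)))) tail≡
        x′≡w′ : x′ ≡ w′
        x′≡w′ = scaled-injective (trans (sym (proj₂ (proj₂ (proj₂ (triples⁻ τ∈)))))
          (trans (cong₂ (λ a b → bump zero (h a) (scaled b)) y≡v x≡w) (proj₂ (proj₂ (proj₂ (triples⁻ τ′∈))))))

      triples-unique : Unique triples
      triples-unique = Uniqueₚ.filter⁺ related? (Uniqueₚ.cartesianProduct⁺ (unique new) (Uniqueₚ.cartesianProduct⁺ (unique old) (unique old)))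

      triples≤ : length triples ℕ.≤ count N χ (colour new) pol L₁ es ℕ.* (R ℕ.^ suc s′ ℕ.* R₂ ℕ.^ t)
      triples≤ = ℕₚ.≤-trans (length-injection triples (cartesianProduct solutions extras) encode triples-unique encode-injective encode-into)
        (ℕₚ.≤-reflexive (trans (length-product _,_ solutions extras) (cong (length solutions ℕ.*_)
          (trans (length-product _,_ (cube (suc s′) R) (cube t R₂)) (cong₂ ℕ._*_ (length-cube (suc s′) R) (length-cube t R₂))))))

      ι-triples : ι (length triples) ≡ Σ (points new) (λ y → pairs (List.map scaled (points old)) (h y))
      ι-triples = trans (length-filter related? (cartesianProduct (points new) (cartesianProduct (points old) (points old))))
        (trans (Σ-product _,_ (points new) (cartesianProduct (points old) (points old)) (λ τ → indicator (related? τ))) (Σ-cong (points new) λ y →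
        trans (Σ-product _,_ (points old) (points old) (λ τ → indicator (related? (y , τ)))) (sym (trans (Σ-map scaled (points old) _) (Σ-cong (points old) λ x → Σ-map scaled (points old) _)))))

      us∈ : All (_∈ configuration) us
      us∈ = All-tabulate λ i → ∈-box (V.at≤ (fε≤ i))

      pairs-many : length (points new) ℕ.* length (points old) ℕ.≤ T ℕ.* length triples
      pairs-many = ι-reflects-≤ (subst₂ ℚ._≤_ (trans (Σ-const (points new) _) (sym (ι-* (length (points new)) (length (points old)))))
        (trans (Σ-* (points new) (ι T) _) (trans (cong (λ x → ι T ℚ.* x) (sym ι-triples)) (sym (ι-* T (length triples)))))
        (Σ-mono (points new) λ y y∈ → recurs y y∈ us us∈))

      -- The structures have about R^(l+1) and R₂^(l+1) points, with l = s′ + t. A proportion 1/T of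
      -- the product counts triples, and the multiplicity R^(s′+1) R₂^t of a solution is divided
      -- out.
      solutions-many : R ℕ.^ t ℕ.* R₂ ℕ.^ suc s′ ℕ.≤ D ℕ.* D₂ ℕ.* T ℕ.* count N χ (colour new) pol L₁ es
      solutions-many = ℕₚ.*-cancelʳ-≤ _ _ (R ℕ.^ suc s′ ℕ.* R₂ ℕ.^ t) {{ℕ.>-nonZero (*-pos (^-pos (suc s′) 1≤R) (^-pos t 1≤R₂))}} (begin
        R ℕ.^ t ℕ.* R₂ ℕ.^ suc s′ ℕ.* (R ℕ.^ suc s′ ℕ.* R₂ ℕ.^ t) ≡⟨ lem (R ℕ.^ t) (R₂ ℕ.^ suc s′) (R ℕ.^ suc s′) (R₂ ℕ.^ t) ⟩
        R ℕ.^ suc s′ ℕ.* R ℕ.^ t ℕ.* (R₂ ℕ.^ suc s′ ℕ.* R₂ ℕ.^ t) ≡⟨ sym (cong₂ ℕ._*_ (ℕₚ.^-distribˡ-+-* R (suc s′) t) (ℕₚ.^-distribˡ-+-* R₂ (suc s′) t)) ⟩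
        R ℕ.^ suc l ℕ.* R₂ ℕ.^ suc l ≤⟨ ℕₚ.*-mono-≤ (many new) (many old) ⟩
        D ℕ.* length (points new) ℕ.* (D₂ ℕ.* length (points old)) ≡⟨ lem₂ D (length (points new)) D₂ (length (points old)) ⟩
        D ℕ.* D₂ ℕ.* (length (points new) ℕ.* length (points old)) ≤⟨ ℕₚ.*-monoʳ-≤ (D ℕ.* D₂) (ℕₚ.≤-trans pairs-many (ℕₚ.*-monoʳ-≤ T triples≤)) ⟩
        D ℕ.* D₂ ℕ.* (T ℕ.* (c ℕ.* (R ℕ.^ suc s′ ℕ.* R₂ ℕ.^ t))) ≡⟨ lem₃ (D ℕ.* D₂) T c _ ⟩
        D ℕ.* D₂ ℕ.* T ℕ.* c ℕ.* (R ℕ.^ suc s′ ℕ.* R₂ ℕ.^ t) ∎)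
        where
        open ℕₚ.≤-Reasoning
        c = count N χ (colour new) pol L₁ es
        lem : ∀ a b c d → a ℕ.* b ℕ.* (c ℕ.* d) ≡ c ℕ.* a ℕ.* (b ℕ.* d)
        lem = ℕ-solve
        lem₂ : ∀ a b c d → a ℕ.* b ℕ.* (c ℕ.* d) ≡ a ℕ.* c ℕ.* (b ℕ.* d)
        lem₂ = ℕ-solve
        lem₃ : ∀ a b c d → a ℕ.* (b ℕ.* (c ℕ.* d)) ≡ a ℕ.* b ℕ.* c ℕ.* d
        lem₃ = ℕ-solve

-- Descent through the scales and the choice of constants.

module Scales where
  open import Data.Integer using (_+_)
  open import Defs using (applyL; ones; count)
  open RationalSums
  open InnerProductSpaces
  open BoxEstimates
  open AveragingPlans
  open PolynomialDifferences using (Deg; dot; linear-sum; Deg-eval)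
  open FormAbsorption
  open PlanBoundsAndSpread
  open RecurrenceLevels
  open PolynomialRecurrence using ()
  open GallaiTheorem
  open MonochromaticStructures
  open Weights
  open SolutionCounting

  integer-root : ∀ e N → ∃[ m ] (m ℕ.^ suc e ℕ.≤ N × N ℕ.< suc m ℕ.^ suc e)
  integer-root e zero = 0 , ℕ.z≤n , ^-pos (suc e) ℕₚ.≤-refl
  integer-root e (suc N) with integer-root e N
  ... | m , lo , hi with suc m ℕ.^ suc e ℕ.≤? suc N
  ...   | yes p = suc m , p , ℕₚ.≤-<-trans hi (ℕₚ.^-monoˡ-< (suc e) (ℕₚ.n<1+n (suc m)))
  ...   | no ¬p = m , ℕₚ.m≤n⇒m≤1+n lo , ℕₚ.≰⇒> ¬p

  module Chain (a₀ a₁ : ℤ) (P : List ℤ) (s : ℤ) (deg : Deg (suc (length P)) (eval (a₀ ∷ a₁ ∷ P)) s) (1≤∣s∣ : 1 ℕ.≤ ℤ.∣ s ∣)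
    (intersective : Intersective (a₀ ∷ a₁ ∷ P)) (s′ t r : ℕ) (b₁ b₂ : ℤ) (bs : Vec ℤ s′) (1≤∣b₁∣ : 1 ℕ.≤ ℤ.∣ b₁ ∣) (es : Vec ℤ t)
    (balanced : applyL (b₁ ∷ b₂ ∷ bs) (ones (suc (suc s′))) ≡ + 0) where
    open Counting a₀ a₁ P s deg 1≤∣s∣ intersective s′ t r b₁ b₂ bs 1≤∣b₁∣ es balanced

    d exponent : ℕ
    d = suc (length P)
    exponent = d ℕ.* suc s′ ℕ.+ t

    weaken : ∀ {χ D D′ R} → D ℕ.≤ D′ → Structure χ D R → Structure χ D′ R
    weaken D≤ σ = record
      { points = points σ ; unique = unique σ ; between = between σ ; offset = offset σ ; step = step σ ; offset≤ = offset≤ σ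
      ; 1≤step = 1≤step σ ; step≤ = step≤ σ ; colour = colour σ ; mono = mono σ ; value≤ = value≤ σ
      ; many = ℕₚ.≤-trans (many σ) (ℕₚ.*-monoˡ-≤ (length (points σ)) D≤) }

    Monochromatic : ℕ → ℕ → ℕ → (ℕ → Fin r) → Set
    Monochromatic Q m N χ = ∃[ κ ] m ℕ.^ exponent ℕ.≤ Q ℕ.* count N χ κ pol (b₁ ∷ b₂ ∷ bs) es

    -- q structures of distinct colours are given at scales ≥ m^(dⁱ), and the scales m^(dⁱ⁻¹), …, m^d, m remain.
    Claim : ℕ → ℕ → ℕ → Set
    Claim i q D = Σ[ Q ∈ ℕ ] Σ[ m₀ ∈ ℕ ] (∀ m → m₀ ℕ.≤ m → 1 ℕ.≤ m → ∀ N → m ℕ.^ (d ℕ.^ r) ℕ.≤ N → ∀ χ (scale : Fin q → ℕ) →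
      (∀ j → m ℕ.^ (d ℕ.^ i) ℕ.≤ scale j) → (∀ j → scale j ℕ.≤ N) → (old : ∀ j → Structure χ D (scale j)) →
      (∀ j j′ → colour (old j) ≡ colour (old j′) → j ≡ j′) → Monochromatic Q m N χ)

    claim : ∀ i q D → 1 ℕ.≤ D → i ℕ.+ q ≡ suc r → Claim i q D
    -- Here q = r + 1 structures would have distinct colours out of r; the values of Q and m₀ are
    -- arbitrary.
    claim zero q D 1≤D refl = 0 , 0 , λ m _ _ N _ χ scale _ _ old distinct →
      let j , j′ , j<j′ , e = Finₚ.pigeonhole (ℕₚ.n<1+n r) (λ j → colour (old j)) in
      ⊥-elim (ℕₚ.<-irrefl (cong Fin.toℕ (distinct j j′ e)) j<j′)
    claim (suc i) q D 1≤D i+q = Q , 𝔾 ℕ.+ proj₁ (proj₂ rec) , proof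
      where
      module S = Step q D 1≤D
      D′ 𝔾 T : ℕ
      D′ = S.D′
      𝔾 = S.𝔾
      T = S.T
      rec = claim i (suc q) (D ℕ.+ D′) (ℕₚ.≤-trans 1≤D (ℕₚ.m≤m+n D D′)) (trans (ℕₚ.+-suc i q) i+q)
      Q₁ Q : ℕ
      Q₁ = D′ ℕ.* D ℕ.* T
      Q = Q₁ ℕ.+ proj₁ rec
      1≤d^ : ∀ j → 1 ℕ.≤ d ℕ.^ j
      1≤d^ j = ^-pos j (ℕ.s≤s ℕ.z≤n)
      i≤r : i ℕ.≤ r
      i≤r = ℕₚ.≤-pred (ℕₚ.≤-trans (ℕₚ.m≤m+n (suc i) q) (ℕₚ.≤-reflexive i+q))

      module _ (m : ℕ) (m₀≤m : 𝔾 ℕ.+ proj₁ (proj₂ rec) ℕ.≤ m) (1≤m : 1 ℕ.≤ m) (N : ℕ) (m^≤N : m ℕ.^ (d ℕ.^ r) ℕ.≤ N) (χ : ℕ → Fin r)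
        (scale : Fin q → ℕ) (≤scale : ∀ j → m ℕ.^ (d ℕ.^ suc i) ℕ.≤ scale j) (scale≤ : ∀ j → scale j ℕ.≤ N)
        (old : ∀ j → Structure χ D (scale j)) (distinct : ∀ j j′ → colour (old j) ≡ colour (old j′) → j ≡ j′) where

        R : ℕ
        R = m ℕ.^ (d ℕ.^ i)

        power≤ : ∀ {x y} → x ℕ.≤ y → m ℕ.^ x ℕ.≤ m ℕ.^ y
        power≤ = ℕₚ.^-monoʳ-≤ m {{ℕ.>-nonZero 1≤m}}

        m≤R : m ℕ.≤ R
        m≤R = ℕₚ.≤-trans (ℕₚ.≤-reflexive (sym (ℕₚ.*-identityʳ m))) (power≤ (1≤d^ i))

        R≤N : R ℕ.≤ N
        R≤N = ℕₚ.≤-trans (power≤ (ℕₚ.^-monoʳ-≤ d i≤r)) m^≤N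

        R^d≤ : ∀ j → R ℕ.^ d ℕ.≤ scale j
        R^d≤ j = ℕₚ.≤-trans (ℕₚ.≤-reflexive (trans (ℕₚ.^-*-assoc m (d ℕ.^ i) d) (cong (m ℕ.^_) (ℕₚ.*-comm (d ℕ.^ i) d)))) (≤scale j)

        m^d≤ : ∀ j → m ℕ.^ d ℕ.≤ scale j
        m^d≤ j = ℕₚ.≤-trans (ℕₚ.^-monoˡ-≤ d m≤R) (R^d≤ j)

        finish : (new : Structure χ D′ R) → (∀ j → Recurrent T new (old j)) → Monochromatic Q m N χ
        finish new recurs with Finₚ.any? (λ j → colour new Fin.≟ colour (old j))
        ... | yes (j , same) = colour new , (begin
          m ℕ.^ (d ℕ.* suc s′ ℕ.+ t) ≡⟨ trans (ℕₚ.^-distribˡ-+-* m (d ℕ.* suc s′) t) (trans (ℕₚ.*-comm (m ℕ.^ (d ℕ.* suc s′)) (m ℕ.^ t)) (cong (m ℕ.^ t ℕ.*_) (sym (ℕₚ.^-*-assoc m d (suc s′))))) ⟩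
          -- R ≥ m and scale j ≥ R^d ≥ m^d: whichever two scales share a colour, this worst case
          -- gives the exponent d(s - 1) + t.
          m ℕ.^ t ℕ.* (m ℕ.^ d) ℕ.^ suc s′ ≤⟨ ℕₚ.*-mono-≤ (ℕₚ.^-monoˡ-≤ t m≤R) (ℕₚ.^-monoˡ-≤ (suc s′) (m^d≤ j)) ⟩
          R ℕ.^ t ℕ.* scale j ℕ.^ suc s′ ≤⟨ Solutions.solutions-many new (old j) same T (recurs j) N R≤N (scale≤ j)
              (ℕₚ.≤-trans 1≤m m≤R) (ℕₚ.≤-trans (^-pos d 1≤m) (m^d≤ j)) ⟩
          Q₁ ℕ.* c ≤⟨ ℕₚ.*-monoˡ-≤ c (ℕₚ.m≤m+n Q₁ (proj₁ rec)) ⟩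
          Q ℕ.* c ∎)
          where
          open ℕₚ.≤-Reasoning
          c = count N χ (colour new) pol (b₁ ∷ b₂ ∷ bs) es
        ... | no fresh = let κ , le = further in κ , ℕₚ.≤-trans le (ℕₚ.*-monoˡ-≤ (count N χ κ pol (b₁ ∷ b₂ ∷ bs) es) (ℕₚ.m≤n+m (proj₁ rec) Q₁))
          where
          scale′ : Fin (suc q) → ℕ
          scale′ zero = R
          scale′ (suc j) = scale j
          all : ∀ j → Structure χ (D ℕ.+ D′) (scale′ j)
          all zero = weaken (ℕₚ.m≤n+m D′ D) new
          all (suc j) = weaken (ℕₚ.m≤m+n D D′) (old j)
          all-distinct : ∀ j j′ → colour (all j) ≡ colour (all j′) → j ≡ j′
          all-distinct zero zero e = refl
          all-distinct zero (suc j′) e = ⊥-elim (fresh (j′ , e))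
          all-distinct (suc j) zero e = ⊥-elim (fresh (j , sym e))
          all-distinct (suc j) (suc j′) e = cong suc (distinct j j′ e)
          ≤scale′ : ∀ j → m ℕ.^ (d ℕ.^ i) ℕ.≤ scale′ j
          ≤scale′ zero = ℕₚ.≤-refl
          ≤scale′ (suc j) = ℕₚ.≤-trans (≤-*ʳ R (^-pos (length P) (ℕₚ.≤-trans 1≤m m≤R))) (R^d≤ j)
          scale′≤ : ∀ j → scale′ j ℕ.≤ N
          scale′≤ zero = R≤N
          scale′≤ (suc j) = scale≤ j
          further : Monochromatic (proj₁ rec) m N χ
          further = proj₂ (proj₂ rec) m (ℕₚ.≤-trans (ℕₚ.m≤n+m _ 𝔾) m₀≤m) 1≤m N m^≤N χ scale′ ≤scale′ scale′≤ all all-distinct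

        proof : Monochromatic Q m N χ
        proof = finish (S.At.new R 𝔾≤R χ scale R^d≤ old) (S.At.recurrent R 𝔾≤R χ scale R^d≤ old)
          where
          𝔾≤R : 𝔾 ℕ.≤ R
          𝔾≤R = ℕₚ.≤-trans (ℕₚ.≤-trans (ℕₚ.m≤m+n 𝔾 _) m₀≤m) m≤R

    -- An integral form of the bound: c₀ = 1/q, and raising to the power d^r avoids the root M of N.
    Conclusion : Set
    Conclusion = ∃[ q ] (1 ℕ.≤ q × ∃[ N₀ ] (1 ℕ.≤ N₀ × (∀ N → N ℕ.≥ N₀ → (χ : ℕ → Fin r) →
      ∃[ κ ] (q ℕ.* count N χ κ pol (b₁ ∷ b₂ ∷ bs) es) ℕ.^ (d ℕ.^ r) ℕ.≥ N ℕ.^ exponent)))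

    conclusion : Conclusion
    conclusion = q , *-pos (^-pos exponent (ℕ.s≤s ℕ.z≤n)) (ℕ.s≤s ℕ.z≤n) , suc m₀ ℕ.^ e , ^-pos e (ℕ.s≤s ℕ.z≤n) , proof
      where
      main = claim (suc r) 0 1 ℕₚ.≤-refl (ℕₚ.+-identityʳ (suc r))
      Q m₀ e e′ q : ℕ
      Q = proj₁ main
      m₀ = proj₁ (proj₂ main)
      e = d ℕ.^ r
      e′ = ℕ.pred e
      -- The power of 2 pays for rounding the root of N, as N < (m + 1)^e ≤ (2 m)^e; the successor
      -- keeps q positive.
      q = 2 ℕ.^ exponent ℕ.* suc Q
      e≡ : suc e′ ≡ e
      e≡ = ℕₚ.suc-pred e {{ℕ.>-nonZero (^-pos r (ℕ.s≤s ℕ.z≤n))}}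
      proof : ∀ N → N ℕ.≥ suc m₀ ℕ.^ e → (χ : ℕ → Fin r) → ∃[ κ ] (q ℕ.* count N χ κ pol (b₁ ∷ b₂ ∷ bs) es) ℕ.^ e ℕ.≥ N ℕ.^ exponent
      proof N N₀≤N χ = κ , (begin
        N ℕ.^ exponent ≤⟨ ℕₚ.^-monoˡ-≤ exponent (ℕₚ.≤-trans (ℕₚ.<⇒≤ hi) (ℕₚ.^-monoˡ-≤ e 1+m≤2m)) ⟩
        ((2 ℕ.* m) ℕ.^ e) ℕ.^ exponent ≡⟨ trans (ℕₚ.^-*-assoc (2 ℕ.* m) e exponent) (trans (cong ((2 ℕ.* m) ℕ.^_) (ℕₚ.*-comm e exponent)) (sym (ℕₚ.^-*-assoc (2 ℕ.* m) exponent e))) ⟩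
        ((2 ℕ.* m) ℕ.^ exponent) ℕ.^ e ≤⟨ ℕₚ.^-monoˡ-≤ e (begin
            (2 ℕ.* m) ℕ.^ exponent ≡⟨ *-^ 2 m exponent ⟩
            2 ℕ.^ exponent ℕ.* m ℕ.^ exponent ≤⟨ ℕₚ.*-monoʳ-≤ (2 ℕ.^ exponent) (ℕₚ.≤-trans (proj₂ found) (ℕₚ.*-monoˡ-≤ c (ℕₚ.n≤1+n Q))) ⟩
            2 ℕ.^ exponent ℕ.* (suc Q ℕ.* c) ≡⟨ sym (ℕₚ.*-assoc (2 ℕ.^ exponent) (suc Q) c) ⟩
            q ℕ.* c ∎) ⟩
        (q ℕ.* c) ℕ.^ e ∎)
        where
        open ℕₚ.≤-Reasoning
        root = integer-root e′ N
        m : ℕ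
        m = proj₁ root
        lo : m ℕ.^ e ℕ.≤ N
        lo = subst (λ x → m ℕ.^ x ℕ.≤ N) e≡ (proj₁ (proj₂ root))
        hi : N ℕ.< suc m ℕ.^ e
        hi = subst (λ x → N ℕ.< suc m ℕ.^ x) e≡ (proj₂ (proj₂ root))
        m₀<m : suc m₀ ℕ.≤ m
        m₀<m with suc m₀ ℕ.≤? m
        ... | yes p = p
        ... | no ¬p = ⊥-elim (ℕₚ.<-irrefl refl (ℕₚ.<-≤-trans hi (ℕₚ.≤-trans (ℕₚ.^-monoˡ-≤ e (ℕₚ.≰⇒> ¬p)) N₀≤N)))
        1≤m : 1 ℕ.≤ m
        1≤m = ℕₚ.≤-trans (ℕ.s≤s ℕ.z≤n) m₀<m
        1+m≤2m : suc m ℕ.≤ 2 ℕ.* m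
        1+m≤2m = ℕₚ.≤-trans (ℕₚ.+-monoˡ-≤ m 1≤m) (ℕₚ.≤-reflexive (cong (m ℕ.+_) (sym (ℕₚ.+-identityʳ m))))
        found : Monochromatic Q m N χ
        found = proj₂ (proj₂ main) m (ℕₚ.<⇒≤ m₀<m) 1≤m N lo χ (λ ()) (λ ()) (λ ()) (λ ()) (λ ())
        κ = proj₁ found
        c = count N χ κ pol (b₁ ∷ b₂ ∷ bs) es

open import Data.Nat using (_+_; _*_; _^_; _≤_; _≥_)
open import Data.Product using (∃)
open import Defs
open PolynomialDifferences using (Deg; Deg-eval)
open AveragingPlans using (*-pos)
open Scales using (module Chain)

theorem1p5 : (d r : ℕ) → 2 ≤ d → 1 ≤ r →
    (P : Poly) → Intersective P → HasDegree P d →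
    (s t : ℕ) → 1 ≤ s → 1 ≤ t → s + t ≥ s₁ d →
    (L₁ : LinForm s) → (L₂ : LinForm t) → NonDegenerate L₁ → NonDegenerate L₂ →
    applyL L₁ (ones s) ≡ + 0 →
    ∃ λ (q : ℕ) → 1 ≤ q × ∃ λ (N₀ : ℕ) → 1 ≤ N₀ ×
    ((N : ℕ) → N ≥ N₀ → (χ : ℕ → Fin r) →
    ∃ λ (k : Fin r) →
    (q * count N χ k P L₁ L₂) ^ (d ^ r) ≥ N ^ (d * (s ∸ 1) + t))
-- For s = 1 the value L₁(1) is the coefficient b itself, which is not zero.
theorem1p5 d r 2≤d 1≤r P int (cs , a , refl , refl , a≢0) (suc zero) t 1≤s 1≤t s+t (b ∷ []) L₂ (b≢0 ∷ []) nd₂ balanced =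
  ⊥-elim (b≢0 (trans (lem b) balanced))
  where
  lem : ∀ b → b ≡ b ℤ.* + 1 ℤ.+ + 0
  lem = ℤ-Solver.solve-∀
theorem1p5 _ r (ℕ.s≤s ()) 1≤r _ int (c₀ ∷ [] , a , refl , refl , a≢0) (suc (suc s′)) t 1≤s 1≤t s+t L₁ L₂ nd₁ nd₂ balanced
theorem1p5 _ r 2≤d 1≤r _ int (c₀ ∷ c₁ ∷ cs , a , refl , refl , a≢0) (suc (suc s′)) t 1≤s 1≤t s+t (b₁ ∷ b₂ ∷ bs) L₂ (b₁≢0 ∷ nd₁) nd₂ balanced =
  subst (λ d → ∃[ q ] (1 ≤ q × ∃[ N₀ ] (1 ≤ N₀ × ((N : ℕ) → N ≥ N₀ → (χ : ℕ → Fin r) →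
      ∃[ k ] ((q * count N χ k (c₀ ∷ c₁ ∷ (cs ++ [ a ])) (b₁ ∷ b₂ ∷ bs) L₂) ^ (d ^ r) ≥ N ^ (d * suc s′ + t))))))
    degree
    (Chain.conclusion c₀ c₁ (cs ++ [ a ]) (+ (length (c₀ ∷ c₁ ∷ cs) !) ℤ.* a) leading 1≤∣s∣ int s′ t r b₁ b₂ bs (nonzero b₁≢0) L₂ balanced)
  where
  nonzero : ∀ {x} → ¬ x ≡ + 0 → 1 ≤ ℤ.∣ x ∣
  nonzero x≢0 = ℕₚ.n≢0⇒n>0 λ e → x≢0 (ℤₚ.∣i∣≡0⇒i≡0 e)
  degree : suc (length (cs ++ [ a ])) ≡ suc (suc (length cs))
  degree = cong suc (trans (Listₚ.length-++ cs) (ℕₚ.+-comm (length cs) 1))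
  leading : Deg (suc (length (cs ++ [ a ]))) (eval (c₀ ∷ c₁ ∷ (cs ++ [ a ]))) (+ (length (c₀ ∷ c₁ ∷ cs) !) ℤ.* a)
  leading = subst (λ k → Deg k (eval (c₀ ∷ c₁ ∷ (cs ++ [ a ]))) (+ (length (c₀ ∷ c₁ ∷ cs) !) ℤ.* a)) (sym degree) (Deg-eval (c₀ ∷ c₁ ∷ cs) a)
  1≤∣s∣ : 1 ≤ ℤ.∣ + (length (c₀ ∷ c₁ ∷ cs) !) ℤ.* a ∣
  1≤∣s∣ = ℕₚ.≤-trans (*-pos (ℕₚ.1≤n! (length (c₀ ∷ c₁ ∷ cs))) (nonzero a≢0)) (ℕₚ.≤-reflexive (sym (ℤₚ.abs-* (+ (length (c₀ ∷ c₁ ∷ cs) !)) a)))
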